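{- Let $\mathbb{K}$ be a field of characteristic zero. (i) For every $n\ge 5$, the set of all invariants $\mathcal{O}(\mathbf g)$, where $\mathbf g$ ranges over the simple graphs on $n$ vertices, does not generate the $\mathbb{K}$-algebra $\mathcal{I}_n$. (ii) For every $n$ with $11\le n\le 18$, the set of all invariants $\mathcal{O}(\mathbf g)$, where $\mathbf g$ ranges over the multigraphs on $n$ vertices having at least one isolated vertex, does not generate the $\mathbb{K}$-algebra $\mathcal{I}_n$.
   Context: Let $\mathbb{K}[x_{\{i,j\}}]$ be the polynomial ring in $\binom n2$ variables indexed by the pairs $\{i,j\}$, $1\le i<j\le n$. The symmetric group $\mathfrak{S}_n$ acts on it by $\mathbb{K}$-algebra automorphisms with $\sigma\cdot x_{\{i,j\}}=x_{\{\sigma(i),\sigma(j)\}}$, and $\mathcal{I}_n:=\mathbb{K}[x_{\{i,j\}}]^{\mathfrak{S}_n}$ is the ring of invariant polynomials. A multigraph $\mathbf g$ on the vertices $\{1,\dots,n\}$ (undirected, no loops) is a family $(g_{\{i,j\}})$ of non-negative integers (edge multiplicities); it is a simple graph if all $g_{\{i,j\}}\in\{0,1\}$. A vertex $i$ is isolated in $\mathbf g$ if $g_{\{i,j\}}=0$ for all $j\ne i$. Write $x^{\mathbf g}:=\prod x_{\{i,j\}}^{g_{\{i,j\}}}$ and $\mathcal{O}(\mathbf g):=\sum_{\mathbf h}x^{\mathbf h}$, the sum being over all distinct multigraphs $\mathbf h$ in the $\mathfrak{S}_n$-orbit of $\mathbf g$ (i.e. isomorphic to $\mathbf g$). -}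

module Defs where

open import Algebra.Apartness.Bundles using (HeytingField; HeytingCommutativeRing)
open import Algebra.Bundles using (CommutativeRing; Semiring)
import Algebra.Definitions.RawSemiring as RawSemiringDefinitions
open import Data.Bool.Base using (if_then_else_)
open import Data.Fin.Base using (Fin; zero; suc; punchIn)
open import Data.Fin.Permutation as Perm using (Permutation′; _⟨$⟩ʳ_; _⟨$⟩ˡ_)
import Data.Fin.Properties as Fin
open import Data.List.Base using (List; []; _∷_; [_]; _++_; foldr; map; concatMap; allFin; deduplicate; cartesianProductWith)
import Data.List.Membership.Propositional.Properties as Membership
import Data.List.Properties as List
open import Data.List.Relation.Unary.Any using (Any; here)
import Data.List.Relation.Unary.Any.Properties as Any
open import Data.Nat.Base using (ℕ; zero; suc; _+_)
import Data.Nat.Properties as ℕ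
open import Data.Product.Base as Product using (∃; _×_; _,_; map₂)
open import Data.Sum.Base as Sum using (_⊎_; inj₁; inj₂)
open import Function.Base using (_∘_)
open import Function.Bundles using (Injection; _⇔_; mk⇔)
open import Function.Properties.Inverse using (↔⇒↣)
open import Level using (Level; _⊔_)
open import Relation.Binary.Core using (Rel)
open import Relation.Binary.Definitions using (Decidable)
open import Relation.Binary.PropositionalEquality using (_≡_; _≢_; refl; sym; trans; cong; cong₂)
open import Relation.Nullary using (Dec; does; ¬_)
open import Relation.Nullary.Decidable using (_×-dec_; _⊎-dec_; dec-false; does-⇔)
open import Relation.Unary using (Pred)

private
  variable
    c ℓ ℓ₁ ℓ₂ p : Level
    n : ℕ

-- A family indexed by the pairs {i , j} with i ≠ j, encoded as a symmetric
-- matrix whose (unused) diagonal is pinned to 0.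

record Multigraph (n : ℕ) : Set where
  field
    mult      : Fin n → Fin n → ℕ
    symmetric : ∀ i j → mult i j ≡ mult j i
    loopless  : ∀ i → mult i i ≡ 0

open Multigraph public

infix 4 _≗_ _≗?_

_≗_ : Rel (Multigraph n) _
g ≗ h = ∀ i j → mult g i j ≡ mult h i j

_≗?_ : Decidable (_≗_ {n})
g ≗? h = Fin.all? λ i → Fin.all? λ j → mult g i j ℕ.≟ mult h i j

∅ : Multigraph n
∅ = record
  { mult      = λ _ _ → 0
  ; symmetric = λ _ _ → refl
  ; loopless  = λ _ → refl
  }

infixl 6 _⊕_

_⊕_ : Multigraph n → Multigraph n → Multigraph n
g ⊕ h = record
  { mult      = λ i j → mult g i j + mult h i j
  ; symmetric = λ i j → cong₂ _+_ (symmetric g i j) (symmetric h i j)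
  ; loopless  = λ i → cong₂ _+_ (loopless g i) (loopless h i)
  }

IsSimple : Pred (Multigraph n) _
IsSimple g = ∀ i j → mult g i j ≡ 0 ⊎ mult g i j ≡ 1

IsIsolated : Multigraph n → Fin n → Set
IsIsolated g i = ∀ j → j ≢ i → mult g i j ≡ 0

HasIsolatedVertex : Pred (Multigraph n) _
HasIsolatedVertex g = ∃ λ i → IsIsolated g i

SamePair : (a b i j : Fin n) → Set
SamePair a b i j = (a ≡ i × b ≡ j) ⊎ (a ≡ j × b ≡ i)

samePair? : (a b i j : Fin n) → Dec (SamePair a b i j)
samePair? a b i j = (a Fin.≟ i ×-dec b Fin.≟ j) ⊎-dec (a Fin.≟ j ×-dec b Fin.≟ i)

edge : (i j : Fin n) → i ≢ j → Multigraph n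
edge i j i≢j = record
  { mult      = λ a b → if does (samePair? a b i j) then 1 else 0
  ; symmetric = λ a b → cong (λ t → if t then 1 else 0) (does-⇔ swapPair (samePair? a b i j) (samePair? b a i j))
  ; loopless  = λ a → cong (λ t → if t then 1 else 0) (dec-false (samePair? a a i j) notLoop)
  }
  where
  swapPair : ∀ {a b} → SamePair a b i j ⇔ SamePair b a i j
  swapPair = mk⇔ (Sum.swap ∘ Sum.map Product.swap Product.swap) (Sum.swap ∘ Sum.map Product.swap Product.swap)

  notLoop : ∀ {a} → ¬ SamePair a a i j
  notLoop (inj₁ (a≡i , a≡j)) = i≢j (trans (sym a≡i) a≡j)
  notLoop (inj₂ (a≡j , a≡i)) = i≢j (trans (sym a≡i) a≡j)

-- The inverse makes the edge {i , j} of g the edge {σ i , σ j} of σ • g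
-- (see •-edge below).

infixr 7 _•_

_•_ : Permutation′ n → Multigraph n → Multigraph n
σ • g = record
  { mult      = λ i j → mult g (σ ⟨$⟩ˡ i) (σ ⟨$⟩ˡ j)
  ; symmetric = λ i j → symmetric g (σ ⟨$⟩ˡ i) (σ ⟨$⟩ˡ j)
  ; loopless  = λ i → loopless g (σ ⟨$⟩ˡ i)
  }

•-edge : ∀ (σ : Permutation′ n) {i j} (i≢j : i ≢ j) →
         σ • edge i j i≢j ≗ edge (σ ⟨$⟩ʳ i) (σ ⟨$⟩ʳ j) (i≢j ∘ Injection.injective (↔⇒↣ σ))
•-edge σ {i} {j} _ a b = cong (λ t → if t then 1 else 0)
  (does-⇔ (mk⇔ (Sum.map (Product.map to to) (Product.map to to))
               (Sum.map (Product.map from from) (Product.map from from)))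
          (samePair? (σ ⟨$⟩ˡ a) (σ ⟨$⟩ˡ b) i j)
          (samePair? a b (σ ⟨$⟩ʳ i) (σ ⟨$⟩ʳ j)))
  where
  to : ∀ {x y} → σ ⟨$⟩ˡ x ≡ y → x ≡ σ ⟨$⟩ʳ y
  to eq = trans (sym (Perm.inverseʳ σ)) (cong (σ ⟨$⟩ʳ_) eq)

  from : ∀ {x y} → x ≡ σ ⟨$⟩ʳ y → σ ⟨$⟩ˡ x ≡ y
  from eq = trans (cong (σ ⟨$⟩ˡ_) eq) (Perm.inverseˡ σ)

permutations : ∀ n → List (Permutation′ n)
permutations zero    = [ Perm.id ]
permutations (suc n) = cartesianProductWith (Perm.insert zero) (allFin (suc n)) (permutations n)

permutations-complete : ∀ (σ : Permutation′ n) → Any (σ Perm.≈_) (permutations n)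
permutations-complete {zero}  σ = here λ ()
permutations-complete {suc n} σ = Any.cartesianProductWith⁺ (Perm.insert zero)
  (λ { {_} {τ} refl σ′≈τ k → trans (sym (Perm.insert-remove zero σ k)) (insert-cong (σ ⟨$⟩ʳ zero) σ′≈τ k) })
  (Membership.∈-allFin (σ ⟨$⟩ʳ zero))
  (permutations-complete (Perm.remove zero σ))
  where
  insert-cong : ∀ j {π ρ : Permutation′ n} → π Perm.≈ ρ → Perm.insert zero j π Perm.≈ Perm.insert zero j ρ
  insert-cong j π≈ρ zero    = refl
  insert-cong j π≈ρ (suc k) = cong (punchIn j) (π≈ρ k)

orbit : Multigraph n → List (Multigraph n)
orbit {n} g = deduplicate _≗?_ (map (_• g) (permutations n))

-- The monoid algebra of the multigraphs under _⊕_: a polynomial is a finite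
-- formal sum of terms a x^g, and two of them are identified when they have the
-- same coefficient at every monomial.

module Polynomials (R : CommutativeRing c ℓ) where

  private
    module R = CommutativeRing R

  Poly : ℕ → Set c
  Poly n = List (R.Carrier × Multigraph n)

  coeff : Poly n → Multigraph n → R.Carrier
  coeff f g = foldr (λ (a , h) s → if does (h ≗? g) then a R.+ s else s) R.0# f

  infix 4 _≈_

  _≈_ : Rel (Poly n) _
  f ≈ f′ = ∀ g → coeff f g R.≈ coeff f′ g

  infixl 6 _⊞_
  infixl 7 _⊠_

  _⊞_ : Poly n → Poly n → Poly n
  _⊞_ = _++_

  _⊠_ : Poly n → Poly n → Poly n
  _⊠_ = cartesianProductWith λ (a , g) (b , h) → a R.* b , g ⊕ h

  const : R.Carrier → Poly n
  const a = [ a , ∅ ]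

  x^ : Multigraph n → Poly n
  x^ g = [ R.1# , g ]

  act : Permutation′ n → Poly n → Poly n
  act σ = map (map₂ (σ •_))

  act-⊞ : ∀ (σ : Permutation′ n) f f′ → act σ (f ⊞ f′) ≡ act σ f ⊞ act σ f′
  act-⊞ σ = List.map-++ _

  act-⊠ : ∀ (σ : Permutation′ n) f f′ → act σ (f ⊠ f′) ≡ act σ f ⊠ act σ f′
  act-⊠ σ []            f′ = refl
  act-⊠ σ ((a , g) ∷ f) f′ = trans (List.map-++ _ (map _ f′) (f ⊠ f′)) (cong₂ _++_ (lemma f′) (act-⊠ σ f f′))
    where
    lemma : ∀ f′ → act σ (map (λ (b , h) → a R.* b , g ⊕ h) f′) ≡ map (λ (b , h) → a R.* b , σ • g ⊕ h) (act σ f′)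
    lemma f′ = trans (sym (List.map-∘ f′)) (List.map-∘ f′)

  IsInvariant : Pred (Poly n) _
  IsInvariant f = ∀ σ → act σ f ≈ f

  𝒪 : Multigraph n → Poly n
  𝒪 g = concatMap x^ (orbit g)

  OrbitSums : Pred (Multigraph n) p → Pred (Poly n) _
  OrbitSums P f = ∃ λ g → P g × f ≡ 𝒪 g

  data Subalgebra {n} (S : Pred (Poly n) p) : Pred (Poly n) (c ⊔ ℓ ⊔ p) where
    gen  : ∀ {f} → S f → Subalgebra S f
    con  : ∀ a → Subalgebra S (const a)
    add  : ∀ {f f′} → Subalgebra S f → Subalgebra S f′ → Subalgebra S (f ⊞ f′)
    mul  : ∀ {f f′} → Subalgebra S f → Subalgebra S f′ → Subalgebra S (f ⊠ f′)
    resp : ∀ {f f′} → f ≈ f′ → Subalgebra S f → Subalgebra S f′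

  -- All orbit sums are invariant, so for sets S of orbit sums only this
  -- inclusion matters.

  GeneratesInvariants : Pred (Poly n) p → Set _
  GeneratesInvariants S = ∀ f → IsInvariant f → Subalgebra S f

open Polynomials public using (GeneratesInvariants; OrbitSums)

CharacteristicZero : CommutativeRing c ℓ → Set _
CharacteristicZero R = ∀ m → m · 1# ≈ 0# → m ≡ 0
  where
  open CommutativeRing R using (_≈_; 0#; 1#; semiring)
  open RawSemiringDefinitions (Semiring.rawSemiring semiring) using () renaming (_×_ to infixr 8 _·_)

ring : HeytingField c ℓ₁ ℓ₂ → CommutativeRing c ℓ₁
ring K = HeytingCommutativeRing.commutativeRing (HeytingField.heytingCommutativeRing K)

{-# OPTIONS --safe #-}

-- (i) On the five-vertex multigraphs with four edges there is a functional
-- that kills all simple orbit sums and all products of two invariants of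
-- positive degree, but not every invariant. The derivatives of a polynomial at 0
-- along four edges are restricted to five vertices, so that it works for every
-- n ≥ 5; it is a primitive element for the Leibniz rule.
--
-- (ii) Dimensions in degree d are compared, with d = 22 for n ≤ 14 and d = 25
-- for n ≥ 15. Modulo the single edge e₁, a product O(s)O(t) of orders
-- |s| + |t| < n merges into orbit sums with an isolated vertex, and an isolated
-- edge can be split off as a factor e₁. Hence the subalgebra is spanned by the
-- products of a power of e₁ and orbit sums without isolated edges, whose orders
-- are below n and pairwise sum up to at least n. At most one order is then less
-- than n / 2. There are fewer such products of degree d than isomorphism classes
-- of multigraphs with d edges, which are counted by Burnside's lemma.

module Submission where

open import Algebra.Bundles using (CommutativeRing)
open import Data.Nat.Base using (ℕ; suc; NonZero)

-- Equality in a Heyting field is undecidable: nonzero integers and the pivots of an elimination are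
-- invertible only up to double negation. The claims are negations, so the reduction and the
-- elimination for (ii) run under a double negation. The comparison of dimensions takes the form of
-- a functional: with more orbit sums in degree d than products, some nontrivial combination of
-- coefficients vanishes on all products, hence on the subalgebra, but not on some orbit sum. The
-- obstacle is size. For 18 vertices and 25 edges no list of graphs can be evaluated, only numbers
-- can: the sum in Burnside's lemma is grouped by cycle types, the generating functions are
-- evaluated at t = 2^1024 modulo t^51, and the coefficients are read off as base t digits. Graphs
-- without isolated vertices and edges are then counted by inclusion and exclusion, since adding
-- such a vertex or edge is injective on classes. In (i), signs are avoided: the functional is a
-- difference of two with natural coefficients, and primitivity becomes an equality of lists of
-- terms.

-- Finite sums over lists, indicators, and enumerations of setoids.

module Sums where
  open import Data.Bool.Base using (if_then_else_)
  open import Data.List.Base using (List; []; _∷_; _++_; map; cartesianProductWith)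
  open import Data.List.Relation.Unary.All using (All; []; _∷_)
  open import Data.Nat.Base
  open import Data.Nat.Properties
  open import Algebra.Properties.CommutativeSemigroup +-commutativeSemigroup using (interchange)
  open import Data.Product.Base using (_×_; _,_; proj₁; proj₂)
  open import Function.Base using (_∘_)
  open import Level using (Level; 0ℓ)
  open import Relation.Binary.Bundles using (DecSetoid)
  open import Relation.Binary.PropositionalEquality hiding (_≗_)
  open import Relation.Nullary using (Dec; yes; no; does; ¬_; contradiction)

  private variable
    a b : Level
    A : Set a
    B : Set b

  ∑ : List A → (A → ℕ) → ℕ
  ∑ []       φ = 0
  ∑ (x ∷ xs) φ = φ x + ∑ xs φ

  ∑-cong : ∀ (xs : List A) {φ ψ : A → ℕ} → (∀ x → φ x ≡ ψ x) → ∑ xs φ ≡ ∑ xs ψ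
  ∑-cong []       eq = refl
  ∑-cong (x ∷ xs) eq = cong₂ _+_ (eq x) (∑-cong xs eq)

  ∑-congᴬ : ∀ {p} {P : A → Set p} {xs : List A} {φ ψ : A → ℕ} → All P xs → (∀ x → P x → φ x ≡ ψ x) → ∑ xs φ ≡ ∑ xs ψ
  ∑-congᴬ []         eq = refl
  ∑-congᴬ (px ∷ pxs) eq = cong₂ _+_ (eq _ px) (∑-congᴬ pxs eq)

  ∑-mono : ∀ (xs : List A) {φ ψ : A → ℕ} → (∀ x → φ x ≤ ψ x) → ∑ xs φ ≤ ∑ xs ψ
  ∑-mono []       le = z≤n
  ∑-mono (x ∷ xs) le = +-mono-≤ (le x) (∑-mono xs le)

  ∑-zero : ∀ (xs : List A) → ∑ xs (λ _ → 0) ≡ 0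
  ∑-zero []       = refl
  ∑-zero (_ ∷ xs) = ∑-zero xs

  ∑-+ : ∀ (xs : List A) (φ ψ : A → ℕ) → ∑ xs (λ x → φ x + ψ x) ≡ ∑ xs φ + ∑ xs ψ
  ∑-+ []       φ ψ = refl
  ∑-+ (x ∷ xs) φ ψ = trans (cong (φ x + ψ x +_) (∑-+ xs φ ψ)) (interchange (φ x) (ψ x) (∑ xs φ) (∑ xs ψ))

  ∑-*ˡ : ∀ (xs : List A) c (φ : A → ℕ) → ∑ xs (λ x → c * φ x) ≡ c * ∑ xs φ
  ∑-*ˡ []       c φ = sym (*-zeroʳ c)
  ∑-*ˡ (x ∷ xs) c φ = trans (cong (c * φ x +_) (∑-*ˡ xs c φ)) (sym (*-distribˡ-+ c (φ x) (∑ xs φ)))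

  ∑-*ʳ : ∀ (xs : List A) c (φ : A → ℕ) → ∑ xs (λ x → φ x * c) ≡ ∑ xs φ * c
  ∑-*ʳ []       c φ = refl
  ∑-*ʳ (x ∷ xs) c φ = trans (cong (φ x * c +_) (∑-*ʳ xs c φ)) (sym (*-distribʳ-+ c (φ x) (∑ xs φ)))

  ∑-swap : ∀ (xs : List A) (ys : List B) (φ : A → B → ℕ) →
           ∑ xs (λ x → ∑ ys (φ x)) ≡ ∑ ys (λ y → ∑ xs (λ x → φ x y))
  ∑-swap []       ys φ = sym (∑-zero ys)
  ∑-swap (x ∷ xs) ys φ = trans (cong (∑ ys (φ x) +_) (∑-swap xs ys φ)) (sym (∑-+ ys (φ x) _))

  ∑-++ : ∀ (xs ys : List A) (φ : A → ℕ) → ∑ (xs ++ ys) φ ≡ ∑ xs φ + ∑ ys φ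
  ∑-++ []       ys φ = refl
  ∑-++ (x ∷ xs) ys φ = trans (cong (φ x +_) (∑-++ xs ys φ)) (sym (+-assoc (φ x) _ _))

  ∑-map : ∀ (f : A → B) (xs : List A) (φ : B → ℕ) → ∑ (map f xs) φ ≡ ∑ xs (φ ∘ f)
  ∑-map f []       φ = refl
  ∑-map f (x ∷ xs) φ = cong (φ (f x) +_) (∑-map f xs φ)

  ∑-product : ∀ {C : Set} (f : A → B → C) (xs : List A) (ys : List B) (φ : C → ℕ) →
              ∑ (cartesianProductWith f xs ys) φ ≡ ∑ xs (λ x → ∑ ys (λ y → φ (f x y)))
  ∑-product f []       ys φ = refl
  ∑-product f (x ∷ xs) ys φ = trans (∑-++ (map (f x) ys) _ φ) (cong₂ _+_ (∑-map (f x) ys φ) (∑-product f xs ys φ))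

  ⟦_⟧ : ∀ {p} {P : Set p} → Dec P → ℕ
  ⟦ P? ⟧ = if does P? then 1 else 0

  ⟦⟧-yes : ∀ {p} {P : Set p} (P? : Dec P) → P → ⟦ P? ⟧ ≡ 1
  ⟦⟧-yes (yes _) _  = refl
  ⟦⟧-yes (no ¬p) pf = contradiction pf ¬p

  ⟦⟧-no : ∀ {p} {P : Set p} (P? : Dec P) → ¬ P → ⟦ P? ⟧ ≡ 0
  ⟦⟧-no (yes pf) ¬p = contradiction pf ¬p
  ⟦⟧-no (no _)   _  = refl

  ⟦⟧-cong : ∀ {p q} {P : Set p} {Q : Set q} (P? : Dec P) (Q? : Dec Q) → (P → Q) → (Q → P) → ⟦ P? ⟧ ≡ ⟦ Q? ⟧
  ⟦⟧-cong (yes p) Q? to from = sym (⟦⟧-yes Q? (to p))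
  ⟦⟧-cong (no ¬p) Q? to from = sym (⟦⟧-no Q? (¬p ∘ from))

  ⟦⟧-× : ∀ {p q r} {P : Set p} {Q : Set q} {R : Set r} (P? : Dec P) (Q? : Dec Q) (R? : Dec R) →
         (R → P × Q) → (P → Q → R) → ⟦ P? ⟧ * ⟦ Q? ⟧ ≡ ⟦ R? ⟧
  ⟦⟧-× (yes p) (yes q) R? to from = sym (⟦⟧-yes R? (from p q))
  ⟦⟧-× (yes p) (no ¬q) R? to from = sym (⟦⟧-no R? (¬q ∘ proj₂ ∘ to))
  ⟦⟧-× (no ¬p) Q?      R? to from = sym (⟦⟧-no R? (¬p ∘ proj₁ ∘ to))

  ⟦⟧-guard : ∀ {p} {P : Set p} (P? : Dec P) {m n : ℕ} → (P → m ≡ n) → ⟦ P? ⟧ * m ≡ ⟦ P? ⟧ * n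
  ⟦⟧-guard (yes p) eq = cong (_+ 0) (eq p)
  ⟦⟧-guard (no _)  eq = refl

  ⟦⟧-≤1 : ∀ {p} {P : Set p} (P? : Dec P) → ⟦ P? ⟧ ≤ 1
  ⟦⟧-≤1 (yes _) = s≤s z≤n
  ⟦⟧-≤1 (no _)  = z≤n

  -- A list representing every class of a decidable setoid x with multiplicity
  -- p x, where p is the indicator of the members.

  record Enum (X : DecSetoid 0ℓ 0ℓ) (p : DecSetoid.Carrier X → ℕ) : Set where
    private
      module X = DecSetoid X
    field
      list  : List X.Carrier
      sound : All (λ x → p x ≡ 1) list
      each  : ∀ y → ∑ list (λ x → ⟦ x X.≟ y ⟧) ≡ p y

  open Enum public

  module _ {X Y : DecSetoid 0ℓ 0ℓ} {p : DecSetoid.Carrier X → ℕ} {q : DecSetoid.Carrier Y → ℕ}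
           (EX : Enum X p) (EY : Enum Y q) where
    private
      module X = DecSetoid X
      module Y = DecSetoid Y

    -- Double counting along a partial bijection. The lists hold arbitrary representatives in
    -- arbitrary order, so neither list is a rearrangement of the image of the other. Instead φ x is
    -- spread over all y with y ≈ f x, the sums are exchanged, and the condition "P x and y ≈ f x"
    -- is replaced by the equivalent "Q y and x ≈ g y".
    reindex-on : ∀ {P : X.Carrier → Set} {Q : Y.Carrier → Set}
      (P? : ∀ x → Dec (P x)) (Q? : ∀ y → Dec (Q y)) (f : X.Carrier → Y.Carrier) (g : Y.Carrier → X.Carrier) →
      (∀ {x x′} → x X.≈ x′ → P x → P x′) → (∀ {y y′} → y Y.≈ y′ → Q y → Q y′) →
      (∀ {x x′} → x X.≈ x′ → f x Y.≈ f x′) → (∀ {y y′} → y Y.≈ y′ → g y X.≈ g y′) →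
      (∀ x → P x → Q (f x) × g (f x) X.≈ x × (p x ≡ 1 → q (f x) ≡ 1)) →
      (∀ y → Q y → P (g y) × f (g y) Y.≈ y × (q y ≡ 1 → p (g y) ≡ 1)) →
      (φ : X.Carrier → ℕ) → (∀ {x x′} → x X.≈ x′ → φ x ≡ φ x′) →
      ∑ (list EX) (λ x → ⟦ P? x ⟧ * φ x) ≡ ∑ (list EY) (λ y → ⟦ Q? y ⟧ * φ (g y))
    reindex-on P? Q? f g P-resp Q-resp f-cong g-cong there back φ φ-cong = begin
      ∑ (list EX) (λ x → ⟦ P? x ⟧ * φ x)
        ≡⟨ ∑-congᴬ (sound EX) (λ x px → ⟦⟧-guard (P? x) λ Px → begin
             φ x ≡⟨ *-identityˡ _ ⟨
             1 * φ x ≡⟨ cong (_* φ x) (trans (each EY (f x)) (proj₂ (proj₂ (there x Px)) px)) ⟨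
             ∑ (list EY) (λ y → ⟦ y Y.≟ f x ⟧) * φ x ≡⟨ ∑-*ʳ (list EY) (φ x) _ ⟨
             ∑ (list EY) (λ y → ⟦ y Y.≟ f x ⟧ * φ x) ∎) ⟩
      ∑ (list EX) (λ x → ⟦ P? x ⟧ * ∑ (list EY) (λ y → ⟦ y Y.≟ f x ⟧ * φ x))
        ≡⟨ ∑-cong (list EX) (λ x → ∑-*ˡ (list EY) ⟦ P? x ⟧ _) ⟨
      ∑ (list EX) (λ x → ∑ (list EY) (λ y → ⟦ P? x ⟧ * (⟦ y Y.≟ f x ⟧ * φ x)))
        ≡⟨ ∑-swap (list EX) (list EY) _ ⟩
      ∑ (list EY) (λ y → ∑ (list EX) (λ x → ⟦ P? x ⟧ * (⟦ y Y.≟ f x ⟧ * φ x)))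
        ≡⟨ ∑-cong (list EY) (λ y → ∑-cong (list EX) (λ x → pointwise x y)) ⟩
      ∑ (list EY) (λ y → ∑ (list EX) (λ x → ⟦ x X.≟ g y ⟧ * (⟦ Q? y ⟧ * φ (g y))))
        ≡⟨ ∑-congᴬ (sound EY) (λ y qy → begin
             ∑ (list EX) (λ x → ⟦ x X.≟ g y ⟧ * (⟦ Q? y ⟧ * φ (g y))) ≡⟨ ∑-*ʳ (list EX) _ _ ⟩
             ∑ (list EX) (λ x → ⟦ x X.≟ g y ⟧) * (⟦ Q? y ⟧ * φ (g y)) ≡⟨ cong (_* _) (each EX (g y)) ⟩
             p (g y) * (⟦ Q? y ⟧ * φ (g y)) ≡⟨ lemma y qy (Q? y) ⟩
             ⟦ Q? y ⟧ * φ (g y) ∎) ⟩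
      ∑ (list EY) (λ y → ⟦ Q? y ⟧ * φ (g y)) ∎
      where
      open ≡-Reasoning

      lemma : ∀ y → q y ≡ 1 → (Q?y : Dec _) → p (g y) * (⟦ Q?y ⟧ * φ (g y)) ≡ ⟦ Q?y ⟧ * φ (g y)
      lemma y qy (yes Qy) = trans (cong (_* _) (proj₂ (proj₂ (back y Qy)) qy)) (*-identityˡ _)
      lemma y qy (no _)   = *-zeroʳ (p (g y))

      to : ∀ x y → _ × y Y.≈ f x → _ × x X.≈ g y
      to x y (Px , y≈fx) = Q-resp (Y.sym y≈fx) (proj₁ (there x Px)) ,
        X.trans (X.sym (proj₁ (proj₂ (there x Px)))) (g-cong (Y.sym y≈fx))

      from : ∀ x y → _ × x X.≈ g y → _ × y Y.≈ f x
      from x y (Qy , x≈gy) = P-resp (X.sym x≈gy) (proj₁ (back y Qy)) ,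
        Y.trans (Y.sym (proj₁ (proj₂ (back y Qy)))) (f-cong (X.sym x≈gy))

      pointwise : ∀ x y → ⟦ P? x ⟧ * (⟦ y Y.≟ f x ⟧ * φ x) ≡ ⟦ x X.≟ g y ⟧ * (⟦ Q? y ⟧ * φ (g y))
      pointwise x y with P? x | y Y.≟ f x | x X.≟ g y | Q? y
      ... | yes Px | yes e | yes e′ | yes Qy = cong (λ t → 1 * (1 * t)) (φ-cong e′)
      ... | yes Px | yes e | no ¬e′ | _      = contradiction (proj₂ (to x y (Px , e))) ¬e′
      ... | yes Px | yes e | yes e′ | no ¬Qy = contradiction (proj₁ (to x y (Px , e))) ¬Qy
      ... | yes Px | no ¬e | yes e′ | yes Qy = contradiction (proj₂ (from x y (Qy , e′))) ¬e
      ... | yes Px | no ¬e | yes e′ | no _   = refl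
      ... | yes Px | no ¬e | no _   | _      = refl
      ... | no ¬Px | _     | yes e′ | yes Qy = contradiction (proj₁ (from x y (Qy , e′))) ¬Px
      ... | no ¬Px | _     | yes e′ | no _   = refl
      ... | no ¬Px | _     | no _   | _      = refl

-- Permutations built by extending cycles, and their cycle types.

module Permutations where
  open Sums
  open import Data.Empty using (⊥)
  open import Data.Fin.Base as Fin using (Fin; zero; suc; fromℕ; inject₁; punchIn; punchOut)
  open import Data.Fin.Permutation as Perm using (Permutation′; _⟨$⟩ʳ_; _∘ₚ_)
  import Data.Fin.Permutation.Components as PC
  import Data.Fin.Properties as Fin
  open import Data.List.Base using (List; []; _∷_; cartesianProductWith; allFin; tabulate)
  open import Data.List.Relation.Unary.All using (All; []; _∷_)
  import Data.List.Relation.Unary.All as All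
  import Data.List.Relation.Unary.All.Properties as All
  import Data.List.Properties as List
  open import Data.Maybe.Base using (Maybe; just; nothing)
  open import Data.Nat.Base
  open import Data.Nat.Properties
  open import Data.Product.Base using (_×_; _,_)
  open import Data.Sum.Base using (_⊎_; inj₁; inj₂)
  open import Function.Base using (_∘_)
  open import Level using (0ℓ)
  open import Relation.Binary.Bundles using (DecSetoid)
  open import Relation.Binary.PropositionalEquality hiding (_≗_)
  open import Relation.Nullary using (yes; no; contradiction)

  private variable
    n v : ℕ

  ∑-tabulate : ∀ {A : Set} (f : Fin n → A) (φ : A → ℕ) → ∑ (tabulate f) φ ≡ ∑ (allFin n) (φ ∘ f)
  ∑-tabulate {zero}  f φ = refl
  ∑-tabulate {suc n} f φ = cong (φ (f zero) +_) (trans (∑-tabulate (f ∘ suc) φ) (sym (∑-tabulate suc (φ ∘ f))))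

  ∑-allFin : ∀ n (φ : Fin (suc n) → ℕ) → ∑ (allFin (suc n)) φ ≡ φ zero + ∑ (allFin n) (φ ∘ suc)
  ∑-allFin n φ = cong (φ zero +_) (∑-tabulate suc φ)

  ∑-const : ∀ n c → ∑ (allFin n) (λ _ → c) ≡ n * c
  ∑-const zero    c = refl
  ∑-const (suc n) c = trans (∑-allFin n _) (cong (c +_) (∑-const n c))

  ∑-δ : ∀ {n} (i : Fin n) → ∑ (allFin n) (λ j → ⟦ j Fin.≟ i ⟧) ≡ 1
  ∑-δ {suc n} zero = trans (∑-allFin n (λ j → ⟦ j Fin.≟ zero ⟧)) (cong suc (∑-zero (allFin n)))
  ∑-δ {suc n} (suc i) = trans (∑-allFin n (λ j → ⟦ j Fin.≟ suc i ⟧)) (trans (∑-cong (allFin n) (λ j → ⟦⟧-cong (suc j Fin.≟ suc i) (j Fin.≟ i) Fin.suc-injective (cong suc))) (∑-δ i))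

  finEnum : ∀ n → Enum (Fin.≡-decSetoid n) (λ _ → 1)
  finEnum n = record { list = allFin n ; sound = All.universal (λ _ → refl) _ ; each = ∑-δ }

  permSetoid : ℕ → DecSetoid 0ℓ 0ℓ
  permSetoid n = record
    { Carrier = Permutation′ n
    ; _≈_ = Perm._≈_
    ; isDecEquivalence = record
      { isEquivalence = record { refl = λ _ → refl ; sym = λ e i → sym (e i) ; trans = λ e e′ i → trans (e i) (e′ i) }
      ; _≟_ = λ σ τ → Fin.all? λ i → (σ ⟨$⟩ʳ i) Fin.≟ (τ ⟨$⟩ʳ i)
      }
    }

  -- The cycle of j is extended by the new point 0, which is inserted in front of j.

  extend : Fin (suc n) → Permutation′ n → Permutation′ (suc n)
  extend j π = Perm.lift₀ π ∘ₚ Perm.transpose zero j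

  -- A second enumeration next to `permutations`: `Perm.insert` has no simple effect on cycles,
  -- whereas `extend` either adds a fixed point or makes one cycle longer by 1.
  perms : ∀ n → List (Permutation′ n)
  perms zero    = Perm.id ∷ []
  perms (suc n) = cartesianProductWith extend (allFin (suc n)) (perms n)

  transpose-at : ∀ (j : Fin (suc n)) → PC.transpose zero j j ≡ zero
  transpose-at zero = refl
  transpose-at (suc j) with j Fin.≟ j
  ... | yes _ = refl
  ... | no ¬e = contradiction refl ¬e

  PC-involutive : ∀ (j k : Fin (suc n)) → PC.transpose zero j (PC.transpose zero j k) ≡ k
  PC-involutive j zero = transpose-at j
  PC-involutive j (suc k) with suc k Fin.≟ j in eq
  ... | yes e = sym e
  ... | no ¬e rewrite eq = refl

  -- Undoes `extend`: 0 is cut out of its cycle, and its predecessor goes to `σ ⟨$⟩ʳ zero` instead.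
  contract : Permutation′ (suc n) → Permutation′ n
  contract σ = Perm.remove zero (σ ∘ₚ Perm.transpose zero (σ ⟨$⟩ʳ zero))

  permEnum : ∀ n → Enum (permSetoid n) (λ _ → 1)
  permEnum n = record { list = perms n ; sound = All.universal (λ _ → refl) _ ; each = once n }
    where
    open ≡-Reasoning
    once : ∀ n (σ : Permutation′ n) → ∑ (perms n) (λ π → ⟦ DecSetoid._≟_ (permSetoid n) π σ ⟧) ≡ 1
    once zero    σ = cong (_+ 0) (⟦⟧-yes (DecSetoid._≟_ (permSetoid 0) Perm.id σ) (λ ()))
    once (suc n) σ = begin
      ∑ (perms (suc n)) (λ π → ⟦ π S.≟ σ ⟧)
        ≡⟨ ∑-product extend (allFin (suc n)) (perms n) _ ⟩
      ∑ (allFin (suc n)) (λ j → ∑ (perms n) (λ π → ⟦ extend j π S.≟ σ ⟧))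
        ≡⟨ ∑-cong (allFin (suc n)) (λ j → ∑-cong (perms n) λ π →
             sym (⟦⟧-× (j Fin.≟ (σ ⟨$⟩ʳ zero)) (π T.≟ contract σ) (extend j π S.≟ σ) (to j π) (from j π))) ⟩
      ∑ (allFin (suc n)) (λ j → ∑ (perms n) (λ π → ⟦ j Fin.≟ (σ ⟨$⟩ʳ zero) ⟧ * ⟦ π T.≟ contract σ ⟧))
        ≡⟨ ∑-cong (allFin (suc n)) (λ j → trans (∑-*ˡ (perms n) ⟦ j Fin.≟ (σ ⟨$⟩ʳ zero) ⟧ _)
             (trans (cong (⟦ j Fin.≟ (σ ⟨$⟩ʳ zero) ⟧ *_) (once n (contract σ))) (*-identityʳ _))) ⟩
      ∑ (allFin (suc n)) (λ j → ⟦ j Fin.≟ (σ ⟨$⟩ʳ zero) ⟧)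
        ≡⟨ ∑-δ (σ ⟨$⟩ʳ zero) ⟩
      1 ∎
      where
      module S = DecSetoid (permSetoid (suc n))
      module T = DecSetoid (permSetoid n)
      σ′ = σ ∘ₚ Perm.transpose zero (σ ⟨$⟩ʳ zero)

      lifted : Perm.lift₀ (contract σ) Perm.≈ σ′
      lifted = Perm.lift₀-remove σ′ (transpose-at (σ ⟨$⟩ʳ zero))

      to : ∀ j π → extend j π S.≈ σ → j ≡ σ ⟨$⟩ʳ zero × π T.≈ contract σ
      to j π e = j≡ , λ i → Fin.suc-injective (begin
        suc (π ⟨$⟩ʳ i) ≡⟨ PC-involutive j _ ⟨
        PC.transpose zero j (PC.transpose zero j (suc (π ⟨$⟩ʳ i))) ≡⟨ cong (PC.transpose zero j) (e (suc i)) ⟩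
        PC.transpose zero j (σ ⟨$⟩ʳ suc i) ≡⟨ cong (λ j → PC.transpose zero j (σ ⟨$⟩ʳ suc i)) j≡ ⟩
        σ′ ⟨$⟩ʳ suc i ≡⟨ lifted (suc i) ⟨
        suc (contract σ ⟨$⟩ʳ i) ∎)
        where
        j≡ : j ≡ σ ⟨$⟩ʳ zero
        j≡ = e zero

      from : ∀ j π → j ≡ σ ⟨$⟩ʳ zero → π T.≈ contract σ → extend j π S.≈ σ
      from j π refl e k = trans (cong (PC.transpose zero j) (trans (Perm.lift₀-cong π (contract σ) e k) (lifted k))) (PC-involutive j (σ ⟨$⟩ʳ k))

  -- A cycle type is a list of parts; the part l stands for a cycle of length l + 1.

  Pos : List ℕ → Set
  Pos []      = ⊥
  Pos (l ∷ λs) = Fin (suc l) ⊎ Pos λs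

  -- The rotation goes downwards. A point inserted in front of p can then be placed at `suc p`, and
  -- `toℕ i` steps take i to zero, which later serves to measure distances in a cycle.
  rot : ∀ {l} → Fin (suc l) → Fin (suc l)
  rot {l} zero = fromℕ l
  rot (suc i)  = inject₁ i

  std : ∀ {λs} → Pos λs → Pos λs
  std {_ ∷ _} (inj₁ i) = inj₁ (rot i)
  std {_ ∷ _} (inj₂ y) = inj₂ (std y)

  -- Conjugacy of self-maps of two sets; the number of fixed graphs depends on nothing else.
  record _≅_ {A B : Set} (s : A → A) (t : B → B) : Set where
    field
      to      : A → B
      from    : B → A
      to-from : ∀ y → to (from y) ≡ y
      from-to : ∀ x → from (to x) ≡ x
      comm    : ∀ x → to (s x) ≡ t (to x)

  HasType : Permutation′ n → List ℕ → Set
  HasType σ λs = (σ ⟨$⟩ʳ_) ≅ std {λs}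

  bump : ∀ λs → Pos λs → List ℕ
  bump (l ∷ λs) (inj₁ _) = suc l ∷ λs
  bump (l ∷ λs) (inj₂ y) = l ∷ bump λs y

  module _ where
    new : ∀ {λs} (x : Pos λs) → Pos (bump λs x)
    new {_ ∷ _} (inj₁ p) = inj₁ (suc p)
    new {_ ∷ _} (inj₂ y) = inj₂ (new y)

    old : ∀ {λs} (x : Pos λs) → Pos λs → Pos (bump λs x)
    old {_ ∷ _} (inj₁ p) (inj₁ i) = inj₁ (punchIn (suc p) i)
    old {_ ∷ _} (inj₁ p) (inj₂ z) = inj₂ z
    old {_ ∷ _} (inj₂ y) (inj₁ i) = inj₁ i
    old {_ ∷ _} (inj₂ y) (inj₂ z) = inj₂ (old y z)

    -- `new` and `old` together are a bijection from the old positions and one more point. This is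
    -- its inverse, with `nothing` for the new point.
    which : ∀ {λs} (x : Pos λs) → Pos (bump λs x) → Maybe (Pos λs)
    which {_ ∷ _} (inj₁ p) (inj₁ i) with suc p Fin.≟ i
    ... | yes _   = nothing
    ... | no  p≢i = just (inj₁ (punchOut p≢i))
    which {_ ∷ _} (inj₁ p) (inj₂ z) = just (inj₂ z)
    which {_ ∷ _} (inj₂ y) (inj₁ i) = just (inj₁ i)
    which {_ ∷ _} (inj₂ y) (inj₂ z) with which y z
    ... | nothing = nothing
    ... | just w  = just (inj₂ w)

    which-new : ∀ {λs} (x : Pos λs) → which x (new x) ≡ nothing
    which-new {_ ∷ _} (inj₁ p) with suc p Fin.≟ suc p
    ... | yes _ = refl
    ... | no ¬e = contradiction refl ¬e
    which-new {_ ∷ _} (inj₂ y) rewrite which-new y = refl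

    which-old : ∀ {λs} (x z : Pos λs) → which x (old x z) ≡ just z
    which-old {_ ∷ _} (inj₁ p) (inj₁ i) with suc p Fin.≟ punchIn (suc p) i
    ... | yes e = contradiction (sym e) (Fin.punchInᵢ≢i (suc p) i)
    ... | no ¬e = cong (just ∘ inj₁) (trans (Fin.punchOut-cong (suc p) {i≢j = ¬e} {i≢k = Fin.punchInᵢ≢i (suc p) i ∘ sym} refl) (Fin.punchOut-punchIn (suc p)))
    which-old {_ ∷ _} (inj₁ p) (inj₂ z) = refl
    which-old {_ ∷ _} (inj₂ y) (inj₁ i) = refl
    which-old {_ ∷ _} (inj₂ y) (inj₂ z) rewrite which-old y z = refl

    Which : ∀ {λs} (x : Pos λs) → Pos (bump λs x) → Maybe (Pos λs) → Set
    Which x y nothing  = new x ≡ y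
    Which x y (just z) = old x z ≡ y

    which-correct : ∀ {λs} (x : Pos λs) y → Which x y (which x y)
    which-correct {_ ∷ _} (inj₁ p) (inj₁ i) with suc p Fin.≟ i
    ... | yes e = cong inj₁ e
    ... | no ¬e = cong inj₁ (Fin.punchIn-punchOut ¬e)
    which-correct {_ ∷ _} (inj₁ p) (inj₂ z) = refl
    which-correct {_ ∷ _} (inj₂ y) (inj₁ i) = refl
    which-correct {_ ∷ _} (inj₂ y) (inj₂ z) with which y z | which-correct y z
    ... | nothing | e = cong inj₂ e
    ... | just _  | e = cong inj₂ e

    inject₁-punchIn : ∀ {l} (p : Fin l) → inject₁ p ≡ punchIn (suc p) p
    inject₁-punchIn zero    = refl
    inject₁-punchIn (suc p) = cong suc (inject₁-punchIn p)

    rot-punchIn-≡ : ∀ {l} (p i : Fin (suc l)) → rot i ≡ p → rot (punchIn (suc p) i) ≡ suc p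
    rot-punchIn-≡ p zero    refl = refl
    rot-punchIn-≡ {suc l} .(inject₁ i) (suc i) refl = lemma i
      where
      lemma : ∀ {m} (i : Fin m) → rot (suc (punchIn (inject₁ i) i)) ≡ suc (inject₁ i)
      lemma zero    = refl
      lemma (suc i) = cong suc (lemma i)

    rot-punchIn-≢ : ∀ {l} (p i : Fin (suc l)) → rot i ≢ p → rot (punchIn (suc p) i) ≡ punchIn (suc p) (rot i)
    rot-punchIn-≢ {zero}  zero    zero ne = contradiction refl ne
    rot-punchIn-≢ {suc l} p zero ne = lemma p ne
      where
      lemma : ∀ {l} (p : Fin (suc l)) → fromℕ l ≢ p → fromℕ (suc l) ≡ punchIn (suc p) (fromℕ l)
      lemma {zero}  zero    ne = contradiction refl ne
      lemma {suc l} zero    ne = refl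
      lemma {suc l} (suc p) ne = cong suc (lemma p (ne ∘ cong suc))
    rot-punchIn-≢ {suc l} p (suc i) ne = lemma p i ne
      where
      lemma : ∀ {l} (p : Fin (suc l)) (i : Fin l) → inject₁ i ≢ p →
              inject₁ (punchIn p i) ≡ punchIn (suc p) (inject₁ i)
      lemma zero    zero    ne = contradiction refl ne
      lemma zero    (suc i) ne = refl
      lemma (suc p) zero    ne = refl
      lemma (suc p) (suc i) ne = cong suc (lemma p i (ne ∘ cong suc))

    -- This and the next two lemmas cover all steps in the lengthened cycle: the new point goes to
    -- x, the former predecessor of x goes to the new point, and all other steps are as before.
    std-new : ∀ {λs} (x : Pos λs) → old x x ≡ std (new x)
    std-new {_ ∷ _} (inj₁ p) = cong inj₁ (sym (inject₁-punchIn p))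
    std-new {_ ∷ _} (inj₂ y) = cong inj₂ (std-new y)

    std-old-≡ : ∀ {λs} (x z : Pos λs) → std z ≡ x → new x ≡ std (old x z)
    std-old-≡ {_ ∷ _} .(inj₁ (rot i)) (inj₁ i) refl = cong inj₁ (sym (rot-punchIn-≡ (rot i) i refl))
    std-old-≡ {_ ∷ _} .(inj₂ (std z)) (inj₂ z) refl = cong inj₂ (std-old-≡ (std z) z refl)

    std-old-≢ : ∀ {λs} (x z : Pos λs) → std z ≢ x → old x (std z) ≡ std (old x z)
    std-old-≢ {_ ∷ _} (inj₁ p) (inj₁ i) ne = cong inj₁ (sym (rot-punchIn-≢ p i (ne ∘ cong inj₁)))
    std-old-≢ {_ ∷ _} (inj₁ p) (inj₂ z) ne = refl
    std-old-≢ {_ ∷ _} (inj₂ y) (inj₁ i) ne = refl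
    std-old-≢ {_ ∷ _} (inj₂ y) (inj₂ z) ne = cong inj₂ (std-old-≢ y z (ne ∘ cong inj₂))

  extend-zero-type : ∀ {σ : Permutation′ n} {λs} → HasType σ λs → HasType (extend zero σ) (0 ∷ λs)
  extend-zero-type {σ = σ} {λs} h = record
    { to      = λ { zero → inj₁ zero ; (suc i) → inj₂ (H.to i) }
    ; from    = λ { (inj₁ _) → zero ; (inj₂ y) → suc (H.from y) }
    ; to-from = λ { (inj₁ zero) → refl ; (inj₂ y) → cong inj₂ (H.to-from y) }
    ; from-to = λ { zero → refl ; (suc i) → cong suc (H.from-to i) }
    ; comm    = λ { zero → refl ; (suc i) → cong inj₂ (H.comm i) }
    }
    where
    module H = _≅_ h

  extend-suc-type : ∀ {σ : Permutation′ n} {λs} (h : HasType σ λs) j → HasType (extend (suc j) σ) (bump λs (_≅_.to h j))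
  extend-suc-type {n} {σ} {λs} h j = record
    { to      = to
    ; from    = λ y → from′ (which x y)
    ; to-from = λ y → to-from (which x y) (which-correct x y)
    ; from-to = λ { zero → cong from′ (which-new x) ; (suc i) → trans (cong from′ (which-old x (H.to i))) (cong suc (H.from-to i)) }
    ; comm    = λ { zero → comm-zero ; (suc i) → comm-suc i }
    }
    where
    module H = _≅_ h
    x = H.to j

    to : Fin (suc n) → Pos (bump λs x)
    to zero    = new x
    to (suc i) = old x (H.to i)

    from′ : Maybe (Pos λs) → Fin (suc n)
    from′ nothing  = zero
    from′ (just z) = suc (H.from z)

    to-from : ∀ {y} m → Which x y m → to (from′ m) ≡ y
    to-from nothing  e = e
    to-from (just z) e = trans (cong (old x) (H.to-from z)) e

    comm-zero : to (PC.transpose zero (suc j) zero) ≡ std (new x)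
    comm-zero = std-new x

    comm-suc : ∀ i → to (PC.transpose zero (suc j) (suc (σ ⟨$⟩ʳ i))) ≡ std (old x (H.to i))
    comm-suc i with σ ⟨$⟩ʳ i Fin.≟ j
    ... | yes e = std-old-≡ x (H.to i) (trans (sym (H.comm i)) (cong H.to e))
    ... | no ¬e = trans (cong (old x) (H.comm i)) (std-old-≢ x (H.to i)
                    (λ e → ¬e (trans (sym (H.from-to _)) (trans (cong H.from (trans (H.comm i) e)) (H.from-to j)))))

-- Cycle types with their numbers, and sums of class functions over all permutations.

module CycleTypes where
  open Sums
  open Permutations
  open import Data.Bool.Base using (Bool; true; false; if_then_else_; T)
  open import Data.Fin.Base as Fin using (Fin; zero; suc)
  open import Data.Fin.Permutation as Perm using (Permutation′)
  import Data.Fin.Properties as Fin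
  open import Data.List.Base using (List; []; _∷_; _++_; map; allFin; foldr)
  open import Data.List.Relation.Binary.Permutation.Propositional as ↭ using (_↭_; ↭-refl; ↭-trans; prep)
  open import Data.List.Relation.Unary.All using (All; []; _∷_)
  import Data.List.Relation.Unary.All as All
  import Data.List.Properties as List
  open import Data.Nat.Base
  open import Data.Nat.Properties
  open import Data.Product.Base using (_×_; _,_)
  open import Data.Sum.Base using (inj₁; inj₂)
  import Data.Sum.Properties as Sum
  open import Data.Unit.Base using (⊤; tt)
  open import Function.Base using (_∘_; id)
  open import Level using (0ℓ)
  open import Relation.Binary.Bundles using (DecSetoid)
  open import Relation.Binary.Definitions using (DecidableEquality)
  import Relation.Binary.PropositionalEquality.Properties as ≡
  open import Relation.Binary.PropositionalEquality hiding (_≗_)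
  open import Relation.Nullary using (yes)

  private variable
    n v : ℕ

  _≟ᴾ_ : ∀ {λs} → DecidableEquality (Pos λs)
  _≟ᴾ_ {_ ∷ _} = Sum.≡-dec Fin._≟_ _≟ᴾ_

  positions : ∀ λs → List (Pos λs)
  positions []       = []
  positions (l ∷ λs) = map inj₁ (allFin (suc l)) ++ map inj₂ (positions λs)

  ∑-positions : ∀ l λs (φ : Pos (l ∷ λs) → ℕ) →
    ∑ (positions (l ∷ λs)) φ ≡ ∑ (allFin (suc l)) (φ ∘ inj₁) + ∑ (positions λs) (φ ∘ inj₂)
  ∑-positions l λs φ = trans (∑-++ (map inj₁ (allFin (suc l))) _ φ) (cong₂ _+_ (∑-map inj₁ (allFin (suc l)) φ) (∑-map inj₂ (positions λs) φ))

  posEnum : ∀ λs → Enum (≡.decSetoid (_≟ᴾ_ {λs})) (λ _ → 1)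
  posEnum λs = record { list = positions λs ; sound = All.universal (λ _ → refl) _ ; each = once λs }
    where
    once : ∀ λs (y : Pos λs) → ∑ (positions λs) (λ x → ⟦ x ≟ᴾ y ⟧) ≡ 1
    once (l ∷ λs) (inj₁ i) = trans (∑-positions l λs (λ x → ⟦ x ≟ᴾ inj₁ i ⟧)) (cong₂ _+_ (∑-δ i) (∑-zero (positions λs)))
    once (l ∷ λs) (inj₂ y) = trans (∑-positions l λs (λ x → ⟦ x ≟ᴾ inj₂ y ⟧)) (cong₂ _+_ (∑-zero (allFin (suc l))) (once λs y))

  reindex : ∀ {X Y : DecSetoid 0ℓ 0ℓ} (EX : Enum X (λ _ → 1)) (EY : Enum Y (λ _ → 1)) →
    (f : DecSetoid.Carrier X → DecSetoid.Carrier Y) (g : DecSetoid.Carrier Y → DecSetoid.Carrier X) →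
    (∀ {x x′} → DecSetoid._≈_ X x x′ → DecSetoid._≈_ Y (f x) (f x′)) → (∀ {y y′} → DecSetoid._≈_ Y y y′ → DecSetoid._≈_ X (g y) (g y′)) →
    (∀ x → DecSetoid._≈_ X (g (f x)) x) → (∀ y → DecSetoid._≈_ Y (f (g y)) y) →
    (φ : DecSetoid.Carrier X → ℕ) → (∀ {x x′} → DecSetoid._≈_ X x x′ → φ x ≡ φ x′) → ∑ (list EX) φ ≡ ∑ (list EY) (φ ∘ g)
  reindex EX EY f g f-cong g-cong gf fg φ φ-cong = trans (∑-cong (list EX) (λ x → sym (+-identityʳ (φ x))))
    (trans (reindex-on EX EY {P = λ _ → ⊤} {Q = λ _ → ⊤} (λ _ → yes tt) (λ _ → yes tt) f g (λ _ _ → tt) (λ _ _ → tt) f-cong g-cong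
      (λ x _ → tt , gf x , λ _ → refl) (λ y _ → tt , fg y , λ _ → refl) φ φ-cong)
    (∑-cong (list EY) (λ y → +-identityʳ (φ (g y)))))

  ∑-type : ∀ {σ : Permutation′ n} {λs} (h : HasType σ λs) (φ : Fin n → ℕ) → ∑ (allFin n) φ ≡ ∑ (positions λs) (φ ∘ _≅_.from h)
  ∑-type {n} {λs = λs} h φ = reindex (finEnum n) (posEnum λs) H.to H.from (cong H.to) (cong H.from) H.from-to H.to-from φ (cong φ)
    where
    module H = _≅_ h

  insort : ℕ → List ℕ → List ℕ
  insort x []       = x ∷ []
  insort x (y ∷ ys) = if x ≤ᵇ y then x ∷ y ∷ ys else y ∷ insort x ys

  -- Types are kept sorted so that equal types are equal lists and can be merged. This keeps the
  -- number of entries down to the number of partitions of n.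
  sort : List ℕ → List ℕ
  sort = foldr insort []

  insort-↭ : ∀ x ys → x ∷ ys ↭ insort x ys
  insort-↭ x [] = ↭-refl
  insort-↭ x (y ∷ ys) with x ≤ᵇ y
  ... | true  = ↭-refl
  ... | false = ↭-trans (↭.swap x y ↭-refl) (prep y (insort-↭ x ys))

  sort-↭ : ∀ xs → xs ↭ sort xs
  sort-↭ []       = ↭-refl
  sort-↭ (x ∷ xs) = ↭-trans (prep x (sort-↭ xs)) (insort-↭ x (sort xs))

  ≅-trans : ∀ {A B C : Set} {s : A → A} {t : B → B} {u : C → C} → s ≅ t → t ≅ u → s ≅ u
  ≅-trans f g = record
    { to = G.to ∘ F.to ; from = F.from ∘ G.from
    ; to-from = λ z → trans (cong G.to (F.to-from _)) (G.to-from z)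
    ; from-to = λ x → trans (cong F.from (G.from-to _)) (F.from-to x)
    ; comm = λ x → trans (cong G.to (F.comm x)) (G.comm _)
    }
    where
    module F = _≅_ f
    module G = _≅_ g

  std-↭ : ∀ {λs μs} → λs ↭ μs → std {λs} ≅ std {μs}
  std-↭ ↭.refl = record { to = id ; from = id ; to-from = λ _ → refl ; from-to = λ _ → refl ; comm = λ _ → refl }
  std-↭ (prep l p) = record
    { to = λ { (inj₁ i) → inj₁ i ; (inj₂ y) → inj₂ (P.to y) } ; from = λ { (inj₁ i) → inj₁ i ; (inj₂ y) → inj₂ (P.from y) }
    ; to-from = λ { (inj₁ i) → refl ; (inj₂ y) → cong inj₂ (P.to-from y) }
    ; from-to = λ { (inj₁ i) → refl ; (inj₂ y) → cong inj₂ (P.from-to y) }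
    ; comm = λ { (inj₁ i) → refl ; (inj₂ y) → cong inj₂ (P.comm y) } }
    where
    module P = _≅_ (std-↭ p)
  std-↭ (↭.swap l m p) = record
    { to = λ { (inj₁ i) → inj₂ (inj₁ i) ; (inj₂ (inj₁ j)) → inj₁ j ; (inj₂ (inj₂ y)) → inj₂ (inj₂ (P.to y)) }
    ; from = λ { (inj₁ i) → inj₂ (inj₁ i) ; (inj₂ (inj₁ j)) → inj₁ j ; (inj₂ (inj₂ y)) → inj₂ (inj₂ (P.from y)) }
    ; to-from = λ { (inj₁ i) → refl ; (inj₂ (inj₁ j)) → refl ; (inj₂ (inj₂ y)) → cong (inj₂ ∘ inj₂) (P.to-from y) }
    ; from-to = λ { (inj₁ i) → refl ; (inj₂ (inj₁ j)) → refl ; (inj₂ (inj₂ y)) → cong (inj₂ ∘ inj₂) (P.from-to y) }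
    ; comm = λ { (inj₁ i) → refl ; (inj₂ (inj₁ j)) → refl ; (inj₂ (inj₂ y)) → cong (inj₂ ∘ inj₂) (P.comm y) } }
    where
    module P = _≅_ (std-↭ p)
  std-↭ (↭.trans p q) = ≅-trans (std-↭ p) (std-↭ q)

  Weighted : Set
  Weighted = List (ℕ × List ℕ)

  eval : Weighted → (List ℕ → ℕ) → ℕ
  eval w F = ∑ w λ (c , λs) → c * F λs

  _==_ : List ℕ → List ℕ → Bool
  []       == []       = true
  []       == (_ ∷ _)  = false
  (_ ∷ _)  == []       = false
  (x ∷ xs) == (y ∷ ys) = if x ≡ᵇ y then xs == ys else false

  ==⇒≡ : ∀ xs ys → (xs == ys) ≡ true → xs ≡ ys
  ==⇒≡ []       []       eq = refl
  ==⇒≡ (x ∷ xs) (y ∷ ys) eq with x ≡ᵇ y in e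
  ... | true = cong₂ _∷_ (≡ᵇ⇒≡ x y (subst T (sym e) tt)) (==⇒≡ xs ys eq)

  -- Compares with the first entry only. In `bumps` that is enough for merging, since cycles of
  -- equal length are neighbours in a sorted type and lead to equal results. `collect` searches the
  -- whole list.
  push : ℕ × List ℕ → Weighted → Weighted
  push e [] = e ∷ []
  push (c , λs) ((c′ , μs) ∷ w) = if λs == μs then (c + c′ , μs) ∷ w else (c , λs) ∷ (c′ , μs) ∷ w

  collect : ℕ × List ℕ → Weighted → Weighted
  collect e [] = e ∷ []
  collect (c , λs) ((c′ , μs) ∷ w) = if λs == μs then (c + c′ , μs) ∷ w else (c′ , μs) ∷ collect (c , λs) w

  merged : ∀ c c′ λs μs (w : Weighted) F → (λs == μs) ≡ true → eval ((c + c′ , μs) ∷ w) F ≡ c * F λs + eval ((c′ , μs) ∷ w) F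
  merged c c′ λs μs w F e with refl ← ==⇒≡ λs μs e =
    trans (cong (_+ eval w F) (*-distribʳ-+ (F λs) c c′)) (+-assoc (c * F λs) _ _)

  eval-push : ∀ c λs w F → eval (push (c , λs) w) F ≡ c * F λs + eval w F
  eval-push c λs [] F = refl
  eval-push c λs ((c′ , μs) ∷ w) F with λs == μs in e
  ... | true  = merged c c′ λs μs w F e
  ... | false = refl

  eval-collect : ∀ c λs w F → eval (collect (c , λs) w) F ≡ c * F λs + eval w F
  eval-collect c λs [] F = refl
  eval-collect c λs ((c′ , μs) ∷ w) F with λs == μs in e
  ... | true  = merged c c′ λs μs w F e
  ... | false = trans (cong (c′ * F μs +_) (eval-collect c λs w F)) (x∙yz≈y∙xz (c′ * F μs) (c * F λs) (eval w F))
    where open import Algebra.Properties.CommutativeSemigroup +-commutativeSemigroup using (x∙yz≈y∙xz)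

  -- `pre` holds the parts already passed. A new point can be put in front of any of the l + 1
  -- points of a cycle, hence the factor `suc l`.
  bumps : ℕ → List ℕ → List ℕ → Weighted
  bumps c pre []       = []
  bumps c pre (l ∷ λs) = push (c * suc l , sort (pre ++ suc l ∷ λs)) (bumps c (pre ++ l ∷ []) λs)

  grow : Weighted → Weighted
  grow []             = []
  grow ((c , λs) ∷ w) = foldr collect (grow w) ((c , sort (0 ∷ λs)) ∷ bumps c [] λs)

  -- The cycle types of the permutations of n points, with their numbers.

  types : ℕ → Weighted
  types zero    = (1 , []) ∷ []
  types (suc n) = grow (types n)

  eval-bumps : ∀ c pre λs F → eval (bumps c pre λs) F ≡ c * ∑ (positions λs) (λ x → F (sort (pre ++ bump λs x)))
  eval-bumps c pre []       F = sym (*-zeroʳ c)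
  eval-bumps c pre (l ∷ λs) F = begin
    eval (push (c * suc l , sort (pre ++ suc l ∷ λs)) (bumps c (pre ++ l ∷ []) λs)) F
      ≡⟨ eval-push (c * suc l) _ (bumps c (pre ++ l ∷ []) λs) F ⟩
    c * suc l * G + eval (bumps c (pre ++ l ∷ []) λs) F
      ≡⟨ cong₂ _+_ (*-assoc c (suc l) G) (eval-bumps c (pre ++ l ∷ []) λs F) ⟩
    c * (suc l * G) + c * ∑ (positions λs) (λ x → F (sort ((pre ++ l ∷ []) ++ bump λs x)))
      ≡⟨ *-distribˡ-+ c (suc l * G) _ ⟨
    c * (suc l * G + ∑ (positions λs) (λ x → F (sort ((pre ++ l ∷ []) ++ bump λs x))))
      ≡⟨ cong (c *_) (cong₂ _+_ (sym (∑-const (suc l) G))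
           (∑-cong (positions λs) (λ x → cong (F ∘ sort) (List.++-assoc pre (l ∷ []) (bump λs x))))) ⟩
    c * (∑ (allFin (suc l)) (λ _ → G) + ∑ (positions λs) (λ x → F (sort (pre ++ l ∷ bump λs x))))
      ≡⟨ cong (c *_) (∑-positions l λs _) ⟨
    c * ∑ (positions (l ∷ λs)) (λ x → F (sort (pre ++ bump (l ∷ λs) x))) ∎
    where
    open ≡-Reasoning
    G = F (sort (pre ++ suc l ∷ λs))

  eval-foldr : ∀ es w F → eval (foldr collect w es) F ≡ eval es F + eval w F
  eval-foldr []              w F = refl
  eval-foldr ((c , λs) ∷ es) w F = trans (eval-collect c λs (foldr collect w es) F)
    (trans (cong (c * F λs +_) (eval-foldr es w F)) (sym (+-assoc (c * F λs) _ _)))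

  eval-grow : ∀ w F → eval (grow w) F ≡ eval w (λ λs → F (sort (0 ∷ λs)) + ∑ (positions λs) (λ x → F (sort (bump λs x))))
  eval-grow []             F = refl
  eval-grow ((c , λs) ∷ w) F = begin
    eval (grow ((c , λs) ∷ w)) F ≡⟨ eval-foldr ((c , sort (0 ∷ λs)) ∷ bumps c [] λs) (grow w) F ⟩
    c * F (sort (0 ∷ λs)) + eval (bumps c [] λs) F + eval (grow w) F
      ≡⟨ cong₂ _+_ (trans (cong (c * F (sort (0 ∷ λs)) +_) (eval-bumps c [] λs F)) (sym (*-distribˡ-+ c (F (sort (0 ∷ λs))) S))) (eval-grow w F) ⟩
    eval ((c , λs) ∷ w) _ ∎
    where
    open ≡-Reasoning
    S = ∑ (positions λs) (λ x → F (sort (bump λs x)))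

  -- By induction on n. The types of all extensions of σ are determined by the type of σ: one has a
  -- new fixed point, and each position gives one with a longer cycle. So the sum over the
  -- extensions of σ is again a function of the type alone, to which the induction hypothesis
  -- applies.
  ∑-perms : ∀ n (Φ : Permutation′ n → ℕ) (F : List ℕ → ℕ) → (∀ σ λs → HasType σ λs → Φ σ ≡ F λs) →
            ∑ (perms n) Φ ≡ eval (types n) F
  ∑-perms zero    Φ F eq = cong (_+ 0) (trans (eq Perm.id [] trivial) (sym (+-identityʳ (F []))))
    where
    trivial : HasType Perm.id []
    trivial = record { to = λ () ; from = λ () ; to-from = λ () ; from-to = λ () ; comm = λ () }
  ∑-perms (suc n) Φ F eq = begin
    ∑ (perms (suc n)) Φ ≡⟨ ∑-product extend (allFin (suc n)) (perms n) Φ ⟩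
    ∑ (allFin (suc n)) (λ j → ∑ (perms n) (λ π → Φ (extend j π))) ≡⟨ ∑-swap (allFin (suc n)) (perms n) _ ⟩
    ∑ (perms n) (λ π → ∑ (allFin (suc n)) (λ j → Φ (extend j π))) ≡⟨ ∑-perms n _ _ step ⟩
    eval (types n) (λ λs → F (sort (0 ∷ λs)) + ∑ (positions λs) (λ x → F (sort (bump λs x)))) ≡⟨ eval-grow (types n) F ⟨
    eval (types (suc n)) F ∎
    where
    open ≡-Reasoning
    step : ∀ σ λs → HasType σ λs → ∑ (allFin (suc n)) (λ j → Φ (extend j σ)) ≡
           F (sort (0 ∷ λs)) + ∑ (positions λs) (λ x → F (sort (bump λs x)))
    step σ λs h = begin
      ∑ (allFin (suc n)) (λ j → Φ (extend j σ)) ≡⟨ ∑-allFin n _ ⟩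
      Φ (extend zero σ) + ∑ (allFin n) (λ j → Φ (extend (suc j) σ))
        ≡⟨ cong₂ _+_ (eq (extend zero σ) _ (≅-trans (extend-zero-type {σ = σ} h) (std-↭ (sort-↭ (0 ∷ λs)))))
                     (∑-cong (allFin n) (λ j → eq (extend (suc j) σ) _ (≅-trans (extend-suc-type {σ = σ} h j) (std-↭ (sort-↭ (bump λs (_≅_.to h j))))))) ⟩
      F (sort (0 ∷ λs)) + ∑ (allFin n) (λ j → F (sort (bump λs (_≅_.to h j))))
        ≡⟨ cong (F (sort (0 ∷ λs)) +_) (trans (∑-type {σ = σ} h _) (∑-cong (positions λs) (λ x → cong (λ z → F (sort (bump λs z))) (_≅_.to-from h x)))) ⟩
      F (sort (0 ∷ λs)) + ∑ (positions λs) (λ x → F (sort (bump λs x))) ∎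

-- Functions with values below q that are invariant under a permutation.

module OrbitSizes (q : ℕ) where
  open Sums
  open Permutations
  open CycleTypes
  open import Data.Fin.Base as Fin using (Fin; zero; suc)
  import Data.Fin.Properties as Fin
  open import Data.List.Base using (List; []; _∷_; _++_; map; allFin; upTo; applyUpTo; cartesianProductWith)
  open import Data.List.Relation.Unary.All using (All; []; _∷_)
  import Data.List.Relation.Unary.All as All
  import Data.List.Relation.Unary.All.Properties as All
  open import Data.Nat.Base hiding (ℕ)
  open import Data.Nat.Properties
  open import Data.Product.Base using (_×_; _,_; proj₁; proj₂)
  open import Data.Product.Relation.Binary.Pointwise.NonDependent using (×-decSetoid)
  open import Function.Base using (_∘_; id)
  open import Function.Definitions using (Injective)
  open import Level using (0ℓ)
  open import Relation.Binary.Bundles using (DecSetoid)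
  open import Relation.Binary.PropositionalEquality hiding (_≗_)
  open import Relation.Nullary using (Dec; yes; contradiction)

  private variable
    n v : ℕ

  all-product : ∀ {A B C : Set} {P : A → Set} {Q : B → Set} {R : C → Set} (f : A → B → C) {xs ys} →
    All P xs → All Q ys → (∀ {x y} → P x → Q y → R (f x y)) → All R (cartesianProductWith f xs ys)
  all-product f []         qs pq = []
  all-product f (px ∷ pxs) qs pq = All.++⁺ (All.map⁺ (All.map (pq px) qs)) (all-product f pxs qs pq)

  module _ {X Y Z : DecSetoid 0ℓ 0ℓ} where
    private
      module X = DecSetoid X
      module Y = DecSetoid Y
      module Z = DecSetoid Z

    combine : ∀ {p q r} → Enum X p → Enum Y q → (f : X.Carrier → Y.Carrier → Z.Carrier) (g : Z.Carrier → X.Carrier) (h : Z.Carrier → Y.Carrier) →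
      (∀ x y z → f x y Z.≈ z → x X.≈ g z × y Y.≈ h z) → (∀ x y z → x X.≈ g z → y Y.≈ h z → f x y Z.≈ z) →
      (∀ z → p (g z) * q (h z) ≡ r z) → (∀ x y → p x ≡ 1 → q y ≡ 1 → r (f x y) ≡ 1) → Enum Z r
    combine EX EY f g h to from pq sd = record
      { list  = cartesianProductWith f (list EX) (list EY)
      ; sound = all-product f (sound EX) (sound EY) (sd _ _)
      ; each  = λ z → trans (∑-product f (list EX) (list EY) _)
          (trans (∑-cong (list EX) (λ x → trans (∑-cong (list EY) (λ y →
                    sym (⟦⟧-× (x X.≟ g z) (y Y.≟ h z) (f x y Z.≟ z) (to x y z) (from x y z)))) (∑-*ˡ (list EY) ⟦ x X.≟ g z ⟧ (λ y → ⟦ y Y.≟ h z ⟧))))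
          (trans (∑-*ʳ (list EX) (∑ (list EY) (λ y → ⟦ y Y.≟ h z ⟧)) (λ x → ⟦ x X.≟ g z ⟧)) (trans (cong₂ _*_ (each EX (g z)) (each EY (h z))) (pq z))))
      }

  pairEnum : ∀ {X Y p p′} → Enum X p → Enum Y p′ → Enum (×-decSetoid X Y) (λ (x , y) → p x * p′ y)
  pairEnum {X} {Y} EX EY = combine EX EY _,_ proj₁ proj₂ (λ _ _ _ → id) (λ _ _ _ → _,_) (λ _ → refl) (λ _ _ → cong₂ _*_)

  ℕ-decSetoid : DecSetoid 0ℓ 0ℓ
  ℕ-decSetoid = record { isDecEquivalence = record { isEquivalence = isEquivalence ; _≟_ = _≟_ } }

  ∑-applyUpTo : ∀ n f φ → ∑ (applyUpTo f n) φ ≡ ∑ (upTo n) (φ ∘ f)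
  ∑-applyUpTo zero    f φ = refl
  ∑-applyUpTo (suc n) f φ = cong (φ (f 0) +_) (trans (∑-applyUpTo n (f ∘ suc) φ) (sym (∑-applyUpTo n suc (φ ∘ f))))

  ∑-upTo-δ : ∀ n y → ∑ (upTo n) (λ x → ⟦ x ≟ y ⟧) ≡ ⟦ y <? n ⟧
  ∑-upTo-δ zero    y       = sym (⟦⟧-no (y <? 0) λ ())
  ∑-upTo-δ (suc n) zero    = cong suc (trans (∑-applyUpTo n suc _) (∑-zero (upTo n)))
  ∑-upTo-δ (suc n) (suc y) = trans (∑-applyUpTo n suc _) (trans (∑-cong (upTo n) (λ x → ⟦⟧-cong (suc x ≟ suc y) (x ≟ y) suc-injective (cong suc)))
    (trans (∑-upTo-δ n y) (⟦⟧-cong (y <? n) (suc y <? suc n) s≤s s≤s⁻¹)))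

  valEnum : Enum ℕ-decSetoid (λ y → ⟦ y <? q ⟧)
  valEnum = record { list = upTo q ; sound = All.map (λ {x} lt → ⟦⟧-yes (x <? q) lt) (All.all-upTo q) ; each = ∑-upTo-δ q }

  ⟦⟧-1 : ∀ {p} {P : Set p} (P? : Dec P) → ⟦ P? ⟧ ≡ 1 → P
  ⟦⟧-1 (yes p) _ = p

  funSetoid : ℕ → DecSetoid 0ℓ 0ℓ
  funSetoid n = record
    { Carrier = Fin n → ℕ ; _≈_ = λ f g → ∀ i → f i ≡ g i
    ; isDecEquivalence = record
      { isEquivalence = record { refl = λ _ → refl ; sym = λ e i → sym (e i) ; trans = λ e e′ i → trans (e i) (e′ i) }
      ; _≟_ = λ f g → Fin.all? λ i → f i ≟ g i } }

  bounded? : (f : Fin n → ℕ) → Dec (∀ i → f i < q)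
  bounded? f = Fin.all? λ i → f i <? q

  cons : ℕ → (Fin n → ℕ) → Fin (suc n) → ℕ
  cons a f zero    = a
  cons a f (suc i) = f i

  box : ∀ n → Enum (funSetoid n) (λ f → ⟦ bounded? f ⟧)
  box zero = record { list = (λ ()) ∷ [] ; sound = refl ∷ [] ; each = λ _ → refl }
  box (suc n) = combine valEnum (box n) cons (λ f → f zero) (_∘ suc)
    (λ _ _ _ e → e zero , e ∘ suc) (λ { _ _ _ e e′ zero → e ; _ _ _ e e′ (suc i) → e′ i })
    (λ f → ⟦⟧-× (f zero <? q) (bounded? (f ∘ suc)) (bounded? f) (λ b → b zero , b ∘ suc) (λ { b b′ zero → b ; b b′ (suc i) → b′ i }))
    (λ a f a< f< → ⟦⟧-yes (bounded? (cons a f)) λ { zero → ⟦⟧-1 (a <? q) a< ; (suc i) → ⟦⟧-1 (bounded? f) f< i })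

  ∑-box : ∀ n φ → ∑ (list (box (suc n))) φ ≡ ∑ (upTo q) (λ a → ∑ (list (box n)) (λ f → φ (cons a f)))
  ∑-box n φ = ∑-product cons (upTo q) (list (box n)) φ

  -- ev μ φ sums φ over all values of a weighted sum with weights μ and
  -- coefficients below q.

  ev : List ℕ → (ℕ → ℕ) → ℕ
  ev []      φ = φ 0
  ev (l ∷ μ) φ = ∑ (upTo q) (λ a → ev μ (λ x → φ (l * a + x)))

  ev-cong : ∀ μ {φ ψ} → (∀ x → φ x ≡ ψ x) → ev μ φ ≡ ev μ ψ
  ev-cong []      eq = eq 0
  ev-cong (l ∷ μ) eq = ∑-cong (upTo q) (λ a → ev-cong μ (λ x → eq (l * a + x)))

  ev-++ : ∀ μ ν φ → ev (μ ++ ν) φ ≡ ev μ (λ x → ev ν (λ y → φ (x + y)))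
  ev-++ []      ν φ = refl
  ev-++ (l ∷ μ) ν φ = ∑-cong (upTo q) (λ a → trans (ev-++ μ ν _) (ev-cong μ (λ x → ev-cong ν (λ y → cong φ (sym (+-assoc (l * a) x y))))))

  ev-scale : ∀ c μ φ → ev μ (λ x → φ (c * x)) ≡ ev (map (c *_) μ) φ
  ev-scale c []      φ = cong φ (*-zeroʳ c)
  ev-scale c (l ∷ μ) φ = ∑-cong (upTo q) (λ a → trans
    (ev-cong μ (λ x → cong φ (trans (*-distribˡ-+ c (l * a) x) (cong (_+ c * x) (sym (*-assoc c l a))))))
    (ev-scale c μ (λ x → φ (c * l * a + x))))

  -- The first return map of π to the points other than zero.
  skip : (Fin (suc n) → Fin (suc n)) → Fin n → Fin n
  skip π i with π (suc i)
  ... | suc k = k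
  ... | zero with π zero
  ...   | suc j = j
  -- A default value: here both `suc i` and zero go to zero, so π is not injective.
  ...   | zero  = i

  skip-suc : ∀ (π : Fin (suc n) → Fin (suc n)) {i k} → π (suc i) ≡ suc k → skip π i ≡ k
  skip-suc π {i} e with π (suc i)
  skip-suc π refl | suc k = refl

  skip-zero : ∀ (π : Fin (suc n) → Fin (suc n)) {i j} → π (suc i) ≡ zero → π zero ≡ suc j → skip π i ≡ j
  skip-zero π {i} e e₀ with π (suc i)
  ... | zero with π zero
  skip-zero π refl refl | zero | suc j = refl

  addAt : Fin n → ℕ → (Fin n → ℕ) → Fin n → ℕ
  addAt j c w i = ⟦ i Fin.≟ j ⟧ * c + w i

  -- Collapsing the orbits of π one point at a time: the weights of identified
  -- points are added.

  orbs : ∀ n → (Fin n → Fin n) → (Fin n → ℕ) → List ℕ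
  orbs zero    π w = []
  orbs (suc n) π w with π zero
  ... | zero  = w zero ∷ orbs n (skip π) (w ∘ suc)
  ... | suc j = orbs n (skip π) (addAt j (w zero) (w ∘ suc))

  orbs-fixed : ∀ (π : Fin (suc n) → Fin (suc n)) w → π zero ≡ zero → orbs (suc n) π w ≡ w zero ∷ orbs n (skip π) (w ∘ suc)
  orbs-fixed π w e with zero ← π zero = refl

  orbs-moved : ∀ (π : Fin (suc n) → Fin (suc n)) w {j} → π zero ≡ suc j → orbs (suc n) π w ≡ orbs n (skip π) (addAt j (w zero) (w ∘ suc))
  orbs-moved π w e with suc j ← π zero with refl ← e = refl

  invariant? : (π : Fin n → Fin n) (h : Fin n → ℕ) → Dec (∀ i → h (π i) ≡ h i)
  invariant? π h = Fin.all? λ i → h (π i) ≟ h i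

  skip-injective : ∀ (π : Fin (suc n) → Fin (suc n)) → Injective _≡_ _≡_ π → Injective _≡_ _≡_ (skip π)
  skip-injective π inj {i} {i′} e with π (suc i) in e₁ | π (suc i′) in e₂
  ... | suc k | suc k′ = Fin.suc-injective (inj (trans e₁ (trans (cong suc e) (sym e₂))))
  ... | zero  | zero   = Fin.suc-injective (inj (trans e₁ (sym e₂)))
  ... | zero  | suc k′ with π zero in e₀
  ...   | suc j = contradiction (inj (trans e₀ (trans (cong suc e) (sym e₂)))) λ ()
  ...   | zero  = contradiction (inj (trans e₀ (sym e₁))) λ ()
  skip-injective π inj {i} {i′} e | suc k | zero with π zero in e₀
  ...   | suc j = contradiction (inj (trans e₀ (trans (cong suc (sym e)) (sym e₁)))) λ ()
  ...   | zero  = contradiction (inj (trans e₀ (sym e₂))) λ ()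

  weigh : (Fin n → ℕ) → (Fin n → ℕ) → ℕ
  weigh w h = ∑ (allFin _) (λ i → w i * h i)

  weigh-addAt : ∀ (j : Fin n) c w h → weigh (addAt j c w) h ≡ c * h j + weigh w h
  weigh-addAt {n} j c w h = begin
    ∑ (allFin n) (λ i → (⟦ i Fin.≟ j ⟧ * c + w i) * h i)
      ≡⟨ ∑-cong (allFin n) (λ i → trans (*-distribʳ-+ (h i) (⟦ i Fin.≟ j ⟧ * c) (w i))
           (cong (_+ w i * h i) (trans (*-assoc ⟦ i Fin.≟ j ⟧ c (h i)) (⟦⟧-guard (i Fin.≟ j) (λ e → cong (λ i → c * h i) e))))) ⟩
    ∑ (allFin n) (λ i → ⟦ i Fin.≟ j ⟧ * (c * h j) + w i * h i) ≡⟨ ∑-+ (allFin n) _ _ ⟩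
    ∑ (allFin n) (λ i → ⟦ i Fin.≟ j ⟧ * (c * h j)) + weigh w h
      ≡⟨ cong (_+ weigh w h) (trans (∑-*ʳ (allFin n) (c * h j) _) (trans (cong (_* (c * h j)) (∑-δ j)) (*-identityˡ _))) ⟩
    c * h j + weigh w h ∎
    where open ≡-Reasoning

  weigh-suc : ∀ (w : Fin (suc n) → ℕ) h → weigh w h ≡ w zero * h zero + weigh (w ∘ suc) (h ∘ suc)
  weigh-suc {n} w h = ∑-allFin n _

  invariants-fixed : ∀ (π : Fin (suc n) → Fin (suc n)) → Injective _≡_ _≡_ π → π zero ≡ zero → ∀ a f →
    ⟦ invariant? π (cons a f) ⟧ ≡ ⟦ invariant? (skip π) f ⟧
  invariants-fixed π inj e₀ a f = ⟦⟧-cong (invariant? π (cons a f)) (invariant? (skip π) f) (λ s i → to i (s (suc i))) λ { s zero → cong (cons a f) e₀ ; s (suc i) → from i (s i) }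
    where
    to : ∀ i → cons a f (π (suc i)) ≡ f i → f (skip π i) ≡ f i
    to i s with π (suc i) in e₁
    ... | suc k = s
    ... | zero  = contradiction (inj (trans e₁ (sym e₀))) λ ()
    from : ∀ i → f (skip π i) ≡ f i → cons a f (π (suc i)) ≡ f i
    from i s with π (suc i) in e₁
    ... | suc k = s
    ... | zero  = contradiction (inj (trans e₁ (sym e₀))) λ ()

  invariants-moved : ∀ (π : Fin (suc n) → Fin (suc n)) {j} → π zero ≡ suc j → ∀ a f →
    ⟦ invariant? (skip π) f ⟧ * ⟦ a ≟ f j ⟧ ≡ ⟦ invariant? π (cons a f) ⟧
  invariants-moved π {j} e₀ a f = ⟦⟧-× (invariant? (skip π) f) (a ≟ f j) (invariant? π (cons a f))
    (λ s → (λ i → to i (sym (trans (cong (cons a f) (sym e₀)) (s zero))) (s (suc i))) , sym (trans (cong (cons a f) (sym e₀)) (s zero)))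
    λ { s e zero → trans (cong (cons a f) e₀) (sym e) ; s e (suc i) → from i e (s i) }
    where
    to : ∀ i → a ≡ f j → cons a f (π (suc i)) ≡ f i → f (skip π i) ≡ f i
    to i e s = go (π (suc i)) refl
      where
      go : ∀ x → π (suc i) ≡ x → f (skip π i) ≡ f i
      go zero    e₁ = trans (cong f (skip-zero π e₁ e₀)) (trans (sym e) (trans (cong (cons a f) (sym e₁)) s))
      go (suc k) e₁ = trans (cong f (skip-suc π e₁)) (trans (cong (cons a f) (sym e₁)) s)
    from : ∀ i → a ≡ f j → f (skip π i) ≡ f i → cons a f (π (suc i)) ≡ f i
    from i e s = go (π (suc i)) refl
      where
      go : ∀ x → π (suc i) ≡ x → cons a f (π (suc i)) ≡ f i
      go zero    e₁ = trans (cong (cons a f) e₁) (trans e (trans (cong f (sym (skip-zero π e₁ e₀))) s))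
      go (suc k) e₁ = trans (cong (cons a f) e₁) (trans (cong f (sym (skip-suc π e₁))) s)

  -- An invariant function is a free choice of one value for each orbit, and contributes this value
  -- times the total weight of the orbit. The induction removes zero: either zero is an orbit by
  -- itself, or its value is forced by that at `π zero`, to which its weight is passed on.
  ∑-invariant : ∀ n (π : Fin n → Fin n) → Injective _≡_ _≡_ π → ∀ w ψ →
    ∑ (list (box n)) (λ h → ⟦ invariant? π h ⟧ * ψ (weigh w h)) ≡ ev (orbs n π w) ψ
  ∑-invariant zero    π inj w ψ = trans (+-identityʳ _) (+-identityʳ _)
  ∑-invariant (suc n) π inj w ψ = go (π zero) refl
    where
    open ≡-Reasoning
    go : ∀ x → π zero ≡ x → ∑ (list (box (suc n))) (λ h → ⟦ invariant? π h ⟧ * ψ (weigh w h)) ≡ ev (orbs (suc n) π w) ψ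
    go zero e₀ = begin
      ∑ (list (box (suc n))) (λ h → ⟦ invariant? π h ⟧ * ψ (weigh w h)) ≡⟨ ∑-box n _ ⟩
      ∑ (upTo q) (λ a → ∑ (list (box n)) (λ f → ⟦ invariant? π (cons a f) ⟧ * ψ (weigh w (cons a f))))
        ≡⟨ ∑-cong (upTo q) (λ a → ∑-cong (list (box n)) λ f → cong₂ _*_ (invariants-fixed π inj e₀ a f) (cong ψ (weigh-suc w (cons a f)))) ⟩
      ∑ (upTo q) (λ a → ∑ (list (box n)) (λ f → ⟦ invariant? (skip π) f ⟧ * ψ (w zero * a + weigh (w ∘ suc) f)))
        ≡⟨ ∑-cong (upTo q) (λ a → ∑-invariant n (skip π) (skip-injective π inj) (w ∘ suc) (λ x → ψ (w zero * a + x))) ⟩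
      ∑ (upTo q) (λ a → ev (orbs n (skip π) (w ∘ suc)) (λ x → ψ (w zero * a + x)))
        ≡⟨ cong (λ μ → ev μ ψ) (orbs-fixed π w e₀) ⟨
      ev (orbs (suc n) π w) ψ ∎
    go (suc j) e₀ = begin
      ∑ (list (box (suc n))) (λ h → ⟦ invariant? π h ⟧ * ψ (weigh w h)) ≡⟨ ∑-box n _ ⟩
      ∑ (upTo q) (λ a → ∑ (list (box n)) (λ f → ⟦ invariant? π (cons a f) ⟧ * ψ (weigh w (cons a f)))) ≡⟨ ∑-swap (upTo q) (list (box n)) _ ⟩
      ∑ (list (box n)) (λ f → ∑ (upTo q) (λ a → ⟦ invariant? π (cons a f) ⟧ * ψ (weigh w (cons a f))))
        ≡⟨ ∑-congᴬ (sound (box n)) (λ f f<q → trans (∑-cong (upTo q) (λ a → trans (cong₂ _*_ (sym (invariants-moved π e₀ a f)) (cong ψ (weigh-suc w (cons a f))))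
             (trans (*-assoc ⟦ invariant? (skip π) f ⟧ ⟦ a ≟ f j ⟧ _) (cong (⟦ invariant? (skip π) f ⟧ *_) (⟦⟧-guard (a ≟ f j) (λ e → cong (λ a → ψ (w zero * a + weigh (w ∘ suc) f)) e))))))
             (trans (∑-*ˡ (upTo q) ⟦ invariant? (skip π) f ⟧ _) (cong (⟦ invariant? (skip π) f ⟧ *_)
               (trans (∑-*ʳ (upTo q) _ _) (trans (cong (_* _) (trans (∑-upTo-δ q (f j)) (⟦⟧-yes (f j <? q) (⟦⟧-1 (bounded? f) f<q j))))
                 (trans (*-identityˡ _) (cong ψ (sym (weigh-addAt j (w zero) (w ∘ suc) f))))))))) ⟩
      ∑ (list (box n)) (λ f → ⟦ invariant? (skip π) f ⟧ * ψ (weigh (addAt j (w zero) (w ∘ suc)) f))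
        ≡⟨ ∑-invariant n (skip π) (skip-injective π inj) (addAt j (w zero) (w ∘ suc)) ψ ⟩
      ev (orbs n (skip π) (addAt j (w zero) (w ∘ suc))) ψ ≡⟨ cong (λ μ → ev μ ψ) (orbs-moved π w e₀) ⟨
      ev (orbs (suc n) π w) ψ ∎

-- Rotations of cycles and symmetric circulant matrices.

module PairRotations (q-1 : ℕ) where
  open Sums
  open Permutations
  open CycleTypes
  open OrbitSizes (suc q-1)
  open import Data.Fin.Base as Fin using (Fin; zero; suc; toℕ; fromℕ; inject₁; opposite)
  import Data.Fin.Properties as Fin
  open import Data.List.Base using (List; []; _∷_; _++_; allFin)
  open import Data.List.Relation.Unary.All using ([]; _∷_)
  open import Data.Nat.Base hiding (ℕ; suc)
  open import Data.Nat.Properties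
  open import Data.Product.Base using (_,_)
  open import Data.Sum.Base using (_⊎_; inj₁; inj₂; [_,_]′)
  open import Function.Base using (_∘_)
  open import Function.Definitions using (Injective)
  open import Level using (0ℓ)
  open import Relation.Binary.Bundles using (DecSetoid)
  open import Relation.Binary.Definitions using (tri<; tri≈; tri>)
  open import Relation.Binary.PropositionalEquality hiding (_≗_)
  open import Relation.Nullary using (Dec; yes; no; contradiction)
  open import Relation.Nullary.Decidable using (_×-dec_; map′)

  private variable
    l n v : ℕ
    λs : List ℕ

  q : ℕ
  q = suc q-1

  iter : ∀ {A : Set} → (A → A) → ℕ → A → A
  iter f 0       x = x
  iter f (suc k) x = iter f k (f x)

  iter-+ : ∀ {A : Set} (f : A → A) a b x → iter f (a + b) x ≡ iter f b (iter f a x)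
  iter-+ f 0       b x = refl
  iter-+ f (suc a) b x = iter-+ f a b (f x)

  iter-comm : ∀ {A : Set} (f : A → A) k x → f (iter f k x) ≡ iter f k (f x)
  iter-comm f 0       x = refl
  iter-comm f (suc k) x = iter-comm f k (f x)

  iter-inverse : ∀ {A : Set} {f g : A → A} → (∀ x → g (f x) ≡ x) → ∀ k x → iter g k (iter f k x) ≡ x
  iter-inverse gf 0 x = refl
  iter-inverse {f = f} {g} gf (suc k) x = trans (cong (iter g k) (trans (cong g (sym (iter-comm f k x))) (gf _))) (iter-inverse gf k x)

  toℕ-iter-rot : ∀ k (j : Fin (suc l)) → k ≤ toℕ j → toℕ (iter rot k j) ≡ toℕ j ∸ k
  toℕ-iter-rot 0       j       k≤j = refl
  toℕ-iter-rot (suc k) (suc j) k≤j = trans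
    (toℕ-iter-rot k (inject₁ j) (≤-trans (s≤s⁻¹ k≤j) (≤-reflexive (sym (Fin.toℕ-inject₁ j))))) (cong (_∸ k) (Fin.toℕ-inject₁ j))

  iter-rot-self : ∀ (j : Fin (suc l)) → iter rot (toℕ j) j ≡ zero
  iter-rot-self j = Fin.toℕ-injective (trans (toℕ-iter-rot (toℕ j) j ≤-refl) (n∸n≡0 (toℕ j)))

  iter-rot-wrap : ∀ k (j : Fin (suc l)) → k ≤ l → toℕ (iter rot (toℕ j + suc k) j) ≡ l ∸ k
  iter-rot-wrap {l} k j k≤l = begin
    toℕ (iter rot (toℕ j + suc k) j) ≡⟨ cong toℕ (iter-+ rot (toℕ j) (suc k) j) ⟩
    toℕ (iter rot (suc k) (iter rot (toℕ j) j)) ≡⟨ cong (toℕ ∘ iter rot (suc k)) (iter-rot-self j) ⟩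
    toℕ (iter rot k (fromℕ l)) ≡⟨ toℕ-iter-rot k (fromℕ l) (≤-trans k≤l (≤-reflexive (sym (Fin.toℕ-fromℕ l)))) ⟩
    toℕ (fromℕ l) ∸ k ≡⟨ cong (_∸ k) (Fin.toℕ-fromℕ l) ⟩
    l ∸ k ∎
    where open ≡-Reasoning

  iter-rot-period : ∀ (j : Fin (suc l)) → iter rot (suc l) j ≡ j
  iter-rot-period {l} j = Fin.toℕ-injective (begin
    toℕ (iter rot (suc l) j) ≡⟨ cong (λ k → toℕ (iter rot k j)) (trans (+-suc (toℕ j) (l ∸ toℕ j)) (cong suc (m+[n∸m]≡n j≤l))) ⟨
    toℕ (iter rot (toℕ j + suc (l ∸ toℕ j)) j) ≡⟨ iter-rot-wrap (l ∸ toℕ j) j (m∸n≤m l (toℕ j)) ⟩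
    l ∸ (l ∸ toℕ j) ≡⟨ m∸[m∸n]≡n j≤l ⟩
    toℕ j ∎)
    where
    open ≡-Reasoning
    j≤l : toℕ j ≤ l
    j≤l = s≤s⁻¹ (Fin.toℕ<n j)

  -- The difference j - i modulo the length of the cycle: both points are rotated until i arrives at
  -- zero.
  dist : Fin (suc l) → Fin (suc l) → Fin (suc l)
  dist i j = iter rot (toℕ i) j

  neg : Fin (suc l) → Fin (suc l)
  neg zero    = zero
  neg (suc k) = suc (opposite k)

  neg-involutive : ∀ (x : Fin (suc l)) → neg (neg x) ≡ x
  neg-involutive zero    = refl
  neg-involutive (suc k) = cong suc (Fin.opposite-involutive k)

  toℕ-neg : ∀ (x : Fin (suc l)) k → toℕ x ≡ suc k → toℕ (neg x) ≡ l ∸ k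
  toℕ-neg {l} (suc y) k e = trans (cong suc (Fin.opposite-prop y)) (trans (sym (+-∸-assoc 1 (Fin.toℕ<n y))) (cong (l ∸_) (suc-injective e)))

  -- With j = i + k + 1, the first i of the j steps bring i to zero, the next one wraps around to l,
  -- and the remaining k lead down to l - k.
  dist-neg-< : ∀ (i j : Fin (suc l)) → toℕ i < toℕ j → dist j i ≡ neg (dist i j)
  dist-neg-< {l} i j i<j with k , e ← m≤n⇒∃[o]m+o≡n i<j = Fin.toℕ-injective (begin
    toℕ (iter rot (toℕ j) i) ≡⟨ cong (λ m → toℕ (iter rot m i)) (trans (sym e) (sym (+-suc (toℕ i) k))) ⟩
    toℕ (iter rot (toℕ i + suc k) i) ≡⟨ iter-rot-wrap k i (≤-trans (m≤n+m k (suc (toℕ i))) (≤-trans (≤-reflexive e) (s≤s⁻¹ (Fin.toℕ<n j)))) ⟩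
    l ∸ k ≡⟨ toℕ-neg (dist i j) k (trans (toℕ-iter-rot (toℕ i) j (<⇒≤ i<j)) (trans (cong (_∸ toℕ i) (trans (sym e) (sym (+-suc (toℕ i) k)))) (m+n∸m≡n (toℕ i) (suc k)))) ⟨
    toℕ (neg (dist i j)) ∎)
    where open ≡-Reasoning

  dist-neg : ∀ (i j : Fin (suc l)) → dist j i ≡ neg (dist i j)
  dist-neg {l} i j with <-cmp (toℕ i) (toℕ j)
  ... | tri< i<j _ _ = dist-neg-< i j i<j
  ... | tri≈ _ i≡j _ with refl ← Fin.toℕ-injective {i = i} {j} i≡j rewrite iter-rot-self i = refl
  ... | tri> _ _ j<i = trans (sym (neg-involutive _)) (cong neg (sym (dist-neg-< j i j<i)))

  -- A representative of the pair of k and `opposite k`. Reading u only at representatives makes the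
  -- rebuilt matrix symmetric for every u, as a multigraph requires, even if u is not invariant
  -- under `opposite`.
  canon : Fin l → Fin l
  canon k with toℕ k ≤? toℕ (opposite k)
  ... | yes _ = k
  ... | no  _ = opposite k

  canon-cases : ∀ (k : Fin l) → canon k ≡ k ⊎ canon k ≡ opposite k
  canon-cases k with toℕ k ≤? toℕ (opposite k)
  ... | yes _ = inj₁ refl
  ... | no  _ = inj₂ refl

  canon-opposite : ∀ (k : Fin l) → canon (opposite k) ≡ canon k
  canon-opposite k with toℕ k ≤? toℕ (opposite k) | toℕ (opposite k) ≤? toℕ (opposite (opposite k))
  ... | yes p | yes p′ = Fin.toℕ-injective (≤-antisym (≤-trans p′ (≤-reflexive (cong toℕ (Fin.opposite-involutive k)))) p)
  ... | yes p | no _   = Fin.opposite-involutive k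
  ... | no _  | yes _  = refl
  ... | no ¬p | no ¬p′ = contradiction (≤-trans (<⇒≤ (≰⇒> ¬p)) (≤-reflexive (cong toℕ (sym (Fin.opposite-involutive k))))) ¬p′

  -- The entries of a symmetric circulant matrix as an even function of the difference, with zero
  -- diagonal.
  hat : (Fin l → ℕ) → Fin (suc l) → ℕ
  hat u zero    = 0
  hat u (suc k) = u (canon k)

  hat-neg : ∀ (u : Fin l → ℕ) x → hat u (neg x) ≡ hat u x
  hat-neg u zero    = refl
  hat-neg u (suc k) = cong u (canon-opposite k)

  circ : (Fin l → ℕ) → Fin (suc l) → Fin (suc l) → ℕ
  circ u i j = hat u (dist i j)

  dist-rot : ∀ (i j : Fin (suc l)) → dist (rot i) (rot j) ≡ dist i j
  dist-rot {l} zero    j = trans (cong (λ k → iter rot k (rot j)) (Fin.toℕ-fromℕ l)) (iter-rot-period j)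
  dist-rot     (suc i) j = cong (λ k → iter rot k (rot j)) (Fin.toℕ-inject₁ i)

  unstd : Pos λs → Pos λs
  unstd {l ∷ _} (inj₁ i) = inj₁ (iter rot l i)
  unstd {_ ∷ _} (inj₂ y) = inj₂ (unstd y)

  std-unstd : ∀ (x : Pos λs) → std (unstd x) ≡ x
  std-unstd {l ∷ _} (inj₁ i) = cong inj₁ (trans (iter-comm rot l i) (iter-rot-period i))
  std-unstd {_ ∷ _} (inj₂ y) = cong inj₂ (std-unstd y)

  unstd-std : ∀ (x : Pos λs) → unstd (std x) ≡ x
  unstd-std {l ∷ _} (inj₁ i) = cong inj₁ (iter-rot-period i)
  unstd-std {_ ∷ _} (inj₂ y) = cong inj₂ (unstd-std y)

  iter-inj₁ : ∀ k (i : Fin (suc l)) → iter (std {l ∷ λs}) k (inj₁ i) ≡ inj₁ (iter rot k i)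
  iter-inj₁ 0       i = refl
  iter-inj₁ (suc k) i = iter-inj₁ k (rot i)

  iter-inj₂ : ∀ k (y : Pos λs) → iter (std {l ∷ λs}) k (inj₂ y) ≡ inj₂ (iter std k y)
  iter-inj₂ 0       y = refl
  iter-inj₂ (suc k) y = iter-inj₂ k (std y)

  ∑-rot : ∀ k (φ : Fin (suc l) → ℕ) → ∑ (allFin (suc l)) (φ ∘ iter rot k) ≡ ∑ (allFin (suc l)) φ
  ∑-rot 0       φ = refl
  ∑-rot {l} (suc k) φ = trans (sym (reindex (finEnum (suc l)) (finEnum (suc l)) (iter rot l) rot (cong _) (cong rot)
    (λ x → trans (iter-comm rot l x) (iter-rot-period x)) iter-rot-period (φ ∘ iter rot k) (cong _))) (∑-rot k φ)

  ∑-std : ∀ k (φ : Pos λs → ℕ) → ∑ (positions λs) (φ ∘ iter std k) ≡ ∑ (positions λs) φ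
  ∑-std 0       φ = refl
  ∑-std {λs} (suc k) φ = trans (sym (reindex (posEnum λs) (posEnum λs) unstd std (cong _) (cong std)
    std-unstd unstd-std (φ ∘ iter std k) (cong _))) (∑-std k φ)

  allPos? : ∀ {λs} {P : Pos λs → Set} → (∀ x → Dec (P x)) → Dec (∀ x → P x)
  allPos? {[]}    P? = yes λ ()
  allPos? {_ ∷ _} P? = map′ (λ { (f , g) (inj₁ i) → f i ; (f , g) (inj₂ y) → g y }) (λ f → f ∘ inj₁ , f ∘ inj₂)
    (Fin.all? (P? ∘ inj₁) ×-dec allPos? (P? ∘ inj₂))

  posSetoid : List ℕ → DecSetoid 0ℓ 0ℓ
  posSetoid λs = record
    { Carrier = Pos λs → ℕ ; _≈_ = λ f g → ∀ i → f i ≡ g i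
    ; isDecEquivalence = record
      { isEquivalence = record { refl = λ _ → refl ; sym = λ e i → sym (e i) ; trans = λ e e′ i → trans (e i) (e′ i) }
      ; _≟_ = λ f g → allPos? λ i → f i ≟ g i } }

  posBounded? : (f : Pos λs → ℕ) → Dec (∀ i → f i < q)
  posBounded? f = allPos? λ i → f i <? q

  posBox : ∀ λs → Enum (posSetoid λs) (λ f → ⟦ posBounded? f ⟧)
  posBox [] = record { list = (λ ()) ∷ [] ; sound = refl ∷ [] ; each = λ _ → refl }
  posBox (l ∷ λs) = combine (box (suc l)) (posBox λs) (λ f g → [ f , g ]′) (_∘ inj₁) (_∘ inj₂)
    (λ _ _ _ e → e ∘ inj₁ , e ∘ inj₂) (λ { _ _ _ e e′ (inj₁ i) → e i ; _ _ _ e e′ (inj₂ y) → e′ y })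
    (λ f → ⟦⟧-× (bounded? (f ∘ inj₁)) (posBounded? (f ∘ inj₂)) (posBounded? f) (λ b → b ∘ inj₁ , b ∘ inj₂)
      (λ { b b′ (inj₁ i) → b i ; b b′ (inj₂ y) → b′ y }))
    (λ f g f< g< → ⟦⟧-yes (posBounded? [ f , g ]′) λ { (inj₁ i) → ⟦⟧-1 (bounded? f) f< i ; (inj₂ y) → ⟦⟧-1 (posBounded? g) g< y })

  ones : Fin n → ℕ
  ones _ = 1

  weigh-ones : ∀ (h : Fin n → ℕ) → weigh ones h ≡ ∑ (allFin n) h
  weigh-ones {n} h = ∑-cong (allFin n) (λ i → *-identityˡ (h i))

  orbsPos : List ℕ → ℕ → List ℕ
  orbsPos []       k = []
  orbsPos (l ∷ λs) k = orbs (suc l) (iter rot k) ones ++ orbsPos λs k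

  posInvariant? : ∀ k (h : Pos λs → ℕ) → Dec (∀ y → h (iter std k y) ≡ h y)
  posInvariant? k h = allPos? λ y → h (iter std k y) ≟ h y

  rot-injective : Injective _≡_ _≡_ (rot {l})
  rot-injective {l} {x} {y} e = trans (sym (iter-rot-period x)) (trans (cong (iter rot l) e) (iter-rot-period y))

  iter-injective : ∀ {A : Set} {f : A → A} → Injective _≡_ _≡_ f → ∀ k → Injective _≡_ _≡_ (iter f k)
  iter-injective inj 0       e = e
  iter-injective inj (suc k) e = inj (iter-injective inj k e)

  -- `std` maps every cycle to itself, so invariance under its k-th iterate is a separate condition
  -- on each cycle, and `∑-invariant` applies to one cycle at a time.
  ∑-posInvariant : ∀ λs k ψ →
    ∑ (list (posBox λs)) (λ h → ⟦ posInvariant? k h ⟧ * ψ (∑ (positions λs) h)) ≡ ev (orbsPos λs k) ψ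
  ∑-posInvariant []       k ψ = trans (+-identityʳ _) (+-identityʳ _)
  ∑-posInvariant (l ∷ λs) k ψ = begin
    ∑ (list (posBox (l ∷ λs))) (λ h → ⟦ posInvariant? k h ⟧ * ψ (∑ (positions (l ∷ λs)) h))
      ≡⟨ ∑-product (λ f g → [ f , g ]′) (list (box (suc l))) (list (posBox λs)) _ ⟩
    ∑ (list (box (suc l))) (λ f → ∑ (list (posBox λs)) (λ g → ⟦ posInvariant? k [ f , g ]′ ⟧ * ψ (∑ (positions (l ∷ λs)) [ f , g ]′)))
      ≡⟨ ∑-cong (list (box (suc l))) (λ f → trans (∑-cong (list (posBox λs)) (λ g → trans (cong₂ _*_ (sym (split f g))
           (cong ψ (trans (∑-positions l λs [ f , g ]′) (cong (_+ ∑ (positions λs) g) (sym (weigh-ones f)))))) (*-assoc ⟦ invariant? (iter rot k) f ⟧ _ _)))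
           (∑-*ˡ (list (posBox λs)) ⟦ invariant? (iter rot k) f ⟧ (λ g → ⟦ posInvariant? k g ⟧ * ψ (weigh ones f + ∑ (positions λs) g)))) ⟩
    ∑ (list (box (suc l))) (λ f → ⟦ invariant? (iter rot k) f ⟧ * ∑ (list (posBox λs)) (λ g → ⟦ posInvariant? k g ⟧ * ψ (weigh ones f + ∑ (positions λs) g)))
      ≡⟨ ∑-cong (list (box (suc l))) (λ f → cong (⟦ invariant? (iter rot k) f ⟧ *_) (∑-posInvariant λs k (λ y → ψ (weigh ones f + y)))) ⟩
    ∑ (list (box (suc l))) (λ f → ⟦ invariant? (iter rot k) f ⟧ * ev (orbsPos λs k) (λ y → ψ (weigh ones f + y)))
      ≡⟨ ∑-invariant (suc l) (iter rot k) (iter-injective rot-injective k) ones (λ x → ev (orbsPos λs k) (λ y → ψ (x + y))) ⟩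
    ev (orbs (suc l) (iter rot k) ones) (λ x → ev (orbsPos λs k) (λ y → ψ (x + y))) ≡⟨ ev-++ (orbs (suc l) (iter rot k) ones) _ ψ ⟨
    ev (orbsPos (l ∷ λs) k) ψ ∎
    where
    open ≡-Reasoning
    split : ∀ f g → ⟦ invariant? (iter rot k) f ⟧ * ⟦ posInvariant? k g ⟧ ≡ ⟦ posInvariant? {l ∷ λs} k [ f , g ]′ ⟧
    split f g = ⟦⟧-× (invariant? (iter rot k) f) (posInvariant? k g) (posInvariant? k [ f , g ]′)
      (λ s → (λ i → trans (cong [ f , g ]′ (sym (iter-inj₁ k i))) (s (inj₁ i))) , λ y → trans (cong [ f , g ]′ (sym (iter-inj₂ k y))) (s (inj₂ y)))
      λ { s t (inj₁ i) → trans (cong [ f , g ]′ (iter-inj₁ k i)) (s i) ; s t (inj₂ y) → trans (cong [ f , g ]′ (iter-inj₂ k y)) (t y) }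

-- Multigraphs fixed by a permutation of given cycle type.

module FixedGraphs (q-1 : ℕ) where
  open Sums
  open Permutations
  open CycleTypes
  open OrbitSizes (suc q-1)
  open PairRotations q-1
  open import Defs using (Multigraph; mult; symmetric; loopless; _≗_; _≗?_)
  open import Data.Fin.Base as Fin using (Fin; zero; suc; toℕ; opposite)
  open import Data.Fin.Permutation as Perm using (Permutation′; _⟨$⟩ʳ_)
  import Data.Fin.Properties as Fin
  open import Data.List.Base using (List; []; _∷_; _++_; map; allFin)
  open import Data.List.Relation.Unary.All using ([]; _∷_)
  open import Data.Nat.Base hiding (ℕ; suc)
  open import Data.Nat.Properties
  open import Data.Nat.Tactic.RingSolver using (solve-∀)
  open import Data.Product.Base using (_×_; _,_)
  open import Data.Product.Relation.Binary.Pointwise.NonDependent using (×-decSetoid)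
  open import Data.Sum.Base using (inj₁; inj₂)
  open import Data.Unit.Base using (⊤; tt)
  open import Function.Base using (_∘_; id)
  open import Level using (0ℓ)
  open import Relation.Binary.Bundles using (DecSetoid)
  open import Relation.Binary.PropositionalEquality hiding (_≗_)
  open import Relation.Nullary using (Dec; yes)
  open import Relation.Nullary.Decidable using (_×-dec_)

  private variable
    l n v : ℕ
    λs : List ℕ

  graphSetoid : ℕ → DecSetoid 0ℓ 0ℓ
  graphSetoid n = record
    { Carrier = Multigraph n ; _≈_ = _≗_
    ; isDecEquivalence = record
      { isEquivalence = record { refl = λ _ _ → refl ; sym = λ e i j → sym (e i j) ; trans = λ e e′ i j → trans (e i j) (e′ i j) }
      ; _≟_ = _≗?_ } }

  joinVertex : (Fin n → ℕ) → Multigraph n → Multigraph (suc n)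
  joinVertex f g = record
    { mult      = λ { zero zero → 0 ; zero (suc j) → f j ; (suc i) zero → f i ; (suc i) (suc j) → mult g i j }
    ; symmetric = λ { zero zero → refl ; zero (suc j) → refl ; (suc i) zero → refl ; (suc i) (suc j) → symmetric g i j }
    ; loopless  = λ { zero → refl ; (suc i) → loopless g i } }

  dropVertex : Multigraph (suc n) → Multigraph n
  dropVertex g = record { mult = λ i j → mult g (suc i) (suc j) ; symmetric = λ i j → symmetric g (suc i) (suc j) ; loopless = λ i → loopless g (suc i) }

  graphBounded? : (g : Multigraph n) → Dec (∀ i j → mult g i j < q)
  graphBounded? g = Fin.all? λ i → Fin.all? λ j → mult g i j <? q

  graphs : ∀ n → Enum (graphSetoid n) (λ g → ⟦ graphBounded? g ⟧)
  graphs zero = record { list = record { mult = λ () ; symmetric = λ () ; loopless = λ () } ∷ [] ; sound = refl ∷ [] ; each = λ _ → refl }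
  graphs (suc n) = combine (box n) (graphs n) joinVertex (λ g j → mult g zero (suc j)) dropVertex
    (λ _ _ _ e → (λ j → e zero (suc j)) , λ i j → e (suc i) (suc j))
    (λ { f g z e e′ zero zero → sym (loopless z zero) ; f g z e e′ zero (suc j) → e j
       ; f g z e e′ (suc i) zero → trans (e i) (symmetric z zero (suc i)) ; f g z e e′ (suc i) (suc j) → e′ i j })
    (λ z → ⟦⟧-× (bounded? λ j → mult z zero (suc j)) (graphBounded? (dropVertex z)) (graphBounded? z)
      (λ b → (λ j → b zero (suc j)) , λ i j → b (suc i) (suc j))
      λ { b b′ zero zero → ≤-trans (s≤s (≤-reflexive (loopless z zero))) (s≤s z≤n) ; b b′ zero (suc j) → b j
        ; b b′ (suc i) zero → ≤-trans (s≤s (≤-reflexive (symmetric z (suc i) zero))) (b i) ; b b′ (suc i) (suc j) → b′ i j })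
    (λ f g f< g< → ⟦⟧-yes (graphBounded? (joinVertex f g))
      λ { zero zero → s≤s z≤n ; zero (suc j) → ⟦⟧-1 (bounded? f) f< j ; (suc i) zero → ⟦⟧-1 (bounded? f) f< i ; (suc i) (suc j) → ⟦⟧-1 (graphBounded? g) g< i j })

  -- A graph on Pos λs invariant under std is determined by the edges between
  -- the zeroes of the cycles and the rest.

  Data : List ℕ → DecSetoid 0ℓ 0ℓ
  Data []       = record { Carrier = ⊤ ; _≈_ = _≡_ ; isDecEquivalence = record { isEquivalence = isEquivalence ; _≟_ = λ _ _ → yes refl } }
  Data (l ∷ λs) = ×-decSetoid (×-decSetoid (funSetoid l) (posSetoid λs)) (Data λs)

  ∣Data∣ : List ℕ → Set
  ∣Data∣ λs = DecSetoid.Carrier (Data λs)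

  allowed : ∀ λs → ∣Data∣ λs → ℕ
  allowed []       _             = 1
  allowed (l ∷ λs) ((u , h) , r) = ⟦ bounded? u ⟧ * ⟦ posBounded? h ⟧ * allowed λs r

  dataEnum : ∀ λs → Enum (Data λs) (allowed λs)
  dataEnum []       = record { list = tt ∷ [] ; sound = refl ∷ [] ; each = λ _ → refl }
  dataEnum (l ∷ λs) = pairEnum (pairEnum (box l) (posBox λs)) (dataEnum λs)

  -- A pair of points is moved by `std` until the point in the first cycle arrives at zero, where
  -- its multiplicity is recorded.
  rebuild : ∀ λs → ∣Data∣ λs → Pos λs → Pos λs → ℕ
  rebuild (l ∷ λs) ((u , h) , r) (inj₁ i) (inj₁ j) = circ u i j
  rebuild (l ∷ λs) ((u , h) , r) (inj₁ i) (inj₂ y) = h (iter std (toℕ i) y)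
  rebuild (l ∷ λs) ((u , h) , r) (inj₂ x) (inj₁ j) = h (iter std (toℕ j) x)
  rebuild (l ∷ λs) ((u , h) , r) (inj₂ x) (inj₂ y) = rebuild λs r x y

  extract : ∀ λs → (Pos λs → Pos λs → ℕ) → ∣Data∣ λs
  extract []       m = tt
  extract (l ∷ λs) m = ((λ k → m (inj₁ zero) (inj₁ (suc k))) , λ y → m (inj₁ zero) (inj₂ y)) , extract λs (λ x y → m (inj₂ x) (inj₂ y))

  -- The consistency of the data. Edges inside the cycle can be read from either end, so the
  -- differences d and -d must agree; and after `suc l` steps the zero of the cycle is back in its
  -- place, while the other end has moved.
  Good : ∀ λs → ∣Data∣ λs → Set
  Good []       _             = ⊤
  Good (l ∷ λs) ((u , h) , r) = (∀ k → u (opposite k) ≡ u k) × (∀ y → h (iter std (suc l) y) ≡ h y) × Good λs r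

  good? : ∀ λs y → Dec (Good λs y)
  good? []       _             = yes tt
  good? (l ∷ λs) ((u , h) , r) = invariant? opposite u ×-dec posInvariant? (suc l) h ×-dec good? λs r

  Good-resp : ∀ λs {y y′} → DecSetoid._≈_ (Data λs) y y′ → Good λs y → Good λs y′
  Good-resp []       e g = tt
  Good-resp (l ∷ λs) ((e , e′) , e″) (g , g′ , g″) =
    (λ k → trans (sym (e _)) (trans (g k) (e k))) , (λ y → trans (sym (e′ _)) (trans (g′ y) (e′ y))) , Good-resp λs e″ g″

  rebuild-cong : ∀ λs {y y′} → DecSetoid._≈_ (Data λs) y y′ → ∀ a b → rebuild λs y a b ≡ rebuild λs y′ a b
  rebuild-cong (l ∷ λs) ((e , e′) , e″) (inj₁ i) (inj₁ j) = lemma (dist i j)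
    where
    lemma : ∀ x → hat _ x ≡ hat _ x
    lemma zero    = refl
    lemma (suc k) = e (canon k)
  rebuild-cong (l ∷ λs) ((e , e′) , e″) (inj₁ i) (inj₂ y) = e′ _
  rebuild-cong (l ∷ λs) ((e , e′) , e″) (inj₂ x) (inj₁ j) = e′ _
  rebuild-cong (l ∷ λs) ((e , e′) , e″) (inj₂ x) (inj₂ y) = rebuild-cong λs e″ x y

  extract-cong : ∀ λs {m m′ : Pos λs → Pos λs → ℕ} → (∀ a b → m a b ≡ m′ a b) → DecSetoid._≈_ (Data λs) (extract λs m) (extract λs m′)
  extract-cong []       e = refl
  extract-cong (l ∷ λs) e = ((λ k → e _ _) , λ y → e _ _) , extract-cong λs (λ a b → e _ _)

  rebuild-sym : ∀ λs y a b → rebuild λs y a b ≡ rebuild λs y b a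
  rebuild-sym (l ∷ λs) ((u , h) , r) (inj₁ i) (inj₁ j) = trans (sym (hat-neg u (dist i j))) (cong (hat u) (sym (dist-neg i j)))
  rebuild-sym (l ∷ λs) ((u , h) , r) (inj₁ i) (inj₂ y) = refl
  rebuild-sym (l ∷ λs) ((u , h) , r) (inj₂ x) (inj₁ j) = refl
  rebuild-sym (l ∷ λs) ((u , h) , r) (inj₂ x) (inj₂ y) = rebuild-sym λs r x y

  rebuild-loopless : ∀ λs y a → rebuild λs y a a ≡ 0
  rebuild-loopless (l ∷ λs) ((u , h) , r) (inj₁ i) = cong (hat u) (iter-rot-self i)
  rebuild-loopless (l ∷ λs) ((u , h) , r) (inj₂ x) = rebuild-loopless λs r x

  cross-invariant : ∀ (h : Pos λs → ℕ) → (∀ y → h (iter std (suc l) y) ≡ h y) → ∀ (i : Fin (suc l)) y →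
    h (iter std (toℕ (rot i)) (std y)) ≡ h (iter std (toℕ i) y)
  cross-invariant {l = l} h inv zero    y = trans (cong (λ k → h (iter std k (std y))) (Fin.toℕ-fromℕ l)) (inv y)
  cross-invariant         h inv (suc i) y = cong (λ k → h (iter std k (std y))) (Fin.toℕ-inject₁ i)

  rebuild-invariant : ∀ λs y → Good λs y → ∀ a b → rebuild λs y (std a) (std b) ≡ rebuild λs y a b
  rebuild-invariant (l ∷ λs) ((u , h) , r) (g , g′ , g″) (inj₁ i) (inj₁ j) = cong (hat u) (dist-rot i j)
  rebuild-invariant (l ∷ λs) ((u , h) , r) (g , g′ , g″) (inj₁ i) (inj₂ y) = cross-invariant h g′ i y
  rebuild-invariant (l ∷ λs) ((u , h) , r) (g , g′ , g″) (inj₂ x) (inj₁ j) = cross-invariant h g′ j x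
  rebuild-invariant (l ∷ λs) ((u , h) , r) (g , g′ , g″) (inj₂ x) (inj₂ y) = rebuild-invariant λs r g″ x y

  extract-rebuild : ∀ λs y → Good λs y → DecSetoid._≈_ (Data λs) (extract λs (rebuild λs y)) y
  extract-rebuild []       y g = refl
  extract-rebuild (l ∷ λs) ((u , h) , r) (g , g′ , g″) = (canonical , λ _ → refl) , extract-rebuild λs r g″
    where
    canonical : ∀ k → u (canon k) ≡ u k
    canonical k with canon-cases k
    ... | inj₁ e = cong u e
    ... | inj₂ e = trans (cong u e) (g k)

  module _ {A B : Set} {s : A → A} {t : B → B} (m : A → B → ℕ) (inv : ∀ a b → m (s a) (t b) ≡ m a b) where
    shift : ∀ k a b → m a b ≡ m (iter s k a) (iter t k b)
    shift 0       a b = refl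
    shift (suc k) a b = trans (sym (inv a b)) (shift k (s a) (t b))

  module Extracted (λs : List ℕ) (l : ℕ) (m : Pos (l ∷ λs) → Pos (l ∷ λs) → ℕ)
    (m-sym : ∀ a b → m a b ≡ m b a) (m-loop : ∀ a → m a a ≡ 0) (inv : ∀ a b → m (std a) (std b) ≡ m a b) where

    inner : ∀ i j → m (inj₁ i) (inj₁ j) ≡ m (inj₁ zero) (inj₁ (dist i j))
    inner i j = trans (shift {s = rot} {t = rot} (λ i j → m (inj₁ i) (inj₁ j)) (λ i j → inv (inj₁ i) (inj₁ j)) (toℕ i) i j)
      (cong (λ z → m (inj₁ z) (inj₁ (dist i j))) (iter-rot-self i))

    outer : ∀ i y → m (inj₁ i) (inj₂ y) ≡ m (inj₁ zero) (inj₂ (iter std (toℕ i) y))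
    outer i y = trans (shift {s = rot} {t = std} (λ i y → m (inj₁ i) (inj₂ y)) (λ i y → inv (inj₁ i) (inj₂ y)) (toℕ i) i y)
      (cong (λ z → m (inj₁ z) (inj₂ (iter std (toℕ i) y))) (iter-rot-self i))

    opp : ∀ k → m (inj₁ zero) (inj₁ (suc (opposite k))) ≡ m (inj₁ zero) (inj₁ (suc k))
    opp k = sym (trans (m-sym _ _) (trans (inner (suc k) zero) (cong (λ z → m (inj₁ zero) (inj₁ z)) (dist-neg zero (suc k)))))

    canonical : ∀ k → m (inj₁ zero) (inj₁ (suc (canon k))) ≡ m (inj₁ zero) (inj₁ (suc k))
    canonical k with canon-cases k
    ... | inj₁ e = cong (λ z → m (inj₁ zero) (inj₁ (suc z))) e
    ... | inj₂ e = trans (cong (λ z → m (inj₁ zero) (inj₁ (suc z))) e) (opp k)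

    period : ∀ y → m (inj₁ zero) (inj₂ (iter std (suc l) y)) ≡ m (inj₁ zero) (inj₂ y)
    period y = sym (trans (shift {s = rot} {t = std} (λ i y → m (inj₁ i) (inj₂ y)) (λ i y → inv (inj₁ i) (inj₂ y)) (suc l) zero y)
      (cong (λ z → m (inj₁ z) (inj₂ (iter std (suc l) y))) (iter-rot-period zero)))

    hat-row : ∀ x → hat (λ k → m (inj₁ zero) (inj₁ (suc k))) x ≡ m (inj₁ zero) (inj₁ x)
    hat-row zero    = sym (m-loop (inj₁ zero))
    hat-row (suc k) = canonical k

  rebuild-extract : ∀ λs (m : Pos λs → Pos λs → ℕ) → (∀ a b → m a b ≡ m b a) → (∀ a → m a a ≡ 0) →
    (∀ a b → m (std a) (std b) ≡ m a b) → ∀ a b → rebuild λs (extract λs m) a b ≡ m a b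
  rebuild-extract (l ∷ λs) m m-sym m-loop inv = λ
    { (inj₁ i) (inj₁ j) → trans (hat-row (dist i j)) (sym (inner i j))
    ; (inj₁ i) (inj₂ y) → sym (outer i y)
    ; (inj₂ x) (inj₁ j) → trans (sym (outer j x)) (m-sym _ _)
    ; (inj₂ x) (inj₂ y) → rebuild-extract λs (λ a b → m (inj₂ a) (inj₂ b)) (λ a b → m-sym _ _) (λ a → m-loop _) (λ a b → inv _ _) x y }
    where open Extracted λs l m m-sym m-loop inv

  extract-good : ∀ λs (m : Pos λs → Pos λs → ℕ) → (∀ a b → m a b ≡ m b a) → (∀ a → m a a ≡ 0) →
    (∀ a b → m (std a) (std b) ≡ m a b) → Good λs (extract λs m)
  extract-good []       m m-sym m-loop inv = tt
  extract-good (l ∷ λs) m m-sym m-loop inv = opp , period ,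
    extract-good λs (λ a b → m (inj₂ a) (inj₂ b)) (λ a b → m-sym _ _) (λ a → m-loop _) (λ a b → inv _ _)
    where open Extracted λs l m m-sym m-loop inv

  extract-allowed : ∀ λs (m : Pos λs → Pos λs → ℕ) → (∀ a b → m a b < q) → allowed λs (extract λs m) ≡ 1
  extract-allowed []       m b = refl
  extract-allowed (l ∷ λs) m b = cong₂ _*_ (cong₂ _*_ (⟦⟧-yes (bounded? λ k → m (inj₁ zero) (inj₁ (suc k))) (λ k → b _ _)) (⟦⟧-yes (posBounded? λ y → m (inj₁ zero) (inj₂ y)) (λ k → b _ _)))
    (extract-allowed λs (λ x y → m (inj₂ x) (inj₂ y)) (λ x y → b _ _))

  rebuild-bounded : ∀ λs y → allowed λs y ≡ 1 → ∀ a b → rebuild λs y a b < q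
  rebuild-bounded (l ∷ λs) ((u , h) , r) e = λ
    { (inj₁ i) (inj₁ j) → lemma (dist i j) ; (inj₁ i) (inj₂ y) → h< _ ; (inj₂ x) (inj₁ j) → h< _
    ; (inj₂ x) (inj₂ y) → rebuild-bounded λs r (m*n≡1⇒n≡1 (⟦ bounded? u ⟧ * ⟦ posBounded? h ⟧) (allowed λs r) e) x y }
    where
    uh≡1 = m*n≡1⇒m≡1 (⟦ bounded? u ⟧ * ⟦ posBounded? h ⟧) (allowed λs r) e
    u< = ⟦⟧-1 (bounded? u) (m*n≡1⇒m≡1 ⟦ bounded? u ⟧ ⟦ posBounded? h ⟧ uh≡1)
    h< = ⟦⟧-1 (posBounded? h) (m*n≡1⇒n≡1 ⟦ bounded? u ⟧ ⟦ posBounded? h ⟧ uh≡1)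
    lemma : ∀ x → hat u x < q
    lemma zero    = s≤s z≤n
    lemma (suc k) = u< (canon k)

  dataSize : ∀ λs → ∣Data∣ λs → ℕ
  dataSize []       _             = 0
  dataSize (l ∷ λs) ((u , h) , r) = suc l * ∑ (allFin l) u + (2 * suc l * ∑ (positions λs) h + dataSize λs r)

  -- All rows of the circulant block are rotations of its row zero, and all rows of the block
  -- between the first cycle and the rest are h moved by a power of `std`. The latter block occurs
  -- twice, together with its transpose.
  rebuild-size : ∀ λs y → Good λs y → ∑ (positions λs) (λ a → ∑ (positions λs) (λ b → rebuild λs y a b)) ≡ dataSize λs y
  rebuild-size []       y g = refl
  rebuild-size (l ∷ λs) ((u , h) , r) (g , g′ , g″) = begin
    ∑ P (λ a → ∑ P (λ b → R a b))
      ≡⟨ ∑-positions l λs _ ⟩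
    ∑ F (λ i → ∑ P (λ b → R (inj₁ i) b)) + ∑ P′ (λ x → ∑ P (λ b → R (inj₂ x) b))
      ≡⟨ cong₂ _+_ (∑-cong F (λ i → ∑-positions l λs (R (inj₁ i)))) (∑-cong P′ (λ x → ∑-positions l λs (R (inj₂ x)))) ⟩
    ∑ F (λ i → ∑ F (λ j → circ u i j) + ∑ P′ (λ y → h (iter std (toℕ i) y))) + ∑ P′ (λ x → ∑ F (λ j → h (iter std (toℕ j) x)) + ∑ P′ (λ y → rebuild λs r x y))
      ≡⟨ cong₂ _+_ (∑-+ F (λ i → ∑ F (circ u i)) (λ i → ∑ P′ (λ y → h (iter std (toℕ i) y)))) (∑-+ P′ (λ x → ∑ F (λ j → h (iter std (toℕ j) x))) (λ x → ∑ P′ (rebuild λs r x))) ⟩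
    ∑ F (λ i → ∑ F (λ j → circ u i j)) + ∑ F (λ i → ∑ P′ (λ y → h (iter std (toℕ i) y))) + (∑ P′ (λ x → ∑ F (λ j → h (iter std (toℕ j) x))) + ∑ P′ (λ x → ∑ P′ (λ y → rebuild λs r x y)))
      ≡⟨ cong₂ _+_ (cong₂ _+_ inside cross) (cong₂ _+_ (trans (∑-swap P′ F _) cross) (rebuild-size λs r g″)) ⟩
    suc l * ∑ (allFin l) u + suc l * ∑ P′ h + (suc l * ∑ P′ h + dataSize λs r)
      ≡⟨ arith (suc l) (∑ (allFin l) u) (∑ P′ h) (dataSize λs r) ⟩
    dataSize (l ∷ λs) ((u , h) , r) ∎
    where
    open ≡-Reasoning
    P = positions (l ∷ λs)
    P′ = positions λs
    F = allFin (suc l)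
    R = rebuild (l ∷ λs) ((u , h) , r)
    arith : ∀ s a b c → s * a + s * b + (s * b + c) ≡ s * a + (2 * s * b + c)
    arith = solve-∀
    canonical : ∀ k → u (canon k) ≡ u k
    canonical k with canon-cases k
    ... | inj₁ e = cong u e
    ... | inj₂ e = trans (cong u e) (g k)
    cross : ∑ F (λ i → ∑ P′ (λ y → h (iter std (toℕ i) y))) ≡ suc l * ∑ P′ h
    cross = trans (∑-cong F (λ i → ∑-std (toℕ i) h)) (∑-const (suc l) _)
    inside : ∑ F (λ i → ∑ F (λ j → circ u i j)) ≡ suc l * ∑ (allFin l) u
    inside = trans (∑-cong F (λ i → trans (∑-rot (toℕ i) (hat u)) (trans (∑-allFin l (hat u)) (∑-cong (allFin l) canonical)))) (∑-const (suc l) _)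

  -- Twice the number of edges, since each pair is met in both orders; hence the comparisons with
  -- `2 * e`.
  size : Multigraph n → ℕ
  size {n} g = ∑ (allFin n) (λ i → ∑ (allFin n) (λ j → mult g i j))

  size-cong : ∀ {g g′ : Multigraph n} → g ≗ g′ → size g ≡ size g′
  size-cong {n} e = ∑-cong (allFin n) (λ i → ∑-cong (allFin n) (e i))

  Fixed : Permutation′ n → Multigraph n → Set
  Fixed σ g = ∀ i j → mult g (σ ⟨$⟩ʳ i) (σ ⟨$⟩ʳ j) ≡ mult g i j

  fixed? : ∀ (σ : Permutation′ n) g → Dec (Fixed σ g)
  fixed? σ g = Fin.all? λ i → Fin.all? λ j → mult g (σ ⟨$⟩ʳ i) (σ ⟨$⟩ʳ j) ≟ mult g i j

  -- The numbers of ordered pairs in the orbits of unordered pairs: those inside the first cycle,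
  -- those between the first cycle and the rest, and those inside the rest. They are the amounts by
  -- which the `size` of a fixed graph grows with the multiplicity on an orbit.
  orbits : List ℕ → List ℕ
  orbits []       = []
  orbits (l ∷ λs) = map (suc l *_) (orbs l opposite ones) ++ map (2 * suc l *_) (orbsPos λs (suc l)) ++ orbits λs

  opposite-injective : ∀ {i j : Fin n} → opposite i ≡ opposite j → i ≡ j
  opposite-injective {i = i} {j} e = trans (sym (Fin.opposite-involutive i)) (trans (cong opposite e) (Fin.opposite-involutive j))

  ∑-good : ∀ λs φ → ∑ (list (dataEnum λs)) (λ y → ⟦ good? λs y ⟧ * φ (dataSize λs y)) ≡ ev (orbits λs) φ
  ∑-good []       φ = trans (+-identityʳ _) (+-identityʳ _)
  ∑-good (l ∷ λs) φ = begin
    ∑ (list (dataEnum (l ∷ λs))) (λ y → ⟦ good? (l ∷ λs) y ⟧ * φ (dataSize (l ∷ λs) y))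
      ≡⟨ trans (∑-product _,_ (list (pairEnum (box l) (posBox λs))) R _) (∑-product _,_ U H _) ⟩
    ∑ U (λ u → ∑ H (λ h → ∑ R (λ r → ⟦ good? (l ∷ λs) ((u , h) , r) ⟧ * φ (su u + (sh h + dataSize λs r)))))
      ≡⟨ ∑-cong U (λ u → trans (∑-cong H (λ h → trans (∑-cong R (λ r → trans (cong (_* φ (su u + (sh h + dataSize λs r))) (split u h r))
           (trans (*-assoc ⟦ invariant? opposite u ⟧ _ _) (cong (⟦ invariant? opposite u ⟧ *_) (*-assoc ⟦ posInvariant? (suc l) h ⟧ _ _)))))
           (trans (∑-*ˡ R ⟦ invariant? opposite u ⟧ _) (cong (⟦ invariant? opposite u ⟧ *_) (∑-*ˡ R ⟦ posInvariant? (suc l) h ⟧ _)))))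
           (∑-*ˡ H ⟦ invariant? opposite u ⟧ _)) ⟩
    ∑ U (λ u → ⟦ invariant? opposite u ⟧ * ∑ H (λ h → ⟦ posInvariant? (suc l) h ⟧ * ∑ R (λ r → ⟦ good? λs r ⟧ * φ (su u + (sh h + dataSize λs r)))))
      ≡⟨ ∑-cong U (λ u → cong (⟦ invariant? opposite u ⟧ *_) (trans (∑-cong H (λ h → cong (⟦ posInvariant? (suc l) h ⟧ *_) (∑-good λs (λ z → φ (su u + (sh h + z))))))
           (trans (∑-posInvariant λs (suc l) (λ y → ev (orbits λs) (λ z → φ (su u + (2 * suc l * y + z)))))
           (trans (ev-scale (2 * suc l) (orbsPos λs (suc l)) (λ y → ev (orbits λs) (λ z → φ (su u + (y + z)))))
           (sym (ev-++ (map (2 * suc l *_) (orbsPos λs (suc l))) (orbits λs) (λ z → φ (su u + z)))))))) ⟩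
    ∑ U (λ u → ⟦ invariant? opposite u ⟧ * ev T (λ z → φ (suc l * ∑ (allFin l) u + z)))
      ≡⟨ ∑-cong U (λ u → cong (⟦ invariant? opposite u ⟧ *_) (cong (λ t → ev T (λ z → φ (suc l * t + z))) (sym (weigh-ones u)))) ⟩
    ∑ U (λ u → ⟦ invariant? opposite u ⟧ * ev T (λ z → φ (suc l * weigh ones u + z)))
      ≡⟨ ∑-invariant l opposite opposite-injective ones (λ x → ev T (λ z → φ (suc l * x + z))) ⟩
    ev (orbs l opposite ones) (λ x → ev T (λ z → φ (suc l * x + z)))
      ≡⟨ ev-scale (suc l) (orbs l opposite ones) (λ x → ev T (λ z → φ (x + z))) ⟩
    ev (map (suc l *_) (orbs l opposite ones)) (λ x → ev T (λ z → φ (x + z)))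
      ≡⟨ ev-++ (map (suc l *_) (orbs l opposite ones)) T φ ⟨
    ev (orbits (l ∷ λs)) φ ∎
    where
    open ≡-Reasoning
    U = list (box l)
    H = list (posBox λs)
    R = list (dataEnum λs)
    T = map (2 * suc l *_) (orbsPos λs (suc l)) ++ orbits λs
    su : (Fin l → ℕ) → ℕ
    su u = suc l * ∑ (allFin l) u
    sh : (Pos λs → ℕ) → ℕ
    sh h = 2 * suc l * ∑ (positions λs) h
    split : ∀ u h r → ⟦ good? (l ∷ λs) ((u , h) , r) ⟧ ≡ ⟦ invariant? opposite u ⟧ * (⟦ posInvariant? (suc l) h ⟧ * ⟦ good? λs r ⟧)
    split u h r = sym (trans (cong (⟦ invariant? opposite u ⟧ *_) (⟦⟧-× (posInvariant? (suc l) h) (good? λs r) (posInvariant? (suc l) h ×-dec good? λs r) id _,_))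
      (⟦⟧-× (invariant? opposite u) (posInvariant? (suc l) h ×-dec good? λs r) (good? (l ∷ λs) ((u , h) , r)) id _,_))

  -- A fixed graph is carried over to the positions by the conjugacy, where it is an invariant
  -- matrix and corresponds to good data. The data consist of invariant functions, so their sum is a
  -- sum over free values on orbits.
  ∑-fixed : ∀ (σ : Permutation′ n) λs → HasType σ λs → ∀ φ →
    ∑ (list (graphs n)) (λ g → ⟦ fixed? σ g ⟧ * φ (size g)) ≡ ev (orbits λs) φ
  ∑-fixed {n} σ λs h φ = begin
    ∑ (list (graphs n)) (λ g → ⟦ fixed? σ g ⟧ * φ (size g))
      ≡⟨ reindex-on (graphs n) (dataEnum λs) (fixed? σ) (good? λs) f gr
           (λ e fx i j → trans (sym (e _ _)) (trans (fx i j) (e i j))) (Good-resp λs)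
           (λ e → extract-cong λs (λ a b → e _ _)) (λ e i j → rebuild-cong λs e _ _)
           (λ g fx → extract-good λs (onPos g) (λ a b → symmetric g _ _) (λ a → loopless g _) (inv g fx) ,
              (λ i j → trans (rebuild-extract λs (onPos g) (λ a b → symmetric g _ _) (λ a → loopless g _) (inv g fx) (H.to i) (H.to j))
                             (cong₂ (mult g) (H.from-to i) (H.from-to j))) ,
              λ b → extract-allowed λs (onPos g) (λ x y → ⟦⟧-1 (graphBounded? g) b _ _))
           (λ y gd → (λ i j → trans (cong₂ (rebuild λs y) (H.comm i) (H.comm j)) (rebuild-invariant λs y gd _ _)) ,
              DecSetoid.trans (Data λs) (extract-cong λs (λ a b → cong₂ (rebuild λs y) (H.to-from a) (H.to-from b))) (extract-rebuild λs y gd) ,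
              λ b → ⟦⟧-yes (graphBounded? (gr y)) (λ i j → rebuild-bounded λs y b _ _))
           (φ ∘ size) (λ {g} {g′} e → cong φ (size-cong {g = g} {g′} e)) ⟩
    ∑ (list (dataEnum λs)) (λ y → ⟦ good? λs y ⟧ * φ (size (gr y)))
      ≡⟨ ∑-cong (list (dataEnum λs)) (λ y → ⟦⟧-guard (good? λs y) (λ gd → cong φ (trans (size-gr y) (rebuild-size λs y gd)))) ⟩
    ∑ (list (dataEnum λs)) (λ y → ⟦ good? λs y ⟧ * φ (dataSize λs y)) ≡⟨ ∑-good λs φ ⟩
    ev (orbits λs) φ ∎
    where
    open ≡-Reasoning
    module H = _≅_ h
    onPos : Multigraph n → Pos λs → Pos λs → ℕ
    onPos g a b = mult g (H.from a) (H.from b)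
    f : Multigraph n → ∣Data∣ λs
    f g = extract λs (onPos g)
    gr : ∣Data∣ λs → Multigraph n
    gr y = record { mult = λ i j → rebuild λs y (H.to i) (H.to j) ; symmetric = λ i j → rebuild-sym λs y _ _ ; loopless = λ i → rebuild-loopless λs y _ }
    from-comm : ∀ a → H.from (std a) ≡ σ ⟨$⟩ʳ H.from a
    from-comm a = trans (cong H.from (trans (cong std (sym (H.to-from a))) (sym (H.comm _)))) (H.from-to _)
    inv : ∀ g → Fixed σ g → ∀ a b → onPos g (std a) (std b) ≡ onPos g a b
    inv g fx a b = trans (cong₂ (mult g) (from-comm a) (from-comm b)) (fx _ _)
    size-gr : ∀ y → size (gr y) ≡ ∑ (positions λs) (λ a → ∑ (positions λs) (λ b → rebuild λs y a b))
    size-gr y = trans (∑-type {σ = σ} h (λ i → ∑ (allFin n) (mult (gr y) i))) (∑-cong (positions λs) (λ a → trans (∑-type {σ = σ} h (mult (gr y) (H.from a)))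
      (∑-cong (positions λs) (λ b → cong₂ (rebuild λs y) (H.to-from a) (H.to-from b)))))

-- Isomorphism classes of multigraphs and Burnside's lemma.

module Representatives (q-1 : ℕ) where
  open Sums
  open Permutations
  open CycleTypes
  open OrbitSizes (suc q-1)
  open PairRotations q-1
  open FixedGraphs q-1
  open import Defs using (Multigraph; mult; _≗_; _≗?_)
  open import Data.Fin.Base as Fin using (Fin; zero; suc)
  open import Data.Fin.Permutation as Perm using (Permutation′; _⟨$⟩ʳ_; _⟨$⟩ˡ_; _∘ₚ_)
  import Data.Fin.Properties as Fin
  open import Data.List.Base using (List; []; _∷_; map; allFin; length; filter)
  import Data.List.Properties as List
  open import Data.List.Membership.Propositional using (_∈_; find; lose)
  import Data.List.Membership.Propositional.Properties as ∈
  open import Data.List.Relation.Unary.All using (All; []; _∷_)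
  import Data.List.Relation.Unary.All as All
  import Data.List.Relation.Unary.All.Properties as All
  open import Data.List.Relation.Unary.Any using (Any; here; there; any?)
  import Data.List.Relation.Unary.Any as Any
  open import Data.Nat.Base hiding (ℕ; suc)
  open import Data.Nat.Properties
  open import Data.Product.Base using (_×_; _,_; ∃)
  open import Function.Base using (_∘_; id)
  open import Relation.Binary.Bundles using (DecSetoid)
  open import Relation.Binary.PropositionalEquality hiding (_≗_)
  open import Relation.Nullary using (Dec; yes; no; ¬_; contradiction)
  open import Relation.Nullary.Decidable using (map′)

  private variable
    n v : ℕ

  ∑-∈ : ∀ {A : Set} {p} {P : A → Set p} (P? : ∀ x → Dec (P x)) xs → ∑ xs (λ x → ⟦ P? x ⟧) ≢ 0 → Any P xs
  ∑-∈ P? []       ≢0 = contradiction refl ≢0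
  ∑-∈ P? (x ∷ xs) ≢0 with P? x
  ... | yes p = here p
  ... | no _  = there (∑-∈ P? xs ≢0)

  ∑-none : ∀ {A : Set} {p} {P : A → Set p} (P? : ∀ x → Dec (P x)) xs → ¬ Any P xs → ∑ xs (λ x → ⟦ P? x ⟧) ≡ 0
  ∑-none P? []       none = refl
  ∑-none P? (x ∷ xs) none = cong₂ _+_ (⟦⟧-no (P? x) (none ∘ here)) (∑-none P? xs (none ∘ there))

  ∑-length : ∀ {A : Set} (xs : List A) → ∑ xs (λ _ → 1) ≡ length xs
  ∑-length []       = refl
  ∑-length (_ ∷ xs) = cong suc (∑-length xs)

  ∑-filter : ∀ {A : Set} {p} {P : A → Set p} (P? : ∀ x → Dec (P x)) xs (φ : A → ℕ) → ∑ (filter P? xs) φ ≡ ∑ xs (λ x → ⟦ P? x ⟧ * φ x)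
  ∑-filter P? []       φ = refl
  ∑-filter P? (x ∷ xs) φ with P? x
  ... | yes _ = cong₂ _+_ (sym (+-identityʳ (φ x))) (∑-filter P? xs φ)
  ... | no _  = ∑-filter P? xs φ

  Maps : Permutation′ n → Multigraph n → Multigraph n → Set
  Maps σ g h = ∀ i j → mult h (σ ⟨$⟩ʳ i) (σ ⟨$⟩ʳ j) ≡ mult g i j

  maps? : ∀ (σ : Permutation′ n) g h → Dec (Maps σ g h)
  maps? σ g h = Fin.all? λ i → Fin.all? λ j → mult h (σ ⟨$⟩ʳ i) (σ ⟨$⟩ʳ j) ≟ mult g i j

  record Iso (g h : Multigraph n) : Set where
    constructor via
    field
      σ    : Permutation′ n
      maps : Maps σ g h

  Maps-flip : ∀ (σ : Permutation′ n) {g h} → Maps σ g h → Maps (Perm.flip σ) h g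
  Maps-flip σ {g} {h} m i j = trans (sym (m _ _)) (cong₂ (mult h) (Perm.inverseʳ σ) (Perm.inverseʳ σ))

  Maps-trans : ∀ (σ τ : Permutation′ n) {g h k} → Maps σ g h → Maps τ h k → Maps (σ ∘ₚ τ) g k
  Maps-trans σ τ m m′ i j = trans (m′ _ _) (m i j)

  Iso-sym : ∀ {g h : Multigraph n} → Iso g h → Iso h g
  Iso-sym {g = g} {h} (via σ m) = via (Perm.flip σ) (Maps-flip σ {g} {h} m)

  Iso-trans : ∀ {g h k : Multigraph n} → Iso g h → Iso h k → Iso g k
  Iso-trans {g = g} {h} {k} (via σ m) (via τ m′) = via (σ ∘ₚ τ) (Maps-trans σ τ {g} {h} {k} m m′)

  ≗⇒Iso : ∀ {g h : Multigraph n} → g ≗ h → Iso g h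
  ≗⇒Iso e = via Perm.id λ i j → sym (e i j)

  Iso-refl : ∀ {g : Multigraph n} → Iso g g
  Iso-refl = via Perm.id λ i j → refl

  perms-complete : ∀ (σ : Permutation′ n) → Any (Perm._≈ σ) (perms n)
  perms-complete {n} σ = ∑-∈ (λ π → DecSetoid._≟_ (permSetoid n) π σ) (perms n) λ e → contradiction (trans (sym e) (each (permEnum n) σ)) λ ()

  opaque
    -- Opaque, as the search through all permutations is never to be carried out.
    iso? : ∀ (g h : Multigraph n) → Dec (Iso g h)
    iso? {n} g h = map′ (λ a → let σ , _ , m = find a in via σ m)
      (λ (via σ m) → Any.map (λ e i j → trans (cong₂ (mult h) (e i) (e j)) (m i j)) (perms-complete σ))
      (any? (λ σ → maps? σ g h) (perms n))

  distinct : List (Multigraph n) → List (Multigraph n)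
  distinct []       = []
  distinct (g ∷ gs) with any? (iso? g) (distinct gs)
  ... | yes _ = distinct gs
  ... | no _  = g ∷ distinct gs

  distinct-none : ∀ gs {g : Multigraph n} → ¬ Any (Iso g) gs → ¬ Any (Iso g) (distinct gs)
  distinct-none (h ∷ gs) none a with any? (iso? h) (distinct gs)
  ... | yes _ = distinct-none gs (none ∘ there) a
  distinct-none (h ∷ gs) none (here i)  | no _ = none (here i)
  distinct-none (h ∷ gs) none (there a) | no _ = distinct-none gs (none ∘ there) a

  distinct-once : ∀ gs {g : Multigraph n} → Any (Iso g) gs → ∑ (distinct gs) (λ r → ⟦ iso? g r ⟧) ≡ 1
  distinct-once (h ∷ gs) {g} a with any? (iso? h) (distinct gs)
  distinct-once (h ∷ gs) {g} (there a) | yes _ = distinct-once gs a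
  distinct-once (h ∷ gs) {g} (here i)  | yes p with any? (iso? h) gs
  ... | yes p′ = distinct-once gs (Any.map (Iso-trans i) p′)
  ... | no ¬p′ = contradiction p (distinct-none gs ¬p′)
  distinct-once (h ∷ gs) {g} a | no ¬p with iso? g h
  ... | yes i = cong suc (∑-none (iso? g) (distinct gs) (λ b → ¬p (Any.map (Iso-trans (Iso-sym i)) b)))
  distinct-once (h ∷ gs) {g} (here i)  | no ¬p | no ¬i = contradiction i ¬i
  distinct-once (h ∷ gs) {g} (there a) | no ¬p | no ¬i = distinct-once gs a

  distinct-All : ∀ {p} {P : Multigraph n → Set p} {gs} → All P gs → All P (distinct gs)
  distinct-All {gs = []}     []         = []
  distinct-All {gs = g ∷ gs} (pg ∷ pgs) with any? (iso? g) (distinct gs)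
  ... | yes _ = distinct-All pgs
  ... | no _  = pg ∷ distinct-All pgs

  HasEdges : ℕ → Multigraph n → Set
  HasEdges e g = size g ≡ 2 * e

  -- One representative for each isomorphism class of multigraphs with n
  -- vertices and e edges.

  opaque
    reps : ∀ n → ℕ → List (Multigraph n)
    reps n e = distinct (filter (λ g → size g ≟ 2 * e) (list (graphs n)))

  ∑-term : ∀ n (φ : Fin n → ℕ) i → φ i ≤ ∑ (allFin n) φ
  ∑-term (suc n) φ zero    = ≤-trans (m≤m+n _ _) (≤-reflexive (sym (∑-allFin n φ)))
  ∑-term (suc n) φ (suc i) = ≤-trans (∑-term n (φ ∘ suc) i) (≤-trans (m≤n+m _ (φ zero)) (≤-reflexive (sym (∑-allFin n φ))))

  mult≤size : ∀ (g : Multigraph n) i j → mult g i j ≤ size g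
  mult≤size {n} g i j = ≤-trans (∑-term n (mult g i) j) (∑-term n (λ i → ∑ (allFin n) (mult g i)) i)

  ∑-permute : ∀ (σ : Permutation′ n) φ → ∑ (allFin n) (φ ∘ (σ ⟨$⟩ʳ_)) ≡ ∑ (allFin n) φ
  ∑-permute {n} σ φ = sym (reindex (finEnum n) (finEnum n) (σ ⟨$⟩ˡ_) (σ ⟨$⟩ʳ_) (cong _) (cong _)
    (λ _ → Perm.inverseʳ σ) (λ _ → Perm.inverseˡ σ) φ (cong φ))

  size-Maps : ∀ (σ : Permutation′ n) {g h} → Maps σ g h → size g ≡ size h
  size-Maps {n} σ {g} {h} m = begin
    size g ≡⟨ ∑-cong (allFin n) (λ i → ∑-cong (allFin n) (λ j → m i j)) ⟨
    ∑ (allFin n) (λ i → ∑ (allFin n) (λ j → mult h (σ ⟨$⟩ʳ i) (σ ⟨$⟩ʳ j))) ≡⟨ ∑-cong (allFin n) (λ i → ∑-permute σ (mult h (σ ⟨$⟩ʳ i))) ⟩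
    ∑ (allFin n) (λ i → ∑ (allFin n) (mult h (σ ⟨$⟩ʳ i))) ≡⟨ ∑-permute σ (λ i → ∑ (allFin n) (mult h i)) ⟩
    size h ∎
    where open ≡-Reasoning

  bounded : ∀ e (g : Multigraph n) → 2 * e < q → HasEdges e g → ∀ i j → mult g i j < q
  bounded e g e<q s i j = ≤-<-trans (≤-trans (mult≤size g i j) (≤-reflexive s)) e<q

  -- No multiplicity exceeds the size `2 * e`, so the bound q excludes no graph with e edges.
  graphs-complete : ∀ e (g : Multigraph n) → 2 * e < q → HasEdges e g → ∑ (list (graphs n)) (λ h → ⟦ h ≗? g ⟧) ≡ 1
  graphs-complete {n} e g e<q s = trans (each (graphs n) g) (⟦⟧-yes (graphBounded? g) (bounded e g e<q s))

  opaque
    unfolding reps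

    reps-once : ∀ e (g : Multigraph n) → 2 * e < q → HasEdges e g → ∑ (reps n e) (λ r → ⟦ iso? g r ⟧) ≡ 1
    reps-once {n} e g e<q s = distinct-once _ (lemma (find (∑-∈ (_≗? g) (list (graphs n)) λ eq → contradiction (trans (sym eq) (graphs-complete e g e<q s)) λ ())))
      where
      lemma : (∃ λ h → h ∈ list (graphs n) × h ≗ g) → Any (Iso g) (filter (λ g → size g ≟ 2 * e) (list (graphs n)))
      lemma (h , h∈ , h≗g) = lose (∈.∈-filter⁺ (λ g → size g ≟ 2 * e) h∈ (trans (size-cong {g = h} {g} h≗g) s)) (≗⇒Iso {g = g} {h} (λ i j → sym (h≗g i j)))

    reps-edges : ∀ n e → All (HasEdges e) (reps n e)
    reps-edges n e = distinct-All (All.all-filter (λ g → size g ≟ 2 * e) (list (graphs n)))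

  -- The isomorphisms from r to g are either absent or form a coset of the automorphism group of g:
  -- a fixed one followed by the automorphisms.
  stabilizer : ∀ (g r : Multigraph n) → ⟦ iso? g r ⟧ * ∑ (perms n) (λ σ → ⟦ fixed? σ g ⟧) ≡ ∑ (perms n) (λ σ → ⟦ maps? σ r g ⟧)
  stabilizer {n} g r with iso? g r
  ... | yes (via ρ mρ) = trans (+-identityʳ _) (trans
    (∑-cong (perms n) (λ σ → ⟦⟧-cong (fixed? σ g) (maps? (τ ∘ₚ σ) r g) (Maps-trans τ σ {r} {g} {g} mτ)
       (λ m i j → trans (cong₂ (λ i j → mult g (σ ⟨$⟩ʳ i) (σ ⟨$⟩ʳ j)) (sym (Perm.inverseˡ ρ)) (sym (Perm.inverseˡ ρ))) (trans (m _ _) (mρ i j)))))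
    (sym (reindex (permEnum n) (permEnum n) (λ σ → ρ ∘ₚ σ) (λ σ → τ ∘ₚ σ) (λ e i → e _) (λ e i → e _)
       (λ σ i → cong (σ ⟨$⟩ʳ_) (Perm.inverseʳ ρ)) (λ σ i → cong (σ ⟨$⟩ʳ_) (Perm.inverseˡ ρ)) (λ σ → ⟦ maps? σ r g ⟧)
       (λ {σ} {σ′} e → ⟦⟧-cong (maps? σ r g) (maps? σ′ r g) (λ m i j → trans (sym (cong₂ (mult g) (e i) (e j))) (m i j)) (λ m i j → trans (cong₂ (mult g) (e i) (e j)) (m i j))))))
    where
    τ = Perm.flip ρ
    mτ = Maps-flip ρ {g} {r} mρ
  ... | no ¬i = sym (∑-none (λ σ → maps? σ r g) (perms n) (λ a → let σ , _ , m = find a in ¬i (Iso-sym (via σ m))))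

  orbit-count : ∀ e (r : Multigraph n) → 2 * e < q → HasEdges e r →
    ∑ (list (graphs n)) (λ g → ∑ (perms n) (λ σ → ⟦ maps? σ r g ⟧)) ≡ length (perms n)
  orbit-count {n} e r e<q s = begin
    ∑ (list (graphs n)) (λ g → ∑ (perms n) (λ σ → ⟦ maps? σ r g ⟧)) ≡⟨ ∑-swap (list (graphs n)) (perms n) _ ⟩
    ∑ (perms n) (λ σ → ∑ (list (graphs n)) (λ g → ⟦ maps? σ r g ⟧))
      ≡⟨ ∑-cong (perms n) (λ σ → trans (∑-cong (list (graphs n)) (λ g → ⟦⟧-cong (maps? σ r g) (g ≗? moved σ)
           (λ m i j → trans (sym (cong₂ (mult g) (Perm.inverseʳ σ) (Perm.inverseʳ σ))) (m _ _))
           (λ eq i j → trans (eq _ _) (cong₂ (mult r) (Perm.inverseˡ σ) (Perm.inverseˡ σ)))))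
           (graphs-complete e (moved σ) e<q (trans (sym (size-Maps σ {r} {moved σ} (λ i j → cong₂ (mult r) (Perm.inverseˡ σ) (Perm.inverseˡ σ)))) s))) ⟩
    ∑ (perms n) (λ _ → 1) ≡⟨ ∑-length (perms n) ⟩
    length (perms n) ∎
    where
    open ≡-Reasoning
    open Defs using (_•_)
    moved : Permutation′ n → Multigraph n
    moved σ = σ • r

  -- Both sides count the pairs of a permutation and a graph with e edges fixed by it. For graphs
  -- isomorphic to r, automorphisms may be exchanged for isomorphisms from r by `stabilizer`; each
  -- permutation is an isomorphism from r to exactly one graph, so every class contributes the order
  -- of the group.
  burnside : ∀ n e → 2 * e < q → length (perms n) * length (reps n e) ≡ eval (types n) (λ λs → ev (orbits λs) (λ x → ⟦ x ≟ 2 * e ⟧))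
  burnside n e e<q = sym (begin
    eval (types n) (λ λs → ev (orbits λs) δ) ≡⟨ ∑-perms n _ _ (λ σ λs h → ∑-fixed σ λs h δ) ⟨
    ∑ (perms n) (λ σ → ∑ L (λ g → ⟦ fixed? σ g ⟧ * δ (size g))) ≡⟨ ∑-swap (perms n) L _ ⟩
    ∑ L (λ g → ∑ (perms n) (λ σ → ⟦ fixed? σ g ⟧ * δ (size g))) ≡⟨ ∑-cong L (λ g → trans (∑-*ʳ (perms n) (δ (size g)) _) (*-comm (stab g) _)) ⟩
    ∑ L (λ g → δ (size g) * stab g)
      ≡⟨ ∑-cong L (λ g → ⟦⟧-guard (size g ≟ 2 * e) (λ s → trans (sym (trans (cong (_* stab g) (reps-once e g e<q s)) (*-identityˡ _))) (trans (sym (∑-*ʳ R (stab g) _)) (∑-cong R (stabilizer g))))) ⟩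
    ∑ L (λ g → δ (size g) * ∑ R (λ r → ∑ (perms n) (λ σ → ⟦ maps? σ r g ⟧))) ≡⟨ ∑-cong L (λ g → ∑-*ˡ R (δ (size g)) _) ⟨
    ∑ L (λ g → ∑ R (λ r → δ (size g) * ∑ (perms n) (λ σ → ⟦ maps? σ r g ⟧))) ≡⟨ ∑-swap L R _ ⟩
    ∑ R (λ r → ∑ L (λ g → δ (size g) * ∑ (perms n) (λ σ → ⟦ maps? σ r g ⟧)))
      ≡⟨ ∑-congᴬ (reps-edges n e) (λ r s → trans (∑-cong L (λ g → trans (sym (∑-*ˡ (perms n) (δ (size g)) _)) (∑-cong (perms n) (λ σ → absorb σ r g s)))) (orbit-count e r e<q s)) ⟩
    ∑ R (λ _ → length (perms n)) ≡⟨ ∑-cong R (λ _ → sym (*-identityʳ (length (perms n)))) ⟩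
    ∑ R (λ _ → length (perms n) * 1) ≡⟨ trans (∑-*ˡ R (length (perms n)) _) (cong (length (perms n) *_) (∑-length R)) ⟩
    length (perms n) * length R ∎)
    where
    open ≡-Reasoning
    L = list (graphs n)
    R = reps n e
    δ : ℕ → ℕ
    δ x = ⟦ x ≟ 2 * e ⟧
    stab : Multigraph n → ℕ
    stab g = ∑ (perms n) (λ σ → ⟦ fixed? σ g ⟧)
    absorb : ∀ σ r g → HasEdges e r → δ (size g) * ⟦ maps? σ r g ⟧ ≡ ⟦ maps? σ r g ⟧
    absorb σ r g s = ⟦⟧-× (size g ≟ 2 * e) (maps? σ r g) (maps? σ r g) (λ m → trans (sym (size-Maps σ {r} {g} m)) s , m) (λ _ m → m)

-- Coefficients of generating functions as digits of one number.

module Counts (q-1 t : ℕ) .{{_ : NonZero t}} where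
  open Sums
  open Permutations
  open CycleTypes
  open OrbitSizes (suc q-1)
  open PairRotations q-1
  open FixedGraphs q-1
  open Representatives q-1
  open import Data.List.Base using (List; []; _∷_; map; length; upTo; applyUpTo)
  open import Data.Nat.Base hiding (ℕ; suc; NonZero)
  open import Data.Nat.DivMod
  open import Data.Nat.Properties
  open import Data.Nat.Tactic.RingSolver using (solve-∀)
  open import Data.Product.Base using (_,_; proj₁; proj₂; ∃)
  open import Function.Base using (_∘_)
  open import Relation.Binary.PropositionalEquality hiding (_≗_)
  open import Relation.Nullary using (yes; no; contradiction)

  multiple : ∀ m .{{_ : NonZero m}} n → m * n % m ≡ 0
  multiple m n = trans (cong (_% m) (*-comm m n)) (m*n%n≡0 n m)

  module Modulo (M : ℕ) .{{_ : NonZero M}} where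
    infix 4 _≡ₘ_
    _≡ₘ_ : ℕ → ℕ → Set
    x ≡ₘ y = x % M ≡ y % M

    +-≡ₘ : ∀ {a b c d} → a ≡ₘ b → c ≡ₘ d → a + c ≡ₘ b + d
    +-≡ₘ {a} {b} {c} {d} e e′ = trans (%-distribˡ-+ a c M) (trans (cong₂ (λ x y → (x + y) % M) e e′) (sym (%-distribˡ-+ b d M)))

    *-≡ₘ : ∀ {a b c d} → a ≡ₘ b → c ≡ₘ d → a * c ≡ₘ b * d
    *-≡ₘ {a} {b} {c} {d} e e′ = trans (%-distribˡ-* a c M) (trans (cong₂ (λ x y → (x * y) % M) e e′) (sym (%-distribˡ-* b d M)))

    %-≡ₘ : ∀ a → a % M ≡ₘ a
    %-≡ₘ a = m%n%n≡m%n a M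

  horner : ℕ → ℕ → ℕ
  horner x 0       = 0
  horner x (suc k) = 1 + x * horner x k

  horner-sum : ∀ l k c → ∑ (upTo k) (λ a → t ^ (l * a) * c) ≡ horner (t ^ l) k * c
  horner-sum l 0       c = refl
  horner-sum l (suc k) c = begin
    t ^ (l * 0) * c + ∑ (applyUpTo suc k) (λ a → t ^ (l * a) * c)
      ≡⟨ cong₂ _+_ (trans (cong (λ z → t ^ z * c) (*-zeroʳ l)) (*-identityˡ c)) (∑-applyUpTo k suc _) ⟩
    c + ∑ (upTo k) (λ a → t ^ (l * suc a) * c)
      ≡⟨ cong (c +_) (∑-cong (upTo k) (λ a → trans (cong (λ z → t ^ z * c) (*-suc l a)) (trans (cong (_* c) (^-distribˡ-+-* t l (l * a))) (*-assoc (t ^ l) _ c)))) ⟩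
    c + ∑ (upTo k) (λ a → t ^ l * (t ^ (l * a) * c)) ≡⟨ cong (c +_) (trans (∑-*ˡ (upTo k) (t ^ l) _) (cong (t ^ l *_) (horner-sum l k c))) ⟩
    c + t ^ l * (horner (t ^ l) k * c) ≡⟨ arith (t ^ l) (horner (t ^ l) k) c ⟩
    horner (t ^ l) (suc k) * c ∎
    where
    open ≡-Reasoning
    arith : ∀ x h c → c + x * (h * c) ≡ (1 + x * h) * c
    arith = solve-∀

  ev-*ˡ : ∀ μ c φ → ev μ (λ x → c * φ x) ≡ c * ev μ φ
  ev-*ˡ []      c φ = refl
  ev-*ˡ (l ∷ μ) c φ = trans (∑-cong (upTo q) (λ a → ev-*ˡ μ c (λ x → φ (l * a + x)))) (∑-*ˡ (upTo q) c _)

  ev-+ : ∀ μ φ ψ → ev μ (λ x → φ x + ψ x) ≡ ev μ φ + ev μ ψ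
  ev-+ []      φ ψ = refl
  ev-+ (l ∷ μ) φ ψ = trans (∑-cong (upTo q) (λ a → ev-+ μ (λ x → φ (l * a + x)) (λ x → ψ (l * a + x)))) (∑-+ (upTo q) (λ a → ev μ (λ x → φ (l * a + x))) (λ a → ev μ (λ x → ψ (l * a + x))))

  -- One orbit contributes a geometric sum in t^l with q terms, and independent orbits multiply.
  ev-power : ∀ l μ → ev (l ∷ μ) (t ^_) ≡ horner (t ^ l) q * ev μ (t ^_)
  ev-power l μ = trans (∑-cong (upTo q) (λ a → trans (ev-cong μ (λ x → ^-distribˡ-+-* t (l * a) x)) (ev-*ˡ μ (t ^ (l * a)) (t ^_)))) (horner-sum l q (ev μ (t ^_)))

  -- The default 1 is what a geometric factor with l ≥ S amounts to modulo t^S, so a table of S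
  -- factors is complete.
  look : List ℕ → ℕ → ℕ
  look []       _       = 1
  look (x ∷ xs) 0       = x
  look (x ∷ xs) (suc i) = look xs i

  look-< : ∀ f n i → i < n → look (applyUpTo f n) i ≡ f i
  look-< f (suc n) 0       _   = refl
  look-< f (suc n) (suc i) i<n = look-< (f ∘ suc) n i (s≤s⁻¹ i<n)

  look-≥ : ∀ f n i → n ≤ i → look (applyUpTo f n) i ≡ 1
  look-≥ f 0       i       _   = refl
  look-≥ f (suc n) (suc i) n≤i = look-≥ (f ∘ suc) n i (s≤s⁻¹ n≤i)

  -- Generating functions modulo t^S, evaluated at the number t.

  module Truncated (S : ℕ) where
    M : ℕ
    M = t ^ S

    instance
      M≢0 : NonZero M
      M≢0 = m^n≢0 t S

    open Modulo M

    hornerM : ℕ → ℕ → ℕ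
    hornerM x 0       = 0
    hornerM x (suc k) = (1 + x * hornerM x k) % M

    hornerM-correct : ∀ x k → hornerM x k ≡ₘ horner x k
    hornerM-correct x 0       = refl
    hornerM-correct x (suc k) = trans (%-≡ₘ (1 + x * hornerM x k)) (+-≡ₘ {1} {1} refl (*-≡ₘ {x} {x} refl (hornerM-correct x k)))

    geometric : List ℕ
    geometric = applyUpTo (λ l → hornerM (t ^ l) q) S

    geometric-correct : ∀ l → look geometric l ≡ₘ horner (t ^ l) q
    geometric-correct l with l <? S
    ... | yes l<S = trans (cong (_% M) (look-< _ S l l<S)) (hornerM-correct (t ^ l) q)
    ... | no  l≮S = trans (cong (_% M) (look-≥ _ S l (≮⇒≥ l≮S))) (sym (trans (+-≡ₘ {1} {1} refl vanish) (cong (_% M) (+-identityʳ 1))))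
      where
      vanish : t ^ l * horner (t ^ l) q-1 ≡ₘ 0
      vanish = trans (cong (λ z → t ^ z * horner (t ^ l) q-1 % M) (sym (m+[n∸m]≡n (≮⇒≥ l≮S))))
        (trans (cong (λ z → z * horner (t ^ l) q-1 % M) (^-distribˡ-+-* t S (l ∸ S)))
        (trans (cong (_% M) (*-assoc M (t ^ (l ∸ S)) (horner (t ^ l) q-1))) (trans (multiple M _) (sym (m<n⇒m%n≡m (>-nonZero⁻¹ M))))))

    product : List ℕ → List ℕ → ℕ
    product gs []      = 1
    product gs (l ∷ μ) = (look gs l * product gs μ) % M

    product-correct : ∀ μ → product geometric μ ≡ₘ ev μ (t ^_)
    product-correct []      = refl
    product-correct (l ∷ μ) = trans (%-≡ₘ (look geometric l * product geometric μ))
      (trans (*-≡ₘ (geometric-correct l) (product-correct μ)) (cong (_% M) (sym (ev-power l μ))))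

    total : List ℕ → Weighted → ℕ
    total gs w = eval w (λ λs → product gs (orbits λs))

    total-correct : ∀ w → total geometric w ≡ₘ eval w (λ λs → ev (orbits λs) (t ^_))
    total-correct []             = refl
    total-correct ((c , λs) ∷ w) = +-≡ₘ (*-≡ₘ {c} {c} refl (product-correct (orbits λs))) (total-correct w)

    coefficient : Weighted → ℕ → ℕ
    coefficient w s = eval w (λ λs → ev (orbits λs) (λ x → ⟦ x ≟ s ⟧))

  digits : ℕ → ℕ → List ℕ
  digits 0       w = []
  digits (suc k) w = w % t ∷ digits k (w / t)

  number : (ℕ → ℕ) → ℕ → ℕ
  number c 0       = 0
  number c (suc k) = c 0 + t * number (c ∘ suc) k

  number-< : ∀ c k → (∀ s → c s < t) → number c k < t ^ k
  number-< c 0       c<t = s≤s z≤n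
  number-< c (suc k) c<t = <-≤-trans (+-monoˡ-< _ (c<t 0)) (≤-trans (≤-reflexive (sym (*-suc t _))) (*-monoʳ-≤ t (number-< (c ∘ suc) k (c<t ∘ suc))))

  digits-number : ∀ c k s → s < k → (∀ s → c s < t) → look (digits k (number c k)) s ≡ c s
  digits-number c (suc k) 0 _ c<t = trans (cong (_% t) (cong (c 0 +_) (*-comm t (number (c ∘ suc) k))))
    (trans ([m+kn]%n≡m%n (c 0) (number (c ∘ suc) k) t) (m<n⇒m%n≡m (c<t 0)))
  digits-number c (suc k) (suc s) s<k c<t = trans (cong (λ z → look (digits k z) s) quotient) (digits-number (c ∘ suc) k s (s≤s⁻¹ s<k) (c<t ∘ suc))
    where
    N = number (c ∘ suc) k
    quotient : (c 0 + t * N) / t ≡ N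
    quotient = trans (+-distrib-/ (c 0) (t * N) (subst₂ (λ x y → x + y < t) (sym (m<n⇒m%n≡m (c<t 0))) (sym (multiple t N)) (subst (_< t) (sym (+-identityʳ (c 0))) (c<t 0))))
      (cong₂ _+_ (m<n⇒m/n≡0 (c<t 0)) (trans (cong (_/ t) (*-comm t N)) (m*n/n≡m N t)))

  number-cong : ∀ {c d} k → (∀ s → c s ≡ d s) → number c k ≡ number d k
  number-cong 0       eq = refl
  number-cong (suc k) eq = cong₂ (λ x y → x + t * y) (eq 0) (number-cong k (eq ∘ suc))

  number-+ : ∀ c d k → number (λ s → c s + d s) k ≡ number c k + number d k
  number-+ c d 0       = refl
  number-+ c d (suc k) = trans (cong (λ z → c 0 + d 0 + t * z) (number-+ (c ∘ suc) (d ∘ suc) k)) (arith (c 0) (d 0) t (number (c ∘ suc) k) (number (d ∘ suc) k))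
    where
    arith : ∀ a b t x y → a + b + t * (x + y) ≡ a + t * x + (b + t * y)
    arith = solve-∀

  number-*ˡ : ∀ a c k → number (λ s → a * c s) k ≡ a * number c k
  number-*ˡ a c 0       = sym (*-zeroʳ a)
  number-*ˡ a c (suc k) = trans (cong (λ z → a * c 0 + t * z) (number-*ˡ a (c ∘ suc) k)) (arith a (c 0) t (number (c ∘ suc) k))
    where
    arith : ∀ a b t x → a * b + t * (a * x) ≡ a * (b + t * x)
    arith = solve-∀

  number-δ : ∀ x k → ∃ λ r → t ^ x ≡ number (λ s → ⟦ x ≟ s ⟧) k + t ^ k * r
  number-δ x       0       = t ^ x , sym (+-identityʳ (t ^ x))
  number-δ 0       (suc k) = 0 , sym (trans (cong₂ _+_ (cong (λ z → 1 + t * z) (zeros k)) (*-zeroʳ (t ^ suc k))) (trans (+-identityʳ _) (cong suc (*-zeroʳ t))))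
    where
    zeros : ∀ k → number (λ _ → 0) k ≡ 0
    zeros 0       = refl
    zeros (suc k) = trans (cong (t *_) (zeros k)) (*-zeroʳ t)
  number-δ (suc x) (suc k) with r , eq ← number-δ x k = r , trans (cong (t *_) eq)
    (trans (*-distribˡ-+ t _ _) (cong₂ (λ a b → t * a + b) (number-cong k (λ s → ⟦⟧-cong (x ≟ s) (suc x ≟ suc s) (cong suc) suc-injective)) (sym (*-assoc t (t ^ k) r))))

  module Digits (S : ℕ) where
    open Truncated S
    open Modulo M

    ev-number : ∀ μ → ev μ (t ^_) ≡ₘ number (λ s → ev μ (λ x → ⟦ x ≟ s ⟧)) S
    ev-number μ = trans (cong (_% M) (trans (ev-cong μ (λ x → proj₂ (number-δ x S))) (trans (ev-+ μ (λ x → number (λ s → ⟦ x ≟ s ⟧) S) (λ x → M * proj₁ (number-δ x S)))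
      (cong₂ _+_ (ev-numbers μ S (λ s x → ⟦ x ≟ s ⟧)) (ev-*ˡ μ M _)))))
      (trans (cong (λ z → (number (λ s → ev μ (λ x → ⟦ x ≟ s ⟧)) S + z) % M) (*-comm M R)) ([m+kn]%n≡m%n (number (λ s → ev μ (λ x → ⟦ x ≟ s ⟧)) S) R M))
      where
      R = ev μ (λ x → proj₁ (number-δ x S))
      ev-numbers : ∀ μ k (c : ℕ → ℕ → ℕ) → ev μ (λ x → number (λ s → c s x) k) ≡ number (λ s → ev μ (c s)) k
      ev-numbers μ 0 c = ev-zero μ
        where
        ev-zero : ∀ μ → ev μ (λ _ → 0) ≡ 0
        ev-zero []      = refl
        ev-zero (l ∷ μ) = trans (∑-cong (upTo q) (λ _ → ev-zero μ)) (∑-zero (upTo q))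
      ev-numbers μ (suc k) c = trans (ev-+ μ (c 0) (λ x → t * number (λ s → c (suc s) x) k))
        (cong (ev μ (c 0) +_) (trans (ev-*ˡ μ t _) (cong (t *_) (ev-numbers μ k (c ∘ suc)))))

    eval-number : ∀ w → eval w (λ λs → ev (orbits λs) (t ^_)) ≡ₘ number (coefficient w) S
    eval-number []             = cong (_% M) (sym (zeros S))
      where
      zeros : ∀ k → number (λ _ → 0) k ≡ 0
      zeros 0       = refl
      zeros (suc k) = trans (cong (t *_) (zeros k)) (*-zeroʳ t)
    eval-number ((c , λs) ∷ w) = trans (+-≡ₘ (*-≡ₘ {c} {c} refl (ev-number (orbits λs))) (eval-number w))
      (cong (_% M) (sym (trans (number-+ (λ s → c * ev (orbits λs) (λ x → ⟦ x ≟ s ⟧)) (coefficient w) S) (cong (_+ _) (number-*ˡ c _ S)))))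

    -- The number of all choices of values on the orbits, summed over the permutations. It bounds
    -- every single coefficient, so if it is below t there are no carries, and the digits are the
    -- coefficients.
    cap : Weighted → ℕ
    cap w = eval w (λ λs → q ^ length (orbits λs))

    coefficient≤cap : ∀ w s → coefficient w s ≤ cap w
    coefficient≤cap w s = ∑-mono w (λ (c , λs) → *-monoʳ-≤ c (ev≤ (orbits λs) (λ x → ⟦⟧-≤1 (x ≟ s))))
      where
      ∑-upTo-const : ∀ k c → ∑ (upTo k) (λ _ → c) ≡ k * c
      ∑-upTo-const 0       c = refl
      ∑-upTo-const (suc k) c = cong (c +_) (trans (∑-applyUpTo k suc _) (∑-upTo-const k c))
      ev≤ : ∀ μ {φ} → (∀ x → φ x ≤ 1) → ev μ φ ≤ q ^ length μ
      ev≤ []      φ≤1 = φ≤1 0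
      ev≤ (l ∷ μ) φ≤1 = ≤-trans (∑-mono (upTo q) (λ a → ev≤ μ (λ x → φ≤1 (l * a + x)))) (≤-reflexive (∑-upTo-const q _))

    coefficient-digits : ∀ w s → s < S → cap w < t → look (digits S (total geometric w % M)) s ≡ coefficient w s
    coefficient-digits w s s<S cap<t = trans (cong (λ z → look (digits S z) s)
      (trans (total-correct w) (trans (eval-number w) (m<n⇒m%n≡m (number-< (coefficient w) S c<t))))) (digits-number (coefficient w) S s s<S c<t)
      where
      c<t : ∀ s → coefficient w s < t
      c<t s = ≤-<-trans (coefficient≤cap w s) cap<t

    order : Weighted → ℕ
    order w = eval w (λ _ → 1)

    perms-order : ∀ n → length (perms n) ≡ order (types n)
    perms-order n = trans (sym (∑-length (perms n))) (∑-perms n (λ _ → 1) (λ _ → 1) (λ _ _ _ → refl))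

    -- Division made total by the value 0, so that rows can be evaluated before the divisor is known
    -- to be nonzero.
    quotientBy : ℕ → ℕ → ℕ
    quotientBy m 0       = 0
    quotientBy m (suc n) = m / suc n

    quotientBy-correct : ∀ a b c → a ≢ 0 → a * b ≡ c → quotientBy c a ≡ b
    quotientBy-correct 0       b c a≢0 eq = contradiction refl a≢0
    quotientBy-correct (suc a) b c a≢0 eq = trans (cong (_/ suc a) (trans (sym eq) (*-comm (suc a) b))) (m*n/n≡m b (suc a))

    row : List ℕ → Weighted → List ℕ
    row gs w = map (λ c → quotientBy c (order w)) (digits S (total gs w % M))

    row-correct : ∀ n e → 2 * e < S → 2 * e < q → order (types n) ≢ 0 → cap (types n) < t →
      look (row geometric (types n)) (2 * e) ≡ length (reps n e)
    row-correct n e e<S e<q o≢0 cap<t = trans (look-map (digits S (total geometric (types n) % M)) (2 * e) (subst (2 * e <_) (sym (digits-length S _)) e<S))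
      (quotientBy-correct (order (types n)) (length (reps n e)) _ o≢0
        (trans (trans (cong (_* length (reps n e)) (sym (perms-order n))) (burnside n e e<q)) (sym (coefficient-digits (types n) (2 * e) e<S cap<t))))
      where
      digits-length : ∀ k w → length (digits k w) ≡ k
      digits-length 0       w = refl
      digits-length (suc k) w = cong suc (digits-length k (w / t))
      look-map : ∀ xs i → i < length xs → look (map (λ c → quotientBy c (order (types n))) xs) i ≡ quotientBy (look xs i) (order (types n))
      look-map (x ∷ xs) 0       _  = refl
      look-map (x ∷ xs) (suc i) lt = look-map xs i (s≤s⁻¹ lt)

-- Adding an isolated vertex or edge is injective on isomorphism classes.

module Extensions (q-1 : ℕ) where
  open Sums
  open Permutations
  open CycleTypes
  open OrbitSizes (suc q-1)
  open PairRotations q-1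
  open FixedGraphs q-1
  open Representatives q-1
  open import Defs using (Multigraph; mult; symmetric; loopless; _≗_)
  open import Data.Fin.Base as Fin using (Fin; zero; suc)
  open import Data.Fin.Permutation as Perm using (Permutation′; _⟨$⟩ʳ_; _⟨$⟩ˡ_; _∘ₚ_)
  import Data.Fin.Permutation.Components as PC
  import Data.Fin.Properties as Fin
  open import Data.List.Base using (allFin; length)
  open import Data.Nat.Base hiding (ℕ; suc)
  open import Data.Nat.Properties
  open import Data.Nat.Tactic.RingSolver using (solve-∀)
  open import Data.Product.Base using (_×_; _,_; proj₁; proj₂; ∃; ∃₂)
  open import Data.Sum.Base using (_⊎_; inj₁; inj₂)
  open import Function.Base using (_∘_; id)
  open import Relation.Binary.PropositionalEquality hiding (_≗_)
  open import Relation.Nullary using (Dec; yes; no; contradiction)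
  open import Relation.Nullary.Decidable using (_×-dec_)

  private variable
    n v : ℕ

  -- The disjoint unions of a graph with an isolated vertex and with an isolated edge.

  ext : Multigraph n → Multigraph (suc n)
  ext g = joinVertex (λ _ → 0) g

  atZero : Fin (suc n) → ℕ
  atZero zero    = 1
  atZero (suc _) = 0

  extK : Multigraph n → Multigraph (2 + n)
  extK g = joinVertex atZero (ext g)

  Isolated : Multigraph n → Fin n → Set
  Isolated g i = ∀ j → mult g i j ≡ 0

  -- The rows of both ends are prescribed completely; in particular the multiplicity is 1, and a
  -- component that consists of a multiple edge is not an isolated edge.
  IsolatedEdge : Multigraph n → Fin n → Fin n → Set
  IsolatedEdge g i j = ∀ k → mult g i k ≡ ⟦ k Fin.≟ j ⟧ × mult g j k ≡ ⟦ k Fin.≟ i ⟧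

  HasIsolated HasIsolatedEdge : Multigraph n → Set
  HasIsolated g = ∃ (Isolated g)
  HasIsolatedEdge g = ∃₂ (IsolatedEdge g)

  hasIsolated? : ∀ (g : Multigraph n) → Dec (HasIsolated g)
  hasIsolated? g = Fin.any? λ i → Fin.all? λ j → mult g i j ≟ 0

  hasIsolatedEdge? : ∀ (g : Multigraph n) → Dec (HasIsolatedEdge g)
  hasIsolatedEdge? g = Fin.any? λ i → Fin.any? λ j → Fin.all? λ k → (mult g i k ≟ ⟦ k Fin.≟ j ⟧) ×-dec (mult g j k ≟ ⟦ k Fin.≟ i ⟧)

  δ-injective : ∀ {m n} (f : Fin m → Fin n) → (∀ {i j} → f i ≡ f j → i ≡ j) → ∀ k j → ⟦ f k Fin.≟ f j ⟧ ≡ ⟦ k Fin.≟ j ⟧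
  δ-injective f inj k j = ⟦⟧-cong (f k Fin.≟ f j) (k Fin.≟ j) inj (cong f)

  perm-injective : ∀ (σ : Permutation′ n) {i j} → σ ⟨$⟩ʳ i ≡ σ ⟨$⟩ʳ j → i ≡ j
  perm-injective σ e = trans (sym (Perm.inverseˡ σ)) (trans (cong (σ ⟨$⟩ˡ_) e) (Perm.inverseˡ σ))

  mult-Maps : ∀ (σ : Permutation′ n) {g h} → Maps σ g h → ∀ i k → mult h (σ ⟨$⟩ʳ i) k ≡ mult g i (σ ⟨$⟩ˡ k)
  mult-Maps σ {g} {h} m i k = trans (cong (mult h _) (sym (Perm.inverseʳ σ))) (m i (σ ⟨$⟩ˡ k))

  Isolated-Maps : ∀ (σ : Permutation′ n) {g h} → Maps σ g h → ∀ {i} → Isolated g i → Isolated h (σ ⟨$⟩ʳ i)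
  Isolated-Maps σ {g} {h} m iso k = trans (mult-Maps σ {g} {h} m _ k) (iso _)

  δ-Maps : ∀ (σ : Permutation′ n) {g h} → Maps σ g h → ∀ {i j} → (∀ k → mult g i k ≡ ⟦ k Fin.≟ j ⟧) → ∀ k → mult h (σ ⟨$⟩ʳ i) k ≡ ⟦ k Fin.≟ (σ ⟨$⟩ʳ j) ⟧
  δ-Maps σ {g} {h} m {i} {j} row k = trans (mult-Maps σ {g} {h} m i k) (trans (row _)
    (⟦⟧-cong ((σ ⟨$⟩ˡ k) Fin.≟ j) (k Fin.≟ (σ ⟨$⟩ʳ j)) (λ e → trans (sym (Perm.inverseʳ σ)) (cong (σ ⟨$⟩ʳ_) e)) (λ e → trans (cong (σ ⟨$⟩ˡ_) e) (Perm.inverseˡ σ))))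

  IsolatedEdge-Maps : ∀ (σ : Permutation′ n) {g h} → Maps σ g h → ∀ {i j} → IsolatedEdge g i j → IsolatedEdge h (σ ⟨$⟩ʳ i) (σ ⟨$⟩ʳ j)
  IsolatedEdge-Maps σ {g} {h} m e k = δ-Maps σ {g} {h} m (proj₁ ∘ e) k , δ-Maps σ {g} {h} m (proj₂ ∘ e) k

  HasIsolated-Iso : ∀ {g h : Multigraph n} → Iso g h → HasIsolated g → HasIsolated h
  HasIsolated-Iso {g = g} {h} (via σ m) (i , iso) = σ ⟨$⟩ʳ i , Isolated-Maps σ {g} {h} m iso

  HasIsolatedEdge-Iso : ∀ {g h : Multigraph n} → Iso g h → HasIsolatedEdge g → HasIsolatedEdge h
  HasIsolatedEdge-Iso {g = g} {h} (via σ m) (i , j , e) = σ ⟨$⟩ʳ i , σ ⟨$⟩ʳ j , IsolatedEdge-Maps σ {g} {h} m e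

  module _ (H : Multigraph n) (τ : Permutation′ n) where

    -- τ fixes the vertex i, or carries its only neighbour along.
    data Swapped (i : Fin n) : Set where
      fixed   : τ ⟨$⟩ʳ i ≡ i → Swapped i
      isolated : Isolated H i → Isolated H (τ ⟨$⟩ʳ i) → Swapped i
      edge    : ∀ p → (∀ k → mult H i k ≡ ⟦ k Fin.≟ p ⟧) → (∀ k → mult H (τ ⟨$⟩ʳ i) k ≡ ⟦ k Fin.≟ (τ ⟨$⟩ʳ p) ⟧) → Swapped i

    -- For a pair i, j it suffices to know the whole row of one of them before and after τ; if
    -- neither row is prescribed, both points are fixed.
    automorphism : (∀ i → Swapped i) → Maps τ H H
    automorphism sw i j with sw i | sw j
    ... | isolated e e′ | _             = trans (e′ _) (sym (e _))
    ... | edge p e e′   | _             = trans (e′ _) (trans (δ-injective (τ ⟨$⟩ʳ_) (perm-injective τ) j p) (sym (e j)))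
    ... | fixed _       | isolated e e′ = trans (symmetric H _ _) (trans (e′ _) (trans (sym (e _)) (symmetric H _ _)))
    ... | fixed _       | edge p e e′   = trans (symmetric H _ _) (trans (e′ _) (trans (δ-injective (τ ⟨$⟩ʳ_) (perm-injective τ) i p) (trans (sym (e i)) (symmetric H _ _))))
    ... | fixed e       | fixed e′      = cong₂ (mult H) e e′

  transpose-cases : ∀ (a b i : Fin n) → (i ≡ a × PC.transpose a b i ≡ b) ⊎ (i ≡ b × PC.transpose a b i ≡ a) ⊎ (i ≢ a × i ≢ b × PC.transpose a b i ≡ i)
  transpose-cases a b i with i Fin.≟ a
  ... | yes e = inj₁ (e , refl)
  ... | no ¬e with i Fin.≟ b
  ...   | yes e′ = inj₂ (inj₁ (e′ , refl))
  ...   | no ¬e′ = inj₂ (inj₂ (¬e , ¬e′ , refl))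

  transpose-to : ∀ (a b : Fin n) → PC.transpose a b a ≡ b
  transpose-to a b with transpose-cases a b a
  ... | inj₁ (_ , e) = e
  ... | inj₂ (inj₁ (a≡b , e)) = trans e a≡b
  ... | inj₂ (inj₂ (ne , _)) = contradiction refl ne

  transpose-from : ∀ (a b : Fin n) → PC.transpose a b b ≡ a
  transpose-from a b with transpose-cases a b b
  ... | inj₁ (b≡a , e) = trans e b≡a
  ... | inj₂ (inj₁ (_ , e)) = e
  ... | inj₂ (inj₂ (_ , ne , _)) = contradiction refl ne

  transpose-off : ∀ (a b : Fin n) {i} → i ≢ a → i ≢ b → PC.transpose a b i ≡ i
  transpose-off a b {i} ne ne′ with transpose-cases a b i
  ... | inj₁ (e , _) = contradiction e ne
  ... | inj₂ (inj₁ (e , _)) = contradiction e ne′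
  ... | inj₂ (inj₂ (_ , _ , e)) = e

  restrict : ∀ {g h : Multigraph (suc n)} (σ : Permutation′ (suc n)) → Maps σ g h → σ ⟨$⟩ʳ zero ≡ zero → Iso (dropVertex g) (dropVertex h)
  restrict {g = g} {h} σ m e = via (Perm.remove zero σ) λ i j → trans (cong₂ (mult h) (Perm.lift₀-remove σ e (suc i)) (Perm.lift₀-remove σ e (suc j))) (m (suc i) (suc j))

  -- If σ moves the added vertex 0, its image is isolated as well, and exchanging it with 0 is an
  -- automorphism of `ext h`. Followed by this exchange, σ fixes 0 and restricts to the other
  -- vertices.
  ext-cancel : ∀ {g h : Multigraph n} → Iso (ext g) (ext h) → Iso g h
  ext-cancel {n} {g} {h} (via σ m) = Iso-trans (Iso-trans (≗⇒Iso λ _ _ → refl) (restrict {g = ext g} {ext h} (σ ∘ₚ τ)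
    (Maps-trans σ τ {ext g} {ext h} {ext h} m (automorphism (ext h) τ swaps)) (transpose-from zero (σ ⟨$⟩ʳ zero)))) (≗⇒Iso λ _ _ → refl)
    where
    τ = Perm.transpose zero (σ ⟨$⟩ʳ zero)
    isolated-0 : Isolated (ext h) zero
    isolated-0 zero    = refl
    isolated-0 (suc _) = refl
    isolated-0′ : Isolated (ext g) zero
    isolated-0′ zero    = refl
    isolated-0′ (suc _) = refl
    isolated-σ0 : Isolated (ext h) (σ ⟨$⟩ʳ zero)
    isolated-σ0 = Isolated-Maps σ {ext g} {ext h} m isolated-0′
    swaps : ∀ i → Swapped (ext h) τ i
    swaps i with transpose-cases zero (σ ⟨$⟩ʳ zero) i
    ... | inj₁ (e , e′) = isolated (subst (Isolated (ext h)) (sym e) isolated-0) (subst (Isolated (ext h)) (sym e′) isolated-σ0)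
    ... | inj₂ (inj₁ (e , e′)) = isolated (subst (Isolated (ext h)) (sym e) isolated-σ0) (subst (Isolated (ext h)) (sym e′) isolated-0)
    ... | inj₂ (inj₂ (_ , _ , e)) = fixed e

  0F : Fin (2 + n)
  0F = zero

  1F : Fin (2 + n)
  1F = suc zero

  extK-edge : ∀ (g : Multigraph n) → IsolatedEdge (extK g) 0F 1F
  extK-edge g zero          = refl , refl
  extK-edge g (suc zero)    = refl , refl
  extK-edge g (suc (suc k)) = refl , refl

  δ-self : ∀ (i : Fin n) → ⟦ i Fin.≟ i ⟧ ≡ 1
  δ-self i = ⟦⟧-yes (i Fin.≟ i) refl

  δ-1 : ∀ (i j : Fin n) → ⟦ i Fin.≟ j ⟧ ≡ 1 → i ≡ j
  δ-1 i j = ⟦⟧-1 (i Fin.≟ j)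

  restrict₂ : ∀ {g h : Multigraph n} (σ : Permutation′ (2 + n)) → Maps σ (extK g) (extK h) → σ ⟨$⟩ʳ 0F ≡ 0F → σ ⟨$⟩ʳ 1F ≡ 1F → Iso g h
  restrict₂ {g = g} {h} σ m e e′ = Iso-trans (≗⇒Iso λ _ _ → refl) (Iso-trans
    (restrict {g = dropVertex (extK g)} {dropVertex (extK h)} (Iso.σ first) (Iso.maps first) (Fin.suc-injective (trans (Perm.lift₀-remove σ e (suc zero)) e′))) (≗⇒Iso λ _ _ → refl))
    where first = restrict {g = extK g} {extK h} σ m e

  -- The image of the added edge is an isolated edge, so it either has the ends 0 and 1 again or
  -- avoids both. In each case an automorphism of `extK h` takes it back with its ends in the right
  -- order, and the composite restricts.
  extK-cancel : ∀ {g h : Multigraph n} → Iso (extK g) (extK h) → Iso g h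
  extK-cancel {n} {g} {h} (via σ m) = cases (σ ⟨$⟩ʳ 0F) (σ ⟨$⟩ʳ 1F) refl refl
    where
    H = extK h
    edge-σ : IsolatedEdge H (σ ⟨$⟩ʳ 0F) (σ ⟨$⟩ʳ 1F)
    edge-σ = IsolatedEdge-Maps σ {extK g} {H} m (extK-edge g)

    -- Follow σ by a permutation τ which swaps its image of the isolated edge back.
    finish : ∀ τ → τ ⟨$⟩ʳ (σ ⟨$⟩ʳ 0F) ≡ 0F → τ ⟨$⟩ʳ (σ ⟨$⟩ʳ 1F) ≡ 1F → (∀ i → Swapped H τ i) → Iso g h
    finish τ e e′ sw = restrict₂ (σ ∘ₚ τ) (Maps-trans σ τ {extK g} {H} {H} m (automorphism H τ sw)) e e′

    cases : ∀ a b → σ ⟨$⟩ʳ 0F ≡ a → σ ⟨$⟩ʳ 1F ≡ b → Iso g h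
    cases zero b ea eb = finish Perm.id ea (trans eb b≡1) (λ _ → fixed refl)
      where
      b≡1 : b ≡ 1F
      b≡1 = sym (δ-1 1F b (trans (cong (λ z → ⟦ 1F {n} Fin.≟ z ⟧) (sym eb)) (trans (sym (proj₁ (edge-σ 1F))) (cong (λ z → mult H z 1F) ea))))
    cases (suc zero) b ea eb = finish (Perm.transpose 0F 1F) (cong (PC.transpose 0F 1F) ea) (cong (PC.transpose 0F 1F) (trans eb b≡0)) swaps
      where
      b≡0 : b ≡ 0F
      b≡0 = sym (δ-1 0F b (trans (cong (λ z → ⟦ 0F {n} Fin.≟ z ⟧) (sym eb)) (trans (sym (proj₁ (edge-σ 0F))) (cong (λ z → mult H z 0F) ea))))
      swaps : ∀ i → Swapped H (Perm.transpose 0F 1F) i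
      swaps zero          = edge 1F (proj₁ ∘ extK-edge h) (proj₂ ∘ extK-edge h)
      swaps (suc zero)    = edge 0F (proj₂ ∘ extK-edge h) (proj₁ ∘ extK-edge h)
      swaps (suc (suc i)) = fixed refl
    cases (suc (suc x)) zero ea eb = contradiction (trans (sym (cong (λ z → mult H z (σ ⟨$⟩ʳ 0F)) eb)) (trans (proj₂ (edge-σ (σ ⟨$⟩ʳ 0F))) (δ-self (σ ⟨$⟩ʳ 0F))))
      (λ e → contradiction (trans (sym (cong (mult H 0F) ea)) e) λ ())
    cases (suc (suc x)) (suc zero) ea eb = contradiction (trans (sym (cong (λ z → mult H z (σ ⟨$⟩ʳ 0F)) eb)) (trans (proj₂ (edge-σ (σ ⟨$⟩ʳ 0F))) (δ-self (σ ⟨$⟩ʳ 0F))))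
      (λ e → contradiction (trans (sym (cong (mult H 1F) ea)) e) λ ())
    cases (suc (suc x)) (suc (suc y)) ea eb = finish τ (trans (cong (τ ⟨$⟩ʳ_) ea) τa) (trans (cong (τ ⟨$⟩ʳ_) eb) τb) swaps
      where
      a b : Fin (2 + n)
      a = suc (suc x)
      b = suc (suc y)
      a≢b : a ≢ b
      a≢b e = contradiction (perm-injective σ (trans ea (trans e (sym eb)))) λ ()
      τ = Perm.transpose 0F a ∘ₚ Perm.transpose 1F b
      τa : τ ⟨$⟩ʳ a ≡ 0F
      τa = trans (cong (PC.transpose 1F b) (transpose-from 0F a)) (transpose-off 1F b (λ ()) (λ ()))
      τb : τ ⟨$⟩ʳ b ≡ 1F
      τb = trans (cong (PC.transpose 1F b) (transpose-off 0F a {b} (λ ()) (a≢b ∘ sym))) (transpose-from 1F b)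
      τ0 : τ ⟨$⟩ʳ 0F ≡ a
      τ0 = trans (cong (PC.transpose 1F b) (transpose-to 0F a)) (transpose-off 1F b (λ ()) a≢b)
      τ1 : τ ⟨$⟩ʳ 1F ≡ b
      τ1 = trans (cong (PC.transpose 1F b) (transpose-off 0F a {1F} (λ ()) (λ ()))) (transpose-to 1F b)
      row-a : ∀ k → mult H a k ≡ ⟦ k Fin.≟ b ⟧
      row-a k = trans (cong (λ z → mult H z k) (sym ea)) (trans (proj₁ (edge-σ k)) (cong (λ z → ⟦ k Fin.≟ z ⟧) eb))
      row-b : ∀ k → mult H b k ≡ ⟦ k Fin.≟ a ⟧
      row-b k = trans (cong (λ z → mult H z k) (sym eb)) (trans (proj₂ (edge-σ k)) (cong (λ z → ⟦ k Fin.≟ z ⟧) ea))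
      moved : ∀ z p {z′ p′} → τ ⟨$⟩ʳ z ≡ z′ → τ ⟨$⟩ʳ p ≡ p′ → (∀ k → mult H z′ k ≡ ⟦ k Fin.≟ p′ ⟧) → ∀ k → mult H (τ ⟨$⟩ʳ z) k ≡ ⟦ k Fin.≟ (τ ⟨$⟩ʳ p) ⟧
      moved z p e e′ row k = trans (cong (λ z → mult H z k) e) (trans (row k) (cong (λ z → ⟦ k Fin.≟ z ⟧) (sym e′)))
      swaps : ∀ i → Swapped H τ i
      swaps i with i Fin.≟ 0F | i Fin.≟ 1F | i Fin.≟ a | i Fin.≟ b
      ... | yes refl | _        | _        | _        = edge 1F (proj₁ ∘ extK-edge h) (moved 0F 1F τ0 τ1 row-a)
      ... | no _     | yes refl | _        | _        = edge 0F (proj₂ ∘ extK-edge h) (moved 1F 0F τ1 τ0 row-b)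
      ... | no _     | no _     | yes refl | _        = edge b row-a (moved a b τa τb (proj₁ ∘ extK-edge h))
      ... | no _     | no _     | no _     | yes refl = edge a row-b (moved b a τb τa (proj₂ ∘ extK-edge h))
      ... | no ≢0    | no ≢1    | no ≢a    | no ≢b    = fixed (trans (cong (PC.transpose 1F b) (transpose-off 0F a ≢0 ≢a)) (transpose-off 1F b ≢1 ≢b))

  move : Permutation′ n → Multigraph n → Multigraph n
  move σ g = record { mult = λ i j → mult g (σ ⟨$⟩ˡ i) (σ ⟨$⟩ˡ j) ; symmetric = λ i j → symmetric g _ _ ; loopless = λ i → loopless g _ }

  move-Maps : ∀ (σ : Permutation′ n) g → Maps σ g (move σ g)
  move-Maps σ g i j = cong₂ (mult g) (Perm.inverseˡ σ) (Perm.inverseˡ σ)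

  split-ext : ∀ (h : Multigraph (suc n)) → Isolated h zero → h ≗ ext (dropVertex h)
  split-ext h iso zero    zero    = loopless h zero
  split-ext h iso zero    (suc j) = iso (suc j)
  split-ext h iso (suc i) zero    = trans (symmetric h _ _) (iso (suc i))
  split-ext h iso (suc i) (suc j) = refl

  isolated-ext : ∀ (g : Multigraph (suc n)) → HasIsolated g → ∃ λ s → Iso (ext s) g
  isolated-ext g (i , iso) = dropVertex h , Iso-sym (Iso-trans (via τ (move-Maps τ g)) (≗⇒Iso {g = h} {ext (dropVertex h)} (split-ext h
    (subst (Isolated h) (transpose-from zero i) (Isolated-Maps τ {g} {h} (move-Maps τ g) iso)))))
    where
    τ = Perm.transpose zero i
    h = move τ g

  ext-isolated : ∀ (s : Multigraph n) → HasIsolated (ext s)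
  ext-isolated s = zero , λ { zero → refl ; (suc _) → refl }

  split-extK : ∀ (h : Multigraph (2 + n)) → IsolatedEdge h 0F 1F → h ≗ extK (dropVertex (dropVertex h))
  split-extK h e zero          zero          = loopless h zero
  split-extK h e zero          (suc zero)    = proj₁ (e 1F)
  split-extK h e zero          (suc (suc j)) = proj₁ (e (suc (suc j)))
  split-extK h e (suc zero)    zero          = proj₂ (e 0F)
  split-extK h e (suc zero)    (suc zero)    = loopless h 1F
  split-extK h e (suc zero)    (suc (suc j)) = proj₂ (e (suc (suc j)))
  split-extK h e (suc (suc i)) zero          = trans (symmetric h _ _) (proj₁ (e (suc (suc i))))
  split-extK h e (suc (suc i)) (suc zero)    = trans (symmetric h _ _) (proj₂ (e (suc (suc i))))
  split-extK h e (suc (suc i)) (suc (suc j)) = refl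

  isolatedEdge-≢ : ∀ (g : Multigraph n) {i j} → IsolatedEdge g i j → i ≢ j
  isolatedEdge-≢ g {i} e refl = contradiction (trans (sym (loopless g i)) (trans (proj₁ (e i)) (δ-self i))) λ ()

  isolatedEdge-extK : ∀ (g : Multigraph (2 + n)) → HasIsolatedEdge g → ∃ λ s → Iso (extK s) g
  isolatedEdge-extK {n} g (i , j , e) = dropVertex (dropVertex h) , Iso-sym (Iso-trans (via τ (move-Maps τ g)) (≗⇒Iso {g = h} {extK (dropVertex (dropVertex h))} (split-extK h
    (subst₂ (IsolatedEdge h) τi τj (IsolatedEdge-Maps τ {g} {h} (move-Maps τ g) e)))))
    where
    τ₁ : Permutation′ (2 + n)
    τ₁ = Perm.transpose 0F i
    -- The first exchange may already have moved j, so the second one must start from its image.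
    j′ = τ₁ ⟨$⟩ʳ j
    τ = τ₁ ∘ₚ Perm.transpose 1F j′
    h = move τ g
    j′≢0 : 0F ≢ j′
    j′≢0 e′ = isolatedEdge-≢ g e (perm-injective τ₁ (trans (transpose-from 0F i) e′))
    τi : τ ⟨$⟩ʳ i ≡ 0F
    τi = trans (cong (PC.transpose 1F j′) (transpose-from 0F i)) (transpose-off 1F j′ (λ ()) j′≢0)
    τj : τ ⟨$⟩ʳ j ≡ 1F
    τj = transpose-from 1F j′

  extK-isolatedEdge : ∀ (s : Multigraph n) → HasIsolatedEdge (extK s)
  extK-isolatedEdge s = 0F , 1F , extK-edge s

  ext-Iso : ∀ {g h : Multigraph n} → Iso g h → Iso (ext g) (ext h)
  ext-Iso (via σ m) = via (Perm.lift₀ σ) λ { zero zero → refl ; zero (suc j) → refl ; (suc i) zero → refl ; (suc i) (suc j) → m i j }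

  extK-Iso : ∀ {g h : Multigraph n} → Iso g h → Iso (extK g) (extK h)
  extK-Iso (via σ m) = via (Perm.lift₀ (Perm.lift₀ σ)) λ
    { zero zero → refl ; zero (suc zero) → refl ; zero (suc (suc j)) → refl ; (suc zero) zero → refl ; (suc zero) (suc zero) → refl ; (suc zero) (suc (suc j)) → refl
    ; (suc (suc i)) zero → refl ; (suc (suc i)) (suc zero) → refl ; (suc (suc i)) (suc (suc j)) → m i j }

  size-join : ∀ (f : Fin n → ℕ) g → size (joinVertex f g) ≡ 2 * ∑ (allFin n) f + size g
  size-join {n} f g = begin
    size (joinVertex f g) ≡⟨ ∑-allFin n _ ⟩
    ∑ (allFin (suc n)) (mult (joinVertex f g) zero) + ∑ (allFin n) (λ i → ∑ (allFin (suc n)) (mult (joinVertex f g) (suc i)))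
      ≡⟨ cong₂ _+_ (∑-allFin n (mult (joinVertex f g) zero)) (trans (∑-cong (allFin n) (λ i → ∑-allFin n (mult (joinVertex f g) (suc i)))) (∑-+ (allFin n) f (λ i → ∑ (allFin n) (mult g i)))) ⟩
    ∑ (allFin n) f + (∑ (allFin n) f + size g) ≡⟨ arith (∑ (allFin n) f) (size g) ⟩
    2 * ∑ (allFin n) f + size g ∎
    where
    open ≡-Reasoning
    arith : ∀ a b → a + (a + b) ≡ 2 * a + b
    arith = solve-∀

  size-ext : ∀ (g : Multigraph n) → size (ext g) ≡ size g
  size-ext {n} g = trans (size-join (λ _ → 0) g) (cong (λ z → 2 * z + size g) (∑-zero (allFin n)))

  size-extK : ∀ (g : Multigraph n) → size (extK g) ≡ 2 + size g
  size-extK {n} g = trans (size-join atZero (ext g)) (cong₂ (λ a b → 2 * a + b) (trans (∑-allFin n atZero) (cong suc (∑-zero (allFin n)))) (size-ext g))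

  -- The classes met by an injective operation F on classes.

  module Image {m n k : ℕ} (F : Multigraph m → Multigraph n) (F-Iso : ∀ {g h} → Iso g h → Iso (F g) (F h)) (F-cancel : ∀ {g h} → Iso (F g) (F h) → Iso g h)
    (F-size : ∀ g → size (F g) ≡ 2 * k + size g) {P : Multigraph n → Set} (P? : ∀ g → Dec (P g)) (P-Iso : ∀ {g h} → Iso g h → P g → P h)
    (F-P : ∀ s → P (F s)) (P-F : ∀ g → P g → ∃ λ s → Iso (F s) g) where

    edges-F : ∀ e s → HasEdges (k + e) (F s) → HasEdges e s
    edges-F e s eq = +-cancelˡ-≡ (2 * k) (size s) (2 * e) (trans (sym (F-size s)) (trans eq (*-distribˡ-+ 2 k e)))

    -- Counts the pairs of representatives s and r with `F s` isomorphic to r in two ways. Every s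
    -- occurs with one r; an r occurs with one s if P holds, by cancellation, and with none
    -- otherwise.
    image-count : ∀ e → 2 * (k + e) < q → ∑ (reps n (k + e)) (λ r → ⟦ P? r ⟧) ≡ length (reps m e)
    image-count e e<q = begin
      ∑ (reps n (k + e)) (λ r → ⟦ P? r ⟧) ≡⟨ ∑-congᴬ (reps-edges n (k + e)) (λ r s → hit r s (P? r)) ⟩
      ∑ (reps n (k + e)) (λ r → ∑ (reps m e) (λ s → ⟦ iso? (F s) r ⟧)) ≡⟨ ∑-swap (reps n (k + e)) (reps m e) _ ⟩
      ∑ (reps m e) (λ s → ∑ (reps n (k + e)) (λ r → ⟦ iso? (F s) r ⟧))
        ≡⟨ ∑-congᴬ (reps-edges m e) (λ s eq → reps-once (k + e) (F s) e<q (trans (F-size s) (trans (cong (2 * k +_) eq) (sym (*-distribˡ-+ 2 k e))))) ⟩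
      ∑ (reps m e) (λ _ → 1) ≡⟨ ∑-length (reps m e) ⟩
      length (reps m e) ∎
      where
      open ≡-Reasoning
      e<q′ : 2 * e < q
      e<q′ = ≤-<-trans (*-monoʳ-≤ 2 (m≤n+m e k)) e<q
      hit : ∀ r → HasEdges (k + e) r → (p : Dec (P r)) → ⟦ p ⟧ ≡ ∑ (reps m e) (λ s → ⟦ iso? (F s) r ⟧)
      hit r eq (no ¬p) = sym (trans (∑-cong (reps m e) (λ s → ⟦⟧-no (iso? (F s) r) (λ i → ¬p (P-Iso i (F-P s))))) (∑-zero (reps m e)))
      hit r eq (yes p) with s₀ , i ← P-F r p = sym (trans
        (∑-cong (reps m e) (λ s → ⟦⟧-cong (iso? (F s) r) (iso? s₀ s) (λ i′ → F-cancel (Iso-trans i (Iso-sym i′))) (λ i′ → Iso-trans (F-Iso (Iso-sym i′)) i)))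
        (reps-once e s₀ e<q′ (edges-F e s₀ (trans (size-Maps (Iso.σ i) {F s₀} {r} (Iso.maps i)) eq))))

-- Graphs without isolated vertices and isolated edges.

module PrimeGraphs (q-1 : ℕ) where
  open Sums
  open Permutations
  open CycleTypes
  open OrbitSizes (suc q-1)
  open PairRotations q-1
  open FixedGraphs q-1
  open Representatives q-1
  open Extensions q-1
  open import Defs using (Multigraph)
  open import Data.Fin.Base as Fin using (Fin; zero; suc)
  import Data.Fin.Properties as Fin
  open import Data.List.Base using (List; length; filter)
  open import Data.Nat.Base hiding (ℕ; suc)
  open import Data.Nat.Properties
  open import Data.Product.Base using (_×_; _,_; proj₁; proj₂)
  open import Function.Base using (_∘_)
  open import Relation.Binary.PropositionalEquality hiding (_≗_)
  open import Relation.Nullary using (Dec; yes; no; ¬_; contradiction)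
  open import Relation.Nullary.Decidable using (_×-dec_; ¬?)

  private variable
    n v : ℕ

  Prime : Multigraph n → Set
  Prime g = ¬ HasIsolated g × ¬ HasIsolatedEdge g

  prime? : ∀ (g : Multigraph n) → Dec (Prime g)
  prime? g = ¬? (hasIsolated? g) ×-dec ¬? (hasIsolatedEdge? g)

  primes : ∀ n → ℕ → List (Multigraph n)
  primes n e = filter prime? (reps n e)

  inclusion-exclusion : ∀ (g : Multigraph n) →
    ⟦ prime? g ⟧ + (⟦ hasIsolated? g ⟧ + ⟦ hasIsolatedEdge? g ⟧) ≡ 1 + ⟦ hasIsolated? g ×-dec hasIsolatedEdge? g ⟧
  inclusion-exclusion g with hasIsolated? g | hasIsolatedEdge? g
  ... | yes _ | yes _ = refl
  ... | yes _ | no _  = refl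
  ... | no _  | yes _ = refl
  ... | no _  | no _  = refl

  primes-total : ∀ n e → length (primes n e) + (∑ (reps n e) (λ g → ⟦ hasIsolated? g ⟧) + ∑ (reps n e) (λ g → ⟦ hasIsolatedEdge? g ⟧)) ≡
    length (reps n e) + ∑ (reps n e) (λ g → ⟦ hasIsolated? g ×-dec hasIsolatedEdge? g ⟧)
  primes-total n e = begin
    length (primes n e) + (∑ R i + ∑ R k) ≡⟨ cong₂ _+_ (trans (sym (∑-length (primes n e))) (trans (∑-filter prime? R (λ _ → 1)) (∑-cong R (λ g → *-identityʳ _)))) (sym (∑-+ R i k)) ⟩
    ∑ R (λ g → ⟦ prime? g ⟧) + ∑ R (λ g → i g + k g) ≡⟨ ∑-+ R (λ g → ⟦ prime? g ⟧) (λ g → i g + k g) ⟨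
    ∑ R (λ g → ⟦ prime? g ⟧ + (i g + k g)) ≡⟨ ∑-cong R inclusion-exclusion ⟩
    ∑ R (λ g → 1 + ⟦ hasIsolated? g ×-dec hasIsolatedEdge? g ⟧) ≡⟨ ∑-+ R (λ _ → 1) _ ⟩
    ∑ R (λ _ → 1) + ∑ R (λ g → ⟦ hasIsolated? g ×-dec hasIsolatedEdge? g ⟧) ≡⟨ cong (_+ ∑ R (λ g → ⟦ hasIsolated? g ×-dec hasIsolatedEdge? g ⟧)) (∑-length R) ⟩
    length R + ∑ R (λ g → ⟦ hasIsolated? g ×-dec hasIsolatedEdge? g ⟧) ∎
    where
    open ≡-Reasoning
    R = reps n e
    i k : Multigraph n → ℕ
    i g = ⟦ hasIsolated? g ⟧
    k g = ⟦ hasIsolatedEdge? g ⟧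

  isolated-count : ∀ n e → 2 * e < q → ∑ (reps (suc n) e) (λ g → ⟦ hasIsolated? g ⟧) ≡ length (reps n e)
  isolated-count n e e<q = Image.image-count {k = 0} ext ext-Iso ext-cancel size-ext hasIsolated? HasIsolated-Iso ext-isolated isolated-ext e e<q

  isolatedEdge-count : ∀ n e → 2 * suc e < q → ∑ (reps (2 + n) (suc e)) (λ g → ⟦ hasIsolatedEdge? g ⟧) ≡ length (reps n e)
  isolatedEdge-count n e e<q = Image.image-count {k = 1} extK extK-Iso extK-cancel size-extK hasIsolatedEdge? HasIsolatedEdge-Iso extK-isolatedEdge isolatedEdge-extK e e<q

  ext-HasIsolatedEdge : ∀ (s : Multigraph n) → HasIsolatedEdge s → HasIsolatedEdge (ext s)
  ext-HasIsolatedEdge s (i , j , e) = suc i , suc j , λ { zero → refl , refl ; (suc k) → e k }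

  HasIsolatedEdge-ext : ∀ (s : Multigraph n) → HasIsolatedEdge (ext s) → HasIsolatedEdge s
  HasIsolatedEdge-ext s (zero , zero , e)    = contradiction (proj₁ (e zero)) λ ()
  HasIsolatedEdge-ext s (zero , suc j , e)   = contradiction (trans (proj₁ (e (suc j))) (δ-self (suc j))) λ ()
  HasIsolatedEdge-ext s (suc i , zero , e)   = contradiction (trans (proj₂ (e (suc i))) (δ-self (suc i))) λ ()
  HasIsolatedEdge-ext s (suc i , suc j , e)  = i , j , λ k → e (suc k)

  both-count : ∀ n e → 2 * suc e < q → ∑ (reps (3 + n) (suc e)) (λ g → ⟦ hasIsolated? g ×-dec hasIsolatedEdge? g ⟧) ≡ length (reps n e)
  both-count n e e<q = Image.image-count {k = 1} (ext ∘ extK) (ext-Iso ∘ extK-Iso) (extK-cancel ∘ ext-cancel) (λ g → trans (size-ext (extK g)) (size-extK g))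
    (λ g → hasIsolated? g ×-dec hasIsolatedEdge? g)
    (λ i (a , b) → HasIsolated-Iso i a , HasIsolatedEdge-Iso i b) (λ s → ext-isolated (extK s) , ext-HasIsolatedEdge (extK s) (extK-isolatedEdge s))
    (λ g (a , b) → let s , i = isolated-ext g a
                       s′ , i′ = isolatedEdge-extK s (HasIsolatedEdge-ext s (HasIsolatedEdge-Iso (Iso-sym i) b))
                   in s′ , Iso-trans (ext-Iso i′) i) e e<q

  ∸-solve : ∀ p i k b c → p + (i + k) ≡ b + c → p ≡ (b + c) ∸ (i + k)
  ∸-solve p i k b c eq = trans (sym (m+n∸n≡m p (i + k))) (cong (_∸ (i + k)) eq)

  -- Inclusion and exclusion: removing an isolated vertex, an isolated edge, or both leaves an
  -- arbitrary graph on 2 + n, 1 + n or n vertices.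
  primes-count : ∀ n e → 2 * suc e < q → length (primes (3 + n) (suc e)) ≡
    (length (reps (3 + n) (suc e)) + length (reps n e)) ∸ (length (reps (2 + n) (suc e)) + length (reps (1 + n) e))
  primes-count n e e<q = trans (∸-solve _ (∑ (reps (3 + n) (suc e)) (λ g → ⟦ hasIsolated? g ⟧)) (∑ (reps (3 + n) (suc e)) (λ g → ⟦ hasIsolatedEdge? g ⟧)) (length (reps (3 + n) (suc e))) _ (primes-total (3 + n) (suc e))) (cong₂ _∸_ (cong (length (reps (3 + n) (suc e)) +_) (both-count n e e<q))
    (cong₂ _+_ (isolated-count (2 + n) (suc e) e<q) (isolatedEdge-count (1 + n) e e<q)))

  -- On two vertices an isolated edge takes up both of them, so there is no graph to be counted back
  -- in.
  primes-count₂ : ∀ e → 2 * suc e < q → length (primes 2 (suc e)) ≡ length (reps 2 (suc e)) ∸ (length (reps 1 (suc e)) + length (reps 0 e))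
  primes-count₂ e e<q = trans (∸-solve _ (∑ (reps 2 (suc e)) (λ g → ⟦ hasIsolated? g ⟧)) (∑ (reps 2 (suc e)) (λ g → ⟦ hasIsolatedEdge? g ⟧)) (length (reps 2 (suc e))) _ (primes-total 2 (suc e))) (cong₂ _∸_
    (trans (cong (length (reps 2 (suc e)) +_) (trans (∑-cong (reps 2 (suc e)) (λ g → ⟦⟧-no (hasIsolated? g ×-dec hasIsolatedEdge? g) (never g))) (∑-zero (reps 2 (suc e))))) (+-identityʳ _))
    (cong₂ _+_ (isolated-count 1 (suc e) e<q) (isolatedEdge-count 0 e e<q)))
    where
    never : ∀ (g : Multigraph 2) → ¬ (HasIsolated g × HasIsolatedEdge g)
    never g ((k , iso) , (i , j , e)) with Fin._≟_ k i | Fin._≟_ k j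
    ... | yes refl | _ = contradiction (trans (sym (iso j)) (trans (proj₁ (e j)) (δ-self j))) λ ()
    ... | no _ | yes refl = contradiction (trans (sym (iso i)) (trans (proj₂ (e i)) (δ-self i))) λ ()
    ... | no k≢i | no k≢j = contradiction (trans (third k i j k≢i k≢j) refl) (isolatedEdge-≢ g e)
      where
      third : ∀ (k i j : Fin 2) → k ≢ i → k ≢ j → i ≡ j
      third zero zero _ ne _ = contradiction refl ne
      third zero (suc zero) zero _ ne = contradiction refl ne
      third zero (suc zero) (suc zero) _ _ = refl
      third (suc zero) (suc zero) _ ne _ = contradiction refl ne
      third (suc zero) zero (suc zero) _ ne = contradiction refl ne
      third (suc zero) zero zero _ _ = refl

-- The ring structure of polynomials up to equality of coefficients, and linear spans.

module Convolution {c ℓ} (R : CommutativeRing c ℓ) where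
  open import Defs
  open Polynomials R hiding (GeneratesInvariants; OrbitSums)
  open import Data.Bool.Base using (true; false; if_then_else_)
  open import Data.Fin.Base using (Fin)
  open import Data.Fin.Permutation as Perm using (Permutation′; _⟨$⟩ʳ_; _⟨$⟩ˡ_)
  import Data.Fin.Properties as Fin
  open import Data.List.Base using (List; []; _∷_; _++_; map)
  import Data.List.Properties as List
  open import Data.Nat.Base as ℕ using (ℕ; _∸_) renaming (_+_ to _+ℕ_; _≤_ to _≤ℕ_)
  import Data.Nat.Properties as ℕ
  open import Data.Product.Base using (_,_)
  open import Function.Base using (_∘_)
  open import Level using (Level; _⊔_)
  open import Relation.Binary.Bundles using (Setoid)
  open import Relation.Binary.PropositionalEquality as ≡ using (_≡_; refl; cong; cong₂)
  open import Relation.Nullary using (Dec; yes; no; does; ¬_; contradiction)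
  open import Relation.Unary using (Pred)

  private
    module R = CommutativeRing R
    variable
      n : ℕ
      p : Level

  open import Relation.Binary.Reasoning.Setoid R.setoid
  open import Algebra.Properties.CommutativeSemigroup R.+-commutativeSemigroup using (interchange)

  -- The linear extension of φ to formal sums. `coeff` is the case of an indicator, which makes
  -- products and exchanges of sums accessible.
  pair : Poly n → (Multigraph n → R.Carrier) → R.Carrier
  pair []            φ = R.0#
  pair ((a , h) ∷ f) φ = a R.* φ h R.+ pair f φ

  pair-cong : ∀ (f : Poly n) {φ ψ} → (∀ h → φ h R.≈ ψ h) → pair f φ R.≈ pair f ψ
  pair-cong []            eq = R.refl
  pair-cong ((a , h) ∷ f) eq = R.+-cong (R.*-congˡ (eq h)) (pair-cong f eq)

  pair-++ : ∀ (f g : Poly n) φ → pair (f ++ g) φ R.≈ pair f φ R.+ pair g φ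
  pair-++ []            g φ = R.sym (R.+-identityˡ _)
  pair-++ ((a , h) ∷ f) g φ = R.trans (R.+-congˡ (pair-++ f g φ)) (R.sym (R.+-assoc _ _ _))

  pair-0 : ∀ (f : Poly n) → pair f (λ _ → R.0#) R.≈ R.0#
  pair-0 []            = R.refl
  pair-0 ((a , h) ∷ f) = R.trans (R.+-cong (R.zeroʳ a) (pair-0 f)) (R.+-identityˡ _)

  pair-+ : ∀ (f : Poly n) φ ψ → pair f (λ h → φ h R.+ ψ h) R.≈ pair f φ R.+ pair f ψ
  pair-+ []            φ ψ = R.sym (R.+-identityˡ _)
  pair-+ ((a , h) ∷ f) φ ψ = R.trans (R.+-cong (R.distribˡ a _ _) (pair-+ f φ ψ)) (interchange _ _ _ _)

  pair-* : ∀ (f : Poly n) b φ → pair f (λ h → b R.* φ h) R.≈ b R.* pair f φ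
  pair-* []            b φ = R.sym (R.zeroʳ b)
  pair-* ((a , h) ∷ f) b φ = R.trans (R.+-cong (x∙yz≈y∙xz a b (φ h)) (pair-* f b φ)) (R.sym (R.distribˡ b _ _))
    where open import Algebra.Properties.CommutativeSemigroup R.*-commutativeSemigroup using (x∙yz≈y∙xz)

  pair-swap : ∀ (f g : Poly n) (φ : Multigraph n → Multigraph n → R.Carrier) →
    pair f (λ h → pair g (φ h)) R.≈ pair g (λ k → pair f (λ h → φ h k))
  pair-swap []            g φ = R.sym (pair-0 g)
  pair-swap ((a , h) ∷ f) g φ = begin
    a R.* pair g (φ h) R.+ pair f (λ h → pair g (φ h)) ≈⟨ R.+-cong (R.sym (pair-* g a (φ h))) (pair-swap f g φ) ⟩
    pair g (λ k → a R.* φ h k) R.+ pair g (λ k → pair f (λ h → φ h k)) ≈⟨ pair-+ g _ _ ⟨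
    pair g (λ k → a R.* φ h k R.+ pair f (λ h → φ h k)) ∎

  when : ∀ {p} {P : Set p} → Dec P → R.Carrier → R.Carrier
  when P? x = if does P? then x else R.0#

  when-yes : ∀ {p} {P : Set p} (P? : Dec P) {x} → P → when P? x R.≈ x
  when-yes (yes _) _ = R.refl
  when-yes (no ¬p) p = contradiction p ¬p

  when-no : ∀ {p} {P : Set p} (P? : Dec P) {x} → ¬ P → when P? x R.≈ R.0#
  when-no (yes p) ¬p = contradiction p ¬p
  when-no (no _)  _  = R.refl

  when-cong : ∀ {p q} {P : Set p} {Q : Set q} (P? : Dec P) (Q? : Dec Q) {x y} → (P → Q) → (Q → P) → (P → x R.≈ y) → when P? x R.≈ when Q? y
  when-cong (yes p) Q? to from e = R.trans (e p) (R.sym (when-yes Q? (to p)))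
  when-cong (no ¬p) Q? to from e = R.sym (when-no Q? (¬p ∘ from))

  δ : Multigraph n → Multigraph n → R.Carrier
  δ g h = when (h ≗? g) R.1#

  δ-no : ∀ {g h : Multigraph n} → ¬ h ≗ g → δ g h R.≈ R.0#
  δ-no {g = g} {h} = when-no (h ≗? g)

  δ-cong : ∀ {m} {g h : Multigraph n} {g′ h′ : Multigraph m} → (h ≗ g → h′ ≗ g′) → (h′ ≗ g′ → h ≗ g) → δ g h R.≈ δ g′ h′
  δ-cong {g = g} {h} {g′} {h′} to from = when-cong (h ≗? g) (h′ ≗? g′) to from (λ _ → R.refl)

  coeff-pair : ∀ (f : Poly n) g → coeff f g R.≈ pair f (δ g)
  coeff-pair []            g = R.refl
  coeff-pair ((a , h) ∷ f) g = term (does (h ≗? g)) (coeff-pair f g)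
    where
    term : ∀ b {x y} → x R.≈ y → (if b then a R.+ x else x) R.≈ a R.* (if b then R.1# else R.0#) R.+ y
    term true  e = R.+-cong (R.sym (R.*-identityʳ a)) e
    term false e = R.trans e (R.trans (R.sym (R.+-identityˡ _)) (R.+-congʳ (R.sym (R.zeroʳ a))))

  pair-map : ∀ {m} (b : R.Carrier) (s : Multigraph m → Multigraph n) (f : Poly m) φ → pair (map (λ (a , h) → b R.* a , s h) f) φ R.≈ b R.* pair f (φ ∘ s)
  pair-map b s []            φ = R.sym (R.zeroʳ b)
  pair-map b s ((a , h) ∷ f) φ = R.trans (R.+-cong (R.*-assoc b a _) (pair-map b s f φ)) (R.sym (R.distribˡ b _ _))

  pair-⊠ : ∀ (f g : Poly n) φ → pair (f ⊠ g) φ R.≈ pair f (λ h → pair g (λ k → φ (h ⊕ k)))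
  pair-⊠ []            g φ = R.refl
  pair-⊠ ((a , h) ∷ f) g φ = R.trans (pair-++ (map _ g) (f ⊠ g) φ) (R.+-cong (pair-map a (h ⊕_) g φ) (pair-⊠ f g φ))

  -- Truncated subtraction, used only when h is contained in g.

  _⊖_ : Multigraph n → Multigraph n → Multigraph n
  g ⊖ h = record { mult = λ i j → mult g i j ∸ mult h i j ; symmetric = λ i j → cong₂ _∸_ (symmetric g i j) (symmetric h i j)
    ; loopless = λ i → ≡.trans (cong (_∸ mult h i i) (loopless g i)) (ℕ.0∸n≡0 (mult h i i)) }

  _≼?_ : ∀ (h g : Multigraph n) → Dec (∀ i j → mult h i j ≤ℕ mult g i j)
  h ≼? g = Fin.all? λ i → Fin.all? λ j → mult h i j ℕ.≤? mult g i j

  cofactor : Poly n → Multigraph n → Multigraph n → R.Carrier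
  cofactor f g h = when (h ≼? g) (coeff f (g ⊖ h))

  pair-shift : ∀ (f : Poly n) g h → pair f (λ k → δ g (h ⊕ k)) R.≈ cofactor f g h
  pair-shift f g h = cases (h ≼? g)
    where
    cases : ∀ le? → pair f (λ k → δ g (h ⊕ k)) R.≈ when le? (coeff f (g ⊖ h))
    cases (yes le) = R.trans (pair-cong f (λ k → δ-cong {g = g} {h ⊕ k} {g ⊖ h} {k}
      (λ e i j → ≡.trans (≡.sym (ℕ.m+n∸m≡n (mult h i j) (mult k i j))) (cong (_∸ mult h i j) (e i j)))
      (λ e i j → ≡.trans (cong (mult h i j +ℕ_) (e i j)) (ℕ.m+[n∸m]≡n (le i j))))) (R.sym (coeff-pair f (g ⊖ h)))
    cases (no ¬le) = R.trans (pair-cong f (λ k → δ-no {g = g} {h ⊕ k} (λ e → ¬le (λ i j → ℕ.≤-trans (ℕ.m≤m+n _ _) (ℕ.≤-reflexive (e i j)))))) (pair-0 f)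

  -- The second factor enters through its coefficients only. This is why the product respects
  -- equality of coefficients, although it is defined on lists of terms.
  coeff-⊠ : ∀ (f f′ : Poly n) g → coeff (f ⊠ f′) g R.≈ pair f (cofactor f′ g)
  coeff-⊠ f f′ g = R.trans (coeff-pair (f ⊠ f′) g) (R.trans (pair-⊠ f f′ (δ g)) (pair-cong f (λ h → pair-shift f′ g h)))

  cofactor-cong : ∀ {f f′ : Poly n} → f ≈ f′ → ∀ g h → cofactor f g h R.≈ cofactor f′ g h
  cofactor-cong eq g h = when-cong (h ≼? g) (h ≼? g) (λ le → le) (λ le → le) (λ _ → eq (g ⊖ h))

  coeff-cong : ∀ (f : Poly n) {g g′} → g ≗ g′ → coeff f g R.≈ coeff f g′
  coeff-cong f {g} {g′} e = R.trans (coeff-pair f g) (R.trans (pair-cong f (λ h → δ-cong {g = g} {h} {g′} {h}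
    (λ e′ i j → ≡.trans (e′ i j) (e i j)) (λ e′ i j → ≡.trans (e′ i j) (≡.sym (e i j))))) (R.sym (coeff-pair f g′)))

  ⊠-comm : ∀ (f g : Poly n) → f ⊠ g ≈ g ⊠ f
  ⊠-comm f g m = begin
    coeff (f ⊠ g) m ≈⟨ coeff-pair (f ⊠ g) m ⟩
    pair (f ⊠ g) (δ m) ≈⟨ pair-⊠ f g (δ m) ⟩
    pair f (λ h → pair g (λ k → δ m (h ⊕ k))) ≈⟨ pair-swap f g _ ⟩
    pair g (λ k → pair f (λ h → δ m (h ⊕ k))) ≈⟨ pair-cong g (λ k → pair-cong f (λ h → δ-cong {g = m} {h ⊕ k} {m} {k ⊕ h}
        (λ e i j → ≡.trans (ℕ.+-comm (mult k i j) _) (e i j)) (λ e i j → ≡.trans (ℕ.+-comm (mult h i j) _) (e i j)))) ⟩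
    pair g (λ k → pair f (λ h → δ m (k ⊕ h))) ≈⟨ pair-⊠ g f (δ m) ⟨
    pair (g ⊠ f) (δ m) ≈⟨ coeff-pair (g ⊠ f) m ⟨
    coeff (g ⊠ f) m ∎

  -- Equality of polynomials, as a record in order to make the polynomials inferable.

  infix 4 _≋_
  record _≋_ (f g : Poly n) : Set ℓ where
    constructor at
    field same : f ≈ g
  open _≋_ public

  polySetoid : ℕ → Setoid c ℓ
  polySetoid n = record { Carrier = Poly n ; _≈_ = _≋_ ; isEquivalence = record
    { refl = at λ m → R.refl ; sym = λ e → at λ m → R.sym (same e m) ; trans = λ e e′ → at λ m → R.trans (same e m) (same e′ m) } }

  module P {n} = Setoid (polySetoid n)

  ⊠-congˡ : ∀ (f : Poly n) {g g′} → g ≋ g′ → f ⊠ g ≋ f ⊠ g′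
  ⊠-congˡ f {g} {g′} e = at λ m → R.trans (coeff-⊠ f g m) (R.trans (pair-cong f (λ h → cofactor-cong {f = g} {g′} (same e) m h)) (R.sym (coeff-⊠ f g′ m)))

  ⊠-congʳ : ∀ (f : Poly n) {g g′} → g ≋ g′ → g ⊠ f ≋ g′ ⊠ f
  ⊠-congʳ f {g} {g′} e = P.trans (at (⊠-comm g f)) (P.trans (⊠-congˡ f e) (at (⊠-comm f g′)))

  ⊠-cong : ∀ {f f′ g g′ : Poly n} → f ≋ f′ → g ≋ g′ → f ⊠ g ≋ f′ ⊠ g′
  ⊠-cong {f′ = f′} {g} e e′ = P.trans (⊠-congʳ g e) (⊠-congˡ f′ e′)

  ⊠-assoc : ∀ (f g h : Poly n) → (f ⊠ g) ⊠ h ≈ f ⊠ (g ⊠ h)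
  ⊠-assoc f g h m = begin
    coeff ((f ⊠ g) ⊠ h) m ≈⟨ coeff-pair ((f ⊠ g) ⊠ h) m ⟩
    pair ((f ⊠ g) ⊠ h) (δ m) ≈⟨ pair-⊠ (f ⊠ g) h (δ m) ⟩
    pair (f ⊠ g) (λ k → pair h (λ l → δ m (k ⊕ l))) ≈⟨ pair-⊠ f g _ ⟩
    pair f (λ j → pair g (λ k → pair h (λ l → δ m ((j ⊕ k) ⊕ l))))
      ≈⟨ pair-cong f (λ j → pair-cong g (λ k → pair-cong h (λ l → δ-cong {g = m} {(j ⊕ k) ⊕ l} {m} {j ⊕ (k ⊕ l)}
          (λ e a b → ≡.trans (≡.sym (ℕ.+-assoc (mult j a b) _ _)) (e a b)) (λ e a b → ≡.trans (ℕ.+-assoc (mult j a b) _ _) (e a b))))) ⟩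
    pair f (λ j → pair g (λ k → pair h (λ l → δ m (j ⊕ (k ⊕ l))))) ≈⟨ pair-cong f (λ j → R.sym (pair-⊠ g h _)) ⟩
    pair f (λ j → pair (g ⊠ h) (λ k → δ m (j ⊕ k))) ≈⟨ pair-⊠ f (g ⊠ h) (δ m) ⟨
    pair (f ⊠ (g ⊠ h)) (δ m) ≈⟨ coeff-pair (f ⊠ (g ⊠ h)) m ⟨
    coeff (f ⊠ (g ⊠ h)) m ∎

  coeff-++ : ∀ (f g : Poly n) m → coeff (f ++ g) m R.≈ coeff f m R.+ coeff g m
  coeff-++ f g m = R.trans (coeff-pair (f ++ g) m) (R.trans (pair-++ f g (δ m)) (R.+-cong (R.sym (coeff-pair f m)) (R.sym (coeff-pair g m))))

  scale : R.Carrier → Poly n → Poly n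
  scale b f = map (λ (a , h) → b R.* a , h) f

  coeff-scale : ∀ b (f : Poly n) m → coeff (scale b f) m R.≈ b R.* coeff f m
  coeff-scale b f m = R.trans (coeff-pair (scale b f) m) (R.trans (pair-map b (λ h → h) f (δ m)) (R.*-congˡ (R.sym (coeff-pair f m))))

  one : Poly n
  one = const R.1#

  ⊠-identityˡ : ∀ (f : Poly n) → one ⊠ f ≈ f
  ⊠-identityˡ f m = begin
    coeff (one ⊠ f) m ≈⟨ coeff-pair (one ⊠ f) m ⟩
    pair (one ⊠ f) (δ m) ≈⟨ pair-⊠ one f (δ m) ⟩
    R.1# R.* pair f (λ k → δ m (∅ ⊕ k)) R.+ R.0# ≈⟨ R.trans (R.+-identityʳ _) (R.*-identityˡ _) ⟩
    pair f (λ k → δ m (∅ ⊕ k)) ≈⟨ pair-cong f (λ k → δ-cong {g = m} {∅ ⊕ k} {m} {k} (λ e → e) (λ e → e)) ⟩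
    pair f (δ m) ≈⟨ coeff-pair f m ⟨
    coeff f m ∎

  ++-⊠ : ∀ (f g h : Poly n) → (f ++ g) ⊠ h ≡ f ⊠ h ++ g ⊠ h
  ++-⊠ []      g h = refl
  ++-⊠ (x ∷ f) g h = ≡.trans (cong (_ ++_) (++-⊠ f g h)) (≡.sym (List.++-assoc (map _ h) (f ⊠ h) (g ⊠ h)))

  scale-⊠ : ∀ b (f g : Poly n) → scale b f ⊠ g ≈ scale b (f ⊠ g)
  scale-⊠ b f g m = begin
    coeff (scale b f ⊠ g) m ≈⟨ coeff-⊠ (scale b f) g m ⟩
    pair (scale b f) (cofactor g m) ≈⟨ pair-map b (λ h → h) f (cofactor g m) ⟩
    b R.* pair f (cofactor g m) ≈⟨ R.*-congˡ (coeff-⊠ f g m) ⟨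
    b R.* coeff (f ⊠ g) m ≈⟨ coeff-scale b (f ⊠ g) m ⟨
    coeff (scale b (f ⊠ g)) m ∎

  ⊠-comm≋ : ∀ (f g : Poly n) → f ⊠ g ≋ g ⊠ f
  ⊠-comm≋ f g = at (⊠-comm f g)

  ⊠-assoc≋ : ∀ (f g h : Poly n) → (f ⊠ g) ⊠ h ≋ f ⊠ (g ⊠ h)
  ⊠-assoc≋ f g h = at (⊠-assoc f g h)

  ⊠-identityˡ≋ : ∀ (f : Poly n) → one ⊠ f ≋ f
  ⊠-identityˡ≋ f = at (⊠-identityˡ f)

  scale-⊠≋ : ∀ b (f g : Poly n) → scale b f ⊠ g ≋ scale b (f ⊠ g)
  scale-⊠≋ b f g = at (scale-⊠ b f g)

  data Span {n} (G : Pred (Poly n) p) : Pred (Poly n) (c ⊔ ℓ ⊔ p) where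
    inc  : ∀ {f} → G f → Span G f
    nil  : Span G []
    plus : ∀ {f g} → Span G f → Span G g → Span G (f ++ g)
    scal : ∀ b {f} → Span G f → Span G (scale b f)
    resp : ∀ {f g} → f ≋ g → Span G f → Span G g

  ++-cong : ∀ {f f′ g g′ : Poly n} → f ≋ f′ → g ≋ g′ → f ++ g ≋ f′ ++ g′
  ++-cong {f = f} {f′} {g} {g′} e e′ = at λ m → R.trans (coeff-++ f g m) (R.trans (R.+-cong (same e m) (same e′ m)) (R.sym (coeff-++ f′ g′ m)))

  Span-bind : ∀ {p′} {G : Pred (Poly n) p} {H : Pred (Poly n) p′} → (∀ {f} → G f → Span H f) → ∀ {f} → Span G f → Span H f
  Span-bind k (inc x)    = k x
  Span-bind k nil        = nil
  Span-bind k (plus x y) = plus (Span-bind k x) (Span-bind k y)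
  Span-bind k (scal b x) = scal b (Span-bind k x)
  Span-bind k (resp e x) = resp e (Span-bind k x)

  Span-⊠ʳ : ∀ {p′} {G : Pred (Poly n) p} {H : Pred (Poly n) p′} g → (∀ {f} → G f → Span H (f ⊠ g)) → ∀ {f} → Span G f → Span H (f ⊠ g)
  Span-⊠ʳ g k (inc x)            = k x
  Span-⊠ʳ g k nil                = nil
  Span-⊠ʳ g k (plus {f} {f′} x y) = ≡.subst (Span _) (≡.sym (++-⊠ f f′ g)) (plus (Span-⊠ʳ g k x) (Span-⊠ʳ g k y))
  Span-⊠ʳ g k (scal b {f} x)     = resp (P.sym (at (scale-⊠ b f g))) (scal b (Span-⊠ʳ g k x))
  Span-⊠ʳ g k (resp e x)         = resp (⊠-congʳ g e) (Span-⊠ʳ g k x)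

  Span-⊠ˡ : ∀ {p′} {G : Pred (Poly n) p} {H : Pred (Poly n) p′} g → (∀ {f} → G f → Span H (g ⊠ f)) → ∀ {f} → Span G f → Span H (g ⊠ f)
  Span-⊠ˡ g k {f} x = resp (at (⊠-comm f g)) (Span-⊠ʳ g (λ {f} y → resp (at (⊠-comm g f)) (k y)) x)

  coeff-act : ∀ (σ : Permutation′ n) f g → coeff (act σ f) g R.≈ coeff f (Perm.flip σ • g)
  coeff-act σ f g = begin
    coeff (act σ f) g ≈⟨ coeff-pair (act σ f) g ⟩
    pair (act σ f) (δ g) ≈⟨ pair-act f ⟩
    pair f (λ h → δ g (σ • h)) ≈⟨ pair-cong f (λ h → δ-cong {g = g} {σ • h} {Perm.flip σ • g} {h}
       (λ e i j → ≡.trans (≡.sym (cong₂ (mult h) (Perm.inverseˡ σ) (Perm.inverseˡ σ))) (e (σ ⟨$⟩ʳ i) (σ ⟨$⟩ʳ j)))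
       (λ e i j → ≡.trans (e (σ ⟨$⟩ˡ i) (σ ⟨$⟩ˡ j)) (cong₂ (mult g) (Perm.inverseʳ σ) (Perm.inverseʳ σ)))) ⟩
    pair f (δ (Perm.flip σ • g)) ≈⟨ coeff-pair f (Perm.flip σ • g) ⟨
    coeff f (Perm.flip σ • g) ∎
    where
    pair-act : ∀ f → pair (act σ f) (δ g) R.≈ pair f (λ h → δ g (σ • h))
    pair-act []            = R.refl
    pair-act ((a , h) ∷ f) = R.+-congˡ (pair-act f)

  act-cong : ∀ (σ : Permutation′ n) {f g} → f ≋ g → act σ f ≋ act σ g
  act-cong σ {f} {g} e = at λ m → R.trans (coeff-act σ f m) (R.trans (same e (Perm.flip σ • m)) (R.sym (coeff-act σ g m)))

  ⊠-invariant : ∀ (f g : Poly n) → IsInvariant f → IsInvariant g → IsInvariant (f ⊠ g)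
  ⊠-invariant f g inv inv′ σ = ≡.subst (_≈ f ⊠ g) (≡.sym (act-⊠ σ f g)) (same (⊠-cong {f = act σ f} {f} {act σ g} {g} (at (inv σ)) (at (inv′ σ))))

-- Orbit sums and the expansion of invariants in them.

module OrbitPolynomials (q-1 : ℕ) {c ℓ} (R : CommutativeRing c ℓ) where
  open Sums
  open Permutations
  open CycleTypes
  open OrbitSizes (suc q-1)
  open PairRotations q-1
  open FixedGraphs q-1
  open Representatives q-1
  open Extensions q-1
  open import Defs hiding (permutations-complete)
  import Defs
  open Polynomials R hiding (GeneratesInvariants; OrbitSums; _≈_)
  open Convolution R
  open import Algebra.Bundles using (Semiring)
  import Algebra.Definitions.RawSemiring as RawSemiringDefinitions
  open import Data.Fin.Base as Fin using (suc)
  open import Data.Fin.Permutation as Perm using (Permutation′; _⟨$⟩ˡ_)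
  import Data.Fin.Properties as Fin
  open import Data.List.Base using (List; []; _∷_; _++_; map; concatMap; deduplicate)
  open import Data.List.Relation.Unary.All using (All; []; _∷_)
  import Data.List.Relation.Unary.All as All
  import Data.List.Relation.Unary.All.Properties as All
  open import Data.List.Relation.Unary.Any using (Any; here; there; any?)
  import Data.List.Relation.Unary.Any as Any
  import Data.List.Relation.Unary.Any.Properties as Any
  open import Data.Nat.Base hiding (ℕ; suc; _⊔_)
  open import Data.Nat.Properties
  open import Data.Product.Base using (_×_; _,_; proj₂; ∃)
  open import Function.Base using (_∘_; id)
  open import Level using (Level; _⊔_)
  open import Relation.Binary.PropositionalEquality hiding (_≗_; resp)
  open import Relation.Nullary using (Dec; yes; no; ¬_; contradiction)
  open import Relation.Nullary.Decidable using (¬?)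
  open import Relation.Unary using (Pred)

  private
    module R = CommutativeRing R
    variable
      n v : ℕ
      p p′ : Level

  open RawSemiringDefinitions (Semiring.rawSemiring R.semiring) using () renaming (_×_ to infixr 8 _·_)

  monomials : Poly n → List (Multigraph n)
  monomials = map proj₂

  count : Poly n → Multigraph n → ℕ
  count f g = ∑ f (λ (a , h) → ⟦ h ≗? g ⟧)

  One : Poly n → Set (c ⊔ ℓ)
  One f = All (λ (a , _) → a R.≈ R.1#) f

  -- A sum of bare monomials has natural numbers as coefficients, so whether such a coefficient
  -- vanishes can be decided in ℕ by characteristic zero.
  coeff-count : ∀ (f : Poly n) g → One f → coeff f g R.≈ count f g · R.1#
  coeff-count f g o = R.trans (coeff-pair f g) (go f o)
    where
    term : ∀ {h} (h? : Dec (h ≗ g)) {a x k} → a R.≈ R.1# → x R.≈ k · R.1# → a R.* when h? R.1# R.+ x R.≈ (⟦ h? ⟧ + k) · R.1#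
    term (yes _) e e′ = R.+-cong (R.trans (R.*-identityʳ _) e) e′
    term (no _)  e e′ = R.trans (R.+-cong (R.zeroʳ _) e′) (R.+-identityˡ _)
    go : ∀ f → One f → pair f (δ g) R.≈ count f g · R.1#
    go []            []      = R.refl
    go ((a , h) ∷ f) (e ∷ o) = term {h} (h ≗? g) e (go f o)

  x^-One : ∀ (gs : List (Multigraph n)) → One (concatMap x^ gs)
  x^-One []       = []
  x^-One (g ∷ gs) = R.refl ∷ x^-One gs

  ⊠-One : ∀ {f f′ : Poly n} → One f → One f′ → One (f ⊠ f′)
  ⊠-One o o′ = all-product′ o o′
    where
    all-product′ : ∀ {f f′ : Poly n} → One f → One f′ → One (f ⊠ f′)
    all-product′ []      o′ = []
    all-product′ (e ∷ o) o′ = All.++⁺ (All.map⁺ (All.map (λ e′ → R.trans (R.*-cong e e′) (R.*-identityˡ R.1#)) o′)) (all-product′ o o′)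

  x^-count : ∀ (gs : List (Multigraph n)) g → count (concatMap x^ gs) g ≡ ∑ gs (λ h → ⟦ h ≗? g ⟧)
  x^-count []       g = refl
  x^-count (h ∷ gs) g = cong (⟦ h ≗? g ⟧ +_) (x^-count gs g)

  deduplicate-count : ∀ (gs : List (Multigraph n)) g → ∑ (deduplicate _≗?_ gs) (λ h → ⟦ h ≗? g ⟧) ≡ ⟦ any? (_≗? g) gs ⟧
  deduplicate-count []       g = refl
  deduplicate-count (h ∷ gs) g = trans (cong (⟦ h ≗? g ⟧ +_) (∑-filter (λ k → ¬? (h ≗? k)) (deduplicate _≗?_ gs) _)) (cases (h ≗? g))
    where
    cases : (e? : Dec (h ≗ g)) → ⟦ e? ⟧ + ∑ (deduplicate _≗?_ gs) (λ k → ⟦ ¬? (h ≗? k) ⟧ * ⟦ k ≗? g ⟧) ≡ ⟦ any? (_≗? g) (h ∷ gs) ⟧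
    cases (yes e) = trans (cong suc (trans (∑-cong (deduplicate _≗?_ gs) (λ k → ⟦⟧-× (¬? (h ≗? k)) (k ≗? g) (no (id {A = Data.Empty.⊥})) (λ ()) (λ ne e′ → ne (λ i j → trans (e i j) (sym (e′ i j)))))) (∑-zero (deduplicate _≗?_ gs))))
      (sym (⟦⟧-yes (any? (_≗? g) (h ∷ gs)) (here e)))
      where import Data.Empty
    cases (no ne) = trans (∑-cong (deduplicate _≗?_ gs) (λ k → ⟦⟧-× (¬? (h ≗? k)) (k ≗? g) (k ≗? g) (λ e → (λ e′ → ne (λ i j → trans (e′ i j) (e i j))) , e) (λ _ e → e)))
      (trans (deduplicate-count gs g) (⟦⟧-cong (any? (_≗? g) gs) (any? (_≗? g) (h ∷ gs)) there λ { (here e) → contradiction e ne ; (there a) → a }))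

  •-Maps : ∀ (σ : Permutation′ n) g → Maps σ g (σ • g)
  •-Maps σ g i j = cong₂ (mult g) (Perm.inverseˡ σ) (Perm.inverseˡ σ)

  orbit-any : ∀ (r g : Multigraph n) → Iso r g → Any (_≗ g) (map (_• r) (permutations n))
  orbit-any r g (via σ m) = Any.map⁺ (Any.map (λ {π} e i j → trans
    (cong₂ (mult r) (inv π e i) (inv π e j)) (trans (sym (m _ _)) (cong₂ (mult g) (Perm.inverseʳ σ) (Perm.inverseʳ σ)))) (Defs.permutations-complete σ))
    where
    inv : ∀ π → σ Perm.≈ π → ∀ i → π ⟨$⟩ˡ i ≡ σ ⟨$⟩ˡ i
    inv π e i = trans (sym (Perm.inverseˡ σ)) (trans (cong (σ ⟨$⟩ˡ_) (e _)) (cong (σ ⟨$⟩ˡ_) (Perm.inverseʳ π)))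

  any-orbit : ∀ (r g : Multigraph n) → Any (_≗ g) (map (_• r) (permutations n)) → Iso r g
  any-orbit r g a with σ , e ← Any.satisfied (Any.map⁻ a) = Iso-trans (via σ (•-Maps σ r)) (≗⇒Iso {g = σ • r} {g} e)

  opaque
    -- Opaque, so that no orbit is ever computed.
    orbitSum : Multigraph n → Poly n
    orbitSum = 𝒪

    orbitSum-≡ : ∀ (r : Multigraph n) → orbitSum r ≡ 𝒪 r
    orbitSum-≡ r = refl

    coeff-orbitSum : ∀ (r g : Multigraph n) → coeff (orbitSum r) g R.≈ ⟦ iso? r g ⟧ · R.1#
    coeff-orbitSum r g = R.trans (coeff-count (orbitSum r) g (x^-One (orbit r))) (R.reflexive (cong (_· R.1#)
      (trans (x^-count (orbit r) g) (trans (deduplicate-count (map (_• r) (permutations _)) g)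
        (⟦⟧-cong (any? (_≗? g) _) (iso? r g) (any-orbit r g) (orbit-any r g))))))

    orbitSum-One : ∀ (r : Multigraph n) → One (orbitSum r)
    orbitSum-One r = x^-One (orbit r)

    orbitSum-monomials : ∀ (r : Multigraph n) → All (Iso r) (monomials (orbitSum r))
    orbitSum-monomials {n} r = subst (All (Iso r)) (sym (monos (orbit r))) (All.deduplicate⁺ _≗?_ (All.map⁺ (All.universal (λ σ → via σ (•-Maps σ r)) (permutations _))))
      where
      monos : ∀ (gs : List (Multigraph n)) → monomials (concatMap x^ gs) ≡ gs
      monos []       = refl
      monos (g ∷ gs) = cong (g ∷_) (monos gs)

    orbitSum-any : ∀ (r : Multigraph n) → Any (λ x → proj₂ x ≗ r) (orbitSum r)
    orbitSum-any {n} r = any-x^ (orbit r) (∑-∈ (_≗? r) (orbit r) λ e → contradiction (trans (sym e) (trans (deduplicate-count G r) (⟦⟧-yes (any? (_≗? r) G) (orbit-any r r Iso-refl)))) λ ())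
      where
      G : List (Multigraph n)
      G = map (_• r) (permutations n)
      any-x^ : ∀ gs → Any (_≗ r) gs → Any (λ x → proj₂ x ≗ r) (concatMap x^ gs)
      any-x^ (_ ∷ gs) (here e)  = here e
      any-x^ (_ ∷ gs) (there a) = there (any-x^ gs a)

  orbitSum-cong : ∀ {r s : Multigraph n} → Iso r s → orbitSum r ≋ orbitSum s
  orbitSum-cong {r = r} {s} i = at λ g → R.trans (coeff-orbitSum r g) (R.trans (R.reflexive (cong (_· R.1#) (⟦⟧-cong (iso? r g) (iso? s g) (Iso-trans (Iso-sym i)) (Iso-trans i)))) (R.sym (coeff-orbitSum s g)))

  orbitSum-invariant : ∀ (r : Multigraph n) → IsInvariant (orbitSum r)
  orbitSum-invariant r σ g = R.trans (coeff-act σ (orbitSum r) g) (R.trans (coeff-orbitSum r _) (R.trans (R.reflexive (cong (_· R.1#)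
    (⟦⟧-cong (iso? r (Perm.flip σ • g)) (iso? r g) (λ i → Iso-trans i (Iso-sym i′)) (λ i → Iso-trans i i′)))) (R.sym (coeff-orbitSum r g))))
    where
    i′ : Iso g (Perm.flip σ • g)
    i′ = via (Perm.flip σ) (•-Maps (Perm.flip σ) g)

  invariant-coeff : ∀ (f : Poly n) → IsInvariant f → ∀ {g h} → Iso g h → coeff f g R.≈ coeff f h
  invariant-coeff f inv {g} {h} (via σ m) = R.trans (coeff-cong f {g} {Perm.flip σ • h} (λ i j → sym (m i j))) (R.trans (R.sym (coeff-act σ f h)) (inv σ h))

  coeff-none : ∀ (f : Poly n) {g} → ¬ Any (_≗ g) (monomials f) → coeff f g R.≈ R.0#
  coeff-none f {g} none = R.trans (coeff-pair f g) (go f none)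
    where
    go : ∀ f → ¬ Any (_≗ g) (monomials f) → pair f (δ g) R.≈ R.0#
    go []            none = R.refl
    go ((a , h) ∷ f) none = R.trans (R.+-cong (R.trans (R.*-congˡ (δ-no {g = g} {h} (none ∘ here))) (R.zeroʳ a)) (go f (none ∘ there))) (R.+-identityˡ R.0#)

  combination : (Multigraph n → R.Carrier) → List (Multigraph n) → Poly n
  combination x []       = []
  combination x (r ∷ rs) = scale (x r) (orbitSum r) ++ combination x rs

  coeff-combination : ∀ x (rs : List (Multigraph n)) g {y} → (∀ r → Iso g r → x r R.≈ y) → coeff (combination x rs) g R.≈ ∑ rs (λ r → ⟦ iso? g r ⟧) · R.1# R.* y
  coeff-combination x []       g eq = R.sym (R.zeroˡ _)
  coeff-combination x (r ∷ rs) g {y} eq = R.trans (coeff-++ (scale (x r) (orbitSum r)) (combination x rs) g)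
    (R.trans (R.+-cong (R.trans (coeff-scale (x r) (orbitSum r) g) (R.*-congˡ (R.trans (coeff-orbitSum r g) (R.reflexive (cong (_· R.1#) (⟦⟧-cong (iso? r g) (iso? g r) Iso-sym Iso-sym))))))
      (coeff-combination x rs g eq)) (term (iso? g r)))
    where
    term : (i? : Dec (Iso g r)) → ∀ {k} → x r R.* ⟦ i? ⟧ · R.1# R.+ k · R.1# R.* y R.≈ (⟦ i? ⟧ + k) · R.1# R.* y
    term (yes i) {k} = R.trans (R.+-congʳ (R.trans (R.*-congˡ (R.+-identityʳ R.1#)) (R.trans (R.*-identityʳ _) (R.trans (eq r i) (R.sym (R.*-identityˡ y)))))) (R.sym (R.distribʳ y R.1# (k · R.1#)))
    term (no _)  {k} = R.trans (R.+-congʳ (R.zeroʳ (x r))) (R.+-identityˡ _)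

  -- Isomorphic graphs have equal coefficients in an invariant, and `distinct` keeps one
  -- representative of every class that occurs in the list. A class whose terms cancel merely enters
  -- with coefficient 0.
  expansion : ∀ (f : Poly n) → IsInvariant f → f ≋ combination (coeff f) (distinct (monomials f))
  expansion f inv = at λ g → R.sym (R.trans (coeff-combination (coeff f) (distinct (monomials f)) g (λ r i → invariant-coeff f inv (Iso-sym i))) (cases g (any? (iso? g) (monomials f))))
    where
    cases : ∀ g → Dec (Any (Iso g) (monomials f)) → ∑ (distinct (monomials f)) (λ r → ⟦ iso? g r ⟧) · R.1# R.* coeff f g R.≈ coeff f g
    cases g (yes a) = R.trans (R.*-congʳ (R.trans (R.reflexive (cong (_· R.1#) (distinct-once (monomials f) a))) (R.+-identityʳ R.1#))) (R.*-identityˡ _)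
    cases g (no ¬a) = R.trans (R.*-congˡ none) (R.trans (R.zeroʳ _) (R.sym none))
      where none = coeff-none f {g} (λ a → ¬a (Any.map (λ {h} e → ≗⇒Iso {g = g} {h} (λ i j → sym (e i j))) a))

  OrbitsOf : Pred (Multigraph n) p → Pred (Poly n) _
  OrbitsOf Q f = ∃ λ t → Q t × f ≡ orbitSum t

  combination-Span : ∀ {Q : Pred (Multigraph n) p} x {rs} → All Q rs → Span (OrbitsOf Q) (combination x rs)
  combination-Span x []       = nil
  combination-Span x (q ∷ qs) = plus (scal _ (inc (_ , q , refl))) (combination-Span x qs)

  expand : ∀ {Q : Pred (Multigraph n) p} (f : Poly n) → IsInvariant f → All Q (monomials f) → Span (OrbitsOf Q) f
  expand f inv qs = resp (P.sym (expansion f inv)) (combination-Span _ (distinct-All qs))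

  ⊠-monomials : ∀ {P : Pred (Multigraph n) p} {Q : Pred (Multigraph n) p} {S : Pred (Multigraph n) p′} (f g : Poly n) → All P (monomials f) → All Q (monomials g) →
    (∀ {h k} → P h → Q k → S (h ⊕ k)) → All S (monomials (f ⊠ g))
  ⊠-monomials []            g []       qs pq = []
  ⊠-monomials ((a , h) ∷ f) g (p ∷ ps) qs pq = subst (All _) (sym (Data.List.Properties.map-++ proj₂ (map _ g) (f ⊠ g)))
    (All.++⁺ (All.map⁺ (All.map⁺ (All.map (pq p) (All.map⁻ qs)))) (⊠-monomials f g ps qs pq))
    where import Data.List.Properties

-- Orders of graphs and products with the single edge.

module Orders (q-1 : ℕ) {c ℓ} (R : CommutativeRing c ℓ) where
  open Sums
  open Permutations
  open CycleTypes
  open OrbitSizes (suc q-1)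
  open PairRotations q-1
  open FixedGraphs q-1
  open Representatives q-1
  open Extensions q-1
  open OrbitPolynomials q-1 R
  open import Defs hiding (permutations-complete)
  open Polynomials R hiding (GeneratesInvariants; OrbitSums; _≈_)
  open Convolution R
  open import Algebra.Bundles using (Semiring)
  import Algebra.Definitions.RawSemiring as RawSemiringDefinitions
  open import Data.Fin.Base as Fin using (Fin; zero; suc)
  open import Data.Fin.Permutation as Perm using (Permutation′; _⟨$⟩ʳ_; _⟨$⟩ˡ_; _∘ₚ_)
  import Data.Fin.Permutation.Components as PC
  import Data.Fin.Properties as Fin
  open import Data.List.Base using (List; []; _∷_; _++_; map; allFin)
  open import Data.List.Relation.Unary.All using (All; []; _∷_)
  import Data.List.Relation.Unary.All as All
  import Data.List.Relation.Unary.All.Properties as All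
  open import Data.List.Relation.Unary.AllPairs using ([]; _∷_)
  open import Data.List.Relation.Unary.Any using (Any; here; there; any?)
  import Data.List.Relation.Unary.Any as Any
  open import Data.Nat.Base hiding (ℕ; suc; _⊔_)
  open import Data.Nat.Properties
  open import Data.Product.Base using (_×_; _,_; proj₁; proj₂; ∃)
  open import Data.Sum.Base using (_⊎_; inj₁; inj₂; [_,_]′)
  open import Function.Base using (_∘_; id)
  open import Level using (Level)
  open import Relation.Binary.PropositionalEquality hiding (_≗_; resp)
  open import Relation.Nullary using (Dec; yes; no; ¬_; contradiction)
  open import Relation.Nullary.Decidable using (¬?)
  open import Relation.Unary using (Pred)

  private
    module R = CommutativeRing R
    variable
      n v : ℕ
      p p′ : Level

  open RawSemiringDefinitions (Semiring.rawSemiring R.semiring) using () renaming (_×_ to infixr 8 _·_)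

  opaque
    isolated? : ∀ (g : Multigraph n) i → Dec (Isolated g i)
    isolated? g i = Fin.all? λ j → mult g i j ≟ 0

  active : Multigraph n → Fin n → ℕ
  active g i = ⟦ ¬? (isolated? g i) ⟧

  -- The number of non-isolated vertices.

  order : Multigraph n → ℕ
  order {n} g = ∑ (allFin n) (active g)

  order-Iso : ∀ {g h : Multigraph n} → Iso g h → order g ≡ order h
  order-Iso {n} {g} {h} (via σ m) = trans (∑-cong (allFin n) (λ i → ⟦⟧-cong (¬? (isolated? g i)) (¬? (isolated? h (σ ⟨$⟩ʳ i)))
    (λ ne iso → ne (λ j → trans (sym (m i j)) (iso _))) (λ ne iso → ne (Isolated-Maps σ {g} {h} m iso)))) (∑-permute σ (active h))

  active-≤ : ∀ {m n} (g : Multigraph m) (h : Multigraph n) i j → (Isolated h j → Isolated g i) → active g i ≤ active h j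
  active-≤ g h i j imp with isolated? g i | isolated? h j
  ... | yes _ | _      = z≤n
  ... | no _  | no _   = s≤s z≤n
  ... | no ¬a | yes b  = contradiction (imp b) ¬a

  order-⊕ : ∀ (g h : Multigraph n) → order (g ⊕ h) ≤ order g + order h
  order-⊕ {n} g h = ≤-trans (∑-mono (allFin n) pointwise) (≤-reflexive (∑-+ (allFin n) (active g) (active h)))
    where
    pointwise : ∀ i → active (g ⊕ h) i ≤ active g i + active h i
    pointwise i with isolated? g i
    ... | yes iso = active-≤ (g ⊕ h) h i i (λ iso′ j → cong₂ _+_ (iso j) (iso′ j))
    ... | no _    = ≤-trans (⟦⟧-≤1 (¬? (isolated? (g ⊕ h) i))) (s≤s z≤n)

  order-ext : ∀ (g : Multigraph n) → order (ext g) ≡ order g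
  order-ext {n} g = trans (∑-allFin n (active (ext g))) (cong₂ _+_ (⟦⟧-no (¬? (isolated? (ext g) zero)) (λ ne → ne λ { zero → refl ; (suc _) → refl }))
    (∑-cong (allFin n) (λ i → ⟦⟧-cong (¬? (isolated? (ext g) (suc i))) (¬? (isolated? g i)) (λ ne iso → ne λ { zero → refl ; (suc j) → iso j }) (λ ne iso → ne (iso ∘ suc)))))

  order-extK : ∀ (g : Multigraph n) → order (extK g) ≡ 2 + order g
  order-extK {n} g = trans (∑-allFin (suc n) (active (extK g))) (cong₂ _+_ (⟦⟧-yes (¬? (isolated? (extK g) zero)) (λ iso → contradiction (iso 1F) λ ()))
    (trans (∑-allFin n (active (extK g) ∘ suc)) (cong₂ _+_ (⟦⟧-yes (¬? (isolated? (extK g) (suc zero))) (λ iso → contradiction (iso 0F) λ ()))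
    (∑-cong (allFin n) (λ i → ⟦⟧-cong (¬? (isolated? (extK g) (suc (suc i)))) (¬? (isolated? g i))
      (λ ne iso → ne λ { zero → refl ; (suc zero) → refl ; (suc (suc j)) → iso j }) (λ ne iso → ne (λ j → iso (suc (suc j)))))))))

  -- Every monomial of the product is a union of a copy of s and a copy of t, and a vertex isolated
  -- in both copies is isolated in the union.
  IsInvariant-merge : ∀ (s t : Multigraph n) → Span (OrbitsOf (λ w → order w ≤ order s + order t)) (orbitSum s ⊠ orbitSum t)
  IsInvariant-merge s t = expand (orbitSum s ⊠ orbitSum t) (⊠-invariant (orbitSum s) (orbitSum t) (orbitSum-invariant s) (orbitSum-invariant t))
    (⊠-monomials (orbitSum s) (orbitSum t) (orbitSum-monomials s) (orbitSum-monomials t)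
      (λ {h} {k} i j → ≤-trans (order-⊕ h k) (≤-reflexive (sym (cong₂ _+_ (order-Iso i) (order-Iso j))))))

  singleEdge : Multigraph (2 + n)
  singleEdge = extK ∅

  e₁ : Poly (2 + n)
  e₁ = orbitSum singleEdge

  singleEdge-rest : ∀ (i : Fin (2 + n)) j → i ≢ 0F → i ≢ 1F → mult (singleEdge {n}) i j ≡ 0
  singleEdge-rest zero          j             ne ne′ = contradiction refl ne
  singleEdge-rest (suc zero)    j             ne ne′ = contradiction refl ne′
  singleEdge-rest (suc (suc i)) zero          ne ne′ = refl
  singleEdge-rest (suc (suc i)) (suc zero)    ne ne′ = refl
  singleEdge-rest (suc (suc i)) (suc (suc j)) ne ne′ = refl

  module Edge (u : Multigraph n) {h k : Multigraph (2 + n)} (ih : Iso singleEdge h) (ik : Iso (ext (ext u)) k) where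
    private
      σ = Iso.σ ih
      a b : Fin (2 + n)
      a = σ ⟨$⟩ʳ 0F
      b = σ ⟨$⟩ʳ 1F
      edge-ab : IsolatedEdge h a b
      edge-ab = IsolatedEdge-Maps σ {singleEdge} {h} (Iso.maps ih) (extK-edge ∅)
      a≢b : a ≢ b
      a≢b = isolatedEdge-≢ h edge-ab
      rest : ∀ i → i ≢ a → i ≢ b → Isolated h i
      rest i ne ne′ j = trans (cong₂ (mult h) (sym (Perm.inverseʳ σ)) (sym (Perm.inverseʳ σ))) (trans (Iso.maps ih (σ ⟨$⟩ˡ i) (σ ⟨$⟩ˡ j))
        (singleEdge-rest (σ ⟨$⟩ˡ i) (σ ⟨$⟩ˡ j) (λ e → ne (trans (sym (Perm.inverseʳ σ)) (cong (σ ⟨$⟩ʳ_) e))) (λ e → ne′ (trans (sym (Perm.inverseʳ σ)) (cong (σ ⟨$⟩ʳ_) e)))))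

      apart : Isolated k a → Isolated k b → Iso (extK u) (h ⊕ k)
      apart iso-a iso-b = Iso-trans (extK-Iso (Iso-sym w≅u)) (Iso-trans (≗⇒Iso {g = extK w} {move τ (h ⊕ k)} (λ i j → sym (split i j))) (Iso-sym (via τ (move-Maps τ (h ⊕ k)))))
        where
        τ₁ : Permutation′ (2 + n)
        τ₁ = Perm.transpose 0F a
        b′ = τ₁ ⟨$⟩ʳ b
        τ = τ₁ ∘ₚ Perm.transpose 1F b′
        τa : τ ⟨$⟩ʳ a ≡ 0F
        τa = trans (cong (PC.transpose 1F b′) (transpose-from 0F a)) (transpose-off 1F b′ (λ ()) (λ e → a≢b (perm-injective τ₁ (trans (transpose-from 0F a) e))))
        τb : τ ⟨$⟩ʳ b ≡ 1F
        τb = transpose-from 1F b′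
        w = dropVertex (dropVertex (move τ k))
        hτ : Maps τ h (move τ h)
        hτ = move-Maps τ h
        edge₀₁ : IsolatedEdge (move τ h) 0F 1F
        edge₀₁ = subst₂ (IsolatedEdge (move τ h)) τa τb (IsolatedEdge-Maps τ {h} {move τ h} hτ edge-ab)
        iso₀ : Isolated (move τ k) 0F
        iso₀ = subst (Isolated (move τ k)) τa (Isolated-Maps τ {k} {move τ k} (move-Maps τ k) iso-a)
        iso₁ : Isolated (move τ k) 1F
        iso₁ = subst (Isolated (move τ k)) τb (Isolated-Maps τ {k} {move τ k} (move-Maps τ k) iso-b)
        rest₂ : ∀ i → Isolated (move τ h) (suc (suc i))
        rest₂ i j = rest (τ ⟨$⟩ˡ suc (suc i)) (λ e → Fin.0≢1+n (sym (off e τa))) (λ e → Fin.0≢1+n (Fin.suc-injective (sym (off e τb)))) (τ ⟨$⟩ˡ j)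
          where
          off : ∀ {x z} → τ ⟨$⟩ˡ suc (suc i) ≡ x → τ ⟨$⟩ʳ x ≡ z → suc (suc i) ≡ z
          off e e′ = trans (sym (Perm.inverseʳ τ)) (trans (cong (τ ⟨$⟩ʳ_) e) e′)
        split : move τ (h ⊕ k) ≗ extK w
        split zero          j             = trans (cong₂ _+_ (proj₁ (edge₀₁ j)) (iso₀ j)) (trans (+-identityʳ _) (sym (proj₁ (extK-edge w j))))
        split (suc zero)    j             = trans (cong₂ _+_ (proj₂ (edge₀₁ j)) (iso₁ j)) (trans (+-identityʳ _) (sym (proj₂ (extK-edge w j))))
        split (suc (suc i)) zero          = cong₂ _+_ (rest₂ i 0F) (trans (symmetric (move τ k) (suc (suc i)) 0F) (iso₀ (suc (suc i))))
        split (suc (suc i)) (suc zero)    = cong₂ _+_ (rest₂ i 1F) (trans (symmetric (move τ k) (suc (suc i)) 1F) (iso₁ (suc (suc i))))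
        split (suc (suc i)) (suc (suc j)) = cong (_+ mult w i j) (rest₂ i (suc (suc j)))
        k≗ : move τ k ≗ ext (ext w)
        k≗ zero          j             = trans (iso₀ j) (sym (proj₂ (ext-isolated (ext w)) j))
        k≗ (suc zero)    zero          = iso₁ zero
        k≗ (suc zero)    (suc zero)    = iso₁ (suc zero)
        k≗ (suc zero)    (suc (suc j)) = iso₁ (suc (suc j))
        k≗ (suc (suc i)) zero          = trans (symmetric (move τ k) (suc (suc i)) 0F) (iso₀ (suc (suc i)))
        k≗ (suc (suc i)) (suc zero)    = trans (symmetric (move τ k) (suc (suc i)) 1F) (iso₁ (suc (suc i)))
        k≗ (suc (suc i)) (suc (suc j)) = refl
        w≅u : Iso w u
        w≅u = ext-cancel (ext-cancel (Iso-trans (≗⇒Iso {g = ext (ext w)} {move τ k} (λ i j → sym (k≗ i j))) (Iso-trans (Iso-sym (via τ (move-Maps τ k))) (Iso-sym ik))))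

      touching : ∀ x y → (∀ i → i ≢ x → i ≢ y → Isolated h i) → ¬ Isolated k x → order (h ⊕ k) < order (extK u)
      touching x y rest ne = begin-strict
        order (h ⊕ k) ≤⟨ ∑-mono (allFin (2 + n)) pointwise ⟩
        ∑ (allFin (2 + n)) (λ i → active k i + ⟦ i Fin.≟ y ⟧) ≡⟨ ∑-+ (allFin (2 + n)) (active k) _ ⟩
        order k + ∑ (allFin (2 + n)) (λ i → ⟦ i Fin.≟ y ⟧) ≡⟨ cong₂ _+_ (trans (sym (order-Iso ik)) (trans (order-ext (ext u)) (order-ext u))) (∑-δ y) ⟩
        order u + 1 ≡⟨ +-comm (order u) 1 ⟩
        1 + order u <⟨ n<1+n _ ⟩
        2 + order u ≡⟨ order-extK u ⟨
        order (extK u) ∎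
        where
        open ≤-Reasoning
        pointwise : ∀ i → active (h ⊕ k) i ≤ active k i + ⟦ i Fin.≟ y ⟧
        pointwise i with i Fin.≟ y
        ... | yes _ = ≤-trans (⟦⟧-≤1 (¬? (isolated? (h ⊕ k) i))) (m≤n+m 1 (active k i))
        ... | no i≢y with i Fin.≟ x
        ...   | yes refl = ≤-trans (⟦⟧-≤1 (¬? (isolated? (h ⊕ k) i))) (≤-trans (≤-reflexive (sym (⟦⟧-yes (¬? (isolated? k i)) ne))) (m≤m+n _ 0))
        ...   | no i≢x  = ≤-trans (active-≤ (h ⊕ k) k i i (λ iso j → cong₂ _+_ (rest i i≢x i≢y j) (iso j))) (m≤m+n _ 0)

    -- If both ends of the edge h are isolated in k, it stays an isolated edge of the union.
    -- Otherwise it adds at most one vertex to the order of u, whereas `extK` adds two.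
    result : Iso (extK u) (h ⊕ k) ⊎ order (h ⊕ k) < order (extK u)
    result with isolated? k a | isolated? k b
    ... | yes ia | yes ib = inj₁ (apart ia ib)
    ... | no na  | _      = inj₂ (touching a b rest na)
    ... | yes _  | no nb  = inj₂ (touching b a (λ i ne ne′ → rest i ne′ ne) nb)

  module _ (u : Multigraph n) where
    private
      t = extK u
      f = e₁ ⊠ orbitSum (ext (ext u))
      N = count f t
      Low : Pred (Multigraph (2 + n)) _
      Low w = order w < order t

    edge-product-invariant : IsInvariant f
    edge-product-invariant = ⊠-invariant e₁ (orbitSum (ext (ext u))) (orbitSum-invariant singleEdge) (orbitSum-invariant (ext (ext u)))

    edge-coefficient : coeff f t R.≈ N · R.1#
    edge-coefficient = coeff-count f t (⊠-One (orbitSum-One singleEdge) (orbitSum-One (ext (ext u))))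

    private
      f-monomials : All (λ w → Iso t w ⊎ Low w) (monomials f)
      f-monomials = ⊠-monomials {S = λ w → Iso t w ⊎ Low w} e₁ (orbitSum (ext (ext u))) (orbitSum-monomials singleEdge) (orbitSum-monomials (ext (ext u))) (λ i j → Edge.result u i j)

      any-⊠ : ∀ (g h : Multigraph (2 + n)) p p′ → Any (λ x → proj₂ x ≗ g) p → Any (λ x → proj₂ x ≗ h) p′ → Any (λ x → proj₂ x ≗ g ⊕ h) (p ⊠ p′)
      any-⊠ g h p p′ a a′ = Data.List.Relation.Unary.Any.Properties.cartesianProductWith⁺ _ (λ e e′ i j → cong₂ _+_ (e i j) (e′ i j)) a a′
        where import Data.List.Relation.Unary.Any.Properties

      singleEdge-split : singleEdge ⊕ ext (ext u) ≗ t
      singleEdge-split zero          zero          = refl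
      singleEdge-split zero          (suc zero)    = refl
      singleEdge-split zero          (suc (suc j)) = refl
      singleEdge-split (suc zero)    zero          = refl
      singleEdge-split (suc zero)    (suc zero)    = refl
      singleEdge-split (suc zero)    (suc (suc j)) = refl
      singleEdge-split (suc (suc i)) zero          = refl
      singleEdge-split (suc (suc i)) (suc zero)    = refl
      singleEdge-split (suc (suc i)) (suc (suc j)) = refl

    -- The standard copies of the edge and of u are disjoint with union t, so t occurs among the
    -- monomials of the product; as all coefficients are 1, nothing is lost by counting.
    N≢0 : N ≢ 0
    N≢0 e = lemma (Any.map (λ e i j → trans (e i j) (singleEdge-split i j)) (any-⊠ singleEdge (ext (ext u)) e₁ (orbitSum (ext (ext u))) (orbitSum-any singleEdge) (orbitSum-any (ext (ext u)))))
      where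
      lemma : ¬ Any (λ x → proj₂ x ≗ t) f
      lemma a = contradiction (trans (sym (⟦⟧-yes (any? (λ x → proj₂ x ≗? t) f) a)) (zero-any f e)) λ ()
        where
        zero-any : ∀ f → count f t ≡ 0 → ⟦ any? (λ x → proj₂ x ≗? t) f ⟧ ≡ 0
        zero-any f e = ⟦⟧-no (any? (λ x → proj₂ x ≗? t) f) (not-any f e)
          where
          not-any : ∀ f → count f t ≡ 0 → ¬ Any (λ x → proj₂ x ≗ t) f
          not-any (x ∷ f) e (here p)  = contradiction (trans (sym (⟦⟧-yes (proj₂ x ≗? t) p)) (m+n≡0⇒m≡0 _ e)) λ ()
          not-any (x ∷ f) e (there a) = not-any f (m+n≡0⇒n≡0 ⟦ proj₂ x ≗? t ⟧ e) a

    private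
      split-combination : ∀ rs → All (λ w → Iso t w ⊎ Low w) rs → ∃ λ low → Span (OrbitsOf Low) low ×
        combination (coeff f) rs ≋ scale (∑ rs (λ r → ⟦ iso? t r ⟧) · R.1# R.* coeff f t) (orbitSum t) ++ low
      split-combination []       []       = [] , nil , at λ m → R.sym (R.trans (coeff-++ (scale (R.0# R.* coeff f t) (orbitSum t)) [] m) (R.trans (R.+-congʳ (R.trans (coeff-scale (R.0# R.* coeff f t) (orbitSum t) m) (R.trans (R.*-congʳ (R.zeroˡ _)) (R.zeroˡ _)))) (R.+-identityʳ _)))
      split-combination (r ∷ rs) (x ∷ xs) with split-combination rs xs
      ... | low , sp , e with iso? t r
      ...   | yes i = low , sp , at λ m → R.trans (coeff-++ (scale (coeff f r) (orbitSum r)) (combination (coeff f) rs) m)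
                (R.trans (R.+-cong (R.trans (coeff-scale (coeff f r) (orbitSum r) m) (R.*-cong (invariant-coeff f edge-product-invariant (Iso-sym i)) (same (orbitSum-cong (Iso-sym i)) m)))
                  (R.trans (same e m) (R.trans (coeff-++ (scale _ (orbitSum t)) low m) (R.+-congʳ (coeff-scale _ (orbitSum t) m)))))
                (R.trans (R.sym (R.+-assoc _ _ _)) (R.trans (R.+-congʳ (R.trans (R.+-congʳ (R.*-congʳ (R.sym (R.*-identityˡ _)))) (R.trans (R.sym (R.distribʳ _ _ _)) (R.*-congʳ (R.sym (R.distribʳ _ _ _))))))
                (R.sym (R.trans (coeff-++ (scale _ (orbitSum t)) low m) (R.+-congʳ (coeff-scale _ (orbitSum t) m)))))))
      ...   | no ¬i = scale (coeff f r) (orbitSum r) ++ low , plus (scal _ (inc (r , [ (λ i → contradiction i ¬i) , id ]′ x , refl))) sp ,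
                at λ m → R.trans (coeff-++ (scale (coeff f r) (orbitSum r)) (combination (coeff f) rs) m) (R.trans (R.+-congˡ (R.trans (same e m) (coeff-++ (scale _ (orbitSum t)) low m)))
                  (R.trans (x∙yz≈y∙xz _ _ _) (R.sym (R.trans (coeff-++ (scale _ (orbitSum t)) (scale (coeff f r) (orbitSum r) ++ low) m) (R.+-congˡ (coeff-++ (scale (coeff f r) (orbitSum r)) low m))))))
        where open import Algebra.Properties.CommutativeSemigroup R.+-commutativeSemigroup using (x∙yz≈y∙xz)

    -- Since t has an isolated edge, e₁ times the orbit sum of the rest of t is a
    -- nonzero multiple of the orbit sum of t up to graphs of smaller order.

    edge-product : ∃ λ low → Span (OrbitsOf Low) low × f ≋ scale (N · R.1#) (orbitSum t) ++ low
    edge-product with split-combination (distinct (monomials f)) (distinct-All f-monomials)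
    ... | low , sp , e = low , sp , P.trans (expansion f edge-product-invariant) (P.trans e (++-cong (at λ m →
      R.trans (coeff-scale _ (orbitSum t) m) (R.trans (R.*-congʳ (R.trans (R.*-congʳ (R.trans (R.reflexive (cong (_· R.1#) (distinct-once (monomials f) any-t))) (R.+-identityʳ _))) (R.trans (R.*-identityˡ _) edge-coefficient)))
        (R.sym (coeff-scale _ (orbitSum t) m)))) (P.refl {x = low})))
      where
      any-t : Any (Iso t) (monomials f)
      any-t = Data.List.Relation.Unary.Any.Properties.map⁺ (Any.map (λ {x} e → ≗⇒Iso {g = t} {proj₂ x} (λ i j → sym (trans (e i j) (singleEdge-split i j)))) (any-⊠ singleEdge (ext (ext u)) e₁ (orbitSum (ext (ext u))) (orbitSum-any singleEdge) (orbitSum-any (ext (ext u)))))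
        where import Data.List.Relation.Unary.Any.Properties

-- Reduction of the subalgebra to normal forms.

module NormalForms (q-1 : ℕ) {c ℓ} (R : CommutativeRing c ℓ) where
  open Sums
  open Permutations
  open CycleTypes
  open OrbitSizes (suc q-1)
  open PairRotations q-1
  open FixedGraphs q-1
  open Representatives q-1
  open Extensions q-1
  open OrbitPolynomials q-1 R
  open Orders q-1 R
  open import Defs hiding (permutations-complete)
  open Polynomials R hiding (GeneratesInvariants; OrbitSums; _≈_)
  open Convolution R
  open import Algebra.Bundles using (Semiring)
  import Algebra.Definitions.RawSemiring as RawSemiringDefinitions
  open import Data.Fin.Base as Fin using (Fin; suc)
  import Data.Fin.Properties as Fin
  open import Data.List.Base using (List; []; _∷_; _++_; map; allFin)
  open import Data.List.Relation.Binary.Permutation.Propositional as ↭ using (_↭_; ↭-refl; ↭-trans; prep)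
  import Data.List.Relation.Binary.Permutation.Propositional.Properties as ↭
  open import Data.List.Relation.Unary.All using (All; []; _∷_)
  import Data.List.Relation.Unary.All as All
  import Data.List.Relation.Unary.All.Properties as All
  open import Data.List.Relation.Unary.AllPairs using (AllPairs; []; _∷_)
  open import Data.List.Relation.Unary.Any using (Any; here; there; any?)
  open import Data.Nat.Base hiding (ℕ; suc; _⊔_)
  open import Data.Nat.Properties
  open import Data.Product.Base using (_×_; _,_; proj₁; proj₂; ∃; ∃₂)
  open import Function.Base using (id)
  open import Level using (Level)
  open import Relation.Binary.PropositionalEquality hiding (_≗_; resp)
  open import Relation.Nullary using (Dec; yes; no; ¬_; contradiction)
  open import Relation.Nullary.Decidable using (¬?)
  open import Relation.Unary using (Pred)

  private
    module R = CommutativeRing R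
    variable
      n : ℕ
      p p′ : Level

  open RawSemiringDefinitions (Semiring.rawSemiring R.semiring) using () renaming (_×_ to infixr 8 _·_)

  return : ∀ {a} {A : Set a} → A → ¬ ¬ A
  return x k = k x

  infixl 1 _>>=_
  _>>=_ : ∀ {a b} {A : Set a} {B : Set b} → ¬ ¬ A → (A → ¬ ¬ B) → ¬ ¬ B
  (m >>= f) k = m λ x → f x k

  Span-⊠ʳ¬¬ : ∀ {G : Pred (Poly n) p} {H : Pred (Poly n) p′} g → (∀ {f} → G f → ¬ ¬ Span H (f ⊠ g)) → ∀ {f} → Span G f → ¬ ¬ Span H (f ⊠ g)
  Span-⊠ʳ¬¬ g k (inc x)             = k x
  Span-⊠ʳ¬¬ g k nil                 = return nil
  Span-⊠ʳ¬¬ g k (plus {f} {f′} x y) = Span-⊠ʳ¬¬ g k x >>= λ x′ → Span-⊠ʳ¬¬ g k y >>= λ y′ → return (subst (Span _) (sym (++-⊠ f f′ g)) (plus x′ y′))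
  Span-⊠ʳ¬¬ g k (scal b {f} x)      = Span-⊠ʳ¬¬ g k x >>= λ x′ → return (resp (P.sym ((scale-⊠≋ b f g))) (scal b x′))
  Span-⊠ʳ¬¬ g k (resp e x)          = Span-⊠ʳ¬¬ g k x >>= λ x′ → return (resp (⊠-congʳ g e) x′)

  Prod : List (Multigraph n) → Poly n
  Prod []       = one
  Prod (t ∷ ts) = orbitSum t ⊠ Prod ts

  pow : ℕ → Poly (2 + n) → Poly (2 + n)
  pow 0       f = f
  pow (suc a) f = e₁ ⊠ pow a f

  ⊠-swap : ∀ (f g h : Poly n) → f ⊠ (g ⊠ h) ≋ g ⊠ (f ⊠ h)
  ⊠-swap f g h = P.trans (P.sym ((⊠-assoc≋ f g h))) (P.trans (⊠-congʳ h ((⊠-comm≋ f g))) ((⊠-assoc≋ g f h)))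

  Prod-↭ : ∀ {ts us : List (Multigraph n)} → ts ↭ us → Prod ts ≋ Prod us
  Prod-↭ ↭.refl           = P.refl
  Prod-↭ (prep t p)       = ⊠-congˡ (orbitSum t) (Prod-↭ p)
  Prod-↭ {us = _ ∷ _ ∷ us} (↭.swap s t p) = P.trans (⊠-swap (orbitSum s) (orbitSum t) _) (⊠-congˡ (orbitSum t) (⊠-congˡ (orbitSum s) (Prod-↭ p)))
  Prod-↭ (↭.trans p q)    = P.trans (Prod-↭ p) (Prod-↭ q)

  -- A measure for termination. Because of the 1 added for every factor, it also decreases when two
  -- factors are replaced by one whose order is the sum of their orders.
  weight : List (Multigraph n) → ℕ
  weight us = ∑ us (λ u → suc (order u))

  weight-↭ : ∀ {ts us : List (Multigraph n)} → ts ↭ us → weight ts ≡ weight us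
  weight-↭ ↭.refl         = refl
  weight-↭ (prep t p)     = cong (suc (order t) +_) (weight-↭ p)
  weight-↭ {us = _ ∷ _ ∷ us} (↭.swap s t p) = trans (x∙yz≈y∙xz (suc (order s)) (suc (order t)) _) (cong (λ z → suc (order t) + (suc (order s) + z)) (weight-↭ p))
    where open import Algebra.Properties.CommutativeSemigroup +-commutativeSemigroup using (x∙yz≈y∙xz)
  weight-↭ (↭.trans p q)  = trans (weight-↭ p) (weight-↭ q)

  pull : ∀ {A : Set} {P : A → Set} {xs} → Any P xs → ∃₂ λ x ys → P x × xs ↭ x ∷ ys
  pull {xs = x ∷ xs} (here p) = x , xs , p , ↭-refl
  pull {xs = x ∷ xs} (there a) with y , ys , p , e ← pull a = y , x ∷ ys , p , ↭-trans (prep x e) (↭.swap x y ↭-refl)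

  AllPairs-resp-↭ : ∀ {A : Set} {_∼_ : A → A → Set} → (∀ {x y} → x ∼ y → y ∼ x) → ∀ {xs ys} → xs ↭ ys → AllPairs _∼_ xs → AllPairs _∼_ ys
  AllPairs-resp-↭ sy ↭.refl         ps                    = ps
  AllPairs-resp-↭ sy (prep x p)     (px ∷ ps)             = ↭.All-resp-↭ p px ∷ AllPairs-resp-↭ sy p ps
  AllPairs-resp-↭ sy (↭.swap x y p) ((xy ∷ px) ∷ py ∷ ps) = (sy xy ∷ ↭.All-resp-↭ p py) ∷ ↭.All-resp-↭ p px ∷ AllPairs-resp-↭ sy p ps
  AllPairs-resp-↭ sy (↭.trans p q)  ps                    = AllPairs-resp-↭ sy q (AllPairs-resp-↭ sy p ps)

  order-0 : ∀ (t : Multigraph n) → order t ≡ 0 → ∅ ≗ t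
  order-0 {n} t e i with isolated? t i
  ... | yes iso = λ j → sym (iso j)
  ... | no ne   = contradiction (trans (sym (⟦⟧-yes (¬? (isolated? t i)) ne)) (n≤0⇒n≡0 (≤-trans (∑-term n (active t) i) (≤-reflexive e)))) λ ()

  orbitSum-empty : ∀ (t : Multigraph n) → order t ≡ 0 → orbitSum t ≋ one
  orbitSum-empty t e = at λ g → R.trans (coeff-orbitSum t g) (R.trans (R.reflexive (cong (_· R.1#) (⟦⟧-cong (iso? t g) (∅ ≗? g)
    (λ { (via σ m) i j → trans (order-0 t e _ _) (trans (sym (m _ _)) (cong₂ (mult g) (Data.Fin.Permutation.inverseʳ σ) (Data.Fin.Permutation.inverseʳ σ))) })
    (λ e′ → ≗⇒Iso {g = t} {g} (λ i j → trans (sym (order-0 t e i j)) (e′ i j)))))) (term g (∅ ≗? g)))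
    where
    import Data.Fin.Permutation
    term : ∀ g (e? : Dec (∅ ≗ g)) → ⟦ e? ⟧ · R.1# R.≈ coeff one g
    term g e? = R.trans (when-· e?) (R.sym (R.trans (coeff-pair one g) (R.trans (R.+-identityʳ _) (R.trans (R.*-identityˡ _) (when-cong (∅ ≗? g) e? id id (λ _ → R.refl))))))
      where
      when-· : ∀ {P : Set} (d : Dec P) → ⟦ d ⟧ · R.1# R.≈ when d R.1#
      when-· (yes _) = R.+-identityʳ _
      when-· (no _)  = R.refl

  order-isolated : ∀ (g : Multigraph (suc n)) → HasIsolatedVertex g → order g ≤ n
  order-isolated {n} g (i , iso) = s≤s⁻¹ (subst (order g <_) total (subst (_< order g + ∑ F (λ j → ⟦ isolated? g j ⟧)) (+-identityʳ (order g))
    (+-monoʳ-< (order g) (≤-trans (≤-reflexive (sym (⟦⟧-yes (isolated? g i) isolated-i))) (∑-term (suc n) (λ j → ⟦ isolated? g j ⟧) i)))))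
    where
    F = allFin (suc n)
    isolated-i : Isolated g i
    isolated-i j with j Fin.≟ i
    ... | yes refl = loopless g j
    ... | no ne    = iso j ne
    total : order g + ∑ F (λ j → ⟦ isolated? g j ⟧) ≡ suc n
    total = trans (sym (∑-+ F (active g) (λ j → ⟦ isolated? g j ⟧))) (trans (∑-cong F (λ j → complement (isolated? g j))) (trans (∑-const (suc n) 1) (*-identityʳ (suc n))))
      where
      complement : ∀ {P : Set} (d : Dec P) → ⟦ ¬? d ⟧ + ⟦ d ⟧ ≡ 1
      complement (yes _) = refl
      complement (no _)  = refl

  module Normal (invertible : ∀ k → k ≢ 0 → ¬ ¬ (∃ λ y → y R.* k · R.1# R.≈ R.1#)) (n : ℕ) where
    -- One less than the number of vertices, hence the greatest order that a graph with an isolated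
    -- vertex can have.
    m : ℕ
    m = suc n

    Factor : Multigraph (2 + n) → Set
    Factor u = order u ≢ 0 × ¬ HasIsolatedEdge u × order u ≤ m

    Crowded : Multigraph (2 + n) → Multigraph (2 + n) → Set
    Crowded s t = m < order s + order t

    Normal : List (Multigraph (2 + n)) → Set
    Normal us = All Factor us × AllPairs Crowded us

    NF : Pred (Poly (2 + n)) _
    NF f = ∃₂ λ a us → Normal us × f ≡ pow a (Prod us)

    N : Pred (Poly (2 + n)) _
    N = Span NF

    N-e₁ : ∀ {f} → N f → N (e₁ ⊠ f)
    N-e₁ = Span-⊠ˡ e₁ λ { (a , us , nf , refl) → inc (suc a , us , nf , refl) }

    N-pow : ∀ a {f} → N f → N (pow a f)
    N-pow 0       x = x
    N-pow (suc a) x = N-e₁ (N-pow a x)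

    Normal-↭ : ∀ {us vs} → us ↭ vs → Normal us → Normal vs
    Normal-↭ p (a , b) = ↭.All-resp-↭ p a , AllPairs-resp-↭ (λ {s} {t} lt → subst (m <_) (+-comm (order s) (order t)) lt) p b

    -- By induction on the measure. A graph of order 0 gives the factor 1. An isolated edge of t is
    -- traded for e₁ and orbit sums of smaller order. A factor u with `order t + order u ≤ m` is
    -- merged with t, after which all orders are still at most m. If none of this applies, t may
    -- join the normal product as it is.
    absorb : ∀ fuel t us → order t ≤ m → Normal us → suc (order t) + weight us ≤ fuel → ¬ ¬ N (orbitSum t ⊠ Prod us)
    absorb (suc fuel) t us t≤m nf le with order t ≟ 0
    ... | yes e = return (resp (P.sym (P.trans (⊠-congʳ (Prod us) (orbitSum-empty t e)) ((⊠-identityˡ≋ (Prod us))))) (inc (0 , us , nf , refl)))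
    ... | no ≢0 with hasIsolatedEdge? t
    ...   | yes he with isolatedEdge-extK t he
    ...     | u , i with edge-product u
    -- With y the inverse of the multiplicity of `extK u` in the product, `edge-product` is solved
    -- for the orbit sum of t: it is y times e₁ times the orbit sum of `ext (ext u)`, minus y times
    -- `low`.
    ...       | low , sp , e = invertible (count (e₁ ⊠ orbitSum (ext (ext u))) (extK u)) (N≢0 u) >>= λ { (y , yx) →
              absorb fuel (ext (ext u)) us (≤-trans (<⇒≤ smaller) t≤m) nf (<-≤-trans′ smaller) >>= λ main →
              Span-⊠ʳ¬¬ (Prod us) (λ { (w , lw , refl) → absorb fuel w us (≤-trans (<⇒≤ (low-smaller lw)) t≤m) nf (<-≤-trans′ (low-smaller lw)) }) sp >>= λ rest →
              return (resp (P.trans (P.sym (⊠-congʳ′ y low)) (⊠-congʳ (Prod us) (isolate y yx low e i))) (plus (scal y (N-e₁ main)) (scal (R.- y) rest))) }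
      where
      smaller : order (ext (ext u)) < order t
      smaller = ≤-trans (s≤s (≤-trans (≤-reflexive (trans (order-ext (ext u)) (order-ext u))) (n≤1+n _))) (≤-reflexive (trans (sym (order-extK u)) (order-Iso i)))
      low-smaller : ∀ {w} → order w < order (extK u) → order w < order t
      low-smaller lw = ≤-trans lw (≤-reflexive (order-Iso i))
      <-≤-trans′ : ∀ {k} → k < order t → suc k + weight us ≤ fuel
      <-≤-trans′ k< = ≤-trans (+-monoˡ-≤ (weight us) k<) (s≤s⁻¹ le)
      ⊠-congʳ′ : ∀ y low → (scale y (e₁ ⊠ orbitSum (ext (ext u))) ++ scale (R.- y) low) ⊠ Prod us ≋ scale y (e₁ ⊠ (orbitSum (ext (ext u)) ⊠ Prod us)) ++ scale (R.- y) (low ⊠ Prod us)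
      ⊠-congʳ′ y low = P.trans (P.reflexive (++-⊠ (scale y (e₁ ⊠ orbitSum (ext (ext u)))) (scale (R.- y) low) (Prod us)))
        (++-cong (P.trans ((scale-⊠≋ y (e₁ ⊠ orbitSum (ext (ext u))) (Prod us))) (scale-cong y ((⊠-assoc≋ e₁ (orbitSum (ext (ext u))) (Prod us))))) ((scale-⊠≋ (R.- y) low (Prod us))))
        where
        scale-cong : ∀ y {f g : Poly (2 + n)} → f ≋ g → scale y f ≋ scale y g
        scale-cong y {f} {g} e = at λ k → R.trans (coeff-scale y f k) (R.trans (R.*-congˡ (same e k)) (R.sym (coeff-scale y g k)))
      isolate : ∀ y → y R.* count (e₁ ⊠ orbitSum (ext (ext u))) (extK u) · R.1# R.≈ R.1# → ∀ low →
        e₁ ⊠ orbitSum (ext (ext u)) ≋ scale (count (e₁ ⊠ orbitSum (ext (ext u))) (extK u) · R.1#) (orbitSum (extK u)) ++ low → Iso (extK u) t →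
        scale y (e₁ ⊠ orbitSum (ext (ext u))) ++ scale (R.- y) low ≋ orbitSum t
      isolate y yx low e i = at λ k → begin
        coeff (scale y (e₁ ⊠ O′) ++ scale (R.- y) low) k ≈⟨ R.trans (coeff-++ (scale y (e₁ ⊠ O′)) _ k) (R.+-cong (coeff-scale y (e₁ ⊠ O′) k) (coeff-scale (R.- y) low k)) ⟩
        y R.* coeff (e₁ ⊠ O′) k R.+ R.- y R.* coeff low k ≈⟨ R.+-congʳ (R.*-congˡ (R.trans (same e k) (R.trans (coeff-++ (scale x O) low k) (R.+-congʳ (coeff-scale x O k))))) ⟩
        y R.* (x R.* coeff O k R.+ coeff low k) R.+ R.- y R.* coeff low k ≈⟨ R.+-cong (R.distribˡ y _ _) (R.sym (-‿distribˡ-* y _)) ⟩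
        y R.* (x R.* coeff O k) R.+ y R.* coeff low k R.+ R.- (y R.* coeff low k) ≈⟨ R.trans (R.+-assoc _ _ _) (R.trans (R.+-congˡ (R.-‿inverseʳ _)) (R.+-identityʳ _)) ⟩
        y R.* (x R.* coeff O k) ≈⟨ R.trans (R.sym (R.*-assoc y x _)) (R.trans (R.*-congʳ yx) (R.*-identityˡ _)) ⟩
        coeff O k ≈⟨ same (orbitSum-cong i) k ⟩
        coeff (orbitSum t) k ∎
        where
        open import Relation.Binary.Reasoning.Setoid R.setoid
        open import Algebra.Properties.Ring R.ring using (-‿distribˡ-*)
        O = orbitSum (extK u)
        O′ = orbitSum (ext (ext u))
        x = count (e₁ ⊠ O′) (extK u) · R.1#
    absorb (suc fuel) t us t≤m nf le | no ≢0 | no ne with any? (λ u → order t + order u ≤? m) us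
    ... | no none = return (inc (0 , t ∷ us , ((≢0 , ne , t≤m) ∷ proj₁ nf , All.map ≰⇒> (All.¬Any⇒All¬ us none) ∷ proj₂ nf) , refl))
    ... | yes a with u , us′ , fits , p ← pull a with (_ ∷ fs) , (_ ∷ cs) ← Normal-↭ p nf =
          Span-⊠ʳ¬¬ (Prod us′) (λ { {f} (w , w≤ , refl) → absorb fuel w us′ (≤-trans w≤ fits) (fs , cs) (bound w w≤) }) (IsInvariant-merge t u) >>= λ x →
          return (resp (P.trans ((⊠-assoc≋ (orbitSum t) (orbitSum u) (Prod us′))) (⊠-congˡ (orbitSum t) (P.sym (Prod-↭ p)))) x)
      where
      bound : ∀ w → order w ≤ order t + order u → suc (order w) + weight us′ ≤ fuel
      bound w w≤ = s≤s⁻¹ (≤-trans (s≤s (s≤s (+-monoˡ-≤ (weight us′) w≤))) (≤-trans (≤-reflexive arith) le))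
        where
        arith : suc (suc (order t + order u + weight us′)) ≡ suc (order t) + weight us
        arith = trans (cong (λ z → suc (suc z)) (+-assoc (order t) (order u) (weight us′))) (trans (cong suc (sym (+-suc (order t) (order u + weight us′)))) (cong (suc (order t) +_) (sym (weight-↭ p))))

    N-orbit : ∀ t → order t ≤ m → ∀ {f} → N f → ¬ ¬ N (orbitSum t ⊠ f)
    N-orbit t t≤m {f} x = Span-⊠ʳ¬¬ (orbitSum t) (λ { (a , us , nf , refl) → absorb _ t us t≤m nf ≤-refl >>= λ y →
      return (resp (P.trans (P.sym (pull-out a (Prod us))) ((⊠-comm≋ (orbitSum t) (pow a (Prod us))))) (N-pow a y)) }) x >>= λ y → return (resp ((⊠-comm≋ f (orbitSum t))) y)
      where
      pull-out : ∀ a f → orbitSum t ⊠ pow a f ≋ pow a (orbitSum t ⊠ f)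
      pull-out 0       f = P.refl
      pull-out (suc a) f = P.trans (⊠-swap (orbitSum t) e₁ (pow a f)) (⊠-congˡ e₁ (pull-out a f))

    N-Prod : ∀ us → All Factor us → ∀ {f} → N f → ¬ ¬ N (Prod us ⊠ f)
    N-Prod []       []       {f} x = return (resp (P.sym ((⊠-identityˡ≋ f))) x)
    N-Prod (u ∷ us) (φ ∷ φs) {f} x = N-Prod us φs x >>= λ y → N-orbit u (proj₂ (proj₂ φ)) y >>= λ z →
      return (resp (P.sym ((⊠-assoc≋ (orbitSum u) (Prod us) f))) z)

    N-⊠ : ∀ {f g} → N f → N g → ¬ ¬ N (f ⊠ g)
    N-⊠ {g = g} x y = Span-⊠ʳ¬¬ g (λ { (a , us , nf , refl) → N-Prod us (proj₁ nf) y >>= λ z → return (resp (P.sym (pull-out a (Prod us))) (N-pow a z)) }) x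
      where
      pull-out : ∀ a f → pow a f ⊠ g ≋ pow a (f ⊠ g)
      pull-out 0       f = P.refl
      pull-out (suc a) f = P.trans ((⊠-assoc≋ e₁ (pow a f) g)) (⊠-congˡ e₁ (pull-out a f))

    ⊠-one : ∀ (f : Poly (2 + n)) → f ⊠ one ≋ f
    ⊠-one f = P.trans ((⊠-comm≋ f one)) ((⊠-identityˡ≋ f))

    subalgebra-N : ∀ {f : Poly (2 + n)} → Subalgebra (OrbitSums R HasIsolatedVertex) f → ¬ ¬ N f
    subalgebra-N (gen (g , iso , refl)) = absorb _ g [] (order-isolated g iso) ([] , []) ≤-refl >>= λ x →
      return (resp (P.trans (⊠-one (orbitSum g)) (P.reflexive (orbitSum-≡ g))) x)
    subalgebra-N (con a) = return (resp (at λ k → R.trans (coeff-scale a one k) (R.trans (R.*-congˡ (coeff-pair one k)) (R.trans (R.*-congˡ (R.+-identityʳ _))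
      (R.sym (R.trans (coeff-pair (const a) k) (R.trans (R.+-identityʳ _) (R.*-congˡ (R.sym (R.*-identityˡ _))))))))) (scal a (inc (0 , [] , ([] , []) , refl))))
    subalgebra-N (add x y) = subalgebra-N x >>= λ x′ → subalgebra-N y >>= λ y′ → return (plus x′ y′)
    subalgebra-N (mul x y) = subalgebra-N x >>= λ x′ → subalgebra-N y >>= λ y′ → N-⊠ x′ y′
    subalgebra-N (Subalgebra.resp e x) = subalgebra-N x >>= λ x′ → return (resp (at e) x′)

-- Lists of generators by degree, and products as multisets of them.

module Generators (q-1 : ℕ) {c ℓ} (R : CommutativeRing c ℓ) where
  open Sums
  open Permutations
  open CycleTypes
  open OrbitSizes (suc q-1)
  open PairRotations q-1
  open FixedGraphs q-1
  open Representatives q-1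
  open Extensions q-1
  open PrimeGraphs q-1
  open OrbitPolynomials q-1 R
  open Orders q-1 R
  open NormalForms q-1 R
  open import Defs hiding (permutations-complete)
  open Polynomials R hiding (GeneratesInvariants; OrbitSums; _≈_)
  open Convolution R
  open import Data.Bool.Base using (Bool; true; false; if_then_else_)
  open import Data.Fin.Base as Fin using (Fin; zero; suc)
  import Data.Fin.Properties as Fin
  open import Data.List.Base using (List; []; _∷_; _++_; map; allFin; replicate; concatMap; upTo; length)
  import Data.List.Properties as List
  open import Data.List.Membership.Propositional using (_∈_; find; lose)
  import Data.List.Membership.Propositional.Properties as ∈
  open import Data.List.Relation.Binary.Permutation.Propositional as ↭ using (_↭_; prep)
  open import Data.List.Relation.Unary.All using (All; []; _∷_)
  import Data.List.Relation.Unary.All as All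
  import Data.List.Relation.Unary.All.Properties as All
  open import Data.List.Relation.Unary.AllPairs using ([]; _∷_)
  open import Data.List.Relation.Unary.Any using (Any; here; there)
  import Data.List.Relation.Unary.Any as Any
  import Data.List.Relation.Unary.Any.Properties as Any
  open import Data.Nat.Base hiding (ℕ; suc; _⊔_)
  open import Data.Nat.Properties
  open import Data.Product.Base using (_×_; _,_; ∃; ∃₂)
  open import Function.Base using (_∘_)
  open import Relation.Binary.PropositionalEquality hiding (_≗_; resp)
  open import Relation.Nullary using (Dec; yes; no; does; ¬_; contradiction)

  private
    module R = CommutativeRing R
    variable
      n : ℕ

  -- Meets every pair once, unlike `size`, so that degrees of products are plain sums.
  edges : Multigraph n → ℕ
  edges {0}     g = 0
  edges {suc n} g = ∑ (allFin n) (λ j → mult g zero (suc j)) + edges (dropVertex g)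

  edges-size : ∀ (g : Multigraph n) → HasEdges (edges g) g
  edges-size {0}     g = refl
  edges-size {suc n} g = trans (size-cong {g = g} {joinVertex row (dropVertex g)} split) (trans (size-join row (dropVertex g))
    (trans (cong (2 * ∑ (allFin n) row +_) (edges-size (dropVertex g))) (sym (*-distribˡ-+ 2 (∑ (allFin n) row) (edges (dropVertex g))))))
    where
    row : Fin n → ℕ
    row j = mult g zero (suc j)
    split : g ≗ joinVertex row (dropVertex g)
    split zero    zero    = loopless g zero
    split zero    (suc j) = refl
    split (suc i) zero    = symmetric g _ _
    split (suc i) (suc j) = refl

  edges-unique : ∀ {e} {g : Multigraph n} → HasEdges e g → edges g ≡ e
  edges-unique {g = g} h = *-cancelˡ-≡ _ _ 2 (trans (sym (edges-size g)) h)

  size-⊕ : ∀ (g h : Multigraph n) → size (g ⊕ h) ≡ size g + size h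
  size-⊕ {n} g h = trans (∑-cong (allFin n) (λ i → ∑-+ (allFin n) (mult g i) (mult h i))) (∑-+ (allFin n) (λ i → ∑ (allFin n) (mult g i)) (λ i → ∑ (allFin n) (mult h i)))

  size-Iso : ∀ {g h : Multigraph n} → Iso g h → size g ≡ size h
  size-Iso {g = g} {h} (via σ m) = size-Maps σ {g} {h} m

  edges-ext : ∀ (g : Multigraph n) → edges (ext g) ≡ edges g
  edges-ext {n} g = edges-unique {g = ext g} (trans (size-ext g) (edges-size g))

  totalEdges : List (Multigraph n) → ℕ
  totalEdges us = ∑ us edges

  totalEdges-↭ : ∀ {us vs : List (Multigraph n)} → us ↭ vs → totalEdges us ≡ totalEdges vs
  totalEdges-↭ ↭.refl       = refl
  totalEdges-↭ (prep u p)   = cong (edges u +_) (totalEdges-↭ p)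
  totalEdges-↭ {vs = _ ∷ _ ∷ vs} (↭.swap s t p) = trans (x∙yz≈y∙xz (edges s) (edges t) _) (cong (λ z → edges t + (edges s + z)) (totalEdges-↭ p))
    where open import Algebra.Properties.CommutativeSemigroup +-commutativeSemigroup using (x∙yz≈y∙xz)
  totalEdges-↭ (↭.trans p r) = trans (totalEdges-↭ p) (totalEdges-↭ r)

  Prod-monomials : ∀ (us : List (Multigraph n)) → All (HasEdges (totalEdges us)) (monomials (Prod us))
  Prod-monomials {n} []       = trans (∑-cong (allFin n) (λ _ → ∑-zero (allFin n))) (∑-zero (allFin n)) ∷ []
  Prod-monomials (u ∷ us) = ⊠-monomials (orbitSum u) (Prod us) (orbitSum-monomials u) (Prod-monomials us)
    (λ {h} {k} i s → trans (size-⊕ h k) (trans (cong₂ _+_ (trans (sym (size-Iso i)) (edges-size u)) s) (sym (*-distribˡ-+ 2 (edges u) (totalEdges us)))))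

  Prod-degree : ∀ (us : List (Multigraph n)) {e} g → HasEdges e g → totalEdges us ≢ e → coeff (Prod us) g R.≈ R.0#
  Prod-degree us {e} g s ne = coeff-none (Prod us) {g} (λ a → let h , h∈ , eq = find a in
    ne (*-cancelˡ-≡ _ _ 2 (trans (sym (All.lookup (Prod-monomials us) h∈)) (trans (size-cong {g = h} {g} eq) s))))

  order-full : ∀ (g : Multigraph n) → ¬ HasIsolated g → order g ≡ n
  order-full {n} g none = trans (∑-cong (allFin n) (λ i → ⟦⟧-yes (¬? (isolated? g i)) (λ iso → none (i , iso)))) (trans (∑-const n 1) (*-identityʳ n))
    where open import Relation.Nullary.Decidable using (¬?)

  -- The graphs on N vertices without isolated edge, with e edges and an order
  -- selected by sel, up to isomorphism.

  gens : (ℕ → Bool) → ∀ N → ℕ → List (Multigraph N)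
  gens sel zero    e = []
  gens sel (suc N) e = map ext (gens sel N e) ++ (if sel (suc N) then primes (suc N) e else [])

  -- Isolated vertices are removed one at a time, which changes neither the order nor the edges.
  -- What remains has full order and no isolated edge, so it is isomorphic to a prime
  -- representative.
  gens-complete : ∀ sel N e → 2 * e < q → ∀ (u : Multigraph N) → HasEdges e u → ¬ HasIsolatedEdge u → order u ≢ 0 → sel (order u) ≡ true → Any (Iso u) (gens sel N e)
  gens-complete sel zero    e e<q u s ne ≢0 ok = contradiction refl ≢0
  gens-complete sel (suc N) e e<q u s ne ≢0 ok with hasIsolated? u
  ... | yes hi with w , i ← isolated-ext u hi = Any.++⁺ˡ (Any.map⁺ (Any.map (λ j → Iso-trans (Iso-sym i) (ext-Iso j))
        (gens-complete sel N e e<q w (trans (sym (size-ext w)) (trans (size-Iso i) s)) (λ he → ne (HasIsolatedEdge-Iso i (ext-HasIsolatedEdge w he)))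
          (λ z → ≢0 (trans (sym same-order) z)) (trans (cong sel same-order) ok))))
        where
        same-order : order w ≡ order u
        same-order = trans (sym (order-ext w)) (order-Iso i)
  ... | no nh = Any.++⁺ʳ (map ext (gens sel N e)) (subst (λ b → Any (Iso u) (if b then primes (suc N) e else [])) (sym (trans (cong sel (sym (order-full u nh))) ok)) in-primes)
    where
    in-primes : Any (Iso u) (primes (suc N) e)
    in-primes with r , r∈ , i ← find (∑-∈ (iso? u) (reps (suc N) e) λ z → contradiction (trans (sym z) (reps-once e u e<q s)) λ ()) =
      lose (∈.∈-filter⁺ prime? r∈ ((λ hi → nh (HasIsolated-Iso (Iso-sym i) hi)) , λ he → ne (HasIsolatedEdge-Iso (Iso-sym i) he))) i

  gens-edges : ∀ sel N e → All (λ g → edges g ≡ e) (gens sel N e)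
  gens-edges sel zero    e = []
  gens-edges sel (suc N) e = All.++⁺ (All.map⁺ (All.map (λ {g} eq → trans (edges-ext g) eq) (gens-edges sel N e))) (lemma (sel (suc N)))
    where
    lemma : ∀ b → All (λ g → edges g ≡ e) (if b then primes (suc N) e else [])
    lemma true  = All.filter⁺ prime? (All.map (λ {g} s → edges-unique {g = g} s) (reps-edges (suc N) e))
    lemma false = []

  gens-length : ∀ sel N e → length (gens sel N e) ≡ ∑ (upTo N) (λ v → if sel (suc v) then length (primes (suc v) e) else 0)
  gens-length sel zero    e = refl
  gens-length sel (suc N) e = trans (List.length-++ (map ext (gens sel N e))) (trans (cong₂ _+_ (trans (List.length-map ext (gens sel N e)) (gens-length sel N e)) (lemma (sel (suc N))))
    (sym (∑-upTo-suc N _)))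
    where
    lemma : ∀ b → length (if b then primes (suc N) e else []) ≡ (if b then length (primes (suc N) e) else 0)
    lemma true  = refl
    lemma false = refl
    ∑-upTo-suc : ∀ N φ → ∑ (upTo (suc N)) φ ≡ ∑ (upTo N) φ + φ N
    ∑-upTo-suc zero    φ = +-comm (φ 0) 0
    ∑-upTo-suc (suc N) φ = trans (cong (φ 0 +_) (trans (∑-applyUpTo (suc N) suc φ) (∑-upTo-suc N (φ ∘ suc))))
      (trans (sym (+-assoc (φ 0) _ _)) (cong (_+ φ (suc N)) (cong (φ 0 +_) (sym (∑-applyUpTo N suc φ)))))

  -- The multisets of total weight d of elements of a weighted list.

  multisets : ∀ {A : Set} → List (ℕ × A) → ℕ → List (List A)
  multisets []            0       = [] ∷ []
  multisets []            (suc d) = []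
  multisets ((e , g) ∷ Γ) d       = concatMap (λ k → if does (k * e ≤? d) then map (replicate k g ++_) (multisets Γ (d ∸ k * e)) else []) (upTo (suc d))

  ∈-if : ∀ {A : Set} {P : Set} (P? : Dec P) {x : A} {xs} → x ∈ (if does P? then xs else []) → P × x ∈ xs
  ∈-if (yes p) x∈ = p , x∈

  if-∈ : ∀ {A : Set} {P : Set} (P? : Dec P) {x : A} {xs} → P → x ∈ xs → x ∈ (if does P? then xs else [])
  if-∈ (yes _) p x∈ = x∈
  if-∈ (no ¬p) p x∈ = contradiction p ¬p

  multisets-∷⁻ : ∀ {A : Set} e (g : A) Γ d {w} → w ∈ multisets ((e , g) ∷ Γ) d → ∃₂ λ k w′ → k ≤ d × k * e ≤ d × w′ ∈ multisets Γ (d ∸ k * e) × w ≡ replicate k g ++ w′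
  multisets-∷⁻ e g Γ d w∈ with k , k∈ , w∈k ← find (Any.concatMap⁻ (λ k → if does (k * e ≤? d) then map (replicate k g ++_) (multisets Γ (d ∸ k * e)) else []) w∈)
    with le , w∈′ ← ∈-if (k * e ≤? d) w∈k with w′ , w′∈ , eq ← ∈.∈-map⁻ (replicate k g ++_) w∈′ = k , w′ , s≤s⁻¹ (∈.∈-upTo⁻ k∈) , le , w′∈ , eq

  multisets-∷⁺ : ∀ {A : Set} e (g : A) Γ d k {w′} → k ≤ d → k * e ≤ d → w′ ∈ multisets Γ (d ∸ k * e) → (replicate k g ++ w′) ∈ multisets ((e , g) ∷ Γ) d
  multisets-∷⁺ e g Γ d k k≤d le w′∈ = Any.concatMap⁺ (λ k → if does (k * e ≤? d) then map (replicate k g ++_) (multisets Γ (d ∸ k * e)) else [])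
    (lose (∈.∈-upTo⁺ (s≤s k≤d)) (if-∈ (k * e ≤? d) le (∈.∈-map⁺ (replicate k g ++_) w′∈)))

  Prod-++ : ∀ (us vs : List (Multigraph n)) → Prod (us ++ vs) ≋ Prod us ⊠ Prod vs
  Prod-++ []       vs = P.sym (⊠-identityˡ≋ (Prod vs))
  Prod-++ (u ∷ us) vs = P.trans (⊠-congˡ (orbitSum u) (Prod-++ us vs)) (P.sym (⊠-assoc≋ (orbitSum u) (Prod us) (Prod vs)))

  -- The multiplicity of the listed graph isomorphic to u goes up by 1, and the product depends only
  -- on the classes of its factors. As u has edges, multiplicities never exceed the degree, which is
  -- where the enumeration stops.
  multisets-insert : ∀ (Γ : List (ℕ × Multigraph n)) d {w} u → edges u ≢ 0 → Any (λ (e , g) → e ≡ edges u × Iso u g) Γ → w ∈ multisets Γ d →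
    ∃ λ w′ → w′ ∈ multisets Γ (edges u + d) × orbitSum u ⊠ Prod w ≋ Prod w′
  multisets-insert ((e , g) ∷ Γ) d u ≢0 (here (refl , i)) w∈ with k , w′ , k≤d , le , w′∈ , refl ← multisets-∷⁻ e g Γ d w∈ =
    replicate (suc k) g ++ w′ , multisets-∷⁺ e g Γ (e + d) (suc k) (≤-trans (m≤m*n (suc k) e {{≢-nonZero ≢0}}) le′) le′ (subst (λ z → w′ ∈ multisets Γ z) (sym ([m+n]∸[m+o]≡n∸o e d (k * e))) w′∈) ,
    ⊠-congʳ (Prod (replicate k g ++ w′)) (orbitSum-cong i)
    where
    le′ : suc k * e ≤ e + d
    le′ = +-monoʳ-≤ e le
  multisets-insert ((e , g) ∷ Γ) d u ≢0 (there a) w∈ with k , w′ , k≤d , le , w′∈ , refl ← multisets-∷⁻ e g Γ d w∈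
    with w″ , w″∈ , eq ← multisets-insert Γ (d ∸ k * e) u ≢0 a w′∈ =
    replicate k g ++ w″ , multisets-∷⁺′ , P.trans (⊠-congˡ (orbitSum u) (Prod-++ (replicate k g) w′)) (P.trans (⊠-swap (orbitSum u) (Prod (replicate k g)) (Prod w′))
      (P.trans (⊠-congˡ (Prod (replicate k g)) eq) (P.sym (Prod-++ (replicate k g) w″))))
    where
    le′ : k * e ≤ edges u + d
    le′ = ≤-trans le (m≤n+m d (edges u))
    multisets-∷⁺′ : (replicate k g ++ w″) ∈ multisets ((e , g) ∷ Γ) (edges u + d)
    multisets-∷⁺′ = multisets-∷⁺ e g Γ (edges u + d) k (≤-trans k≤d (m≤n+m d (edges u))) le′ (subst (λ z → w″ ∈ multisets Γ z) (sym (+-∸-assoc (edges u) le)) w″∈)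

  multisets-collect : ∀ (Γ : List (ℕ × Multigraph n)) us → All (λ u → edges u ≢ 0 × Any (λ (e , g) → e ≡ edges u × Iso u g) Γ) us →
    ∃ λ w → w ∈ multisets Γ (totalEdges us) × Prod us ≋ Prod w
  multisets-collect Γ []       []             = [] , empty Γ , P.refl
    where
    empty : ∀ {A : Set} (Γ : List (ℕ × A)) → [] ∈ multisets Γ 0
    empty []            = here refl
    empty ((e , g) ∷ Γ) = multisets-∷⁺ e g Γ 0 0 z≤n z≤n (empty Γ)
  multisets-collect Γ (u ∷ us) ((≢0 , a) ∷ as) with w , w∈ , eq ← multisets-collect Γ us as with w′ , w′∈ , eq′ ← multisets-insert Γ (totalEdges us) u ≢0 a w∈ =
    w′ , w′∈ , P.trans (⊠-congˡ (orbitSum u) eq) eq′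

-- The number of multisets of given total weight.

module Blocks where
  open Sums
  open import Data.Bool.Base using (true; false; if_then_else_)
  open import Data.List.Base using (List; []; _∷_; _++_; replicate; concatMap; upTo; applyUpTo)
  import Data.List.Properties as List
  open import Data.Nat.Base
  open import Data.Nat.DivMod using (_/_; m*n/n≡m)
  open import Data.Nat.Induction using (<-rec)
  open import Data.Nat.Properties
  open import Data.Nat.Tactic.RingSolver using (solve-∀)
  open import Data.Product.Base using (_×_; _,_)
  open import Function.Base using (_∘_)
  open import Relation.Binary.PropositionalEquality
  open import Relation.Nullary using (Dec; yes; no)

  ∑-applyUpTo′ : ∀ n f φ → ∑ (applyUpTo f n) φ ≡ ∑ (upTo n) (φ ∘ f)
  ∑-applyUpTo′ zero    f φ = refl
  ∑-applyUpTo′ (suc n) f φ = cong (φ (f 0) +_) (trans (∑-applyUpTo′ n (f ∘ suc) φ) (sym (∑-applyUpTo′ n suc (φ ∘ f))))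

  -- The number of multisets of k elements out of r.

  multichoose : ℕ → ℕ → ℕ
  multichoose r       0       = 1
  multichoose 0       (suc k) = 0
  multichoose (suc r) (suc k) = multichoose r (suc k) + multichoose (suc r) k

  -- With the value (r + k - 1 choose k), the ratios of neighbours in both directions. The two
  -- identities need each other in a joint induction by Pascal's rule; this one allows a row to be
  -- computed by exact divisions.
  multichoose-step : ∀ r k → suc k * multichoose r (suc k) ≡ (r + k) * multichoose r k
  multichoose-shift : ∀ r k → r * multichoose (suc r) k ≡ (r + k) * multichoose r k

  multichoose-step 0       0       = refl
  multichoose-step 0       (suc k) = trans (*-zeroʳ (suc (suc k))) (sym (*-zeroʳ (suc k)))
  multichoose-step (suc r) k = begin
    suc k * (multichoose r (suc k) + multichoose (suc r) k) ≡⟨ *-distribˡ-+ (suc k) (multichoose r (suc k)) _ ⟩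
    suc k * multichoose r (suc k) + suc k * multichoose (suc r) k ≡⟨ cong (_+ suc k * multichoose (suc r) k) (trans (multichoose-step r k) (sym (multichoose-shift r k))) ⟩
    r * multichoose (suc r) k + suc k * multichoose (suc r) k ≡⟨ *-distribʳ-+ (multichoose (suc r) k) r (suc k) ⟨
    (r + suc k) * multichoose (suc r) k ≡⟨ cong (_* multichoose (suc r) k) (+-suc r k) ⟩
    (suc r + k) * multichoose (suc r) k ∎
    where open ≡-Reasoning
  multichoose-shift r 0       = cong (_* 1) (sym (+-identityʳ r))
  multichoose-shift r (suc k) = begin
    r * (multichoose r (suc k) + multichoose (suc r) k) ≡⟨ *-distribˡ-+ r (multichoose r (suc k)) _ ⟩
    r * multichoose r (suc k) + r * multichoose (suc r) k ≡⟨ cong (r * multichoose r (suc k) +_) (trans (multichoose-shift r k) (sym (multichoose-step r k))) ⟩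
    r * multichoose r (suc k) + suc k * multichoose r (suc k) ≡⟨ *-distribʳ-+ (multichoose r (suc k)) r (suc k) ⟨
    (r + suc k) * multichoose r (suc k) ∎
    where open ≡-Reasoning

  size-multisets : List ℕ → ℕ → ℕ
  size-multisets []       d = ⟦ d ≟ 0 ⟧
  size-multisets (e ∷ es) d = ∑ (upTo (suc d)) (λ k → ⟦ k * e ≤? d ⟧ * size-multisets es (d ∸ k * e))

  -- The same for r elements of weight e in addition to the rest.

  convolve : (ℕ → ℕ) → ℕ → (ℕ → ℕ) → ℕ → ℕ
  convolve c e F d = ∑ (upTo (suc d)) (λ k → ⟦ k * e ≤? d ⟧ * (c k * F (d ∸ k * e)))

  ∑-extend : ∀ m n φ → m ≤ n → (∀ k → m ≤ k → φ k ≡ 0) → ∑ (upTo n) φ ≡ ∑ (upTo m) φ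
  ∑-extend 0       n       φ _  z = trans (∑-cong (upTo n) (λ k → z k z≤n)) (∑-zero (upTo n))
  ∑-extend (suc m) (suc n) φ le z = cong (φ 0 +_) (trans (∑-applyUpTo′ n suc φ) (trans (∑-extend m n (φ ∘ suc) (s≤s⁻¹ le) (λ k m≤k → z (suc k) (s≤s m≤k))) (sym (∑-applyUpTo′ m suc φ))))

  guarded : ∀ (c : ℕ → ℕ) e (F : ℕ → ℕ) d k → d < k * e → ⟦ k * e ≤? d ⟧ * (c k * F (d ∸ k * e)) ≡ 0
  guarded c e F d k lt = cong (_* (c k * F (d ∸ k * e))) (⟦⟧-no (k * e ≤? d) (<⇒≱ lt))

  convolve-long : ∀ (c : ℕ → ℕ) e (F : ℕ → ℕ) d n → e ≢ 0 → d < n → ∑ (upTo n) (λ k → ⟦ k * e ≤? d ⟧ * (c k * F (d ∸ k * e))) ≡ convolve c e F d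
  convolve-long c e F d n e≢0 d<n = ∑-extend (suc d) n _ d<n (λ k d<k → guarded c e F d k (≤-trans d<k (m≤m*n k e {{≢-nonZero e≢0}})))

  convolve-suc : ∀ c e F d → e ≢ 0 → convolve c e F d ≡ c 0 * F d + ⟦ e ≤? d ⟧ * convolve (c ∘ suc) e F (d ∸ e)
  convolve-suc c e F d e≢0 = cong₂ _+_ (+-identityʳ (c 0 * F d)) (trans (∑-applyUpTo′ d suc _) (rest (e ≤? d)))
    where
    rest : (e? : Dec (e ≤ d)) → ∑ (upTo d) (λ k → ⟦ suc k * e ≤? d ⟧ * (c (suc k) * F (d ∸ suc k * e))) ≡ ⟦ e? ⟧ * convolve (c ∘ suc) e F (d ∸ e)
    rest (no e≰d) = trans (∑-cong (upTo d) (λ k → guarded c e F d (suc k) (<-≤-trans (≰⇒> e≰d) (m≤m+n e (k * e))))) (∑-zero (upTo d))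
    rest (yes e≤d) = trans (∑-cong (upTo d) (λ k → cong₂ _*_ (⟦⟧-cong (suc k * e ≤? d) (k * e ≤? d ∸ e)
        (λ le → ≤-trans (≤-reflexive (sym (m+n∸m≡n e (k * e)))) (∸-monoˡ-≤ e le)) (λ le → ≤-trans (+-monoʳ-≤ e le) (≤-reflexive (m+[n∸m]≡n e≤d))))
        (cong (λ z → c (suc k) * F z) (sym (∸-+-assoc d e (k * e))))))
      (trans (convolve-long (c ∘ suc) e F (d ∸ e) d e≢0 (∸-monoʳ-< {d} {e} {0} (n≢0⇒n>0 e≢0) e≤d)) (sym (+-identityʳ _)))

  convolve-+ : ∀ c c′ e F d → convolve (λ k → c k + c′ k) e F d ≡ convolve c e F d + convolve c′ e F d
  convolve-+ c c′ e F d = trans (∑-cong (upTo (suc d)) (λ k → arith ⟦ k * e ≤? d ⟧ (c k) (c′ k) (F (d ∸ k * e)))) (∑-+ (upTo (suc d)) (λ k → ⟦ k * e ≤? d ⟧ * (c k * F (d ∸ k * e))) (λ k → ⟦ k * e ≤? d ⟧ * (c′ k * F (d ∸ k * e))))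
    where
    arith : ∀ g a b f → g * ((a + b) * f) ≡ g * (a * f) + g * (b * f)
    arith = solve-∀

  size-one : ∀ e es d → size-multisets (e ∷ es) d ≡ convolve (λ _ → 1) e (size-multisets es) d
  size-one e es d = ∑-cong (upTo (suc d)) (λ k → cong (⟦ k * e ≤? d ⟧ *_) (sym (+-identityʳ _)))

  -- Multiplication by one more factor 1 / (1 - x^e). If G counts with r elements of weight e and H
  -- with r + 1, then H d = G d + H (d - e), which is Pascal's rule for `multichoose` term by term;
  -- hence the induction on d inside the one on r.
  size-replicate : ∀ r e es → e ≢ 0 → ∀ d → size-multisets (replicate r e ++ es) d ≡ convolve (multichoose r) e (size-multisets es) d
  size-replicate 0       e es e≢0 d = sym (trans (convolve-suc (multichoose 0) e F d e≢0) (trans (cong₂ _+_ (+-identityʳ (F d))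
    (trans (cong (⟦ e ≤? d ⟧ *_) (trans (∑-cong (upTo (suc (d ∸ e))) (λ k → *-zeroʳ ⟦ k * e ≤? d ∸ e ⟧)) (∑-zero (upTo (suc (d ∸ e)))))) (*-zeroʳ ⟦ e ≤? d ⟧))) (+-identityʳ (F d))))
    where F = size-multisets es
  size-replicate (suc r) e es e≢0 = <-rec _ step
    where
    F = size-multisets es
    G = size-multisets (replicate r e ++ es)
    open ≡-Reasoning
    step : ∀ d → (∀ {d′} → d′ < d → size-multisets (replicate (suc r) e ++ es) d′ ≡ convolve (multichoose (suc r)) e F d′) →
           size-multisets (replicate (suc r) e ++ es) d ≡ convolve (multichoose (suc r)) e F d
    step d rec = begin
      size-multisets (e ∷ replicate r e ++ es) d ≡⟨ trans (size-one e (replicate r e ++ es) d) (convolve-suc (λ _ → 1) e G d e≢0) ⟩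
      1 * G d + ⟦ e ≤? d ⟧ * convolve (λ _ → 1) e G (d ∸ e)
        ≡⟨ cong₂ _+_ (trans (+-identityʳ (G d)) (trans (size-replicate r e es e≢0 d) (convolve-suc (multichoose r) e F d e≢0)))
             (⟦⟧-guard (e ≤? d) (λ e≤d → trans (sym (size-one e (replicate r e ++ es) (d ∸ e))) (rec (∸-monoʳ-< {d} {e} {0} (n≢0⇒n>0 e≢0) e≤d)))) ⟩
      1 * F d + ⟦ e ≤? d ⟧ * convolve (multichoose r ∘ suc) e F (d ∸ e) + ⟦ e ≤? d ⟧ * convolve (multichoose (suc r)) e F (d ∸ e)
        ≡⟨ +-assoc (1 * F d) _ _ ⟩
      1 * F d + (⟦ e ≤? d ⟧ * convolve (multichoose r ∘ suc) e F (d ∸ e) + ⟦ e ≤? d ⟧ * convolve (multichoose (suc r)) e F (d ∸ e))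
        ≡⟨ cong (1 * F d +_) (trans (sym (*-distribˡ-+ ⟦ e ≤? d ⟧ (convolve (multichoose r ∘ suc) e F (d ∸ e)) _)) (cong (⟦ e ≤? d ⟧ *_) (sym (convolve-+ (multichoose r ∘ suc) (multichoose (suc r)) e F (d ∸ e))))) ⟩
      1 * F d + ⟦ e ≤? d ⟧ * convolve (multichoose (suc r) ∘ suc) e F (d ∸ e) ≡⟨ convolve-suc (multichoose (suc r)) e F d e≢0 ⟨
      convolve (multichoose (suc r)) e F d ∎

  Blocks : Set
  Blocks = List (ℕ × ℕ)

  flatten : Blocks → List ℕ
  flatten = concatMap (λ (r , e) → replicate r e)

  block-count : Blocks → ℕ → ℕ
  block-count []             d = ⟦ d ≟ 0 ⟧
  block-count ((r , e) ∷ bs) d = convolve (multichoose r) e (block-count bs) d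

  open import Data.List.Relation.Unary.All using (All; []; _∷_)

  size-blocks : ∀ bs → All (λ (r , e) → e ≢ 0) bs → ∀ d → size-multisets (flatten bs) d ≡ block-count bs d
  size-blocks []             []           d = refl
  size-blocks ((r , e) ∷ bs) (e≢0 ∷ nz) d = trans (size-replicate r e (flatten bs) e≢0 d)
    (∑-cong (upTo (suc d)) (λ k → cong (λ z → ⟦ k * e ≤? d ⟧ * (multichoose r k * z)) (size-blocks bs nz (d ∸ k * e))))

  -- Tabulated versions for evaluation.

  at : List ℕ → ℕ → ℕ
  at []       _       = 0
  at (x ∷ xs) 0       = x
  at (x ∷ xs) (suc i) = at xs i

  at-applyUpTo : ∀ f n i → i < n → at (applyUpTo f n) i ≡ f i
  at-applyUpTo f (suc n) 0       _   = refl
  at-applyUpTo f (suc n) (suc i) i<n = at-applyUpTo (f ∘ suc) n i (s≤s⁻¹ i<n)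

  -- Computes a row from left to right, x being its entry at k. The division is exact by
  -- `multichoose-step`.
  multichooses : ℕ → ℕ → ℕ → ℕ → List ℕ
  multichooses r k x 0       = x ∷ []
  multichooses r k x (suc n) = x ∷ multichooses r (suc k) ((r + k) * x / suc k) n

  multichooses-correct : ∀ r k n i → i ≤ n → at (multichooses r k (multichoose r k) n) i ≡ multichoose r (k + i)
  multichooses-correct r k 0       0       le = cong (multichoose r) (sym (+-identityʳ k))
  multichooses-correct r k (suc n) 0       le = cong (multichoose r) (sym (+-identityʳ k))
  multichooses-correct r k (suc n) (suc i) le = trans (cong (λ z → at (multichooses r (suc k) z n) i)
    (trans (cong (_/ suc k) (trans (sym (multichoose-step r k)) (*-comm (suc k) (multichoose r (suc k))))) (m*n/n≡m (multichoose r (suc k)) (suc k))))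
    (trans (multichooses-correct r (suc k) n i (s≤s⁻¹ le)) (cong (multichoose r) (sym (+-suc k i))))

  -- dot e cs xs pairs cs with every e-th entry of the list xs.

  entry : ℕ → List ℕ → List ℕ → ℕ → ℕ
  entry e cs xs d = ∑ (upTo (suc d)) (λ k → if k * e ≤ᵇ d then at cs k * at xs (d ∸ k * e) else 0)

  table : ℕ → Blocks → List ℕ
  table D []             = applyUpTo (λ d → if d ≡ᵇ 0 then 1 else 0) (suc D)
  table D ((r , e) ∷ bs) = step (multichooses r 0 1 D) (table D bs)
    where
    step : List ℕ → List ℕ → List ℕ
    step cs xs = applyUpTo (entry e cs xs) (suc D)

  table-correct : ∀ D bs d → d ≤ D → at (table D bs) d ≡ block-count bs d
  table-correct D []             d d≤D = at-applyUpTo (λ d → if d ≡ᵇ 0 then 1 else 0) (suc D) d (s≤s d≤D)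
  table-correct D ((r , e) ∷ bs) d d≤D = trans (at-applyUpTo (entry e (multichooses r 0 1 D) (table D bs)) (suc D) d (s≤s d≤D)) (∑-upTo-cong (suc d) (λ k k<d → term k (s≤s⁻¹ k<d)))
    where
    ∑-upTo-cong : ∀ n {φ ψ} → (∀ k → k < n → φ k ≡ ψ k) → ∑ (upTo n) φ ≡ ∑ (upTo n) ψ
    ∑-upTo-cong 0       eq = refl
    ∑-upTo-cong (suc n) eq = cong₂ _+_ (eq 0 (s≤s z≤n)) (trans (∑-applyUpTo′ n suc _) (trans (∑-upTo-cong n (λ k k<n → eq (suc k) (s≤s k<n))) (sym (∑-applyUpTo′ n suc _))))
    term : ∀ k → k ≤ d → (if k * e ≤ᵇ d then at (multichooses r 0 1 D) k * at (table D bs) (d ∸ k * e) else 0) ≡ ⟦ k * e ≤? d ⟧ * (multichoose r k * block-count bs (d ∸ k * e))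
    term k k≤d = trans (cong (λ z → if k * e ≤ᵇ d then z else 0) (cong₂ _*_ (multichooses-correct r 0 D k (≤-trans k≤d d≤D)) (table-correct D bs (d ∸ k * e) (≤-trans (m∸n≤m d (k * e)) d≤D))))
      (lemma (k * e ≤ᵇ d))
      where
      lemma : ∀ b {x} → (if b then x else 0) ≡ (if b then 1 else 0) * x
      lemma true  = sym (+-identityʳ _)
      lemma false = refl

-- The number of normal forms in terms of the numbers of graphs.

module NormalCounts (q-1 : ℕ) where
  open Sums
  open Permutations
  open CycleTypes
  open OrbitSizes (suc q-1)
  open PairRotations q-1
  open FixedGraphs q-1
  open Representatives q-1
  open PrimeGraphs q-1
  open Blocks
  open import Defs using (loopless)
  open import Data.Bool.Base using (Bool; true; if_then_else_; _∧_)
  open import Data.Bool.Properties using (T-≡)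
  open import Data.Fin.Base using (zero; suc)
  open import Data.List.Base using (List; []; _∷_; applyUpTo; upTo; length)
  import Data.List.Properties as List
  open import Data.List.Relation.Unary.All using (All; []; _∷_)
  open import Data.Nat.Base hiding (ℕ; suc)
  open import Data.Nat.Properties
  open import Data.Product.Base using (_,_)
  open import Function.Bundles using (Equivalence)
  open import Relation.Binary.PropositionalEquality hiding (_≗_; resp)
  open import Relation.Nullary using (contradiction)

  between : ℕ → ℕ → ℕ → Bool
  between lo hi v = (lo ≤ᵇ v) ∧ (v ≤ᵇ hi)

  between-true : ∀ lo hi v → lo ≤ v → v ≤ hi → between lo hi v ≡ true
  between-true lo hi v le le′ = cong₂ _∧_ (Equivalence.to T-≡ (≤⇒≤ᵇ le)) (Equivalence.to T-≡ (≤⇒≤ᵇ le′))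

  selected : (ℕ → ℕ → ℕ) → (ℕ → Bool) → ℕ → ℕ → ℕ
  selected pc sel N e = ∑ (upTo N) (λ v → if sel (suc v) then pc (suc v) e else 0)

  -- The block (1 , 1) is the single edge, whose copies stand for the power of e₁. The prime graphs
  -- do not include it, since it is an isolated edge.
  blocks : (ℕ → ℕ → ℕ) → (ℕ → Bool) → ℕ → ℕ → Blocks
  blocks pc sel N d = (1 , 1) ∷ applyUpTo (λ e → selected pc sel N (suc e) , suc e) d

  -- The number of normal forms with d edges on m + 1 vertices. Here h is half
  -- of m: at most one factor has an order ≤ h.

  opaque
    normal-count : (ℕ → ℕ → ℕ) → ℕ → ℕ → ℕ → ℕ
    normal-count pc h m d = block-count (blocks pc (between (suc h) m) (suc m) d) d +
      ∑ (upTo h) (λ v → ∑ (upTo d) (λ e → selected pc (between (suc v) (suc v)) (suc m) (suc e) * block-count (blocks pc (between (m ∸ v) m) (suc m) d) (d ∸ suc e)))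

  prime-count : ℕ → ℕ → ℕ
  prime-count v e = length (primes v e)

  prime-count₁ : ∀ e → prime-count 1 (suc e) ≡ 0
  prime-count₁ e = n≤0⇒n≡0 (≤-trans (List.length-filter prime? (reps 1 (suc e))) (≤-reflexive (cong length (none (reps 1 (suc e)) (reps-edges 1 (suc e))))))
    where
    none : ∀ gs → All (HasEdges (suc e)) gs → gs ≡ []
    none []       _        = refl
    none (g ∷ gs) (eq ∷ _) = contradiction (trans (sym eq) (cong (λ z → z + 0 + 0) (loopless g zero))) λ ()

  -- The number of prime graphs in terms of the numbers c of all graphs.

  prime-formula : (ℕ → ℕ → ℕ) → ℕ → ℕ → ℕ
  prime-formula c 0                   e = 0
  prime-formula c 1                   e = 0
  prime-formula c 2                   e = c 2 e ∸ (c 1 e + c 0 (pred e))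
  prime-formula c (suc (suc (suc n))) e = (c (3 + n) e + c n (pred e)) ∸ (c (2 + n) e + c (1 + n) (pred e))

  prime-formula-correct : ∀ (c : ℕ → ℕ → ℕ) N d → 2 * d < q → (∀ v e → v ≤ N → e ≤ d → c v e ≡ length (reps v e)) →
    ∀ v e → v < N → e < d → prime-formula c (suc v) (suc e) ≡ prime-count (suc v) (suc e)
  prime-formula-correct c N d d<q agree 0 e v<N e<d = sym (prime-count₁ e)
  prime-formula-correct c N d d<q agree 1 e v<N e<d = trans (cong₂ _∸_ (agree 2 (suc e) v<N e<d) (cong₂ _+_ (agree 1 (suc e) (<⇒≤ v<N) e<d) (agree 0 e z≤n (<⇒≤ e<d))))
    (sym (primes-count₂ e (≤-<-trans (*-monoʳ-≤ 2 e<d) d<q)))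
  prime-formula-correct c N d d<q agree (suc (suc v)) e v<N e<d = trans (cong₂ _∸_ (cong₂ _+_ (agree (3 + v) (suc e) v<N e<d) (agree v e (<⇒≤ (<⇒≤ (<⇒≤ v<N))) (<⇒≤ e<d)))
      (cong₂ _+_ (agree (2 + v) (suc e) (<⇒≤ v<N) e<d) (agree (1 + v) e (<⇒≤ (<⇒≤ v<N)) (<⇒≤ e<d))))
    (sym (primes-count v e (≤-<-trans (*-monoʳ-≤ 2 e<d) d<q)))

  ∑-upTo-cong : ∀ n {φ ψ : ℕ → ℕ} → (∀ k → k < n → φ k ≡ ψ k) → ∑ (upTo n) φ ≡ ∑ (upTo n) ψ
  ∑-upTo-cong 0       eq = refl
  ∑-upTo-cong (suc n) eq = cong₂ _+_ (eq 0 (s≤s z≤n)) (trans (∑-applyUpTo n suc _) (trans (∑-upTo-cong n (λ k k<n → eq (suc k) (s≤s k<n))) (sym (∑-applyUpTo n suc _))))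

  tabulated-count : (ℕ → ℕ → ℕ) → ℕ → ℕ → ℕ → ℕ
  tabulated-count pc h m d = at (table d (blocks pc (between (suc h) m) (suc m) d)) d +
    -- The table is passed as an argument in order to be shared by all e.
    ∑ (upTo h) (λ v → with-small v (table d (blocks pc (between (m ∸ v) m) (suc m) d)))
    where
    with-small : ℕ → List ℕ → ℕ
    with-small v bs = ∑ (upTo d) (λ e → selected pc (between (suc v) (suc v)) (suc m) (suc e) * at bs (d ∸ suc e))

  module _ (pc pc′ : ℕ → ℕ → ℕ) (N d : ℕ) (agree : ∀ v e → v < N → e < d → pc (suc v) (suc e) ≡ pc′ (suc v) (suc e)) where
    selected-cong : ∀ sel e → e < d → selected pc sel N (suc e) ≡ selected pc′ sel N (suc e)
    selected-cong sel e e<d = ∑-upTo-cong N (λ v v<N → cong (λ z → if sel (suc v) then z else 0) (agree v e v<N e<d))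

    blocks-cong : ∀ sel → blocks pc sel N d ≡ blocks pc′ sel N d
    blocks-cong sel = cong ((1 , 1) ∷_) (applyUpTo-cong d (λ e e<d → cong (_, suc e) (selected-cong sel e e<d)))
      where
      applyUpTo-cong : ∀ {A : Set} k {f g : ℕ → A} → (∀ i → i < k → f i ≡ g i) → applyUpTo f k ≡ applyUpTo g k
      applyUpTo-cong 0       eq = refl
      applyUpTo-cong (suc k) eq = cong₂ _∷_ (eq 0 (s≤s z≤n)) (applyUpTo-cong k (λ i i<k → eq (suc i) (s≤s i<k)))

  opaque
    unfolding normal-count

    tabulated-count-correct : ∀ pc pc′ h m d → (∀ v e → v < suc m → e < d → pc (suc v) (suc e) ≡ pc′ (suc v) (suc e)) → tabulated-count pc h m d ≡ normal-count pc′ h m d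
    tabulated-count-correct pc pc′ h m d agree = cong₂ _+_ (lookup-count (between (suc h) m) d ≤-refl)
      (∑-upTo-cong h (λ v _ → ∑-upTo-cong d (λ e e<d → cong₂ _*_ (selected-cong pc pc′ (suc m) d agree (between (suc v) (suc v)) e e<d) (lookup-count (between (m ∸ v) m) (d ∸ suc e) (m∸n≤m d (suc e))))))
      where
      lookup-count : ∀ sel e → e ≤ d → at (table d (blocks pc sel (suc m) d)) e ≡ block-count (blocks pc′ sel (suc m) d) e
      lookup-count sel e e≤d = trans (table-correct d (blocks pc sel (suc m) d) e e≤d) (cong (λ bs → block-count bs e) (blocks-cong pc pc′ (suc m) d agree sel))

-- A finite list of products that covers the normal forms of degree d.

module Classification (q-1 : ℕ) {c ℓ} (R : CommutativeRing c ℓ) where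
  open Sums
  open Permutations
  open CycleTypes
  open OrbitSizes (suc q-1)
  open PairRotations q-1
  open FixedGraphs q-1
  open Representatives q-1
  open Extensions q-1
  open PrimeGraphs q-1
  open OrbitPolynomials q-1 R
  open Orders q-1 R
  open NormalForms q-1 R
  open Generators q-1 R
  open Blocks
  open NormalCounts q-1
  open import Defs hiding (permutations-complete)
  open Polynomials R hiding (GeneratesInvariants; OrbitSums; _≈_)
  open Convolution R hiding (at)
  open import Algebra.Bundles using (Semiring)
  import Algebra.Definitions.RawSemiring as RawSemiringDefinitions
  open import Data.Bool.Base using (Bool; true; if_then_else_)
  open import Data.List.Base using (List; []; _∷_; _++_; map; replicate; concatMap; upTo; applyUpTo; length)
  import Data.List.Properties as List
  open import Data.List.Membership.Propositional using (_∈_; find; lose)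
  import Data.List.Membership.Propositional.Properties as ∈
  open import Data.List.Relation.Binary.Permutation.Propositional as ↭ using (_↭_)
  open import Data.List.Relation.Unary.All using (All; []; _∷_)
  import Data.List.Relation.Unary.All as All
  import Data.List.Relation.Unary.All.Properties as All
  open import Data.List.Relation.Unary.AllPairs using ([]; _∷_)
  open import Data.List.Relation.Unary.Any using (Any; here; there; any?)
  import Data.List.Relation.Unary.Any as Any
  import Data.List.Relation.Unary.Any.Properties as Any
  open import Data.Nat.Base hiding (ℕ; suc; _⊔_)
  open import Data.Nat.Properties
  open import Data.Product.Base using (_×_; _,_; proj₁; proj₂; ∃; ∃₂)
  open import Function.Base using (_∘_; id)
  open import Relation.Binary.PropositionalEquality hiding (_≗_; resp)
  open import Relation.Nullary using (Dec; yes; no; does; ¬_; contradiction)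

  private
    module R = CommutativeRing R

  open RawSemiringDefinitions (Semiring.rawSemiring R.semiring) using () renaming (_×_ to infixr 8 _·_)

  length-concatMap : ∀ {A B : Set} (f : A → List B) xs → length (concatMap f xs) ≡ ∑ xs (length ∘ f)
  length-concatMap f []       = refl
  length-concatMap f (x ∷ xs) = trans (List.length-++ (f x)) (cong (length (f x) +_) (length-concatMap f xs))

  multisets-length : ∀ {A : Set} (Γ : List (ℕ × A)) d → length (multisets Γ d) ≡ size-multisets (map proj₁ Γ) d
  multisets-length []            0       = refl
  multisets-length []            (suc d) = refl
  multisets-length ((e , g) ∷ Γ) d       = trans (length-concatMap (λ k → if does (k * e ≤? d) then map (replicate k g ++_) (multisets Γ (d ∸ k * e)) else []) (upTo (suc d))) (∑-cong (upTo (suc d)) (λ k → lemma k (k * e ≤? d)))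
    where
    lemma : ∀ k (le? : Dec (k * e ≤ d)) → length (if does le? then map (replicate k g ++_) (multisets Γ (d ∸ k * e)) else []) ≡ ⟦ le? ⟧ * size-multisets (map proj₁ Γ) (d ∸ k * e)
    lemma k (yes _) = trans (List.length-map (replicate k g ++_) (multisets Γ (d ∸ k * e))) (trans (multisets-length Γ (d ∸ k * e)) (sym (+-identityʳ _)))
    lemma k (no _)  = refl

  edges-singleEdge : ∀ n → edges (singleEdge {n}) ≡ 1
  edges-singleEdge n = edges-unique {g = singleEdge {n}} (trans (size-extK (∅ {n})) (cong (2 +_) (trans (∑-cong (Data.List.Base.allFin n) (λ _ → ∑-zero (Data.List.Base.allFin n))) (∑-zero (Data.List.Base.allFin n)))))

  module Classify (invertible : ∀ k → k ≢ 0 → ¬ ¬ (∃ λ y → y R.* k · R.1# R.≈ R.1#)) (n d h : ℕ) (d<q : 2 * d < q)  where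
    open Normal invertible n

    block : (ℕ → Bool) → ℕ → List (ℕ × Multigraph (2 + n))
    block sel e = map (suc e ,_) (gens sel (2 + n) (suc e))

    Γ : (ℕ → Bool) → List (ℕ × Multigraph (2 + n))
    Γ sel = (1 , singleEdge) ∷ concatMap (block sel) (upTo d)

    Listed : (ℕ → Bool) → Multigraph (2 + n) → Set
    Listed sel u = edges u ≢ 0 × Any (λ (e , g) → e ≡ edges u × Iso u g) (Γ sel)

    nonempty-edges : ∀ (u : Multigraph (2 + n)) → order u ≢ 0 → edges u ≢ 0
    nonempty-edges u ≢0 z = ≢0 (trans (∑-cong (Data.List.Base.allFin (2 + n)) (λ i → ⟦⟧-no (¬? (isolated? u i)) (λ ne → ne (λ j → n≤0⇒n≡0 (≤-trans (mult≤size u i j) (≤-reflexive (trans (edges-size u) (cong (2 *_) z)))))))) (∑-zero (Data.List.Base.allFin (2 + n))))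
      where open import Relation.Nullary.Decidable using (¬?)

    listed : ∀ sel u → Factor u → sel (order u) ≡ true → edges u ≤ d → Listed sel u
    listed sel u (≢0 , ne , _) ok le with edges u in eq
    ... | 0     = contradiction eq (nonempty-edges u ≢0)
    ... | suc e = (λ ()) , there (Any.concatMap⁺ (block sel) (lose (∈.∈-upTo⁺ le) (Any.map⁺ (Any.map (refl ,_)
          (gens-complete sel (2 + n) (suc e) (≤-<-trans (*-monoʳ-≤ 2 le) d<q) u (trans (edges-size u) (cong (2 *_) eq)) ne ≢0 ok)))))

    listed-edge : ∀ sel → Listed sel singleEdge
    listed-edge sel = (λ z → contradiction (trans (sym (edges-singleEdge n)) z) λ ()) , here (sym (edges-singleEdge n) , Iso-refl)

    smallPart : ℕ → ℕ → List (List (Multigraph (2 + n)))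
    smallPart v e = concatMap (λ t → map (t ∷_) (multisets (Γ (between (m ∸ v) m)) (d ∸ suc e))) (gens (between (suc v) (suc v)) (2 + n) (suc e))

    -- Either all factors other than single edges have orders above h, or one factor of order v + 1
    -- at most h is singled out. Repetitions would do no harm, since the length serves as an upper
    -- bound for the number of equations.
    W : List (List (Multigraph (2 + n)))
    W = multisets (Γ (between (suc h) m)) d ++ concatMap (λ v → concatMap (smallPart v) (upTo d)) (upTo h)

    copies : ℕ → List (Multigraph (2 + n))
    copies a = replicate a singleEdge

    pow-replicate : ∀ a (us : List (Multigraph (2 + n))) → pow a (Prod us) ≋ Prod (copies a ++ us)
    pow-replicate 0       us = P.refl
    pow-replicate (suc a) us = ⊠-congˡ e₁ (pow-replicate a us)

    totalEdges-++ : ∀ (us vs : List (Multigraph (2 + n))) → totalEdges (us ++ vs) ≡ totalEdges us + totalEdges vs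
    totalEdges-++ us vs = ∑-++ us vs edges

    edges≤total : ∀ (us : List (Multigraph (2 + n))) → All (λ u → edges u ≤ totalEdges us) us
    edges≤total []       = []
    edges≤total (u ∷ us) = m≤m+n (edges u) _ ∷ All.map (λ le → ≤-trans le (m≤n+m _ (edges u))) (edges≤total us)

    found : ∀ sel a us → All (λ u → Factor u × sel (order u) ≡ true × edges u ≤ d) us →
      ∃ λ w → w ∈ multisets (Γ sel) (totalEdges (copies a ++ us)) × Prod (copies a ++ us) ≋ Prod w
    found sel a us fs = multisets-collect (Γ sel) (copies a ++ us) (All.++⁺ (All.replicate⁺ a (listed-edge sel)) (All.map (λ {u} (f , ok , le) → listed sel u f ok le) fs))

    total-bound : ∀ a (us : List (Multigraph (2 + n))) → totalEdges (copies a ++ us) ≡ d → totalEdges us ≤ d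
    total-bound a us total = ≤-trans (m≤n+m _ (totalEdges (copies a))) (≤-reflexive (trans (sym (totalEdges-++ (copies a) us)) total))

    Classified : ℕ → List (Multigraph (2 + n)) → Set _
    Classified a us = ∃ λ w → w ∈ W × pow a (Prod us) ≋ Prod w

    uncrowded : ∀ a us → Normal us → All (λ u → h < order u) us → totalEdges (copies a ++ us) ≡ d → Classified a us
    uncrowded a us nf large total = conclude (found (between (suc h) m) a us (All.zipWith (λ {u} (f , (lt , le)) → f , between-true (suc h) m (order u) lt (proj₂ (proj₂ f)) , le)
            (proj₁ nf , All.zip (large , All.map (λ le → ≤-trans le (total-bound a us total)) (edges≤total us)))))
      where
      conclude : (∃ λ w → w ∈ multisets (Γ (between (suc h) m)) (totalEdges (copies a ++ us)) × Prod (copies a ++ us) ≋ Prod w) → Classified a us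
      conclude (w , w∈ , eq) = w , ∈.∈-++⁺ˡ (subst (λ z → w ∈ multisets (Γ (between (suc h) m)) z) total w∈) , P.trans (pow-replicate a us) eq

    -- If u has order v + 1, then `m < order u + order s` forces every other factor s to have order
    -- at least m - v. So after u is split off, the rest is a multiset of graphs with orders from m
    -- - v to m.
    crowded : ∀ a u us → Normal (u ∷ us) → order u ≤ h → totalEdges (copies a ++ us) + edges u ≡ d → Classified a (u ∷ us)
    crowded a u us ((f ∷ fs) , (cs ∷ _)) small total = go (order u) refl (edges u) refl
      where
      within : totalEdges us ≤ d
      within = ≤-trans (m≤n+m _ (totalEdges (copies a))) (≤-trans (≤-reflexive (sym (totalEdges-++ (copies a) us))) (≤-trans (m≤m+n _ (edges u)) (≤-reflexive total)))
      shuffle : copies a ++ u ∷ us ↭ u ∷ copies a ++ us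
      shuffle = ↭.shift u (copies a) us
        where import Data.List.Relation.Binary.Permutation.Propositional.Properties as ↭
      go : ∀ v → order u ≡ v → ∀ e → edges u ≡ e → Classified a (u ∷ us)
      go 0       ov e       eu = contradiction ov (proj₁ f)
      go (suc v) ov 0       eu = contradiction eu (nonempty-edges u (proj₁ f))
      go (suc v) ov (suc e) eu = conclude
        (find (gens-complete (between (suc v) (suc v)) (2 + n) (suc e) (≤-<-trans (*-monoʳ-≤ 2 e<d) d<q) u (trans (edges-size u) (cong (2 *_) eu)) (proj₁ (proj₂ f)) (proj₁ f)
          (trans (cong (between (suc v) (suc v)) ov) (between-true (suc v) (suc v) (suc v) ≤-refl ≤-refl))))
        (found (between (m ∸ v) m) a us (All.zipWith (λ {s} (f , (lt , le)) → f , between-true (m ∸ v) m (order s) (crowd s lt) (proj₂ (proj₂ f)) , le)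
          (fs , All.zip (cs , All.map (λ le → ≤-trans le within) (edges≤total us)))))
        where
        e<d : e < d
        e<d = ≤-trans (≤-reflexive (sym eu)) (≤-trans (m≤n+m (edges u) (totalEdges (copies a ++ us))) (≤-reflexive total))
        crowd : ∀ s → m < order u + order s → m ∸ v ≤ order s
        crowd s lt = ≤-trans (∸-monoˡ-≤ v (s≤s⁻¹ (≤-trans lt (≤-reflexive (cong (_+ order s) ov))))) (≤-reflexive (m+n∸m≡n v (order s)))
        rest : totalEdges (copies a ++ us) ≡ d ∸ suc e
        rest = trans (sym (m+n∸n≡m _ (suc e))) (cong (_∸ suc e) (trans (cong (totalEdges (copies a ++ us) +_) (sym eu)) total))
        v<h : v < h
        v<h = ≤-trans (≤-reflexive (sym ov)) small
        conclude : (∃ λ t → t ∈ gens (between (suc v) (suc v)) (2 + n) (suc e) × Iso u t) →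
          (∃ λ w → w ∈ multisets (Γ (between (m ∸ v) m)) (totalEdges (copies a ++ us)) × Prod (copies a ++ us) ≋ Prod w) → Classified a (u ∷ us)
        conclude (t , t∈ , i) (w , w∈ , eq) = t ∷ w , ∈.∈-++⁺ʳ (multisets (Γ (between (suc h) m)) d) (Any.concatMap⁺ (λ v → concatMap (smallPart v) (upTo d)) (lose (∈.∈-upTo⁺ v<h)
          (Any.concatMap⁺ (smallPart v) (lose (∈.∈-upTo⁺ e<d) (Any.concatMap⁺ (λ t → map (t ∷_) (multisets (Γ (between (m ∸ v) m)) (d ∸ suc e))) (lose t∈ (∈.∈-map⁺ (t ∷_)
            (subst (λ z → w ∈ multisets (Γ (between (m ∸ v) m)) z) rest w∈)))))))) ,
          P.trans (pow-replicate a (u ∷ us)) (P.trans (Prod-↭ shuffle) (P.trans (⊠-congʳ (Prod (copies a ++ us)) (orbitSum-cong i)) (⊠-congˡ (orbitSum t) eq)))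

    classify : ∀ a us → Normal us → totalEdges (copies a ++ us) ≡ d → Classified a us
    classify a us nf total = split (any? (λ u → order u ≤? h) us)
      where
      split : Dec (Any (λ u → order u ≤ h) us) → Classified a us
      split (no none) = uncrowded a us nf (All.map ≰⇒> (All.¬Any⇒All¬ us none)) total
      split (yes ay) = pulled (pull ay)
        where
        pulled : (∃₂ λ u us′ → order u ≤ h × us ↭ u ∷ us′) → Classified a us
        pulled (u , us′ , small , p) = back (crowded a u us′ (Normal-↭ p nf) small total′)
          where
          open ≡-Reasoning
          total′ : totalEdges (copies a ++ us′) + edges u ≡ d
          total′ = begin
            totalEdges (copies a ++ us′) + edges u ≡⟨ cong (_+ edges u) (totalEdges-++ (copies a) us′) ⟩
            totalEdges (copies a) + totalEdges us′ + edges u ≡⟨ trans (+-assoc (totalEdges (copies a)) (totalEdges us′) (edges u)) (cong (totalEdges (copies a) +_) (+-comm (totalEdges us′) (edges u))) ⟩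
            totalEdges (copies a) + totalEdges (u ∷ us′) ≡⟨ cong (totalEdges (copies a) +_) (totalEdges-↭ p) ⟨
            totalEdges (copies a) + totalEdges us ≡⟨ totalEdges-++ (copies a) us ⟨
            totalEdges (copies a ++ us) ≡⟨ total ⟩
            d ∎
          pow-cong : ∀ a {f g} → f ≋ g → pow a f ≋ pow a g
          pow-cong 0       e = e
          pow-cong (suc a) e = ⊠-congˡ e₁ (pow-cong a e)
          back : Classified a (u ∷ us′) → Classified a us
          back (w , w∈ , eq) = w , w∈ , P.trans (pow-cong a (Prod-↭ p)) eq

    Γ-weights : ∀ sel → map proj₁ (Γ sel) ≡ flatten (blocks prime-count sel (2 + n) d)
    Γ-weights sel = cong (1 ∷_) (lemma d id)
      where
      const-map : ∀ {A : Set} e (gs : List A) → map proj₁ (map (e ,_) gs) ≡ replicate (length gs) e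
      const-map e []       = refl
      const-map e (g ∷ gs) = cong (e ∷_) (const-map e gs)
      lemma : ∀ k (f : ℕ → ℕ) → map proj₁ (concatMap (block sel) (applyUpTo f k)) ≡ flatten (applyUpTo (λ e → selected prime-count sel (2 + n) (suc (f e)) , suc (f e)) k)
      lemma 0       f = refl
      lemma (suc k) f = trans (List.map-++ proj₁ (block sel (f 0)) _) (cong₂ _++_ (trans (const-map (suc (f 0)) (gens sel (2 + n) (suc (f 0)))) (cong (λ z → replicate z (suc (f 0))) (gens-length sel (2 + n) (suc (f 0))))) (lemma k (f ∘ suc)))

    Γ-length : ∀ sel e → length (multisets (Γ sel) e) ≡ block-count (blocks prime-count sel (2 + n) d) e
    Γ-length sel e = trans (multisets-length (Γ sel) e) (trans (cong (λ z → size-multisets z e) (Γ-weights sel)) (size-blocks (blocks prime-count sel (2 + n) d) ((λ ()) ∷ All.applyUpTo⁺₂ _ d (λ _ ())) e))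

    opaque
      unfolding normal-count

      W-length : length W ≡ normal-count prime-count h m d
      W-length = trans (List.length-++ (multisets (Γ (between (suc h) m)) d)) (cong₂ _+_ (Γ-length (between (suc h) m) d)
        (trans (length-concatMap (λ v → concatMap (smallPart v) (upTo d)) (upTo h)) (∑-cong (upTo h) (λ v → trans (length-concatMap (smallPart v) (upTo d)) (∑-cong (upTo d) (λ e → part v e))))))
        where
        part : ∀ v e → length (smallPart v e) ≡ selected prime-count (between (suc v) (suc v)) (2 + n) (suc e) * block-count (blocks prime-count (between (m ∸ v) m) (2 + n) d) (d ∸ suc e)
        part v e = trans (length-concatMap (λ t → map (t ∷_) (multisets (Γ (between (m ∸ v) m)) (d ∸ suc e))) G) (trans (∑-cong G (λ t → trans (List.length-map (t ∷_) (multisets (Γ (between (m ∸ v) m)) (d ∸ suc e))) (trans (Γ-length (between (m ∸ v) m) (d ∸ suc e)) (sym (*-identityˡ _)))))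
          (trans (∑-*ʳ G (block-count (blocks prime-count (between (m ∸ v) m) (2 + n) d) (d ∸ suc e)) (λ _ → 1)) (cong (_* block-count (blocks prime-count (between (m ∸ v) m) (2 + n) d) (d ∸ suc e)) (trans (∑-length G) (gens-length (between (suc v) (suc v)) (2 + n) (suc e))))))
          where
          G : List (Multigraph (2 + n))
          G = gens (between (suc v) (suc v)) (2 + n) (suc e)

-- Nontrivial solutions of linear systems with more unknowns than equations.

module LinearAlgebra {c ℓ} (R : CommutativeRing c ℓ) where
  open import Algebra.Properties.CommutativeMonoid.Sum (CommutativeRing.+-commutativeMonoid R)
  open import Algebra.Properties.Ring (CommutativeRing.ring R) using (-‿distribˡ-*)
  open import Algebra.Properties.Semiring.Sum (CommutativeRing.semiring R) using (*-distribʳ-sum)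
  open import Data.Fin.Base using (Fin; zero; suc; punchIn)
  open import Data.List.Base using (List; []; _∷_; length)
  open import Data.List.Relation.Unary.All using (All; []; _∷_)
  import Data.List.Relation.Unary.All as All
  open import Data.Nat.Base using (ℕ; suc; _<_; s≤s⁻¹)
  import Data.Nat.Properties as ℕ
  open import Data.Product.Base using (_×_; _,_; ∃)
  open import Data.Sum.Base using (_⊎_; inj₁; inj₂)
  open import Data.Vec.Functional using (insertAt; removeAt)
  open import Data.Vec.Functional.Properties using (insertAt-lookup; insertAt-punchIn)
  open import Relation.Nullary using (¬_)
  open import Relation.Binary.Reasoning.Setoid (CommutativeRing.setoid R)

  private
    module R = CommutativeRing R
  open R using (_≈_; _+_; _*_; -_; 0#; 1#)

  Unit : R.Carrier → Set _
  Unit x = ∃ λ y → y * x ≈ 1#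

  sum-zero : ∀ {k} (t : Fin k → R.Carrier) → (∀ i → t i ≈ 0#) → sum t ≈ 0#
  sum-zero {k} t z = R.trans (sum-cong-≋ z) (sum-replicate-zero k)

  module _ (decide : ∀ x → ¬ ¬ (x ≈ 0# ⊎ Unit x)) where
    pivot : ∀ {k} (t : Fin k → R.Carrier) → ¬ ¬ ((∀ i → t i ≈ 0#) ⊎ (∃ λ i → Unit (t i)))
    pivot {0}     t no = no (inj₁ λ ())
    pivot {suc k} t no = decide (t zero) λ
      { (inj₂ u) → no (inj₂ (zero , u))
      ; (inj₁ z) → pivot (λ i → t (suc i)) λ
        { (inj₂ (i , u)) → no (inj₂ (suc i , u))
        ; (inj₁ zs)      → no (inj₁ λ { zero → z ; (suc i) → zs i }) } }

    -- Gaussian elimination, one equation f at a time. If all coefficients of f are zero, any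
    -- solution of the rest will do. Otherwise a unit coefficient serves to eliminate one unknown,
    -- so the surplus of unknowns persists. Nontriviality means that some value is a unit, which
    -- survives the extension by the eliminated unknown.
    kernel : ∀ {b} {B : Set b} (fs : List B) {k} → length fs < k → (v : Fin k → B → R.Carrier) →
      ¬ ¬ (∃ λ (y : Fin k → R.Carrier) → (∃ λ i → Unit (y i)) × All (λ f → sum (λ i → y i * v i f) ≈ 0#) fs)
    kernel []       {suc k} lt v no = no ((λ _ → 1#) , (zero , 1# , R.*-identityˡ 1#) , [])
    kernel {B = B} (f ∷ fs) {suc k} lt v no = pivot {suc k} (λ i → v i f) λ
      { (inj₁ zs) → kernel fs {suc k} (ℕ.<⇒≤ lt) v λ (y , u , all) → no (y , u , sum-zero (λ i → y i * v i f) (λ i → R.trans (R.*-congˡ (zs i)) (R.zeroʳ (y i))) ∷ all)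
      ; (inj₂ (p , z , zp)) → kernel fs {k} (s≤s⁻¹ lt) (eliminate p z) λ (y , (i , u) , all) →
          no (complete p z y , (punchIn p i , subst-Unit (R.reflexive (insertAt-punchIn y p _ i)) u) ,
              R.trans (R.sym (eliminated p z y f)) (sum-zero (λ j → y j * eliminate p z j f) (λ j → R.trans (R.*-congˡ (pivoted p z zp j)) (R.zeroʳ (y j)))) ∷
              All.map (λ {g} e → R.trans (R.sym (eliminated p z y g)) e) all) }
      where
      eliminate : Fin (suc k) → R.Carrier → Fin k → B → R.Carrier
      eliminate p z j g = v (punchIn p j) g + - (v (punchIn p j) f * z) * v p g
      -- The value of the eliminated unknown: it collects the multiples of the pivot vector that
      -- were subtracted from the others.
      complete : Fin (suc k) → R.Carrier → (Fin k → R.Carrier) → Fin (suc k) → R.Carrier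
      complete p z y = insertAt y p (sum (λ j → y j * - (v (punchIn p j) f * z)))
      subst-Unit : ∀ {x y} → x ≈ y → Unit y → Unit x
      subst-Unit e (w , wy) = w , R.trans (R.*-congˡ e) wy
      pivoted : ∀ p z → z * v p f ≈ 1# → ∀ j → eliminate p z j f ≈ 0#
      pivoted p z zp j = begin
        v (punchIn p j) f + - (v (punchIn p j) f * z) * v p f ≈⟨ R.+-congˡ (R.sym (-‿distribˡ-* _ _)) ⟩
        v (punchIn p j) f + - (v (punchIn p j) f * z * v p f) ≈⟨ R.+-congˡ (R.-‿cong (R.trans (R.*-assoc _ _ _) (R.trans (R.*-congˡ zp) (R.*-identityʳ _)))) ⟩
        v (punchIn p j) f + - v (punchIn p j) f ≈⟨ R.-‿inverseʳ _ ⟩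
        0# ∎
      eliminated : ∀ p z y g → sum (λ j → y j * eliminate p z j g) ≈ sum (λ i → complete p z y i * v i g)
      eliminated p z y g = begin
        sum (λ j → y j * eliminate p z j g) ≈⟨ sum-cong-≋ (λ j → R.trans (R.distribˡ (y j) _ _) (R.trans (R.+-comm _ _) (R.+-congʳ (R.sym (R.*-assoc (y j) _ _))))) ⟩
        sum (λ j → y j * coefficient j * v p g + y j * v (punchIn p j) g) ≈⟨ ∑-distrib-+ (λ j → y j * coefficient j * v p g) _ ⟩
        sum (λ j → y j * coefficient j * v p g) + sum (λ j → y j * v (punchIn p j) g)
          ≈⟨ R.+-cong (R.trans (R.sym (*-distribʳ-sum (v p g) (λ j → y j * coefficient j))) (R.*-congʳ (R.reflexive (sym (insertAt-lookup y p _)))))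
                      (sum-cong-≋ (λ j → R.*-congʳ (R.reflexive (sym (insertAt-punchIn y p _ j))))) ⟩
        Y p * v p g + sum (removeAt (λ i → Y i * v i g) p) ≈⟨ sum-remove {i = p} (λ i → Y i * v i g) ⟨
        sum (λ i → Y i * v i g) ∎
        where
        open import Relation.Binary.PropositionalEquality using (sym)
        coefficient = λ j → - (v (punchIn p j) f * z)
        Y = complete p z y

-- The dimension argument for graphs with an isolated vertex.

module IsolatedVertices (q-1 : ℕ) {c ℓ} (R : CommutativeRing c ℓ) where
  open Sums
  open Permutations
  open CycleTypes
  open OrbitSizes (suc q-1)
  open PairRotations q-1
  open FixedGraphs q-1
  open Representatives q-1
  open Extensions q-1
  open OrbitPolynomials q-1 R
  open NormalForms q-1 R
  open Generators q-1 R
  open NormalCounts q-1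
  open Classification q-1 R
  open LinearAlgebra R
  open import Defs hiding (permutations-complete)
  open Polynomials R hiding (GeneratesInvariants; OrbitSums; _≈_)
  open Convolution R
  open import Algebra.Bundles using (Semiring)
  import Algebra.Definitions.RawSemiring as RawSemiringDefinitions
  open import Algebra.Properties.CommutativeMonoid.Sum (CommutativeRing.+-commutativeMonoid R) using (sum; sum-cong-≋; ∑-distrib-+)
  open import Algebra.Properties.Semiring.Sum (CommutativeRing.semiring R) using (*-distribˡ-sum)
  open import Data.Fin.Base using (Fin; zero; suc)
  open import Data.List.Base using (List; _∷_; _++_; length; lookup)
  open import Data.List.Membership.Propositional.Properties using (∈-lookup)
  open import Data.List.Relation.Unary.All using (All; _∷_)
  import Data.List.Relation.Unary.All as All
  open import Data.Nat.Base hiding (ℕ; suc; _⊔_)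
  open import Data.Nat.Properties
  open import Data.Product.Base using (_×_; _,_; ∃)
  open import Data.Sum.Base using (_⊎_)
  open import Function.Base using (_∘_)
  open import Relation.Binary.PropositionalEquality hiding (_≗_; resp)
  open import Relation.Nullary using (Dec; yes; no; ¬_)

  private
    module R = CommutativeRing R

  open RawSemiringDefinitions (Semiring.rawSemiring R.semiring) using () renaming (_×_ to infixr 8 _·_)

  sum-select : ∀ {A : Set} {P : A → Set} (P? : ∀ x → Dec (P x)) xs → ∑ xs (λ x → ⟦ P? x ⟧) ≡ 1 → ∀ i → P (lookup xs i) →
    ∀ (y : Fin (length xs) → R.Carrier) → sum (λ j → y j R.* ⟦ P? (lookup xs j) ⟧ · R.1#) R.≈ y i
  sum-select P? (x ∷ xs) once zero    px y = R.trans (R.+-cong (R.trans (R.*-congˡ (R.trans (R.reflexive (cong (_· R.1#) (⟦⟧-yes (P? x) px))) (R.+-identityʳ R.1#))) (R.*-identityʳ (y zero)))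
    (sum-zero (λ j → y (suc j) R.* ⟦ P? (lookup xs j) ⟧ · R.1#) (λ j → R.trans (R.*-congˡ (R.reflexive (cong (_· R.1#) (others xs none j)))) (R.zeroʳ _)))) (R.+-identityʳ (y zero))
    where
    none : ∑ xs (λ x → ⟦ P? x ⟧) ≡ 0
    none = suc-injective (trans (cong (_+ ∑ xs (λ x → ⟦ P? x ⟧)) (sym (⟦⟧-yes (P? x) px))) once)
    others : ∀ xs → ∑ xs (λ x → ⟦ P? x ⟧) ≡ 0 → ∀ j → ⟦ P? (lookup xs j) ⟧ ≡ 0
    others (x ∷ xs) z zero    = m+n≡0⇒m≡0 _ z
    others (x ∷ xs) z (suc j) = others xs (m+n≡0⇒n≡0 ⟦ P? x ⟧ z) j
  sum-select P? (x ∷ xs) once (suc i) px y = R.trans (R.+-cong (R.trans (R.*-congˡ (R.reflexive (cong (_· R.1#) not))) (R.zeroʳ (y zero))) (sum-select P? xs once′ i px (y ∘ suc))) (R.+-identityˡ _)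
    where
    present : ∀ xs i → ⟦ P? (lookup xs i) ⟧ ≤ ∑ xs (λ x → ⟦ P? x ⟧)
    present (x ∷ xs) zero    = m≤m+n _ _
    present (x ∷ xs) (suc i) = ≤-trans (present xs i) (m≤n+m _ ⟦ P? x ⟧)
    not : ⟦ P? x ⟧ ≡ 0
    not = n≤0⇒n≡0 (+-cancelʳ-≤ 1 _ 0 (≤-trans (+-monoʳ-≤ ⟦ P? x ⟧ (≤-trans (≤-reflexive (sym (⟦⟧-yes (P? (lookup xs i)) px))) (present xs i))) (≤-reflexive once)))
    once′ : ∑ xs (λ x → ⟦ P? x ⟧) ≡ 1
    once′ = trans (cong (_+ ∑ xs (λ x → ⟦ P? x ⟧)) (sym not)) once

  module _ (decide : ∀ x → ¬ ¬ (x R.≈ R.0# ⊎ Unit x)) (invertible : ∀ k → k ≢ 0 → ¬ ¬ (∃ λ y → y R.* k · R.1# R.≈ R.1#)) (1≉0 : ¬ R.1# R.≈ R.0#) where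
    -- The unknowns are the values y i of a functional ψ on the orbit sums of degree d, and the
    -- equations say that ψ vanishes on the products listed in W. A solution vanishes on all normal
    -- forms, since those of other degrees have no coefficients in degree d, and thus on the
    -- subalgebra; but it takes a unit as value on some orbit sum.
    isolated-not-generating : ∀ n d h → 2 * d < q → normal-count prime-count h (suc n) d < length (reps (2 + n) d) → ¬ GeneratesInvariants R (OrbitSums R (HasIsolatedVertex {2 + n}))
    isolated-not-generating n d h d<q few generates =
      kernel decide W {length G} (subst (_< length G) (sym W-length) few) (λ i w → coeff (Prod w) (lookup G i))
      λ (y , (i , z , zy) , killed) → subalgebra-N (generates (orbitSum (lookup G i)) (orbitSum-invariant (lookup G i)))
      λ span → 1≉0 (R.trans (R.sym zy) (R.trans (R.*-congˡ (R.trans (R.sym (dual y i)) (vanish y killed span))) (R.zeroʳ z)))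
      where
      open Normal invertible n
      open Classify invertible n d h d<q
      open import Relation.Binary.Reasoning.Setoid R.setoid
      G : List (Multigraph (2 + n))
      G = reps (2 + n) d
      G-edges : ∀ i → HasEdges d (lookup G i)
      G-edges i = All.lookup (reps-edges (2 + n) d) (∈-lookup i)
      module _ (y : Fin (length G) → R.Carrier) where
        ψ : Poly (2 + n) → R.Carrier
        ψ f = sum (λ i → y i R.* coeff f (lookup G i))
        dual : ∀ i → ψ (orbitSum (lookup G i)) R.≈ y i
        dual i = R.trans (sum-cong-≋ (λ j → R.*-congˡ (coeff-orbitSum (lookup G i) (lookup G j))))
          (sum-select (iso? (lookup G i)) G (reps-once d (lookup G i) d<q (G-edges i)) i Iso-refl y)
        ψ-cong : ∀ {f g} → f ≋ g → ψ f R.≈ ψ g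
        ψ-cong e = sum-cong-≋ (λ i → R.*-congˡ (same e (lookup G i)))
        module _ (killed : All (λ w → ψ (Prod w) R.≈ R.0#) W) where
          vanish : ∀ {f} → N f → ψ f R.≈ R.0#
          vanish (inc (a , us , nf , refl)) = split (totalEdges (copies a ++ us) ≟ d)
            where
            split : Dec (totalEdges (copies a ++ us) ≡ d) → ψ (pow a (Prod us)) R.≈ R.0#
            split (yes total) = let w , w∈ , eq = classify a us nf total in R.trans (ψ-cong eq) (All.lookup killed w∈)
            split (no ne)     = R.trans (ψ-cong (pow-replicate a us)) (sum-zero (λ i → y i R.* coeff (Prod (copies a ++ us)) (lookup G i))
              (λ i → R.trans (R.*-congˡ (Prod-degree (copies a ++ us) (lookup G i) (G-edges i) ne)) (R.zeroʳ (y i))))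
          vanish nil = sum-zero _ (λ i → R.zeroʳ (y i))
          vanish (plus {f} {g} s t) = begin
            ψ (f ++ g) ≈⟨ sum-cong-≋ (λ i → R.trans (R.*-congˡ (coeff-++ f g (lookup G i))) (R.distribˡ (y i) _ _)) ⟩
            sum (λ i → y i R.* coeff f (lookup G i) R.+ y i R.* coeff g (lookup G i)) ≈⟨ ∑-distrib-+ (λ i → y i R.* coeff f (lookup G i)) _ ⟩
            ψ f R.+ ψ g ≈⟨ R.trans (R.+-cong (vanish s) (vanish t)) (R.+-identityʳ R.0#) ⟩
            R.0# ∎
          vanish (scal b {f} s) = begin
            ψ (scale b f) ≈⟨ sum-cong-≋ (λ i → R.trans (R.*-congˡ (coeff-scale b f (lookup G i))) (x∙yz≈y∙xz (y i) b _)) ⟩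
            sum (λ i → b R.* (y i R.* coeff f (lookup G i))) ≈⟨ *-distribˡ-sum b (λ i → y i R.* coeff f (lookup G i)) ⟨
            b R.* ψ f ≈⟨ R.trans (R.*-congˡ (vanish s)) (R.zeroʳ b) ⟩
            R.0# ∎
            where open import Algebra.Properties.CommutativeSemigroup R.*-commutativeSemigroup using (x∙yz≈y∙xz)
          vanish (resp e s) = R.trans (R.sym (ψ-cong e)) (vanish s)

-- Evaluation of both counts.

module Verification where
  open CycleTypes using (Weighted; types; grow)
  open Representatives 50 using (reps)
  open NormalCounts 50
  open import Data.Bool.Base using (Bool; true; false; T; _∧_; not)
  open import Data.Bool.Properties using (T-≡; T-∧)
  open import Data.List.Base using (List; []; _∷_; length)
  open import Data.Bool.ListAction using (all)
  open import Data.List.Relation.Unary.All using (All; []; _∷_)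
  import Data.List.Relation.Unary.All as All
  open import Data.Nat.Base
  open import Data.Nat.Properties
  open import Data.Product.Base using (_×_; _,_; proj₁; proj₂)
  open import Function.Base using (_∘_)
  open import Function.Bundles using (Equivalence)
  open import Relation.Binary.PropositionalEquality

  instance
    -- On 18 vertices there are 153 pairs, so `cap` is at most 18! * 51^153, which has fewer than
    -- 1024 binary digits.
    base-nonZero : NonZero (2 ^ 1024)
    base-nonZero = m^n≢0 2 1024

  -- Graphs with at most 25 edges have size at most 50. This keeps multiplicities below q = 51 and
  -- calls for the digits 0 to 50.
  open Counts 50 (2 ^ 1024)
  open Truncated 51
  open Digits 51

  Row : Set
  Row = Bool × List ℕ

  -- The first component tests what makes the second one meaningful: the order of the group is a
  -- proper divisor of digits that involve no carries, that is, it is nonzero and `cap` is below the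
  -- base.
  summary : Weighted → Row
  summary w = not (order w ≡ᵇ 0) ∧ (cap w <ᵇ 2 ^ 1024) , row geometric w

  -- The cycle types are handed on from row to row instead of being computed anew for every number
  -- of vertices.
  rows : ℕ → Weighted → List Row
  rows zero    w = []
  rows (suc k) w = summary w ∷ rows k (grow w)

  nth : List Row → ℕ → Row
  nth []       i       = false , []
  nth (r ∷ rs) zero    = r
  nth (r ∷ rs) (suc i) = nth rs i

  count : List Row → ℕ → ℕ → ℕ
  count rs v e = look (proj₂ (nth rs v)) (2 * e)

  nth-rows : ∀ k n i → i < k → nth (rows k (types n)) i ≡ summary (types (i + n))
  nth-rows (suc k) n zero    _   = refl
  nth-rows (suc k) n (suc i) i<k = trans (nth-rows k (suc n) i (s≤s⁻¹ i<k)) (cong (summary ∘ types) (+-suc i n))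

  T-nth : ∀ rs i → T (all proj₁ rs) → i < length rs → T (proj₁ (nth rs i))
  T-nth (r ∷ rs) zero    ok _  = proj₁ (Equivalence.to T-∧ ok)
  T-nth (r ∷ rs) (suc i) ok lt = T-nth rs i (proj₂ (Equivalence.to (T-∧ {proj₁ r}) ok)) (s≤s⁻¹ lt)

  length-rows : ∀ k w → length (rows k w) ≡ k
  length-rows zero    w = refl
  length-rows (suc k) w = cong suc (length-rows k (grow w))

  summary-correct : ∀ n e r → r ≡ summary (types n) → T (proj₁ r) → e ≤ 25 → look (proj₂ r) (2 * e) ≡ length (reps n e)
  summary-correct n e r refl ok e≤25 = row-correct n e (s≤s (*-monoʳ-≤ 2 e≤25)) (s≤s (*-monoʳ-≤ 2 e≤25))
    (λ z → subst (T ∘ not ∘ (_≡ᵇ 0)) z (proj₁ (Equivalence.to T-∧ ok)))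
    (<ᵇ⇒< (cap (types n)) (2 ^ 1024) (proj₂ (Equivalence.to (T-∧ {not (order (types n) ≡ᵇ 0)}) ok)))

  count-correct : ∀ rs k → rs ≡ rows k (types 0) → T (all proj₁ rs) → ∀ v e → v < k → e ≤ 25 → count rs v e ≡ length (reps v e)
  count-correct rs k refl ok v e v<k e≤25 = summary-correct v e (nth rs v) (trans (nth-rows k 0 v v<k) (cong (summary ∘ types) (+-identityʳ v)))
    (T-nth rs v ok (subst (v <_) (sym (length-rows k (types 0))) v<k)) e≤25

  record Case : Set where
    constructor case
    field
      m d : ℕ

  fewer : List Row → Case → Bool
  fewer rs (case m d) = tabulated-count (prime-formula (count rs)) ⌊ m /2⌋ m d <ᵇ count rs (suc m) d

  verify : List Case → List Row → Bool
  verify cs rs = all proj₁ rs ∧ all (fewer rs) cs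

  -- The bounds on m and d are premises of the inequality because `verify` does not test them.
  record Few (k m d : ℕ) : Set where
    constructor few
    field bound : suc m < k → d ≤ 25 → normal-count prime-count ⌊ m /2⌋ m d < length (reps (suc m) d)
  open Few public

  opaque
    verify-correct : ∀ rs k cs → rs ≡ rows k (types 0) → verify cs rs ≡ true → All (λ (case m d) → Few k m d) cs
    verify-correct rs k cs eq ok = each cs (proj₂ both)
      where
      both : T (all proj₁ rs) × T (all (fewer rs) cs)
      both = Equivalence.to (T-∧ {all proj₁ rs}) (Equivalence.from T-≡ ok)
      each : ∀ cs → T (all (fewer rs) cs) → All (λ (case m d) → Few k m d) cs
      each []              _  = []
      each (case m d ∷ cs) ok = few (λ m<k d≤25 → subst₂ _<_
          (tabulated-count-correct (prime-formula (count rs)) prime-count ⌊ m /2⌋ m d (prime-formula-correct (count rs) (suc m) d (s≤s (*-monoʳ-≤ 2 d≤25))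
            (λ v e v≤ e≤d → count-correct rs k eq (proj₁ both) v e (≤-<-trans v≤ m<k) (≤-trans e≤d d≤25))))
          (count-correct rs k eq (proj₁ both) (suc m) d m<k d≤25)
          (<ᵇ⇒< (tabulated-count (prime-formula (count rs)) ⌊ m /2⌋ m d) (count rs (suc m) d) (proj₁ (Equivalence.to T-∧ ok)))) ∷
        each cs (proj₂ (Equivalence.to (T-∧ {fewer rs (case m d)}) ok))

  -- As m is one less than the number of vertices, these are the graphs on 11 to 18 vertices.
  cases : List Case
  cases = case 10 22 ∷ case 11 22 ∷ case 12 22 ∷ case 13 22 ∷ case 14 25 ∷ case 15 25 ∷ case 16 25 ∷ case 17 25 ∷ []

-- The evaluated inequalities.

module FewNormalForms where
  open CycleTypes using (types)
  open Verification
  open import Data.Bool.Base using (true)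
  open import Data.List.Relation.Unary.All using (All)
  open import Relation.Binary.PropositionalEquality

  opaque
    verified : verify cases (rows 19 (types 0)) ≡ true
    verified = refl

    few-normal-forms : All (λ (case m d) → Few 19 m d) cases
    few-normal-forms = verify-correct (rows 19 (types 0)) 19 cases refl verified

-- Constant terms of iterated derivatives of monomials.

module Derivatives where
  open Sums
  open import Defs using (Multigraph; mult; symmetric; loopless; _≗_; _≗?_; ∅; _⊕_; _•_; SamePair; samePair?)
  open import Data.Bool.Base using (Bool; true; false; if_then_else_)
  open import Data.Fin.Base using (Fin; suc)
  import Data.Fin.Properties as Fin
  open import Data.Fin.Permutation as Perm using (Permutation′; _⟨$⟩ʳ_; _⟨$⟩ˡ_)
  open import Data.List.Base using (List; []; _∷_; _++_; map)
  import Data.List.Properties as List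
  open import Data.List.Relation.Unary.All using (All; []; _∷_)
  import Data.List.Relation.Unary.All as All
  open import Data.Maybe.Base using (Maybe; just; nothing)
  open import Data.Nat.Base hiding (ℕ; suc)
  open import Data.Nat.Properties
  open import Data.Product.Base using (_×_; _,_; proj₁; proj₂; swap)
  open import Data.Sum.Base as Sum using (inj₁; inj₂)
  open import Function.Base using (_∘_)
  open import Relation.Binary.PropositionalEquality hiding (_≗_; resp)
  open import Relation.Nullary.Decidable using (decidable-stable)
  open import Relation.Nullary using (Dec; yes; no; does; contradiction)

  private
    variable
      n m : ℕ

  Edge : ℕ → Set
  Edge n = Fin n × Fin n

  Word : ℕ → Set
  Word n = List (Edge n)

  mapWord : (Fin n → Fin m) → Word n → Word m
  mapWord ρ = map λ (i , j) → ρ i , ρ j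

  at-edge : Multigraph n → Edge n → ℕ
  at-edge h (i , j) = mult h i j

  same? : ∀ (a b : Fin n) (e : Edge n) → Dec (SamePair a b (proj₁ e) (proj₂ e))
  same? a b (i , j) = samePair? a b i j

  SamePair-swap : ∀ {a b i j : Fin n} → SamePair a b i j → SamePair b a i j
  SamePair-swap = Sum.swap ∘ Sum.map swap swap

  infixl 6 _∖_

  -- The subtraction is truncated. For an absent edge the result is not the exponent of a
  -- derivative, but the derivative then carries the factor `at-edge h e`, which is 0.
  _∖_ : Multigraph n → Edge n → Multigraph n
  h ∖ e = record
    { mult      = λ a b → mult h a b ∸ ⟦ same? a b e ⟧
    ; symmetric = λ a b → cong₂ _∸_ (symmetric h a b) (⟦⟧-cong (same? a b e) (same? b a e) SamePair-swap SamePair-swap)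
    ; loopless  = λ a → trans (cong (_∸ ⟦ same? a a e ⟧) (loopless h a)) (0∸n≡0 ⟦ same? a a e ⟧)
    }

  ∖-cong : ∀ e {h k : Multigraph n} → h ≗ k → h ∖ e ≗ k ∖ e
  ∖-cong e eq a b = cong (_∸ ⟦ same? a b e ⟧) (eq a b)

  -- κ w h is the constant term of the iterated derivative of x^h along the edges
  -- of w.

  κ : Word n → Multigraph n → ℕ
  κ []      h = ⟦ h ≗? ∅ ⟧
  κ (e ∷ w) h = at-edge h e * κ w (h ∖ e)

  κ-cong : ∀ w {h k : Multigraph n} → h ≗ k → κ w h ≡ κ w k
  κ-cong []      {h} {k} eq = ⟦⟧-cong (h ≗? ∅) (k ≗? ∅) (λ z i j → trans (sym (eq i j)) (z i j)) (λ z i j → trans (eq i j) (z i j))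
  κ-cong (e ∷ w) {h} {k} eq = cong₂ _*_ (eq _ _) (κ-cong w (∖-cong e {h} {k} eq))

  splits : Word n → List (Word n × Word n)
  splits []      = ([] , []) ∷ []
  splits (e ∷ w) = map (λ (s , t) → e ∷ s , t) (splits w) ++ map (λ (s , t) → s , e ∷ t) (splits w)

  same-edge : ∀ (h : Multigraph n) {a b} e → SamePair a b (proj₁ e) (proj₂ e) → mult h a b ≡ at-edge h e
  same-edge h e (inj₁ (refl , refl)) = refl
  same-edge h e (inj₂ (refl , refl)) = symmetric h _ _

  ∖-⊕ˡ : ∀ (h k : Multigraph n) e → at-edge h e ≢ 0 → (h ⊕ k) ∖ e ≗ (h ∖ e) ⊕ k
  ∖-⊕ˡ h k e ≢0 a b = lemma (same? a b e)
    where
    lemma : (d : Dec (SamePair a b (proj₁ e) (proj₂ e))) → mult h a b + mult k a b ∸ ⟦ d ⟧ ≡ mult h a b ∸ ⟦ d ⟧ + mult k a b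
    lemma (yes p) = +-∸-comm (mult k a b) (n≢0⇒n>0 (λ z → ≢0 (trans (sym (same-edge h e p)) z)))
    lemma (no _)  = refl

  ∖-⊕ʳ : ∀ (h k : Multigraph n) e → at-edge k e ≢ 0 → (h ⊕ k) ∖ e ≗ h ⊕ (k ∖ e)
  ∖-⊕ʳ h k e ≢0 a b = lemma (same? a b e)
    where
    lemma : (d : Dec (SamePair a b (proj₁ e) (proj₂ e))) → mult h a b + mult k a b ∸ ⟦ d ⟧ ≡ mult h a b + (mult k a b ∸ ⟦ d ⟧)
    lemma (yes p) = +-∸-assoc (mult h a b) (n≢0⇒n>0 (λ z → ≢0 (trans (sym (same-edge k e p)) z)))
    lemma (no _)  = refl

  *-guard : ∀ a {x y} → (a ≢ 0 → x ≡ y) → a * x ≡ a * y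
  *-guard 0       eq = refl
  *-guard (suc a) eq = cong (suc a *_) (eq λ ())

  -- The Leibniz rule: each of the derivatives falls on one of the two factors.
  κ-⊕ : ∀ w (h k : Multigraph n) → κ w (h ⊕ k) ≡ ∑ (splits w) (λ (s , t) → κ s h * κ t k)
  κ-⊕ [] h k = trans (sym (⟦⟧-× (h ≗? ∅) (k ≗? ∅) (h ⊕ k ≗? ∅) (λ z → (λ i j → m+n≡0⇒m≡0 _ (z i j)) , (λ i j → m+n≡0⇒n≡0 (mult h i j) (z i j)))
    (λ y z i j → cong₂ _+_ (y i j) (z i j)))) (sym (+-identityʳ _))
  κ-⊕ (e ∷ w) h k = begin
    (at-edge h e + at-edge k e) * κ w ((h ⊕ k) ∖ e) ≡⟨ *-distribʳ-+ (κ w ((h ⊕ k) ∖ e)) (at-edge h e) _ ⟩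
    at-edge h e * κ w ((h ⊕ k) ∖ e) + at-edge k e * κ w ((h ⊕ k) ∖ e)
      ≡⟨ cong₂ _+_ (*-guard (at-edge h e) (λ ≢0 → trans (κ-cong w (∖-⊕ˡ h k e ≢0)) (κ-⊕ w (h ∖ e) k)))
                   (*-guard (at-edge k e) (λ ≢0 → trans (κ-cong w (∖-⊕ʳ h k e ≢0)) (κ-⊕ w h (k ∖ e)))) ⟩
    at-edge h e * ∑ (splits w) (λ (s , t) → κ s (h ∖ e) * κ t k) + at-edge k e * ∑ (splits w) (λ (s , t) → κ s h * κ t (k ∖ e))
      ≡⟨ cong₂ _+_ (trans (sym (∑-*ˡ (splits w) (at-edge h e) _)) (trans (∑-cong (splits w) (λ (s , t) → sym (*-assoc (at-edge h e) (κ s (h ∖ e)) (κ t k)))) (sym (∑-map (λ (s , t) → e ∷ s , t) (splits w) _))))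
                   (trans (sym (∑-*ˡ (splits w) (at-edge k e) _)) (trans (∑-cong (splits w) (λ (s , t) → x∙yz≈y∙xz (at-edge k e) (κ s h) (κ t (k ∖ e)))) (sym (∑-map (λ (s , t) → s , e ∷ t) (splits w) _)))) ⟩
    ∑ (map (λ (s , t) → e ∷ s , t) (splits w)) (λ (s , t) → κ s h * κ t k) + ∑ (map (λ (s , t) → s , e ∷ t) (splits w)) (λ (s , t) → κ s h * κ t k)
      ≡⟨ ∑-++ (map (λ (s , t) → e ∷ s , t) (splits w)) _ _ ⟨
    ∑ (splits (e ∷ w)) (λ (s , t) → κ s h * κ t k) ∎
    where
    open ≡-Reasoning
    open import Algebra.Properties.CommutativeSemigroup *-commutativeSemigroup using (x∙yz≈y∙xz)

  -- Derivatives commute. For different pairs the factors do not influence each other; for the same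
  -- pair with multiplicity a, both sides begin with a (a - 1).
  κ-swap : ∀ e e′ w (h : Multigraph n) → κ (e ∷ e′ ∷ w) h ≡ κ (e′ ∷ e ∷ w) h
  κ-swap e@(i , j) e′@(a , b) w h = begin
    at-edge h e * ((at-edge h e′ ∸ ⟦ same? a b e ⟧) * κ w (h ∖ e ∖ e′)) ≡⟨ *-assoc (at-edge h e) _ _ ⟨
    at-edge h e * (at-edge h e′ ∸ ⟦ same? a b e ⟧) * κ w (h ∖ e ∖ e′)
      ≡⟨ cong₂ _*_ (trans (scalar (same? a b e)) (cong (λ z → at-edge h e′ * (at-edge h e ∸ z)) (⟦⟧-cong (same? a b e) (same? i j e′) flip flip)))
                   (κ-cong w (λ x y → ∸-comm (mult h x y) ⟦ same? x y e ⟧ ⟦ same? x y e′ ⟧)) ⟩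
    at-edge h e′ * (at-edge h e ∸ ⟦ same? i j e′ ⟧) * κ w (h ∖ e′ ∖ e) ≡⟨ *-assoc (at-edge h e′) _ _ ⟩
    at-edge h e′ * ((at-edge h e ∸ ⟦ same? i j e′ ⟧) * κ w (h ∖ e′ ∖ e)) ∎
    where
    open ≡-Reasoning
    ∸-comm : ∀ x y z → x ∸ y ∸ z ≡ x ∸ z ∸ y
    ∸-comm x y z = trans (∸-+-assoc x y z) (trans (cong (x ∸_) (+-comm y z)) (sym (∸-+-assoc x z y)))
    flip : ∀ {n} {a b i j : Fin n} → SamePair a b i j → SamePair i j a b
    flip (inj₁ (refl , refl)) = inj₁ (refl , refl)
    flip (inj₂ (refl , refl)) = inj₂ (refl , refl)
    scalar : (d : Dec (SamePair a b i j)) → at-edge h e * (at-edge h e′ ∸ ⟦ d ⟧) ≡ at-edge h e′ * (at-edge h e ∸ ⟦ d ⟧)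
    scalar (yes p) = cong₂ (λ x y → x * (y ∸ 1)) (sym (same-edge h e p)) (same-edge h e p)
    scalar (no _)  = *-comm (at-edge h e) (at-edge h e′)

  κ-flip : ∀ {e e′ : Edge n} w h → SamePair (proj₁ e) (proj₂ e) (proj₁ e′) (proj₂ e′) → κ (e ∷ w) h ≡ κ (e′ ∷ w) h
  κ-flip w h (inj₁ (refl , refl)) = refl
  κ-flip {e = i , j} w h (inj₂ (refl , refl)) = cong₂ _*_ (symmetric h i j) (κ-cong w (λ a b → cong (mult h a b ∸_)
    (⟦⟧-cong (same? a b (i , j)) (same? a b (j , i)) Sum.swap Sum.swap)))

  remove : Edge n → Word n → Maybe (Word n)
  remove e []      = nothing
  remove e (x ∷ w) = if does (same? (proj₁ e) (proj₂ e) x) then just w else Data.Maybe.Base.map (x ∷_) (remove e w)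

  -- Equality of words as multisets of unordered pairs.
  matches : Word n → Word n → Bool
  matches []      []      = true
  matches []      (_ ∷ _) = false
  matches (e ∷ w) v       = Data.Maybe.Base.maybe (matches w) false (remove e v)

  module _ (ρ : Fin n → Fin m) where
    remove-κ : ∀ e v v′ h → remove e v ≡ just v′ → κ (mapWord ρ (e ∷ v′)) h ≡ κ (mapWord ρ v) h
    remove-κ e (x ∷ v) v′ h eq = cases (same? (proj₁ e) (proj₂ e) x) (remove e v) refl eq
      where
      cases : (d : Dec (SamePair (proj₁ e) (proj₂ e) (proj₁ x) (proj₂ x))) → ∀ r → remove e v ≡ r → (if does d then just v else Data.Maybe.Base.map (x ∷_) r) ≡ just v′ →
        κ (mapWord ρ (e ∷ v′)) h ≡ κ (mapWord ρ (x ∷ v)) h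
      cases (yes p) r       _   refl = κ-flip {e = ρ (proj₁ e) , ρ (proj₂ e)} {ρ (proj₁ x) , ρ (proj₂ x)} (mapWord ρ v) h
        (Sum.map (λ (y , z) → cong ρ y , cong ρ z) (λ (y , z) → cong ρ y , cong ρ z) p)
      cases (no _) (just r) eq′ refl = trans (κ-swap _ _ (mapWord ρ r) h) (cong (mult h _ _ *_) (remove-κ e v r _ eq′))

    matches-κ : ∀ w v h → matches w v ≡ true → κ (mapWord ρ w) h ≡ κ (mapWord ρ v) h
    matches-κ []      []      h ok = refl
    matches-κ (e ∷ w) v       h ok = cases (remove e v) refl ok
      where
      cases : ∀ r → remove e v ≡ r → Data.Maybe.Base.maybe (matches w) false r ≡ true → κ (mapWord ρ (e ∷ w)) h ≡ κ (mapWord ρ v) h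
      cases (just r) eq ok = trans (cong (mult h _ _ *_) (matches-κ w r _ ok)) (remove-κ e v r h eq)

  κ-• : ∀ (σ : Permutation′ n) w h → κ (mapWord (σ ⟨$⟩ʳ_) w) (σ • h) ≡ κ w h
  κ-• σ []            h = ⟦⟧-cong (σ • h ≗? ∅) (h ≗? ∅) (λ z i j → trans (sym (cong₂ (mult h) (Perm.inverseˡ σ) (Perm.inverseˡ σ))) (z (σ ⟨$⟩ʳ i) (σ ⟨$⟩ʳ j))) (λ z i j → z _ _)
  κ-• σ ((i , j) ∷ w) h = cong₂ _*_ (cong₂ (mult h) (Perm.inverseˡ σ) (Perm.inverseˡ σ)) (trans (κ-cong (mapWord (σ ⟨$⟩ʳ_) w) {σ • h ∖ (σ ⟨$⟩ʳ i , σ ⟨$⟩ʳ j)} {σ • (h ∖ (i , j))}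
    (λ a b → cong (mult h (σ ⟨$⟩ˡ a) (σ ⟨$⟩ˡ b) ∸_) (⟦⟧-cong (same? a b (σ ⟨$⟩ʳ i , σ ⟨$⟩ʳ j)) (same? (σ ⟨$⟩ˡ a) (σ ⟨$⟩ˡ b) (i , j))
      (Sum.map (λ (x , y) → back x , back y) (λ (x , y) → back x , back y)) (Sum.map (λ (x , y) → forth x , forth y) (λ (x , y) → forth x , forth y))))) (κ-• σ w (h ∖ (i , j))))
    where
    back : ∀ {x y} → x ≡ σ ⟨$⟩ʳ y → σ ⟨$⟩ˡ x ≡ y
    back eq = trans (cong (σ ⟨$⟩ˡ_) eq) (Perm.inverseˡ σ)
    forth : ∀ {x y} → σ ⟨$⟩ˡ x ≡ y → x ≡ σ ⟨$⟩ʳ y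
    forth eq = trans (sym (Perm.inverseʳ σ)) (cong (σ ⟨$⟩ʳ_) eq)

  κ-support : ∀ w (h : Multigraph n) → κ w h ≢ 0 → All (λ e → at-edge h e ≢ 0) w
  κ-support []      h ≢0 = []
  κ-support (e ∷ w) h ≢0 = (λ z → ≢0 (cong (_* κ w (h ∖ e)) z)) ∷
    All.map (λ {x} ne z → ne (trans (cong (_∸ ⟦ same? (proj₁ x) (proj₂ x) e ⟧) z) (0∸n≡0 ⟦ same? (proj₁ x) (proj₂ x) e ⟧))) (κ-support w (h ∖ e) (λ z → ≢0 (trans (cong (at-edge h e *_) z) (*-zeroʳ (at-edge h e)))))

  -- An `Edge` may have equal ends; the diagonal is set to 0 so that a multigraph results in any
  -- case.
  edgeGraph : Edge n → Multigraph n
  edgeGraph e = record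
    { mult      = λ a b → if does (a Fin.≟ b) then 0 else ⟦ same? a b e ⟧
    ; symmetric = λ a b → cong₂ (λ x y → if x then 0 else y) (does-⇔ (mk⇔ sym sym) (a Fin.≟ b) (b Fin.≟ a)) (⟦⟧-cong (same? a b e) (same? b a e) SamePair-swap SamePair-swap)
    ; loopless  = λ a → cong (if_then 0 else ⟦ same? a a e ⟧) (dec-true (a Fin.≟ a) refl)
    }
    where
    open import Function.Bundles using (mk⇔)
    open import Relation.Nullary.Decidable using (does-⇔; dec-true)

  graph : Word n → Multigraph n
  graph []      = ∅
  graph (e ∷ w) = edgeGraph e ⊕ graph w

  edgeGraph-off : ∀ (e : Edge n) {a b} → a ≢ b → mult (edgeGraph e) a b ≡ ⟦ same? a b e ⟧
  edgeGraph-off e {a} {b} ne = cong (if_then 0 else ⟦ same? a b e ⟧) (dec-false (a Fin.≟ b) ne)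
    where open import Relation.Nullary.Decidable using (dec-false)

  -- A constant is left only if the derivatives use up all edges of h. Hence `κ w` sees just one
  -- monomial, and derivatives at 0 are multiples of coefficients.
  κ-graph : ∀ w (h : Multigraph n) → κ w h ≢ 0 → h ≗ graph w
  κ-graph []      h ≢0 = decidable-stable (h ≗? ∅) (λ ne → ≢0 (⟦⟧-no (h ≗? ∅) ne))
  κ-graph {n} (e ∷ w) h ≢0 a b = cases (a Fin.≟ b)
    where
    lemma : (d : Dec (SamePair a b (proj₁ e) (proj₂ e))) → mult h a b ≡ ⟦ d ⟧ + (mult h a b ∸ ⟦ d ⟧)
    lemma (yes p) = sym (m+[n∸m]≡n (n≢0⇒n>0 (λ z → ≢0 (cong (_* κ w (h ∖ e)) (trans (sym (same-edge h e p)) z)))))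
    lemma (no _)  = refl
    cases : Dec (a ≡ b) → mult h a b ≡ mult (graph (e ∷ w)) a b
    cases (yes refl) = trans (loopless h a) (sym (loopless (graph (e ∷ w)) a))
    cases (no ne)    = trans (lemma (same? a b e)) (cong₂ _+_ (sym (edgeGraph-off e ne)) (κ-graph w (h ∖ e) (λ z → ≢0 (trans (cong (at-edge h e *_) z) (*-zeroʳ (at-edge h e)))) a b))

  κ-self : ∀ w → All (λ (i , j) → i ≢ j) w → κ w (graph {n} w) ≢ 0
  κ-self {n} []  []        eq = contradiction (trans (sym (⟦⟧-yes (∅ {n} ≗? ∅ {n}) (λ _ _ → refl))) eq) λ ()
  κ-self (e@(i , j) ∷ w) (ne ∷ nes) eq with m*n≡0⇒m≡0∨n≡0 (at-edge (graph (e ∷ w)) e) eq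
  ... | inj₁ z = contradiction (trans (sym (trans (edgeGraph-off e ne) (⟦⟧-yes (same? i j e) (inj₁ (refl , refl))))) (m+n≡0⇒m≡0 _ z)) λ ()
  ... | inj₂ z = κ-self w nes (trans (κ-cong w λ a b → cancel a b (a Fin.≟ b)) z)
    where
    cancel : ∀ a b → Dec (a ≡ b) → mult (graph w) a b ≡ mult (graph (e ∷ w)) a b ∸ ⟦ same? a b e ⟧
    cancel a .a (yes refl) = trans (loopless (graph w) a) (sym (trans (cong (_∸ ⟦ same? a a e ⟧) (loopless (graph (e ∷ w)) a)) (0∸n≡0 ⟦ same? a a e ⟧)))
    cancel a b  (no ne)    = sym (trans (cong (λ z → z + mult (graph w) a b ∸ ⟦ same? a b e ⟧) (edgeGraph-off e ne)) (m+n∸m≡n ⟦ same? a b e ⟧ _))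

-- A primitive functional of degree 4 on five vertices.

module PrimitiveFunctional where
  open import Defs using (permutations)
  open Derivatives
  open import Data.Bool.Base using (Bool; if_then_else_; _∧_)
  open import Data.Bool.ListAction using (any)
  open import Data.Fin.Base using (Fin)
  open import Data.Fin.Patterns
  import Data.Fin.Properties as Fin
  open import Data.Fin.Permutation using (_⟨$⟩ʳ_)
  open import Data.List.Base using (List; []; _∷_; _++_; map; concatMap; length; cartesianProduct; take)
  import Data.List.Properties as List
  open import Data.Nat.Base using (ℕ; _+_; _≡ᵇ_)
  open import Data.Product.Base using (_×_; _,_; proj₂; ∃; ∃₂)
  open import Data.List.Membership.Propositional using (_∈_)
  open import Data.List.Relation.Unary.Any using (here; there)
  import Data.Product.Properties as Product
  open import Relation.Binary.Definitions using (DecidableEquality)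
  open import Relation.Binary.PropositionalEquality
  open import Data.List.Relation.Unary.All using (All; []; _∷_)
  open import Function.Base using (_∘_)
  open import Relation.Nullary using (does)

  -- The lengths are compared first in order to avoid a search through 120 permutations.
  similar : Word 5 → Word 5 → Bool
  similar r w = (length w ≡ᵇ length r) ∧ any (λ σ → matches (mapWord (σ ⟨$⟩ʳ_) w) r) (permutations 5)

  search : List (Word 5) → Word 5 → Word 5
  search []       w = w
  search (r ∷ rs) w = if similar r w then r else search rs w

  -- The isomorphism classes on five vertices with one, two and three edges; there are 1, 3 and 7 of
  -- them.
  words₁ words₂ words₃ : List (Word 5)
  words₁ = ((0F , 1F) ∷ []) ∷ []
  words₂ = ((0F , 1F) ∷ (0F , 1F) ∷ []) ∷ ((0F , 1F) ∷ (0F , 2F) ∷ []) ∷ ((0F , 1F) ∷ (2F , 3F) ∷ []) ∷ []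
  words₃ = ((0F , 1F) ∷ (0F , 1F) ∷ (0F , 1F) ∷ []) ∷ ((0F , 1F) ∷ (0F , 1F) ∷ (0F , 2F) ∷ []) ∷ ((0F , 1F) ∷ (0F , 1F) ∷ (2F , 3F) ∷ []) ∷
           ((0F , 1F) ∷ (0F , 2F) ∷ (0F , 3F) ∷ []) ∷ ((0F , 1F) ∷ (0F , 2F) ∷ (1F , 2F) ∷ []) ∷ ((0F , 1F) ∷ (0F , 2F) ∷ (1F , 3F) ∷ []) ∷
           ((0F , 1F) ∷ (0F , 2F) ∷ (3F , 4F) ∷ []) ∷ []

  opaque
    representatives : List (Word 5)
    representatives = words₁ ++ words₂ ++ words₃

  canon : Word 5 → Word 5
  canon = search representatives

  -- A summand of the product rule: a multiple of the derivative of one factor along the first word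
  -- times the derivative of the other along the second.
  Term : Set
  Term = ℕ × Word 5 × Word 5

  Functional : Set
  Functional = List (ℕ × Word 5)

  _≟ʷ_ : DecidableEquality (Word 5 × Word 5)
  _≟ʷ_ = Product.≡-dec word word
    where
    word : DecidableEquality (Word 5)
    word = List.≡-dec (Product.≡-dec Fin._≟_ Fin._≟_)

  insert : Term → List Term → List Term
  insert (a , x) []             = (a , x) ∷ []
  insert (a , x) ((b , y) ∷ ts) = if does (x ≟ʷ y) then (a + b , y) ∷ ts else (b , y) ∷ insert (a , x) ts

  collect : List Term → List Term → List Term
  collect []       acc = acc
  collect (t ∷ ts) acc = collect ts (insert t acc)

  splitTerms : Functional → List Term
  splitTerms = concatMap (λ (a , w) → map (λ (s , t) → a , canon s , canon t) (splits w))

  opaque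
    -- Terms with coefficient 0 for all 1 * 7 + 3 * 3 + 7 * 1 = 23 pairs of classes of degrees
    -- (1,3), (2,2) and (3,1). They fix the order of the results of `collect`, so that those of two
    -- functionals can be compared as lists.
    keys : List Term
    keys = map (0 ,_) (cartesianProduct words₁ words₃ ++ cartesianProduct words₂ words₂ ++ cartesianProduct words₃ words₁)

  trivial : Functional → List Term
  trivial = concatMap (λ (a , w) → (a , w , []) ∷ (a , [] , w) ∷ [])

  triple double : Word 5
  triple = (0F , 1F) ∷ (0F , 1F) ∷ (0F , 1F) ∷ (2F , 3F) ∷ []
  double = (0F , 1F) ∷ (0F , 1F) ∷ (2F , 3F) ∷ (2F , 3F) ∷ []

  adjacent⁺ adjacent⁻ : Functional
  adjacent⁺ = (3 , (0F , 1F) ∷ (0F , 1F) ∷ (0F , 2F) ∷ (0F , 2F) ∷ []) ∷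
              (3 , (0F , 1F) ∷ (0F , 1F) ∷ (0F , 2F) ∷ (2F , 3F) ∷ []) ∷
              (3 , (0F , 1F) ∷ (0F , 1F) ∷ (2F , 3F) ∷ (2F , 4F) ∷ []) ∷ []
  adjacent⁻ = (2 , (0F , 1F) ∷ (0F , 1F) ∷ (0F , 1F) ∷ (0F , 2F) ∷ []) ∷
              (3 , (0F , 1F) ∷ (0F , 1F) ∷ (0F , 2F) ∷ (1F , 3F) ∷ []) ∷
              (3 , (0F , 1F) ∷ (0F , 1F) ∷ (0F , 2F) ∷ (3F , 4F) ∷ []) ∷ []

  -- positive − negative spans the functionals of degree 4 that vanish on the
  -- simple graphs and on the products of invariants of positive degree.

  positive negative : Functional
  positive = (2 , triple) ∷ adjacent⁺
  negative = (3 , double) ∷ adjacent⁻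

  opaque
    unfolding representatives keys

    -- The mixed terms of the product rule, at the places of the 23 keys. They are the same for both
    -- functionals, so in the difference only the terms survive in which all derivatives fall on one
    -- factor.
    core : List Term
    core = take 23 (collect (splitTerms positive) keys)

    collect-positive : collect (splitTerms positive) keys ≡ core ++ trivial positive
    collect-positive = refl

    collect-negative : collect (splitTerms negative) keys ≡ core ++ trivial negative
    collect-negative = refl

  -- A second derivative along one and the same edge annihilates the monomials of simple graphs.
  Doubled : Word 5 → Set
  Doubled w = ∃₂ λ e v → w ≡ e ∷ e ∷ v

  positive-doubled : All (Doubled ∘ proj₂) positive
  positive-doubled = (_ , _ , refl) ∷ (_ , _ , refl) ∷ (_ , _ , refl) ∷ (_ , _ , refl) ∷ []

  negative-doubled : All (Doubled ∘ proj₂) negative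
  negative-doubled = (_ , _ , refl) ∷ (_ , _ , refl) ∷ (_ , _ , refl) ∷ (_ , _ , refl) ∷ []

  -- Two different edges at one vertex: derivatives along such a word annihilate the monomials of
  -- matchings, with or without multiplicities.
  Adjacent : Word 5 → Set
  Adjacent w = ∃ λ a → ∃₂ λ b c → (a , b) ∈ w × (a , c) ∈ w × b ≢ c

  adjacent⁺-adjacent : All (Adjacent ∘ proj₂) adjacent⁺
  adjacent⁺-adjacent = (0F , 1F , 2F , here refl , there (there (here refl)) , λ ()) ∷ (0F , 1F , 2F , here refl , there (there (here refl)) , λ ()) ∷
    (2F , 3F , 4F , there (there (here refl)) , there (there (there (here refl))) , λ ()) ∷ []

  adjacent⁻-adjacent : All (Adjacent ∘ proj₂) adjacent⁻
  adjacent⁻-adjacent = (0F , 1F , 2F , here refl , there (there (there (here refl))) , λ ()) ∷ (0F , 1F , 2F , here refl , there (there (here refl)) , λ ()) ∷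
    (0F , 1F , 2F , here refl , there (there (here refl)) , λ ()) ∷ []

-- Orbit sums of simple graphs do not generate.

module SimpleGraphs (q-1 : ℕ) {c ℓ} (R : CommutativeRing c ℓ) where
  open Sums
  open Permutations
  open Representatives q-1
  open OrbitPolynomials q-1 R
  open Derivatives
  open PrimitiveFunctional
  open import Defs hiding (permutations-complete)
  open Polynomials R hiding (GeneratesInvariants; OrbitSums; _≈_)
  open Convolution R
  open import Algebra.Bundles using (Semiring)
  import Algebra.Definitions.RawSemiring as RawSemiringDefinitions
  open import Algebra.Properties.Semiring.Mult (CommutativeRing.semiring R) using (×-congʳ; ×-homo-+; ×-assocˡ; ×-assoc-*; ×-comm-*; ×1-homo-*)
  open import Algebra.Properties.CommutativeMonoid.Mult (CommutativeRing.+-commutativeMonoid R) using (×-distrib-+)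
  open import Algebra.Properties.CommutativeSemigroup (CommutativeRing.+-commutativeSemigroup R) using (x∙yz≈y∙xz; interchange)
  open import Algebra.Properties.CommutativeSemigroup (CommutativeRing.*-commutativeSemigroup R) using () renaming (interchange to *-interchange)
  open import Data.Bool.Base using (true; false; if_then_else_; T)
  open import Data.Bool.Properties using (T-≡; T-∧)
  open import Data.Fin.Base using (Fin; suc; _↑ʳ_)
  open import Data.Fin.Patterns
  import Data.Fin.Properties as Fin
  open import Data.Fin.Permutation as Perm using (Permutation′; _⟨$⟩ʳ_; _⟨$⟩ˡ_)
  open import Data.List.Base using (List; []; _∷_; _++_; map; length; foldr)
  import Data.List.Properties as List
  open import Data.List.Membership.Propositional using (_∈_; find)
  open import Data.List.Relation.Unary.All using (All; []; _∷_)
  import Data.List.Relation.Unary.All as All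
  import Data.List.Relation.Unary.Any.Properties as Any
  open import Data.Nat.Base hiding (ℕ; suc; _⊔_)
  open import Data.Nat.Properties
  open import Data.Product.Base using (_×_; _,_; proj₁; proj₂; ∃)
  open import Data.Sum.Base as Sum using (_⊎_; inj₁; inj₂)
  open import Function.Base using (_∘_)
  open import Function.Bundles using (Equivalence)
  open import Relation.Binary.PropositionalEquality as ≡ hiding (_≗_; resp)
  open import Relation.Nullary using (Dec; yes; no; does; ¬_; contradiction)

  private
    module R = CommutativeRing R
    variable
      n : ℕ

  open RawSemiringDefinitions (Semiring.rawSemiring R.semiring) using () renaming (_×_ to infixr 8 _·_)
  open import Relation.Binary.Reasoning.Setoid R.setoid

  Σ : ∀ {a} {A : Set a} → List A → (A → R.Carrier) → R.Carrier
  Σ xs φ = foldr (λ x s → φ x R.+ s) R.0# xs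

  Σ-cong : ∀ {a} {A : Set a} (xs : List A) {φ ψ} → (∀ x → φ x R.≈ ψ x) → Σ xs φ R.≈ Σ xs ψ
  Σ-cong []       eq = R.refl
  Σ-cong (x ∷ xs) eq = R.+-cong (eq x) (Σ-cong xs eq)

  Σ-++ : ∀ {a} {A : Set a} (xs ys : List A) φ → Σ (xs ++ ys) φ R.≈ Σ xs φ R.+ Σ ys φ
  Σ-++ []       ys φ = R.sym (R.+-identityˡ _)
  Σ-++ (x ∷ xs) ys φ = R.trans (R.+-congˡ (Σ-++ xs ys φ)) (R.sym (R.+-assoc _ _ _))

  Σ-map : ∀ {a b} {A : Set a} {B : Set b} (f : A → B) xs φ → Σ (map f xs) φ R.≈ Σ xs (φ ∘ f)
  Σ-map f []       φ = R.refl
  Σ-map f (x ∷ xs) φ = R.+-congˡ (Σ-map f xs φ)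

  Σ-· : ∀ {a} {A : Set a} (xs : List A) k φ → Σ xs (λ x → k · φ x) R.≈ k · Σ xs φ
  Σ-· []       k φ = R.sym (R.trans (R.sym (×-congʳ k (R.zeroˡ R.0#))) (R.trans (R.sym (×-assoc-* k R.0# R.0#)) (R.zeroʳ _)))
  Σ-· (x ∷ xs) k φ = R.trans (R.+-congˡ (Σ-· xs k φ)) (R.sym (×-distrib-+ (φ x) (Σ xs φ) k))

  -- The derivatives of f at 0, cf. κ.

  hat : Poly n → Word n → R.Carrier
  hat f w = pair f (λ h → κ w h · R.1#)

  κ-δ : ∀ w (h : Multigraph n) → κ w h · R.1# R.≈ κ w (graph w) · R.1# R.* δ (graph w) h
  κ-δ w h = cases (h ≗? graph w)
    where
    cases : (d : Dec (h ≗ graph w)) → κ w h · R.1# R.≈ κ w (graph w) · R.1# R.* when d R.1#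
    cases (yes eq) = R.trans (R.reflexive (cong (_· R.1#) (κ-cong w {h} {graph w} eq))) (R.sym (R.*-identityʳ _))
    cases (no ne)  = R.trans (R.reflexive (cong (_· R.1#) vanish)) (R.sym (R.zeroʳ _))
      where
      open import Relation.Nullary.Decidable using (decidable-stable)
      vanish : κ w h ≡ 0
      vanish = decidable-stable (κ w h ≟ 0) (λ ≢0 → ne (κ-graph w h ≢0))

  hat-coeff : ∀ (f : Poly n) w → hat f w R.≈ κ w (graph w) · R.1# R.* coeff f (graph w)
  hat-coeff f w = R.trans (pair-cong f (κ-δ w)) (R.trans (pair-* f (κ w (graph w) · R.1#) (δ (graph w))) (R.*-congˡ (R.sym (coeff-pair f (graph w)))))

  hat-cong : ∀ {f g : Poly n} w → f ≋ g → hat f w R.≈ hat g w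
  hat-cong {f = f} {g} w e = R.trans (hat-coeff f w) (R.trans (R.*-congˡ (same e (graph w))) (R.sym (hat-coeff g w)))

  hat-⊠ : ∀ (f g : Poly n) w → hat (f ⊠ g) w R.≈ Σ (splits w) (λ (s , t) → hat f s R.* hat g t)
  hat-⊠ f g w = R.trans (pair-⊠ f g (λ h → κ w h · R.1#)) (R.trans (pair-cong f (λ h → pair-cong g (λ k → R.reflexive (cong (_· R.1#) (κ-⊕ w h k))))) (distribute (splits w)))
    where
    distribute : ∀ L → pair f (λ h → pair g (λ k → ∑ L (λ (s , t) → κ s h * κ t k) · R.1#)) R.≈ Σ L (λ (s , t) → hat f s R.* hat g t)
    distribute []            = R.trans (pair-cong f (λ _ → pair-0 g)) (pair-0 f)
    distribute ((s , t) ∷ L) = begin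
      pair f (λ h → pair g (λ k → (κ s h * κ t k + rest h k) · R.1#))
        ≈⟨ pair-cong f (λ h → R.trans (pair-cong g (λ k → R.trans (×-homo-+ R.1# (κ s h * κ t k) (rest h k)) (R.+-congʳ (×1-homo-* (κ s h) (κ t k))))) (pair-+ g _ _)) ⟩
      pair f (λ h → pair g (λ k → κ s h · R.1# R.* κ t k · R.1#) R.+ pair g (λ k → rest h k · R.1#)) ≈⟨ pair-+ f _ _ ⟩
      pair f (λ h → pair g (λ k → κ s h · R.1# R.* κ t k · R.1#)) R.+ pair f (λ h → pair g (λ k → rest h k · R.1#))
        ≈⟨ R.+-cong (R.trans (pair-cong f (λ h → R.trans (pair-* g (κ s h · R.1#) _) (R.*-comm _ _))) (R.trans (pair-* f (hat g t) _) (R.*-comm _ _))) (distribute L) ⟩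
      hat f s R.* hat g t R.+ Σ L (λ (s , t) → hat f s R.* hat g t) ∎
      where
      rest : Multigraph _ → Multigraph _ → ℕ
      rest h k = ∑ L (λ (s , t) → κ s h * κ t k)

  hat-const : ∀ a e (w : Word n) → hat (const a) (e ∷ w) R.≈ R.0#
  hat-const a e w = R.trans (R.+-identityʳ _) (R.zeroʳ a)

  hat-zero : ∀ (f : Poly n) w → All (λ h → κ w h ≡ 0) (monomials f) → hat f w R.≈ R.0#
  hat-zero []            w []       = R.refl
  hat-zero ((a , h) ∷ f) w (z ∷ zs) = R.trans (R.+-cong (R.trans (R.*-congˡ (R.reflexive (cong (_· R.1#) z))) (R.zeroʳ a)) (hat-zero f w zs)) (R.+-identityˡ _)

  hat-act : ∀ (σ : Permutation′ n) f w → hat (act σ f) (mapWord (σ ⟨$⟩ʳ_) w) R.≈ hat f w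
  hat-act σ []            w = R.refl
  hat-act σ ((a , h) ∷ f) w = R.+-cong (R.*-congˡ (R.reflexive (cong (_· R.1#) (κ-• σ w h)))) (hat-act σ f w)

  hat-invariant : ∀ (σ : Permutation′ n) (f : Poly n) → IsInvariant f → ∀ w → hat f (mapWord (σ ⟨$⟩ʳ_) w) R.≈ hat f w
  hat-invariant σ f inv w = R.trans (R.sym (hat-cong {f = act σ f} {f} (mapWord (σ ⟨$⟩ʳ_) w) (at (inv σ)))) (hat-act σ f w)

  lift : ∀ k → Permutation′ n → Permutation′ (k + n)
  lift 0       σ = σ
  lift (suc k) σ = Perm.lift₀ (lift k σ)

  lift-↑ʳ : ∀ k (σ : Permutation′ n) i → lift k σ ⟨$⟩ʳ (k ↑ʳ i) ≡ k ↑ʳ (σ ⟨$⟩ʳ i)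
  lift-↑ʳ 0       σ i = refl
  lift-↑ʳ (suc k) σ i = cong suc (lift-↑ʳ k σ i)

  splits-map : ∀ {m} (ρ : Fin n → Fin m) w → splits (mapWord ρ w) ≡ map (λ (s , t) → mapWord ρ s , mapWord ρ t) (splits w)
  splits-map ρ []      = refl
  splits-map ρ (e ∷ w) = trans (cong (λ z → map _ z ++ map _ z) (splits-map ρ w)) (trans (cong₂ _++_ (trans (sym (List.map-∘ (splits w))) (List.map-∘ (splits w))) (trans (sym (List.map-∘ (splits w))) (List.map-∘ (splits w))))
    (sym (List.map-++ _ (map _ (splits w)) _)))

  module _ (k : ℕ) where
    ι : Word 5 → Word (k + 5)
    ι = mapWord (k ↑ʳ_)

    -- A permutation of the five chosen vertices extends to all vertices by fixing the others, so an
    -- invariant has equal derivatives along similar words.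
    similar-hat : ∀ f → IsInvariant f → ∀ r w → T (similar r w) → hat f (ι r) R.≈ hat f (ι w)
    similar-hat f inv r w ok = from (find (Any.any⁻ (λ σ → matches (mapWord (σ ⟨$⟩ʳ_) w) r) (permutations 5) (proj₂ (Equivalence.to (T-∧ {length w ≡ᵇ length r}) ok))))
      where
      from : ∀ {σs : List (Permutation′ 5)} → (∃ λ σ → σ ∈ σs × T (matches (mapWord (σ ⟨$⟩ʳ_) w) r)) → hat f (ι r) R.≈ hat f (ι w)
      from (σ , _ , m) = begin
        hat f (ι r) ≈⟨ pair-cong f (λ h → R.reflexive (cong (_· R.1#) (matches-κ (k ↑ʳ_) (mapWord (σ ⟨$⟩ʳ_) w) r h (Equivalence.to T-≡ m)))) ⟨
        hat f (ι (mapWord (σ ⟨$⟩ʳ_) w)) ≡⟨ cong (hat f) (trans (sym (List.map-∘ w)) (trans (List.map-cong (λ (i , j) → cong₂ _,_ (sym (lift-↑ʳ k σ i)) (sym (lift-↑ʳ k σ j))) w) (List.map-∘ w))) ⟩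
        hat f (mapWord (lift k σ ⟨$⟩ʳ_) (ι w)) ≈⟨ hat-invariant (lift k σ) f inv (ι w) ⟩
        hat f (ι w) ∎

    search-hat : ∀ f → IsInvariant f → ∀ rs w → hat f (ι (search rs w)) R.≈ hat f (ι w)
    search-hat f inv []       w = R.refl
    search-hat f inv (r ∷ rs) w = cases (similar r w) refl
      where
      cases : ∀ b → similar r w ≡ b → hat f (ι (if b then r else search rs w)) R.≈ hat f (ι w)
      cases true  eq = similar-hat f inv r w (Equivalence.from T-≡ eq)
      cases false eq = search-hat f inv rs w

    φ : Functional → Poly (k + 5) → R.Carrier
    φ P f = Σ P (λ (a , w) → a · hat f (ι w))

    φ-cong : ∀ P {f g} → f ≋ g → φ P f R.≈ φ P g
    φ-cong P e = Σ-cong P (λ (a , w) → ×-congʳ a (hat-cong (ι w) e))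

    module _ (f g : Poly (k + 5)) where
      value : Term → R.Carrier
      value (a , s , t) = a · (hat f (ι s) R.* hat g (ι t))

      insert-value : ∀ t ts → Σ (insert t ts) value R.≈ value t R.+ Σ ts value
      insert-value (a , x) []             = R.refl
      insert-value (a , x) ((b , y) ∷ ts) = cases (x ≟ʷ y)
        where
        cases : (d : Dec (x ≡ y)) → Σ (if does d then (a + b , y) ∷ ts else (b , y) ∷ insert (a , x) ts) value R.≈ value (a , x) R.+ (value (b , y) R.+ Σ ts value)
        cases (yes refl) = R.trans (R.+-congʳ (×-homo-+ _ a b)) (R.+-assoc _ _ _)
        cases (no _)     = R.trans (R.+-congˡ (insert-value (a , x) ts)) (x∙yz≈y∙xz _ _ _)

      collect-value : ∀ ts acc → Σ (collect ts acc) value R.≈ Σ ts value R.+ Σ acc value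
      collect-value []       acc = R.sym (R.+-identityˡ _)
      collect-value (t ∷ ts) acc = R.trans (collect-value ts (insert t acc)) (R.trans (R.+-congˡ (insert-value t acc)) (R.trans (x∙yz≈y∙xz _ _ _) (R.sym (R.+-assoc _ _ _))))

      -- The Leibniz rule, after which invariance of both factors permits each word to be replaced
      -- by its representative.
      expand-value : IsInvariant f → IsInvariant g → ∀ P → Σ (splitTerms P) value R.≈ φ P (f ⊠ g)
      expand-value inv inv′ []            = R.refl
      expand-value inv inv′ ((a , w) ∷ P) = R.trans (Σ-++ (map _ (splits w)) (splitTerms P) value) (R.+-cong (begin
        Σ (map (λ (s , t) → a , canon s , canon t) (splits w)) value ≈⟨ Σ-map _ (splits w) value ⟩
        Σ (splits w) (λ (s , t) → a · (hat f (ι (canon s)) R.* hat g (ι (canon t)))) ≈⟨ Σ-· (splits w) a _ ⟩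
        a · Σ (splits w) (λ (s , t) → hat f (ι (canon s)) R.* hat g (ι (canon t)))
          ≈⟨ ×-congʳ a (Σ-cong (splits w) (λ (s , t) → R.*-cong (search-hat f inv representatives s) (search-hat g inv′ representatives t))) ⟩
        a · Σ (splits w) (λ (s , t) → hat f (ι s) R.* hat g (ι t)) ≈⟨ ×-congʳ a (Σ-map _ (splits w) (λ (s , t) → hat f s R.* hat g t)) ⟨
        a · Σ (map (λ (s , t) → ι s , ι t) (splits w)) (λ (s , t) → hat f s R.* hat g t) ≡⟨ cong (λ L → a · Σ L (λ (s , t) → hat f s R.* hat g t)) (splits-map (k ↑ʳ_) w) ⟨
        a · Σ (splits (ι w)) (λ (s , t) → hat f s R.* hat g t) ≈⟨ ×-congʳ a (hat-⊠ f g (ι w)) ⟨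
        a · hat (f ⊠ g) (ι w) ∎) (expand-value inv inv′ P))

      trivial-value : ∀ P → Σ (trivial P) value R.≈ φ P f R.* hat g [] R.+ hat f [] R.* φ P g
      trivial-value []            = R.sym (R.trans (R.+-cong (R.zeroˡ _) (R.zeroʳ _)) (R.+-identityˡ _))
      trivial-value ((a , w) ∷ P) = begin
        a · (hat f (ι w) R.* hat g []) R.+ (a · (hat f [] R.* hat g (ι w)) R.+ Σ (trivial P) value)
          ≈⟨ R.+-cong (R.sym (×-assoc-* a _ _)) (R.+-cong (R.sym (×-comm-* a _ _)) (trivial-value P)) ⟩
        a · hat f (ι w) R.* hat g [] R.+ (hat f [] R.* a · hat g (ι w) R.+ (φ P f R.* hat g [] R.+ hat f [] R.* φ P g)) ≈⟨ R.sym (R.+-assoc _ _ _) ⟩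
        a · hat f (ι w) R.* hat g [] R.+ hat f [] R.* a · hat g (ι w) R.+ (φ P f R.* hat g [] R.+ hat f [] R.* φ P g) ≈⟨ interchange _ _ _ _ ⟩
        a · hat f (ι w) R.* hat g [] R.+ φ P f R.* hat g [] R.+ (hat f [] R.* a · hat g (ι w) R.+ hat f [] R.* φ P g)
          ≈⟨ R.+-cong (R.distribʳ _ _ _) (R.distribˡ _ _ _) ⟨
        (a · hat f (ι w) R.+ φ P f) R.* hat g [] R.+ hat f [] R.* (a · hat g (ι w) R.+ φ P g) ∎

      -- The sum over the keys is simply carried along; it is the same for both functionals and
      -- cancels in `Balanced-⊠`.
      φ-⊠ : IsInvariant f → IsInvariant g → ∀ P → collect (splitTerms P) keys ≡ core ++ trivial P →
        φ P (f ⊠ g) R.+ Σ keys value R.≈ Σ core value R.+ (φ P f R.* hat g [] R.+ hat f [] R.* φ P g)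
      φ-⊠ inv inv′ P eq = begin
        φ P (f ⊠ g) R.+ Σ keys value ≈⟨ R.+-congʳ (expand-value inv inv′ P) ⟨
        Σ (splitTerms P) value R.+ Σ keys value ≈⟨ collect-value (splitTerms P) keys ⟨
        Σ (collect (splitTerms P) keys) value ≡⟨ cong (λ L → Σ L value) eq ⟩
        Σ (core ++ trivial P) value ≈⟨ R.trans (Σ-++ core (trivial P) value) (R.+-congˡ (trivial-value P)) ⟩
        Σ core value R.+ (φ P f R.* hat g [] R.+ hat f [] R.* φ P g) ∎

    -- The vanishing of positive - negative without a subtraction. Invariance is part of it because
    -- the product rule compares words up to similarity.
    Balanced : Poly (k + 5) → Set _
    Balanced f = IsInvariant f × φ positive f R.≈ φ negative f

    Balanced-⊠ : ∀ {f g} → Balanced f → Balanced g → Balanced (f ⊠ g)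
    Balanced-⊠ {f} {g} (inv , bal) (inv′ , bal′) = ⊠-invariant f g inv inv′ , +-cancelʳ (Σ keys (value f g)) _ _ (begin
      φ positive (f ⊠ g) R.+ Σ keys (value f g) ≈⟨ φ-⊠ f g inv inv′ positive collect-positive ⟩
      Σ core (value f g) R.+ (φ positive f R.* hat g [] R.+ hat f [] R.* φ positive g) ≈⟨ R.+-congˡ (R.+-cong (R.*-congʳ bal) (R.*-congˡ bal′)) ⟩
      Σ core (value f g) R.+ (φ negative f R.* hat g [] R.+ hat f [] R.* φ negative g) ≈⟨ φ-⊠ f g inv inv′ negative collect-negative ⟨
      φ negative (f ⊠ g) R.+ Σ keys (value f g) ∎)
      where open import Algebra.Properties.Group R.+-group using () renaming (∙-cancelʳ to +-cancelʳ)

    φ-++ : ∀ P (f g : Poly (k + 5)) → φ P (f ++ g) R.≈ φ P f R.+ φ P g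
    φ-++ []            f g = R.sym (R.+-identityˡ _)
    φ-++ ((a , w) ∷ P) f g = R.trans (R.+-cong (R.trans (×-congʳ a (pair-++ f g _)) (×-distrib-+ _ _ a)) (φ-++ P f g)) (interchange _ _ _ _)

    φ-zero : ∀ (f : Poly (k + 5)) P → All (λ (a , w) → hat f (ι w) R.≈ R.0#) P → φ P f R.≈ R.0#
    φ-zero f []            []       = R.refl
    φ-zero f ((a , w) ∷ P) (z ∷ zs) = R.trans (R.+-cong (R.trans (×-congʳ a z) (·-zero a)) (φ-zero f P zs)) (R.+-identityˡ _)
      where
      ·-zero : ∀ a → a · R.0# R.≈ R.0#
      ·-zero 0       = R.refl
      ·-zero (suc a) = R.trans (R.+-identityˡ _) (·-zero a)

    subalgebra-Balanced : ∀ {f} → Subalgebra (OrbitSums R IsSimple) f → Balanced f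
    subalgebra-Balanced (gen (g , simple , refl)) = subst Balanced (orbitSum-≡ g) (orbitSum-invariant g ,
      R.trans (φ-zero (orbitSum g) positive (All.map (λ {t} → doubled-zero {t}) positive-doubled)) (R.sym (φ-zero (orbitSum g) negative (All.map (λ {t} → doubled-zero {t}) negative-doubled))))
      where
      square-zero : ∀ e w → hat (orbitSum g) (e ∷ e ∷ w) R.≈ R.0#
      square-zero e w = hat-zero (orbitSum g) (e ∷ e ∷ w) (All.map (λ {h} (via σ m) → square h (Sum.map (trans (sym (value≡ {h} σ m))) (trans (sym (value≡ {h} σ m))) (simple _ _))) (orbitSum-monomials g))
        where
        value≡ : ∀ {h} (σ : Permutation′ (k + 5)) → Maps σ g h → mult g (σ ⟨$⟩ˡ proj₁ e) (σ ⟨$⟩ˡ proj₂ e) ≡ at-edge h e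
        value≡ {h} σ m = trans (sym (m _ _)) (cong₂ (mult h) (Perm.inverseʳ σ) (Perm.inverseʳ σ))
        square : ∀ h → at-edge h e ≡ 0 ⊎ at-edge h e ≡ 1 → κ (e ∷ e ∷ w) h ≡ 0
        square h (inj₁ eq) = cong (_* κ (e ∷ w) (h ∖ e)) eq
        square h (inj₂ eq) = trans (cong (at-edge h e *_) (cong (_* κ w (h ∖ e ∖ e)) (cong₂ _∸_ eq (⟦⟧-yes (same? (proj₁ e) (proj₂ e) e) (inj₁ (refl , refl)))))) (*-zeroʳ (at-edge h e))
      doubled-zero : ∀ {t : ℕ × Word 5} → Doubled (proj₂ t) → hat (orbitSum g) (ι (proj₂ t)) R.≈ R.0#
      doubled-zero (e , w , refl) = square-zero (k ↑ʳ proj₁ e , k ↑ʳ proj₂ e) (ι w)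
    subalgebra-Balanced (con a) = invariant , R.trans (φ-zero (const a) positive (All.map (λ {t} → z {t}) positive-doubled)) (R.sym (φ-zero (const a) negative (All.map (λ {t} → z {t}) negative-doubled)))
      where
      z : ∀ {t : ℕ × Word 5} → Doubled (proj₂ t) → hat (const {k + 5} a) (ι (proj₂ t)) R.≈ R.0#
      z (e , w , refl) = hat-const a (k ↑ʳ proj₁ e , k ↑ʳ proj₂ e) (ι (e ∷ w))
      invariant : IsInvariant (const a)
      invariant σ g = R.trans (coeff-act σ (const a) g) (R.trans (coeff-pair (const a) (Perm.flip σ • g)) (R.trans (R.+-congʳ (R.*-congˡ (δ-cong {g = Perm.flip σ • g} {∅} {g} {∅}
        (λ e i j → trans (e (σ ⟨$⟩ˡ i) (σ ⟨$⟩ˡ j)) (cong₂ (mult g) (Perm.inverseʳ σ) (Perm.inverseʳ σ))) (λ e i j → e _ _)))) (R.sym (coeff-pair (const a) g))))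
    subalgebra-Balanced (add {f} {f′} x y) = let inv , bal = subalgebra-Balanced x ; inv′ , bal′ = subalgebra-Balanced y in
      (λ σ → subst (λ z → ∀ g → coeff z g R.≈ coeff (f ++ f′) g) (sym (act-⊞ σ f f′)) (same (++-cong {f = act σ f} {f} {act σ f′} {f′} (at (inv σ)) (at (inv′ σ))))) ,
      R.trans (φ-++ positive f f′) (R.trans (R.+-cong bal bal′) (R.sym (φ-++ negative f f′)))
    subalgebra-Balanced (mul {f} {f′} x y) = Balanced-⊠ {f} {f′} (subalgebra-Balanced x) (subalgebra-Balanced y)
    subalgebra-Balanced (Subalgebra.resp {f} {f′} e x) = let inv , bal = subalgebra-Balanced x in
      (λ σ → same (P.trans (act-cong σ {f′} {f} (P.sym (at e))) (P.trans {i = act σ f} {f} {f′} (at (inv σ)) (at e)))) ,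
      R.trans (R.sym (φ-cong positive {f} {f′} (at e))) (R.trans bal (φ-cong negative {f} {f′} (at e)))

    -- Properties that tell the graph of `double` from the other words of the functional: the
    -- adjacent words contradict the first one, `triple` contradicts the second.
    Matching : Multigraph (k + 5) → Set
    Matching h = (∀ i j l → mult h i j ≢ 0 → mult h i l ≢ 0 → j ≡ l) × (∀ i j → mult h i j ≤ 2)

    Matching-Iso : ∀ {g h} → Iso g h → Matching g → Matching h
    Matching-Iso {g} {h} (via σ m) (partner , two) =
      (λ i j l a b → trans (sym (Perm.inverseʳ σ)) (trans (cong (σ ⟨$⟩ʳ_) (partner (σ ⟨$⟩ˡ i) (σ ⟨$⟩ˡ j) (σ ⟨$⟩ˡ l) (a ∘ trans (value≡ i j)) (b ∘ trans (value≡ i l)))) (Perm.inverseʳ σ))) ,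
      (λ i j → ≤-trans (≤-reflexive (value≡ i j)) (two _ _))
      where
      value≡ : ∀ i j → mult h i j ≡ mult g (σ ⟨$⟩ˡ i) (σ ⟨$⟩ˡ j)
      value≡ i j = trans (sym (cong₂ (mult h) (Perm.inverseʳ σ) (Perm.inverseʳ σ))) (m _ _)

    edgeGraph-≤1 : ∀ (e : Edge n) i j → mult (edgeGraph e) i j ≤ 1
    edgeGraph-≤1 e i j with does (i Fin.≟ j)
    ... | true  = z≤n
    ... | false = ⟦⟧-≤1 (same? i j e)

    edgeGraph-support : ∀ (e : Edge n) i j → mult (edgeGraph e) i j ≢ 0 → SamePair i j (proj₁ e) (proj₂ e)
    edgeGraph-support e i j ≢0 = decidable-stable (same? i j e) (λ ne → ≢0 (vanish (does (i Fin.≟ j)) ne))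
      where
      open import Relation.Nullary.Decidable using (decidable-stable)
      vanish : ∀ b → ¬ SamePair i j (proj₁ e) (proj₂ e) → (if b then 0 else ⟦ same? i j e ⟧) ≡ 0
      vanish true  ne = refl
      vanish false ne = ⟦⟧-no (same? i j e) ne

    Matching-double : Matching (graph (ι double))
    Matching-double = unique , bound
      where
      e₁′ e₂ : Edge (k + 5)
      e₁′ = k ↑ʳ 0F , k ↑ʳ 1F
      e₂ = k ↑ʳ 2F , k ↑ʳ 3F
      partner : Fin 5 → Fin 5
      partner 0F = 1F
      partner 1F = 0F
      partner 2F = 3F
      partner 3F = 2F
      partner 4F = 4F
      Partners : Fin (k + 5) → Fin (k + 5) → Set
      Partners i j = ∃ λ x → i ≡ k ↑ʳ x × j ≡ k ↑ʳ partner x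
      partners : ∀ {i j} → SamePair i j (proj₁ e₁′) (proj₂ e₁′) ⊎ SamePair i j (proj₁ e₂) (proj₂ e₂) → Partners i j
      partners (inj₁ (inj₁ (p , r))) = 0F , p , r
      partners (inj₁ (inj₂ (p , r))) = 1F , p , r
      partners (inj₂ (inj₁ (p , r))) = 2F , p , r
      partners (inj₂ (inj₂ (p , r))) = 3F , p , r
      support : ∀ i j → mult (graph (ι double)) i j ≢ 0 → Partners i j
      support i j ≢0 = partners (cases (mult (edgeGraph e₁′) i j ≟ 0) (mult (edgeGraph e₂) i j ≟ 0))
        where
        cases : Dec (mult (edgeGraph e₁′) i j ≡ 0) → Dec (mult (edgeGraph e₂) i j ≡ 0) → SamePair i j (proj₁ e₁′) (proj₂ e₁′) ⊎ SamePair i j (proj₁ e₂) (proj₂ e₂)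
        cases (no ne) _        = inj₁ (edgeGraph-support e₁′ i j ne)
        cases _       (no ne)  = inj₂ (edgeGraph-support e₂ i j ne)
        cases (yes y) (yes y′) = contradiction (cong₂ (λ a b → a + (a + (b + (b + 0)))) y y′) ≢0
      unique : ∀ i j l → mult (graph (ι double)) i j ≢ 0 → mult (graph (ι double)) i l ≢ 0 → j ≡ l
      unique i j l a b with support i j a | support i l b
      ... | x , p , r | y , p′ , r′ = trans r (trans (cong (λ z → k ↑ʳ partner z) (Fin.↑ʳ-injective k x y (trans (sym p) p′))) (sym r′))
      disjoint : ∀ {i j} → SamePair i j (proj₁ e₁′) (proj₂ e₁′) → ¬ SamePair i j (proj₁ e₂) (proj₂ e₂)
      disjoint (inj₁ (p , _)) (inj₁ (p′ , _)) = contradiction (Fin.↑ʳ-injective k 0F 2F (trans (sym p) p′)) λ ()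
      disjoint (inj₁ (p , _)) (inj₂ (p′ , _)) = contradiction (Fin.↑ʳ-injective k 0F 3F (trans (sym p) p′)) λ ()
      disjoint (inj₂ (p , _)) (inj₁ (p′ , _)) = contradiction (Fin.↑ʳ-injective k 1F 2F (trans (sym p) p′)) λ ()
      disjoint (inj₂ (p , _)) (inj₂ (p′ , _)) = contradiction (Fin.↑ʳ-injective k 1F 3F (trans (sym p) p′)) λ ()
      bound : ∀ i j → mult (graph (ι double)) i j ≤ 2
      bound i j = cases (mult (edgeGraph e₁′) i j ≟ 0) (mult (edgeGraph e₂) i j ≟ 0)
        where
        a = mult (edgeGraph e₁′) i j
        b = mult (edgeGraph e₂) i j
        cases : Dec (a ≡ 0) → Dec (b ≡ 0) → a + (a + (b + (b + 0))) ≤ 2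
        cases (yes z) _       = ≤-trans (≤-reflexive (cong (λ a → a + (a + (b + (b + 0)))) z)) (+-mono-≤ (edgeGraph-≤1 e₂ i j) (+-mono-≤ (edgeGraph-≤1 e₂ i j) z≤n))
        cases _       (yes z) = ≤-trans (≤-reflexive (cong (λ b → a + (a + (b + (b + 0)))) z)) (+-mono-≤ (edgeGraph-≤1 e₁′ i j) (≤-trans (≤-reflexive (+-identityʳ a)) (edgeGraph-≤1 e₁′ i j)))
        cases (no ne) (no ne′) = contradiction (edgeGraph-support e₂ i j ne′) (disjoint (edgeGraph-support e₁′ i j ne))

    private
      F : Poly (k + 5)
      F = orbitSum (graph (ι double))

      F-Matching : All Matching (monomials F)
      F-Matching = All.map (λ i → Matching-Iso i Matching-double) (orbitSum-monomials (graph (ι double)))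

      F-adjacent : ∀ w → Adjacent w → hat F (ι w) R.≈ R.0#
      F-adjacent w (a , b , c , ab , ac , ne) = hat-zero F (ι w) (All.map (λ {h} (unique , _) → decidable-stable (κ (ι w) h ≟ 0) (λ ≢0 →
        ne (Fin.↑ʳ-injective k b c (unique _ _ _ (All.lookup (κ-support (ι w) h ≢0) (∈.∈-map⁺ _ ab)) (All.lookup (κ-support (ι w) h ≢0) (∈.∈-map⁺ _ ac)))))) F-Matching)
        where
        open import Relation.Nullary.Decidable using (decidable-stable)
        import Data.List.Membership.Propositional.Properties as ∈

      F-triple : ∀ e w → hat F (e ∷ e ∷ e ∷ w) R.≈ R.0#
      F-triple e w = hat-zero F (e ∷ e ∷ e ∷ w) (All.map (λ {h} (_ , two) → trans (cong (λ z → at-edge h e * ((at-edge h e ∸ z) * ((at-edge h e ∸ z ∸ z) * κ w (h ∖ e ∖ e ∖ e)))) (⟦⟧-yes (same? (proj₁ e) (proj₂ e) e) (inj₁ (refl , refl))))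
        (cube (at-edge h e) (two _ _))) F-Matching)
        where
        cube : ∀ a {x} → a ≤ 2 → a * ((a ∸ 1) * ((a ∸ 1 ∸ 1) * x)) ≡ 0
        cube 0 _ = refl
        cube 1 _ = refl
        cube 2 _ = refl
        cube (suc (suc (suc _))) (s≤s (s≤s ()))

    -- The orbit sum F of two disjoint double edges is the test polynomial. All terms of both
    -- functionals vanish on it except that of `double`, whose value is 3 * N with N nonzero; if F
    -- were in the subalgebra, this would be 0.
    simple-not-generating : (∀ a → a · R.1# R.≈ R.0# → a ≡ 0) → ¬ GeneratesInvariants R (OrbitSums R (IsSimple {k + 5}))
    simple-not-generating char generates = κ-self (ι double) (distinct-ends 0F 1F (λ ()) ∷ distinct-ends 0F 1F (λ ()) ∷ distinct-ends 2F 3F (λ ()) ∷ distinct-ends 2F 3F (λ ()) ∷ [])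
      (m*n≡0⇒m≡0 N 3 (trans (*-comm N 3) (char (3 * N) (begin
        (3 * N) · R.1# ≈⟨ ×-assocˡ R.1# 3 N ⟨
        3 · N · R.1# ≈⟨ ×-congʳ 3 (R.trans (R.trans (R.*-congˡ self) (R.*-identityʳ _)) R.refl) ⟨
        3 · (N · R.1# R.* coeff F (graph (ι double))) ≈⟨ ×-congʳ 3 (hat-coeff F (ι double)) ⟨
        3 · hat F (ι double) ≈⟨ R.trans (R.+-congˡ (φ-zero F adjacent⁻ (All.map (λ {t} → F-adjacent (proj₂ t)) adjacent⁻-adjacent))) (R.+-identityʳ _) ⟨
        φ negative F ≈⟨ proj₂ (subalgebra-Balanced (generates F (orbitSum-invariant (graph (ι double))))) ⟨
        φ positive F ≈⟨ φ-zero F positive (F-triple (k ↑ʳ 0F , k ↑ʳ 1F) (ι ((2F , 3F) ∷ [])) ∷ All.map (λ {t} → F-adjacent (proj₂ t)) adjacent⁺-adjacent) ⟩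
        R.0# ∎))))
      where
      N = κ (ι double) (graph (ι double))
      distinct-ends : ∀ (x y : Fin 5) → x ≢ y → k ↑ʳ x ≢ k ↑ʳ y
      distinct-ends x y ne = ne ∘ Fin.↑ʳ-injective k x y
      self : coeff F (graph (ι double)) R.≈ R.1#
      self = R.trans (coeff-orbitSum (graph (ι double)) (graph (ι double))) (R.trans (R.reflexive (cong (_· R.1#) (⟦⟧-yes (iso? (graph (ι double)) (graph (ι double))) Iso-refl))) (R.+-identityʳ _))

-- Assembly over a field of characteristic zero.

open CycleTypes using (types)

open NormalCounts 50
open LinearAlgebra using (Unit)
open Representatives 50 using (reps)
open Verification
open FewNormalForms
open import Defs
open import Algebra.Apartness.Bundles using (HeytingField)
open import Algebra.Bundles using (CommutativeRing; Semiring)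
import Algebra.Definitions.RawSemiring as RawSemiringDefinitions
open import Data.List.Relation.Unary.All using (All; _∷_)
open import Data.Nat.Base
open import Data.Nat.Properties
open import Data.Product.Base using (_×_; _,_; proj₁; ∃)
open import Data.Sum.Base using (_⊎_; inj₁; inj₂)
open import Relation.Binary.PropositionalEquality using (_≡_; _≢_; subst)
open import Relation.Nullary using (¬_; contradiction)

find-case : All (λ (case m d) → Few 19 m d) cases → ∀ k → k ≤ 7 → ∃ λ d → d ≤ 25 × Few 19 (10 + k) d
find-case (b ∷ _)                             0 _ = 22 , ≤ᵇ⇒≤ 22 25 _ , b
find-case (_ ∷ b ∷ _)                         1 _ = 22 , ≤ᵇ⇒≤ 22 25 _ , b
find-case (_ ∷ _ ∷ b ∷ _)                     2 _ = 22 , ≤ᵇ⇒≤ 22 25 _ , b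
find-case (_ ∷ _ ∷ _ ∷ b ∷ _)                 3 _ = 22 , ≤ᵇ⇒≤ 22 25 _ , b
find-case (_ ∷ _ ∷ _ ∷ _ ∷ b ∷ _)             4 _ = 25 , ≤-refl , b
find-case (_ ∷ _ ∷ _ ∷ _ ∷ _ ∷ b ∷ _)         5 _ = 25 , ≤-refl , b
find-case (_ ∷ _ ∷ _ ∷ _ ∷ _ ∷ _ ∷ b ∷ _)     6 _ = 25 , ≤-refl , b
find-case (_ ∷ _ ∷ _ ∷ _ ∷ _ ∷ _ ∷ _ ∷ b ∷ _) 7 _ = 25 , ≤-refl , b
find-case _ (suc (suc (suc (suc (suc (suc (suc (suc k)))))))) k≤7 = contradiction k≤7 (<⇒≱ (m≤m+n 8 k))

module _ {c ℓ₁ ℓ₂} (K : HeytingField c ℓ₁ ℓ₂) (char : CharacteristicZero (ring K)) where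
  private
    module K = HeytingField K
    module R = CommutativeRing (ring K)
  open RawSemiringDefinitions (Semiring.rawSemiring R.semiring) using () renaming (_×_ to infixr 8 _·_)

  open NormalForms 50 (ring K) using (return; _>>=_)

  -- By tightness, an element that is not apart from 0 equals 0. An element apart from 0 has an
  -- invertible difference x - 0, which is x.
  zero-or-unit : ∀ x → ¬ ¬ (x R.≈ R.0# ⊎ Unit (ring K) x)
  zero-or-unit x no = no (inj₁ (proj₁ (K.tight x R.0#) λ x#0 →
    let y , y*x , _ = K.#⇒invertible x#0 in no (inj₂ (y , R.trans (R.*-congˡ (R.sym (R.trans (R.+-congˡ ε⁻¹≈ε) (R.+-identityʳ x)))) y*x))))
    where open import Algebra.Properties.Group R.+-group using (ε⁻¹≈ε)

  natural-unit : ∀ k → k ≢ 0 → ¬ ¬ (∃ λ y → y R.* k · R.1# R.≈ R.1#)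
  natural-unit k k≢0 = zero-or-unit (k · R.1#) >>= λ
    { (inj₁ z) → contradiction (char k z) k≢0
    ; (inj₂ u) → return u }

  1≉0 : ¬ R.1# R.≈ R.0#
  1≉0 z = contradiction (char 1 (R.trans (R.+-identityʳ R.1#) z)) λ ()

  isolated-not-generates : ∀ n d → 2 * d < 51 → suc (suc n) < 19 → d ≤ 25 → Few 19 (suc n) d → ¬ GeneratesInvariants (ring K) (OrbitSums (ring K) (HasIsolatedVertex {2 + n}))
  isolated-not-generates n d 2d<51 n<19 d≤25 f = IsolatedVertices.isolated-not-generating 50 (ring K) zero-or-unit natural-unit 1≉0 n d ⌊ suc n /2⌋ 2d<51 (bound f n<19 d≤25)

  -- The equation keeps Agda from comparing the orbits of graphs on closed
  -- numbers of vertices.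

  isolated-range : All (λ (case m d) → Few 19 m d) cases → ∀ k n → k ≤ 7 → 2 + (9 + k) ≡ n → ¬ GeneratesInvariants (ring K) {n} (OrbitSums (ring K) HasIsolatedVertex)
  isolated-range fs k n k≤7 eq = conclude (find-case fs k k≤7)
    where
    conclude : (∃ λ d → d ≤ 25 × Few 19 (10 + k) d) → ¬ GeneratesInvariants (ring K) {n} (OrbitSums (ring K) HasIsolatedVertex)
    conclude (d , d≤25 , f) = subst (λ n → ¬ GeneratesInvariants (ring K) {n} (OrbitSums (ring K) HasIsolatedVertex)) eq
      (isolated-not-generates (9 + k) d (s≤s (*-monoʳ-≤ 2 d≤25)) (+-monoʳ-≤ 12 k≤7) d≤25 f)

theorem2p3 : ∀ {c ℓ₁ ℓ₂} (K : HeytingField c ℓ₁ ℓ₂) → CharacteristicZero (ring K) →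
  (∀ n → 5 ≤ n → ¬ GeneratesInvariants (ring K) {n} (OrbitSums (ring K) IsSimple)) ×
  (∀ n → 11 ≤ n → n ≤ 18 → ¬ GeneratesInvariants (ring K) {n} (OrbitSums (ring K) HasIsolatedVertex))
theorem2p3 K char =
  (λ n 5≤n → subst (λ n → ¬ GeneratesInvariants (ring K) {n} (OrbitSums (ring K) IsSimple)) (m∸n+n≡m 5≤n) (SimpleGraphs.simple-not-generating 50 (ring K) (n ∸ 5) char)) ,
  λ n 11≤n n≤18 → isolated-range K char few-normal-forms (n ∸ 11) n (∸-monoˡ-≤ 11 n≤18) (m+[n∸m]≡n 11≤n)
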